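{- Let $m,n$ be positive integers and $\kappa=m+2n-1$. Then \begin{multline*} \sum_{\substack{\lambda\\ \lambda_1\le m}}q^{|\lambda|/2}\Big(\prod_{i=1}^{m-1}(-q^{n-1/2};q^{n-1/2})_{m_i(\lambda)}\Big)P_\lambda(1,q,q^2,\dots;q^{2n-1})\\ =\frac{(q^\kappa;q^\kappa)_\infty^n}{(q;q)_\infty^{n-1}(q^{1/2};q^{1/2})_\infty}\prod_{i=1}^n\theta(q^{i+m/2-1/2};q^\kappa)\prod_{1\le i<j\le n}\theta(q^{j-i},q^{i+j-2};q^\kappa). \end{multline*}
   Context: $(z;q)_k=\prod_{j=0}^{k-1}(1-zq^j)$, $(z;q)_\infty=\prod_{j\ge0}(1-zq^j)$, $\theta(z;q)=(z;q)_\infty(q/z;q)_\infty$, $\theta(a,b;q)=\theta(a;q)\theta(b;q)$. $m_i(\lambda)$ is the multiplicity of $i$ in $\lambda$. $P_\lambda(x;t)$ is the Hall–Littlewood symmetric function (for $n$ variables $\frac{1}{v_\lambda(t)}\sum_{w\in S_n}w(x^\lambda\prod_{i<j}\frac{x_i-tx_j}{x_i-x_j})$, $v_\lambda(t)=\prod_{i\ge0}(t;t)_{m_i(\lambda)}/(1-t)^{m_i(\lambda)}$, $m_0=n-\ell(\lambda)$, extended by stability), and $P_\lambda(1,q,q^2,\dots;t)$ its evaluation at the alphabet $\{q^k\}_{k\ge0}$. Identities are of formal power series in $q^{1/2}$. -}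

module Defs where

open import Data.Nat using (ℕ; zero; suc; _+_; _*_; _∸_; _≡ᵇ_; _<ᵇ_; _≤ᵇ_)
open import Data.Integer using (ℤ; 0ℤ; 1ℤ; -_) renaming (_+_ to _+ℤ_; _*_ to _*ℤ_)
open import Data.List using (List; []; _∷_; map; foldr; upTo; concatMap; replicate; zipWith; length; _++_)
open import Data.Bool using (if_then_else_)
open import Relation.Binary.PropositionalEquality using (_≡_)

-- Formal power series in the variable x = q^{1/2} with integer
-- coefficients, represented by their coefficient sequence.

Series : Set
Series = ℕ → ℤ

_≋_ : Series → Series → Set
f ≋ g = ∀ N → f N ≡ g N

sumℤ : List ℤ → ℤ
sumℤ = foldr _+ℤ_ 0ℤ

sumℕ : List ℕ → ℕ
sumℕ = foldr _+_ 0

mono : ℕ → Series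
mono e N = if N ≡ᵇ e then 1ℤ else 0ℤ

zeroS : Series
zeroS _ = 0ℤ

oneS : Series
oneS = mono 0

_⊕_ : Series → Series → Series
(f ⊕ g) N = f N +ℤ g N

_⊖_ : Series → Series → Series
(f ⊖ g) N = f N +ℤ (- g N)

_·S_ : ℤ → Series → Series
(c ·S f) N = c *ℤ f N

_⊗_ : Series → Series → Series
(f ⊗ g) N = sumℤ (map (λ k → f k *ℤ g (N ∸ k)) (upTo (suc N)))

infixl 7 _⊗_
infixl 6 _⊕_ _⊖_

sumS : List Series → Series
sumS = foldr _⊕_ zeroS

prodS : List Series → Series
prodS = foldr _⊗_ oneS

powS : Series → ℕ → Series
powS s k = prodS (replicate k s)

-- Multiplicative inverse of a series with constant term 1:
-- g 0 = 1,  g (N+1) = - Σ_{k=1}^{N+1} f k * g (N+1-k).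
-- invRev f N = [g N , g (N-1) , … , g 0]
invRev : Series → ℕ → List ℤ
invRev f zero = 1ℤ ∷ []
invRev f (suc N) =
  (- sumℤ (zipWith _*ℤ_ (map (λ i → f (suc i)) (upTo (suc N))) (invRev f N)))
  ∷ invRev f N

head0 : List ℤ → ℤ
head0 [] = 0ℤ
head0 (g ∷ _) = g

-- 1/f  (only used for f with constant term 1)
invU : Series → Series
invU f N = head0 (invRev f N)

-- q-Pochhammer symbols and theta functions (exponents are in x = q^{1/2})

poch : ℤ → ℕ → ℕ → ℕ → Series
poch c e d k = prodS (map (λ j → oneS ⊖ (c ·S mono (e + d * j))) (upTo k))

-- (c x^e ; x^d)_∞ (d ≥ 1): the N-th coefficient only depends on the
-- factors j ≤ N, since the others are ≡ 1 mod x^{N+1}.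
pochInf : ℤ → ℕ → ℕ → Series
pochInf c e d N = poch c e d (suc N) N

-- θ(x^a ; x^b) = (x^a ; x^b)_∞ (x^{b-a} ; x^b)_∞   (used with a < b)
theta : ℕ → ℕ → Series
theta a b = pochInf 1ℤ a b ⊗ pochInf 1ℤ (b ∸ a) b

range : ℕ → ℕ → List ℕ
range a b = map (a +_) (upTo (suc b ∸ a))

-- Partitions (weakly decreasing lists of positive parts)

partsLE : ℕ → ℕ → List (List ℕ)
partsLE zero s = if s ≡ᵇ 0 then [] ∷ [] else []
partsLE (suc k) s =
  concatMap (λ c → if c * suc k ≤ᵇ s
                     then map (replicate c (suc k) ++_) (partsLE k (s ∸ c * suc k))
                     else [])
            (upTo (suc s))

mult : ℕ → List ℕ → ℕ
mult i = foldr (λ a r → if a ≡ᵇ i then suc r else r) 0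

insertions : ℕ → List ℕ → List (List ℕ)
insertions x [] = (x ∷ []) ∷ []
insertions x (y ∷ ys) = (x ∷ y ∷ ys) ∷ map (y ∷_) (insertions x ys)

perms : List ℕ → List (List ℕ)
perms [] = [] ∷ []
perms (x ∷ xs) = concatMap (insertions x) (perms xs)

-- Hall–Littlewood P_λ(x_1,…,x_K ; t) evaluated at x_i = q^{i-1},
-- with q = x^Q, t = x^T (x = q^{1/2}).
--
-- P_λ = (1/v_λ(t)) Σ_{w ∈ S_K} w( x^λ ∏_{i<j} (x_i - t x_j)/(x_i - x_j) ).
-- A permutation is given as the list σ = [σ_1,…,σ_K] of the exponents
-- of the variables placed in positions 1…K (x_{w(i)} = q^{σ_i}).
-- The factor (q^a - t q^b)/(q^a - q^b) is expanded as a power series: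
--   a < b :  (1 - t q^{b-a}) / (1 - q^{b-a})
--   a > b :  (t - q^{a-b}) / (1 - q^{a-b})

pairF : ℕ → ℕ → ℕ → ℕ → Series
pairF Q T a b =
  if a <ᵇ b
    then (oneS ⊖ mono (T + Q * (b ∸ a))) ⊗ invU (oneS ⊖ mono (Q * (b ∸ a)))
    else (mono T ⊖ mono (Q * (a ∸ b))) ⊗ invU (oneS ⊖ mono (Q * (a ∸ b)))

pairProd : ℕ → ℕ → List ℕ → Series
pairProd Q T [] = oneS
pairProd Q T (a ∷ r) = prodS (map (pairF Q T a) r) ⊗ pairProd Q T r

padTo : ℕ → List ℕ → List ℕ
padTo K λ' = λ' ++ replicate (K ∸ length λ') 0

vHL : ℕ → ℕ → List ℕ → Series
vHL T K λ' =
  let ms = map (λ i → mult i (padTo K λ')) (upTo (suc (sumℕ λ')))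
  in prodS (map (poch 1ℤ T T) ms) ⊗ invU (powS (oneS ⊖ mono T) (sumℕ ms))

HLspec : ℕ → ℕ → List ℕ → ℕ → Series
HLspec Q T λ' K =
  if K <ᵇ length λ'
    then zeroS
    else invU (vHL T K λ') ⊗
         sumS (map (λ σ → mono (Q * sumℕ (zipWith _*_ σ (padTo K λ'))) ⊗ pairProd Q T σ)
                   (perms (upTo K)))

-- P_λ(1, q, q², … ; t): by stability, the coefficient of x^N is that of
-- the K-variable specialisation for any K > N with K ≥ ℓ(λ).
HLinf : ℕ → ℕ → List ℕ → Series
HLinf Q T λ' N = HLspec Q T λ' (suc N + length λ') N

lhsTerm : ℕ → ℕ → List ℕ → Series
lhsTerm m n λ' =
  mono (sumℕ λ')
  ⊗ prodS (map (λ i → poch (- 1ℤ) (2 * n ∸ 1) (2 * n ∸ 1) (mult i λ')) (range 1 (m ∸ 1)))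
  ⊗ HLinf 2 (2 * (2 * n ∸ 1)) λ'

-- Σ_{λ, λ_1 ≤ m}: the coefficient of x^N only receives contributions
-- from |λ| ≤ N (because of the factor x^{|λ|}).
lhs : ℕ → ℕ → Series
lhs m n N = sumS (map (lhsTerm m n) (concatMap (partsLE m) (upTo (suc N)))) N

kappa : ℕ → ℕ → ℕ
kappa m n = m + 2 * n ∸ 1

rhs : ℕ → ℕ → Series
rhs m n =
  let b = 2 * kappa m n in
  powS (pochInf 1ℤ b b) n
  ⊗ prodS (map (λ i → theta (2 * i + m ∸ 1) b) (range 1 n))
  ⊗ prodS (concatMap (λ i → map (λ j → theta (2 * (j ∸ i)) b ⊗ theta (2 * (i + j ∸ 2)) b)
                                (range (suc i) n))
                     (range 1 n))
  ⊗ invU (powS (pochInf 1ℤ 2 2) (n ∸ 1) ⊗ pochInf 1ℤ 1 1)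

{-# OPTIONS --safe #-}
-- Put x = q^{1/2}, t = s² with s = x^P, and let F(S) = ∏ (1 + s xᵃ)/(1 - xᵃ) ∏ φ(a + b) over a, b ∈ S, where φ(d) = (1 - t xᵈ)/(1 - xᵈ).
-- For P = 2n - 1 the bounded Littlewood identity turns the left-hand side over the alphabet S = {1, 3, 5, …} into W_m(S), the sum
-- of xᵐ-weighted F over all sign changes of S. It is proved level by level, with partial fractions, in a shuffle algebra of set functions.
-- Partial fractions also kill every sign choice except the monotone ones on the runners S = {P(2i + 1) + 2a : |a| < n} of an abacus, so
-- that 2 W_m(S) V = F(S) det Θ with V a Vandermonde determinant in xᵃ + x⁻ᵃ, and Θ an n × n matrix of theta functions in P and Q = m + 2n - 1.
-- In the limit Θ is transposed when (P, m) = (2n - 1, m) is exchanged with (P, m) = (m + 2n - 1, 0). Hence both determinants agree; in the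
-- second case W_0 = (s;t)_∞, which expresses the left-hand side as a quotient of the explicit products F for the two values of P.
-- All limits are taken as congruences modulo powers of x over finite alphabets, in a localisation of ℤ[[x]] that contains x⁻¹.

module Submission where

open import Defs
open import Data.Nat using (ℕ; _≤_)
import Data.Nat as N
open import Data.Nat using (zero; suc; _<_; z≤n; s≤s)
import Data.Nat.Properties as NP
open import Data.Nat.Properties using (*-suc; +-cancelˡ-<; +-cancelˡ-≡; +-mono-<; +-mono-≤; +-monoʳ-<; +-monoʳ-≤; +-monoˡ-≤; +-suc; +-∸-assoc; <-cmp; <⇒≢; <⇒≤; <⇒≱; m+[n∸m]≡n; m+n∸m≡n; m+n∸n≡m; m<n⇒0<n∸m; m∸n+n≡m; m∸n≤m; m≤m*n; m≤m+n; m≤n+m; m≤n⇒m<n∨m≡n; m≤n⇒m∸n≡0; m≤n⇒m≤1+n; n∸n≡0; n≤1+n; suc-injective; ∸-monoʳ-≤; ≡ᵇ⇒≡; ≤-<-connex; ≤-<-trans; ≤-pred; ≤-refl; ≤-reflexive; ≤-trans; ≤∧≢⇒<)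
import Data.Integer as Z
open import Data.Integer using (ℤ; +_; -[1+_]; 0ℤ; 1ℤ; ∣_∣)
import Data.Integer.Properties as ZP
open import Data.Integer.Properties using (*-cancelˡ-≡; *-distribʳ-+; *-distribˡ-+; +-injective; +-inverseʳ; +-inverseˡ; -1*i≡-i; [1+m]⊖[1+n]≡m⊖n; abs-*; i-j≡0⇒i≡j; m-n≡m⊖n; neg-distrib-+; neg-distribʳ-*; neg-distribˡ-*; neg-involutive; pos-*; pos-+; ∣-i∣≡∣i∣; ∣i+j∣≤∣i∣+∣j∣; ⊖-≥)
open import Data.Integer.Tactic.RingSolver using (solve-∀)
open import Data.Nat.Tactic.RingSolver using () renaming (solve-∀ to ℕ-solve-∀)
import Data.Sign as Sign
open import Data.List using (List; []; _∷_; map; upTo; concatMap; replicate; zipWith; length; _++_; applyUpTo; downFrom)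
import Data.List.Properties as Lₚ
open import Data.List.Relation.Unary.All as All using (All; []; _∷_)
import Data.List.Relation.Unary.All.Properties as Allₚ
open import Data.List.Relation.Unary.AllPairs using (AllPairs; []; _∷_)
open import Data.List.Relation.Binary.Permutation.Propositional using (_↭_; prep; swap; ↭-sym; ↭-reflexive) renaming (refl to ↭-refl; trans to ↭-trans)
open import Data.List.Relation.Binary.Permutation.Propositional.Properties using (All-resp-↭; shift; shifts; ++-comm; ++⁺ˡ; ++⁺ʳ; map⁺) renaming (++⁺ to ↭-++)
import Data.Bool
open import Data.Bool using (Bool; true; false; if_then_else_)
open import Data.Empty using (⊥-elim)
open import Data.Maybe using (Maybe; just; nothing)
open import Data.Product using (Σ; _×_; _,_; proj₁; proj₂; ∃)
open import Data.Sum using (inj₁; inj₂)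
open import Function using (_∘_; id)
open import Level using (0ℓ)
open import Relation.Nullary using (yes; no)
open import Relation.Binary.PropositionalEquality as P using (_≡_; _≢_)
open import Algebra.Bundles using (CommutativeRing; RawRing)
open import Algebra.Solver.Ring.AlmostCommutativeRing using (_-Raw-AlmostCommutative⟶_; fromCommutativeRing)
import Algebra.Solver.Ring
import Algebra.Properties.CommutativeSemigroup
import Algebra.Properties.Ring
import Algebra.Properties.Semiring.Mult.TCOptimised
import Relation.Binary.Reasoning.Setoid
open import Relation.Binary.Definitions using (tri<; tri≈; tri>)
open import Data.Unit using (⊤; tt)

-- No determinant is evaluated and no theta identity is invoked: the theta functions of the
-- statement arise by telescoping from F for P = m + 2n - 1. The value P = 2n - 1 is forced by the
-- alphabet, since the classes P + 2a with |a| < n must exhaust the odd classes modulo 2P. For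
-- larger P the runners leave gaps, but W_0 is a product for every alphabet. A sign choice dies as
-- soon as two neighbours on a runner have sum -2P, because φ(-2P) = 0. The exponent Q is the weight
-- of one sign change y → -y: (m + 1)y from the runner itself and 2y from each of the n - 1 other
-- runners. The entries of Θ become signed sums of powers x^(PQk² + 2Qka + 2aj + 2Pkj) over the
-- signs of a and j, so exchanging P with Q exchanges rows with columns. A finite alphabet disturbs
-- this only through the ends of its progressions. As the exponents may be negative, every row is
-- multiplied by a fixed power of x before it is reduced modulo x^Λ; this costs a number of
-- coefficients that does not depend on Λ.

-- Finite sums and products in a commutative ring

module RingKit (CR : CommutativeRing 0ℓ 0ℓ) where
  open CommutativeRing CR public
    hiding (zero)
    renaming (Carrier to C)
  open Algebra.Properties.Ring ring public
    using (-‿distribˡ-*; -‿distribʳ-*; -‿involutive; -0#≈0#; -‿+-comm)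
  open Algebra.Properties.CommutativeSemigroup *-commutativeSemigroup public
    using (x∙yz≈y∙xz; x∙yz≈yx∙z; x∙yz≈xz∙y; x∙yz≈z∙xy; xy∙z≈y∙xz; xy∙z≈xz∙y; xy∙z≈yz∙x)
  open Relation.Binary.Reasoning.Setoid setoid public

  cong≈ : {A : Set} (f : A → C) {x y : A} → x ≡ y → f x ≈ f y
  cong≈ f e = reflexive (P.cong f e)

  module ℤ-coefficients where
    open Algebra.Properties.Semiring.Mult.TCOptimised semiring
      using (×-homo-+; ×1-homo-*; 1+×) renaming (_×_ to _×ⁿ_)

    ⟦_⟧ℤ : ℤ → C
    ⟦ + n ⟧ℤ      = n ×ⁿ 1#
    ⟦ -[1+ n ] ⟧ℤ = - (suc n ×ⁿ 1#)

    ⊖-homo : ∀ m n → ⟦ m Z.⊖ n ⟧ℤ ≈ m ×ⁿ 1# + - (n ×ⁿ 1#)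
    ⊖-homo m zero = sym (trans (+-congˡ -0#≈0#) (+-identityʳ _))
    ⊖-homo zero (suc n) = sym (+-identityˡ _)
    ⊖-homo (suc m) (suc n) = begin
      ⟦ suc m Z.⊖ suc n ⟧ℤ ≡⟨ P.cong ⟦_⟧ℤ ([1+m]⊖[1+n]≡m⊖n m n) ⟩
      ⟦ m Z.⊖ n ⟧ℤ ≈⟨ ⊖-homo m n ⟩
      a + - b ≈⟨ +-congʳ (sym (trans (+-congʳ (-‿inverseʳ 1#)) (+-identityˡ a))) ⟩
      (1# + - 1# + a) + - b ≈⟨ +-congʳ (trans (+-assoc _ _ _) (+-congˡ (+-comm _ _))) ⟩
      (1# + (a + - 1#)) + - b ≈⟨ trans (+-congʳ (sym (+-assoc _ _ _))) (+-assoc _ _ _) ⟩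
      (1# + a) + (- 1# + - b) ≈⟨ +-congˡ (-‿+-comm 1# b) ⟩
      (1# + a) + - (1# + b) ≈⟨ +-cong (sym (1+× m 1#)) (-‿cong (sym (1+× n 1#))) ⟩
      suc m ×ⁿ 1# + - (suc n ×ⁿ 1#) ∎
      where
      a = m ×ⁿ 1#
      b = n ×ⁿ 1#

    +-homo : ∀ i j → ⟦ i Z.+ j ⟧ℤ ≈ ⟦ i ⟧ℤ + ⟦ j ⟧ℤ
    +-homo (+ m) (+ n) = ×-homo-+ 1# m n
    +-homo (+ m) -[1+ n ] = ⊖-homo m (suc n)
    +-homo -[1+ m ] (+ n) = trans (⊖-homo n (suc m)) (+-comm _ _)
    +-homo -[1+ m ] -[1+ n ] = begin
      - (suc (suc (m N.+ n)) ×ⁿ 1#) ≡⟨ P.cong (λ k → - (suc k ×ⁿ 1#)) (P.sym (+-suc m n)) ⟩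
      - ((suc m N.+ suc n) ×ⁿ 1#) ≈⟨ -‿cong (×-homo-+ 1# (suc m) (suc n)) ⟩
      - (suc m ×ⁿ 1# + suc n ×ⁿ 1#) ≈⟨ sym (-‿+-comm _ _) ⟩
      - (suc m ×ⁿ 1#) + - (suc n ×ⁿ 1#) ∎

    -homo : ∀ i → ⟦ Z.- i ⟧ℤ ≈ - ⟦ i ⟧ℤ
    -homo (+ zero) = sym -0#≈0#
    -homo (+ suc n) = refl
    -homo -[1+ n ] = sym (-‿involutive _)

    +◃-homo : ∀ n → ⟦ Sign.+ Z.◃ n ⟧ℤ ≈ n ×ⁿ 1#
    +◃-homo zero = refl
    +◃-homo (suc n) = refl

    -◃-homo : ∀ n → ⟦ Sign.- Z.◃ n ⟧ℤ ≈ - (n ×ⁿ 1#)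
    -◃-homo zero = sym -0#≈0#
    -◃-homo (suc n) = refl

    *-homo : ∀ i j → ⟦ i Z.* j ⟧ℤ ≈ ⟦ i ⟧ℤ * ⟦ j ⟧ℤ
    *-homo (+ m) (+ n) = trans (+◃-homo (m N.* n)) (×1-homo-* m n)
    *-homo (+ m) -[1+ n ] =
      trans (-◃-homo (m N.* suc n)) (trans (-‿cong (×1-homo-* m (suc n))) (-‿distribʳ-* _ _))
    *-homo -[1+ m ] (+ n) =
      trans (-◃-homo (suc m N.* n)) (trans (-‿cong (×1-homo-* (suc m) n)) (-‿distribˡ-* _ _))
    *-homo -[1+ m ] -[1+ n ] = trans (+◃-homo (suc m N.* suc n)) (trans (×1-homo-* (suc m) (suc n))
      (trans (sym (-‿involutive _)) (trans (-‿cong (-‿distribˡ-* _ _)) (-‿distribʳ-* _ _))))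

    ℤ-rawRing : RawRing 0ℓ 0ℓ
    ℤ-rawRing = CommutativeRing.rawRing ZP.+-*-commutativeRing

    morphism : ℤ-rawRing -Raw-AlmostCommutative⟶ fromCommutativeRing CR
    morphism = record
      { ⟦_⟧ = ⟦_⟧ℤ ; +-homo = +-homo ; *-homo = *-homo ; -‿homo = -homo
      ; 0-homo = refl ; 1-homo = refl }

    decide : (i j : ℤ) → Maybe (⟦ i ⟧ℤ ≈ ⟦ j ⟧ℤ)
    decide i j with i Z.≟ j
    ... | yes i≡j = just (cong≈ ⟦_⟧ℤ i≡j)
    ... | no _ = nothing

  open Algebra.Solver.Ring ℤ-coefficients.ℤ-rawRing (fromCommutativeRing CR)
    ℤ-coefficients.morphism ℤ-coefficients.decide public
    using (solve; _:=_; _:+_; _:*_; _:-_; :-_; con)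

  ∑ : {A : Set} → (A → C) → List A → C
  ∑ f [] = 0#
  ∑ f (x ∷ xs) = f x + ∑ f xs

  ∏ : {A : Set} → (A → C) → List A → C
  ∏ f [] = 1#
  ∏ f (x ∷ xs) = f x * ∏ f xs

  infixr 8 _^_
  _^_ : C → ℕ → C
  a ^ zero = 1#
  a ^ suc n = a * a ^ n

  ∑pick : {A : Set} → (A → List A → C) → List A → C
  ∑pick h [] = 0#
  ∑pick h (x ∷ xs) = h x xs + ∑pick (λ y ys → h y (x ∷ ys)) xs

  ∑split : {A : Set} → (List A → List A → C) → List A → C
  ∑split g [] = g [] []
  ∑split g (x ∷ xs) = ∑split (λ I J → g (x ∷ I) J) xs + ∑split (λ I J → g I (x ∷ J)) xs

  private variable A B : Set

  ^-cong : ∀ {a b} n → a ≈ b → a ^ n ≈ b ^ n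
  ^-cong zero e = refl
  ^-cong (suc n) e = *-cong e (^-cong n e)

  ^-+ : ∀ a m n → a ^ (m N.+ n) ≈ a ^ m * a ^ n
  ^-+ a zero n = sym (*-identityˡ _)
  ^-+ a (suc m) n = trans (*-congˡ (^-+ a m n)) (sym (*-assoc _ _ _))

  1^ : ∀ n → 1# ^ n ≈ 1#
  1^ zero = refl
  1^ (suc n) = trans (*-identityˡ _) (1^ n)

  *-^ : ∀ a b n → (a * b) ^ n ≈ a ^ n * b ^ n
  *-^ a b zero = sym (*-identityˡ _)
  *-^ a b (suc n) = trans (*-congˡ (*-^ a b n))
    (solve 4 (λ a b c d → a :* b :* (c :* d) := a :* c :* (b :* d)) refl a b (a ^ n) (b ^ n))

  ∑-cong∈ : ∀ {P : A → Set} {f g} {xs : List A} → All P xs → (∀ x → P x → f x ≈ g x) → ∑ f xs ≈ ∑ g xs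
  ∑-cong∈ [] e = refl
  ∑-cong∈ (p ∷ ps) e = +-cong (e _ p) (∑-cong∈ ps e)

  ∑-cong : ∀ {f g : A → C} xs → (∀ x → f x ≈ g x) → ∑ f xs ≈ ∑ g xs
  ∑-cong [] e = refl
  ∑-cong (x ∷ xs) e = +-cong (e x) (∑-cong xs e)

  ∏-cong∈ : ∀ {P : A → Set} {f g} {xs : List A} → All P xs → (∀ x → P x → f x ≈ g x) → ∏ f xs ≈ ∏ g xs
  ∏-cong∈ [] e = refl
  ∏-cong∈ (p ∷ ps) e = *-cong (e _ p) (∏-cong∈ ps e)

  ∏-cong : ∀ {f g : A → C} xs → (∀ x → f x ≈ g x) → ∏ f xs ≈ ∏ g xs
  ∏-cong [] e = refl
  ∏-cong (x ∷ xs) e = *-cong (e x) (∏-cong xs e)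

  +-interchange : ∀ a b c d → (a + b) + (c + d) ≈ (a + c) + (b + d)
  +-interchange = solve 4 (λ a b c d → (a :+ b) :+ (c :+ d) := (a :+ c) :+ (b :+ d)) refl

  *-interchange : ∀ a b c d → (a * b) * (c * d) ≈ (a * c) * (b * d)
  *-interchange = solve 4 (λ a b c d → (a :* b) :* (c :* d) := (a :* c) :* (b :* d)) refl

  ∑-+ : ∀ (f g : A → C) xs → ∑ (λ x → f x + g x) xs ≈ ∑ f xs + ∑ g xs
  ∑-+ f g [] = sym (+-identityˡ _)
  ∑-+ f g (x ∷ xs) = trans (+-congˡ (∑-+ f g xs)) (+-interchange _ _ _ _)

  ∑-*ˡ : ∀ c (f : A → C) xs → ∑ (λ x → c * f x) xs ≈ c * ∑ f xs
  ∑-*ˡ c f [] = sym (zeroʳ c)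
  ∑-*ˡ c f (x ∷ xs) = trans (+-congˡ (∑-*ˡ c f xs)) (sym (distribˡ _ _ _))

  ∑-*ʳ : ∀ c (f : A → C) xs → ∑ (λ x → f x * c) xs ≈ ∑ f xs * c
  ∑-*ʳ c f [] = sym (zeroˡ c)
  ∑-*ʳ c f (x ∷ xs) = trans (+-congˡ (∑-*ʳ c f xs)) (sym (distribʳ _ _ _))

  ∑-0 : ∀ (xs : List A) → ∑ (λ _ → 0#) xs ≈ 0#
  ∑-0 [] = refl
  ∑-0 (x ∷ xs) = trans (+-identityˡ _) (∑-0 xs)

  ∑-swap : ∀ (f : A → B → C) xs ys → ∑ (λ x → ∑ (f x) ys) xs ≈ ∑ (λ y → ∑ (λ x → f x y) xs) ys
  ∑-swap f [] ys = sym (∑-0 ys)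
  ∑-swap f (x ∷ xs) ys = trans (+-congˡ (∑-swap f xs ys)) (sym (∑-+ _ _ ys))

  ∑-++ : ∀ (f : A → C) xs ys → ∑ f (xs ++ ys) ≈ ∑ f xs + ∑ f ys
  ∑-++ f [] ys = sym (+-identityˡ _)
  ∑-++ f (x ∷ xs) ys = trans (+-congˡ (∑-++ f xs ys)) (sym (+-assoc _ _ _))

  ∑-map : ∀ (f : B → C) (g : A → B) xs → ∑ f (map g xs) ≈ ∑ (λ x → f (g x)) xs
  ∑-map f g [] = refl
  ∑-map f g (x ∷ xs) = +-congˡ (∑-map f g xs)

  ∑-concatMap : ∀ (f : B → C) (g : A → List B) xs → ∑ f (concatMap g xs) ≈ ∑ (λ x → ∑ f (g x)) xs
  ∑-concatMap f g [] = refl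
  ∑-concatMap f g (x ∷ xs) = trans (∑-++ f (g x) _) (+-congˡ (∑-concatMap f g xs))

  ∏-* : ∀ (f g : A → C) xs → ∏ (λ x → f x * g x) xs ≈ ∏ f xs * ∏ g xs
  ∏-* f g [] = sym (*-identityˡ _)
  ∏-* f g (x ∷ xs) = trans (*-congˡ (∏-* f g xs)) (*-interchange _ _ _ _)

  ∏-1 : ∀ (xs : List A) → ∏ (λ _ → 1#) xs ≈ 1#
  ∏-1 [] = refl
  ∏-1 (x ∷ xs) = trans (*-identityˡ _) (∏-1 xs)

  ∏-const : ∀ a (xs : List A) → ∏ (λ _ → a) xs ≈ a ^ length xs
  ∏-const a [] = refl
  ∏-const a (x ∷ xs) = *-congˡ (∏-const a xs)

  ∏-++ : ∀ (f : A → C) xs ys → ∏ f (xs ++ ys) ≈ ∏ f xs * ∏ f ys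
  ∏-++ f [] ys = sym (*-identityˡ _)
  ∏-++ f (x ∷ xs) ys = trans (*-congˡ (∏-++ f xs ys)) (sym (*-assoc _ _ _))

  ∏-upTo-snoc : ∀ (f : ℕ → C) k → ∏ f (upTo (suc k)) ≈ ∏ f (upTo k) * f k
  ∏-upTo-snoc f k = trans (cong≈ (∏ f) (P.sym (Lₚ.upTo-∷ʳ k))) (trans (∏-++ f (upTo k) (k ∷ [])) (*-congˡ (*-identityʳ _)))

  ∏-map : ∀ (f : B → C) (g : A → B) xs → ∏ f (map g xs) ≈ ∏ (λ x → f (g x)) xs
  ∏-map f g [] = refl
  ∏-map f g (x ∷ xs) = *-congˡ (∏-map f g xs)

  ∏-concatMap : ∀ (f : B → C) (g : A → List B) xs → ∏ f (concatMap g xs) ≈ ∏ (λ x → ∏ f (g x)) xs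
  ∏-concatMap f g [] = refl
  ∏-concatMap f g (x ∷ xs) = trans (∏-++ f (g x) _) (*-congˡ (∏-concatMap f g xs))

  ∏-swap : ∀ (f : A → B → C) xs ys → ∏ (λ x → ∏ (f x) ys) xs ≈ ∏ (λ y → ∏ (λ x → f x y) xs) ys
  ∏-swap f [] ys = sym (∏-1 ys)
  ∏-swap f (x ∷ xs) ys = trans (*-congˡ (∏-swap f xs ys)) (sym (∏-* _ _ ys))

  ∏-↭ : ∀ (f : A → C) {xs ys} → xs ↭ ys → ∏ f xs ≈ ∏ f ys
  ∏-↭ f ↭-refl = refl
  ∏-↭ f (prep x p) = *-congˡ (∏-↭ f p)
  ∏-↭ f (swap x y p) = trans (*-congˡ (*-congˡ (∏-↭ f p)))
    (solve 3 (λ a b c → a :* (b :* c) := b :* (a :* c)) refl (f x) (f y) _)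
  ∏-↭ f (↭-trans p q) = trans (∏-↭ f p) (∏-↭ f q)

  ∑pick-cong : ∀ {h h' : A → List A → C} xs → (∀ y ys → xs ↭ y ∷ ys → h y ys ≈ h' y ys) → ∑pick h xs ≈ ∑pick h' xs
  ∑pick-cong [] e = refl
  ∑pick-cong (x ∷ xs) e = +-cong (e x xs ↭-refl)
    (∑pick-cong xs (λ y ys p → e y (x ∷ ys) (↭-trans (prep x p) (swap x y ↭-refl))))

  ∑pick-+ : ∀ (f g : A → List A → C) xs → ∑pick (λ y ys → f y ys + g y ys) xs ≈ ∑pick f xs + ∑pick g xs
  ∑pick-+ f g [] = sym (+-identityˡ _)
  ∑pick-+ f g (x ∷ xs) = trans (+-congˡ (∑pick-+ _ _ xs)) (+-interchange _ _ _ _)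

  ∑pick-*ˡ : ∀ c (f : A → List A → C) xs → ∑pick (λ y ys → c * f y ys) xs ≈ c * ∑pick f xs
  ∑pick-*ˡ c f [] = sym (zeroʳ c)
  ∑pick-*ˡ c f (x ∷ xs) = trans (+-congˡ (∑pick-*ˡ c _ xs)) (sym (distribˡ _ _ _))

  ∑pick-map : ∀ (h : B → List B → C) (f : A → B) xs → ∑pick h (map f xs) ≈ ∑pick (λ y ys → h (f y) (map f ys)) xs
  ∑pick-map h f [] = refl
  ∑pick-map h f (x ∷ xs) = +-congˡ (∑pick-map _ f xs)

  ∑counts : ℕ → ℕ → (List ℕ → C) → C
  ∑counts N zero f = f []
  ∑counts N (suc m) f = ∑ (λ c → ∑counts N m (λ cs → f (c ∷ cs))) (upTo (suc N))

  ∑counts-cong : ∀ N m {f g : List ℕ → C} → (∀ cs → length cs ≡ m → All (_≤ N) cs → f cs ≈ g cs) → ∑counts N m f ≈ ∑counts N m g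
  ∑counts-cong N zero e = e [] P.refl []
  ∑counts-cong N (suc m) e = ∑-cong∈ (Allₚ.applyUpTo⁺₁ {P = _≤ N} id (suc N) (λ q → ≤-pred q)) (λ c q → ∑counts-cong N m (λ cs l a → e (c ∷ cs) (P.cong suc l) (q ∷ a)))

  ∑counts-*ˡ : ∀ N m c f → ∑counts N m (λ cs → c * f cs) ≈ c * ∑counts N m f
  ∑counts-*ˡ N zero c f = refl
  ∑counts-*ˡ N (suc m) c f = trans (∑-cong (upTo (suc N)) (λ k → ∑counts-*ˡ N m c _)) (∑-*ˡ c _ (upTo (suc N)))

-- Partial fractions

module PartialFractions (CR : CommutativeRing 0ℓ 0ℓ) where
  open RingKit CR

  -- For u = 1/(1 - w) this is (1 - c w)/(1 - w): a simple pole at w = 1 with value c at w = ∞.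
  mix : C → C → C
  mix c u = c + (1# - c) * u

  module _ {A : Set} (c : A → C) (τ : A → A → C) where

    -- A product of two simple poles splits into the single poles; `τ i j` is the value of the j-th
    -- function at the i-th pole.
    Compatible : (A → C) → A → A → Set
    Compatible g i j = g i * g j ≈ τ i j * g i + τ j i * g j

    -- The induction in `partial-fractions` applies its hypothesis to the tail twice, for g and for
    -- `τ x` of the head x, so these coefficient functions have to be compatible themselves.
    data Family : List A → Set where
      []  : Family []
      _∷_ : ∀ {x xs} → AllPairs (Compatible (τ x)) xs → Family xs → Family (x ∷ xs)

    residues : (A → C) → List A → C
    residues g = ∑pick (λ i is → (1# - c i) * g i * ∏ (λ j → mix (c j) (τ i j)) is)

    -- Partial fractions: with g i = 1/(1 - xᵢ/z) and τ i j = 1/(1 - xⱼ/xᵢ) the family g is compatible,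
    -- and so is the constant family g = 1, which is the limit z → ∞.
    partial-fractions : ∀ xs → Family xs → ∀ g → AllPairs (Compatible g) xs →
      ∏ (λ i → mix (c i) (g i)) xs ≈ ∏ c xs + residues g xs
    partial-fractions [] _ g _ = sym (+-identityʳ _)
    partial-fractions (x ∷ xs) (τx ∷ fam) g (gx ∷ gs) = begin
      mix cx (g x) * ∏ (λ i → mix (c i) (g i)) xs
        ≈⟨ *-congˡ (partial-fractions xs fam g gs) ⟩
      mix cx (g x) * (∏ c xs + residues g xs)
        ≈⟨ solve 4 (λ c g p s → (c :+ (con (+ 1) :- c) :* g) :* (p :+ s) :=
             c :* p :+ ((con (+ 1) :- c) :* g :* p :+ (c :+ (con (+ 1) :- c) :* g) :* s)) refl cx (g x) (∏ c xs) (residues g xs) ⟩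
      cx * ∏ c xs + ((1# - cx) * g x * ∏ c xs + mix cx (g x) * residues g xs)
        ≈⟨ +-congˡ (+-congˡ (trans (sym (∑pick-*ˡ _ _ xs)) (trans (∑pick-cong xs exchange)
             (trans (∑pick-+ _ _ xs) (+-congʳ (∑pick-*ˡ _ _ xs)))))) ⟩
      cx * ∏ c xs + ((1# - cx) * g x * ∏ c xs + ((1# - cx) * g x * residues (τ x) xs + rest))
        ≈⟨ +-congˡ (solve 4 (λ a b c d → a :* b :+ (a :* c :+ d) := a :* (b :+ c) :+ d) refl _ _ _ _) ⟩
      cx * ∏ c xs + ((1# - cx) * g x * (∏ c xs + residues (τ x) xs) + rest)
        ≈⟨ +-congˡ (+-congʳ (*-congˡ (sym (partial-fractions xs fam (τ x) τx)))) ⟩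
      cx * ∏ c xs + ((1# - cx) * g x * ∏ (λ j → mix (c j) (τ x j)) xs + rest) ∎
      where
      cx = c x
      rest = ∑pick (λ i is → (1# - c i) * g i * (mix cx (τ i x) * ∏ (λ j → mix (c j) (τ i j)) is)) xs
      -- The head factor times a residue of the tail has poles at x and at i; compatibility
      -- distributes it over both.
      exchange : ∀ i is → xs ↭ i ∷ is →
        mix cx (g x) * ((1# - c i) * g i * ∏ (λ j → mix (c j) (τ i j)) is) ≈
        (1# - cx) * g x * ((1# - c i) * τ x i * ∏ (λ j → mix (c j) (τ i j)) is) +
        (1# - c i) * g i * (mix cx (τ i x) * ∏ (λ j → mix (c j) (τ i j)) is)
      exchange i is p with All-resp-↭ p gx
      ... | e ∷ _ = begin
        mix cx (g x) * ((1# - c i) * g i * R)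
          ≈⟨ solve 5 (λ c g d e r → (c :+ (con (+ 1) :- c) :* g) :* ((con (+ 1) :- d) :* e :* r) :=
               (con (+ 1) :- d) :* r :* (c :* e :+ (con (+ 1) :- c) :* (g :* e))) refl cx (g x) (c i) (g i) R ⟩
        (1# - c i) * R * (cx * g i + (1# - cx) * (g x * g i)) ≈⟨ *-congˡ (+-congˡ (*-congˡ e)) ⟩
        (1# - c i) * R * (cx * g i + (1# - cx) * (τ x i * g x + τ i x * g i))
          ≈⟨ solve 7 (λ c g d e r u v →
               (con (+ 1) :- d) :* r :* (c :* e :+ (con (+ 1) :- c) :* (u :* g :+ v :* e)) :=
               (con (+ 1) :- c) :* g :* ((con (+ 1) :- d) :* u :* r) :+
               (con (+ 1) :- d) :* e :* ((c :+ (con (+ 1) :- c) :* v) :* r)) refl cx (g x) (c i) (g i) R (τ x i) (τ i x) ⟩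
        (1# - cx) * g x * ((1# - c i) * τ x i * R) + (1# - c i) * g i * (mix cx (τ i x) * R) ∎
        where R = ∏ (λ j → mix (c j) (τ i j)) is

-- A commutative ring with an invertible element q = ξ 1 such that every 1 - qᵈ with d ≠ 0 is a unit, with inverse τ d.
record LaurentRing : Set₁ where
  field
    CR : CommutativeRing 0ℓ 0ℓ
  open CommutativeRing CR
  field
    ξ : ℤ → Carrier
    ξ-+ : ∀ a b → ξ (a Z.+ b) ≈ ξ a * ξ b
    ξ-0 : ξ 0ℤ ≈ 1#
    τ : ℤ → Carrier
    τ-inverse : ∀ d → d ≢ 0ℤ → τ d * (1# - ξ d) ≈ 1#

-- Arithmetic of the powers `ξ` and the simple poles `τ`

module LaurentKit (L : LaurentRing) where
  open LaurentRing L public using (CR; ξ; ξ-+; ξ-0; τ; τ-inverse)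
  open RingKit CR public
  open PartialFractions CR public

  ξ-ℕ : ∀ m n → ξ (+ (m N.+ n)) ≈ ξ (+ m) * ξ (+ n)
  ξ-ℕ m n = trans (cong≈ ξ (pos-+ m n)) (ξ-+ (+ m) (+ n))

  ξ-inv : ∀ a → ξ a * ξ (Z.- a) ≈ 1#
  ξ-inv a = trans (sym (ξ-+ a (Z.- a))) (trans (cong≈ ξ (+-inverseʳ a)) ξ-0)

  ξτ : ∀ a → a ≢ 0ℤ → ξ a * τ a ≈ τ a - 1#
  ξτ a a≢0 = begin
    ξ a * τ a ≈⟨ solve 2 (λ u v → u :* v := v :- v :* (con (+ 1) :- u)) refl (ξ a) (τ a) ⟩
    τ a - τ a * (1# - ξ a) ≈⟨ +-congˡ (-‿cong (τ-inverse a a≢0)) ⟩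
    τ a - 1# ∎

  neg≢0 : ∀ {a} → a ≢ 0ℤ → Z.- a ≢ 0ℤ
  neg≢0 {a} a≢0 e = a≢0 (P.trans (P.sym (neg-involutive a)) (P.cong Z.-_ e))

  -- The two signs of an exponent contribute a constant in total. This is why residues lose their
  -- dependence on the variables when they are symmetrised.
  τ-reflect : ∀ a → a ≢ 0ℤ → τ a + τ (Z.- a) ≈ 1#
  τ-reflect a a≢0 = begin
    τ a + τ b ≈⟨ +-congʳ (sym (*-identityˡ _)) ⟩
    1# * τ a + τ b ≈⟨ +-congʳ (*-congʳ (sym (τ-inverse b (neg≢0 a≢0)))) ⟩
    τ b * (1# - v) * τ a + τ b
      ≈⟨ +-congʳ (*-congʳ (*-congˡ (+-congʳ (sym (ξ-inv a))))) ⟩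
    τ b * (u * v - v) * τ a + τ b
      ≈⟨ solve 4 (λ u v s r → r :* (u :* v :- v) :* s :+ r := r :- r :* v :* (s :* (con (+ 1) :- u))) refl u v (τ a) (τ b) ⟩
    τ b - τ b * v * (τ a * (1# - u)) ≈⟨ +-congˡ (-‿cong (*-congˡ (τ-inverse a a≢0))) ⟩
    τ b - τ b * v * 1# ≈⟨ solve 2 (λ v r → r :- r :* v :* con (+ 1) := r :* (con (+ 1) :- v)) refl v (τ b) ⟩
    τ b * (1# - v) ≈⟨ τ-inverse b (neg≢0 a≢0) ⟩
    1# ∎
    where
    b = Z.- a
    u = ξ a
    v = ξ b

  unit-cancel : ∀ {u v a b} → u * v ≈ 1# → a * v ≈ b * v → a ≈ b
  unit-cancel {u} {v} {a} {b} uv e = begin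
    a ≈⟨ sym (*-identityʳ a) ⟩
    a * 1# ≈⟨ *-congˡ (sym uv) ⟩
    a * (u * v) ≈⟨ solve 3 (λ a u v → a :* (u :* v) := u :* (a :* v)) refl a u v ⟩
    u * (a * v) ≈⟨ *-congˡ e ⟩
    u * (b * v) ≈⟨ solve 3 (λ a u v → u :* (a :* v) := a :* (u :* v)) refl b u v ⟩
    b * (u * v) ≈⟨ *-congˡ uv ⟩
    b * 1# ≈⟨ *-identityʳ b ⟩
    b ∎

  -- This is compatibility for the poles in question. The units 1 - `ξ a` and 1 - `ξ (a + d)` are
  -- multiplied out, after which only a linear identity in `τ d` remains.
  τ-product : ∀ a d → a ≢ 0ℤ → d ≢ 0ℤ → a Z.+ d ≢ 0ℤ →
    τ a * τ (a Z.+ d) ≈ τ d * τ a + τ (Z.- d) * τ (a Z.+ d)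
  τ-product a d a≢0 d≢0 b≢0 = unit-cancel (τ-inverse a a≢0) (unit-cancel (τ-inverse b b≢0) (begin
    τ a * τ b * (1# - u) * (1# - ξ b)
      ≈⟨ solve 4 (λ r s u v → r :* s :* (con (+ 1) :- u) :* (con (+ 1) :- v) :=
           (r :* (con (+ 1) :- u)) :* (s :* (con (+ 1) :- v))) refl (τ a) (τ b) u (ξ b) ⟩
    (τ a * (1# - u)) * (τ b * (1# - ξ b)) ≈⟨ *-cong (τ-inverse a a≢0) (τ-inverse b b≢0) ⟩
    1# * 1# ≈⟨ solve 3 (λ u w p → con (+ 1) :* con (+ 1) :=
           w :* (con (+ 1) :- u :* p) :+ (con (+ 1) :- w) :* (con (+ 1) :- u) :+ u :* (p :* w :- (w :- con (+ 1)))) refl u w p ⟩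
    w * (1# - u * p) + (1# - w) * (1# - u) + u * (p * w - (w - 1#))
      ≈⟨ +-congˡ (*-congˡ (+-congʳ (ξτ d d≢0))) ⟩
    w * (1# - u * p) + (1# - w) * (1# - u) + u * ((w - 1#) - (w - 1#))
      ≈⟨ solve 3 (λ u w p → w :* (con (+ 1) :- u :* p) :+ (con (+ 1) :- w) :* (con (+ 1) :- u) :+ u :* ((w :- con (+ 1)) :- (w :- con (+ 1))) :=
           w :* (con (+ 1) :- u :* p) :+ ((w :- w) :+ (con (+ 1) :- w)) :* (con (+ 1) :- u)) refl u w p ⟩
    w * (1# - u * p) + ((w - w) + (1# - w)) * (1# - u)
      ≈⟨ solve 3 (λ u w p → w :* (con (+ 1) :- u :* p) :+ ((w :- w) :+ (con (+ 1) :- w)) :* (con (+ 1) :- u) :=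
           w :* con (+ 1) :* (con (+ 1) :- u :* p) :+ (con (+ 1) :- w) :* con (+ 1) :* (con (+ 1) :- u)) refl u w p ⟩
    w * 1# * (1# - u * p) + (1# - w) * 1# * (1# - u)
      ≈⟨ +-cong (*-cong (*-congˡ (sym (τ-inverse a a≢0))) (+-congˡ (-‿cong (sym (ξ-+ a d)))))
           (*-congʳ (*-cong 1-w (sym (τ-inverse b b≢0)))) ⟩
    w * (τ a * (1# - u)) * (1# - ξ b) + τ (Z.- d) * (τ b * (1# - ξ b)) * (1# - u)
      ≈⟨ solve 6 (λ w r u v w' s → w :* (r :* (con (+ 1) :- u)) :* (con (+ 1) :- v) :+ w' :* (s :* (con (+ 1) :- v)) :* (con (+ 1) :- u) :=
           (w :* r :+ w' :* s) :* (con (+ 1) :- u) :* (con (+ 1) :- v)) refl w (τ a) u (ξ b) (τ (Z.- d)) (τ b) ⟩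
    (w * τ a + τ (Z.- d) * τ b) * (1# - u) * (1# - ξ b) ∎))
    where
    b = a Z.+ d
    u = ξ a
    w = τ d
    p = ξ d
    1-w : 1# - w ≈ τ (Z.- d)
    1-w = begin
      1# - w ≈⟨ +-congʳ (sym (τ-reflect d d≢0)) ⟩
      w + τ (Z.- d) - w ≈⟨ solve 2 (λ w v → w :+ v :- w := v) refl w _ ⟩
      τ (Z.- d) ∎

upTo-< : ∀ k → All (_< k) (upTo k)
upTo-< k = Allₚ.applyUpTo⁺₁ id k id

-- Alphabets in general position

-- This keeps every y, y + y' and y - y' away from 0 for all choices of signs, so that no `τ` is
-- evaluated at 0, where its value is unspecified.
Good : List ℤ → Set
Good S = AllPairs (λ a b → ∣ a ∣ ≢ ∣ b ∣) S × All (λ a → ∣ a ∣ ≢ 0) S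

abs≢0 : ∀ {a} → ∣ a ∣ ≢ 0 → a ≢ 0ℤ
abs≢0 n P.refl = n P.refl

abs≢⇒+≢0 : ∀ {a b} → ∣ a ∣ ≢ ∣ b ∣ → a Z.+ b ≢ 0ℤ
abs≢⇒+≢0 {a} {b} n e = n (P.trans (P.cong ∣_∣ a≡-b) (∣-i∣≡∣i∣ b))
  where
  a≡-b : a ≡ Z.- b
  a≡-b = P.trans (lemma a b) (P.trans (P.cong (Z._+ (Z.- b)) e) (ZP.+-identityˡ _))
    where
    lemma : ∀ a b → a ≡ a Z.+ b Z.+ (Z.- b)
    lemma = solve-∀

abs≢⇒-≢0 : ∀ {a b} → ∣ a ∣ ≢ ∣ b ∣ → a Z.- b ≢ 0ℤ
abs≢⇒-≢0 {a} {b} n = abs≢⇒+≢0 {a} {Z.- b} (λ e → n (P.trans e (∣-i∣≡∣i∣ b)))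

AllPairs-resp-↭ : ∀ {A : Set} {R : A → A → Set} → (∀ {x y} → R x y → R y x) →
  ∀ {xs ys} → xs ↭ ys → AllPairs R xs → AllPairs R ys
AllPairs-resp-↭ s ↭-refl ps = ps
AllPairs-resp-↭ s (prep x p) (q ∷ qs) = All-resp-↭ p q ∷ AllPairs-resp-↭ s p qs
AllPairs-resp-↭ s (swap x y p) ((xy ∷ x*) ∷ y* ∷ qs) =
  (s xy ∷ All-resp-↭ p y*) ∷ All-resp-↭ p x* ∷ AllPairs-resp-↭ s p qs
AllPairs-resp-↭ s (↭-trans p q) ps = AllPairs-resp-↭ s q (AllPairs-resp-↭ s p ps)

Good-↭ : ∀ {S T} → S ↭ T → Good S → Good T
Good-↭ p (u , z) = AllPairs-resp-↭ (λ n e → n (P.sym e)) p u , All-resp-↭ p z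

All-abs : ∀ (P : ℕ → Set) {S T} → map ∣_∣ S ≡ map ∣_∣ T → All (λ a → P ∣ a ∣) S → All (λ a → P ∣ a ∣) T
All-abs P e h = Allₚ.map⁻ (P.subst (All P) e (Allₚ.map⁺ h))

Good-abs : ∀ S T → map ∣_∣ S ≡ map ∣_∣ T → Good S → Good T
Good-abs [] [] e g = g
Good-abs (a ∷ S) (b ∷ T) e (u ∷ us , z ∷ zs) with Lₚ.∷-injective e
... | e₁ , e₂ with Good-abs S T e₂ (us , zs)
... | (us' , zs') = (All-abs (λ n → ∣ b ∣ ≢ n) e₂ (P.subst (λ k → All (λ c → k ≢ ∣ c ∣) S) e₁ u) ∷ us')
                  , (P.subst (_≢ 0) e₁ z ∷ zs')

-- Sums over sign changes

module SignSums (L : LaurentRing) where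
  open LaurentKit L public

  ∑± : (List ℤ → C) → List ℤ → C
  ∑± g [] = g []
  ∑± g (e ∷ S) = ∑± (λ Y → g (e ∷ Y)) S + ∑± (λ Y → g ((Z.- e) ∷ Y)) S

  ∑±-cong : ∀ {g h} S → (∀ Y → map ∣_∣ Y ≡ map ∣_∣ S → g Y ≈ h Y) → ∑± g S ≈ ∑± h S
  ∑±-cong [] e = e [] P.refl
  ∑±-cong (x ∷ S) e = +-cong
    (∑±-cong S (λ Y p → e (x ∷ Y) (P.cong (∣ x ∣ ∷_) p)))
    (∑±-cong S (λ Y p → e ((Z.- x) ∷ Y) (P.cong₂ _∷_ (∣-i∣≡∣i∣ x) p)))

  ∑±-+ : ∀ f g S → ∑± (λ Y → f Y + g Y) S ≈ ∑± f S + ∑± g S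
  ∑±-+ f g [] = refl
  ∑±-+ f g (x ∷ S) = trans (+-cong (∑±-+ _ _ S) (∑±-+ _ _ S)) (+-interchange _ _ _ _)

  ∑±-*ˡ : ∀ c f S → ∑± (λ Y → c * f Y) S ≈ c * ∑± f S
  ∑±-*ˡ c f [] = refl
  ∑±-*ˡ c f (x ∷ S) = trans (+-cong (∑±-*ˡ c _ S) (∑±-*ˡ c _ S)) (sym (distribˡ _ _ _))

  ∑±-0 : ∀ S → ∑± (λ _ → 0#) S ≈ 0#
  ∑±-0 [] = refl
  ∑±-0 (x ∷ S) = trans (+-cong (∑±-0 S) (∑±-0 S)) (+-identityˡ _)

  ∑±-pick : ∀ (h : ℤ → List ℤ → C) S →
    ∑± (∑pick h) S ≈ ∑pick (λ e → ∑± (λ Y → h e Y + h (Z.- e) Y)) S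
  ∑±-pick h [] = refl
  ∑±-pick h (x ∷ S) = begin
    ∑± (λ Y → h x Y + ∑pick (λ y ys → h y (x ∷ ys)) Y) S + ∑± (λ Y → h x' Y + ∑pick (λ y ys → h y (x' ∷ ys)) Y) S
      ≈⟨ +-cong (∑±-+ _ _ S) (∑±-+ _ _ S) ⟩
    _ + _ + (_ + _) ≈⟨ +-interchange _ _ _ _ ⟩
    ∑± (h x) S + ∑± (h x') S + (∑± (∑pick (λ y ys → h y (x ∷ ys))) S + ∑± (∑pick (λ y ys → h y (x' ∷ ys))) S)
      ≈⟨ +-cong (sym (∑±-+ _ _ S)) (+-cong (∑±-pick _ S) (∑±-pick _ S)) ⟩
    ∑± (λ Y → h x Y + h x' Y) S + (∑pick _ S + ∑pick _ S) ≈⟨ +-congˡ (sym (∑pick-+ _ _ S)) ⟩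
    ∑± (λ Y → h x Y + h x' Y) S + ∑pick (λ e S' → ∑± (λ Y → h e (x ∷ Y) + h (Z.- e) (x ∷ Y)) S' + ∑± (λ Y → h e (x' ∷ Y) + h (Z.- e) (x' ∷ Y)) S') S ∎
    where x' = Z.- x

  -- Entrywise symmetrisation: only the even part of the weight G survives against a summand that is even in the picked entry.
  ∑±-even : ∀ (G : ℤ → C) (H : ℤ → List ℤ → C) S →
    (∀ e → (H' : List ℤ) → H (Z.- e) H' ≈ H e H') →
    (∀ e S' → S ↭ e ∷ S' → G e + G (Z.- e) ≈ 1# + 1#) →
    ∑± (∑pick (λ y Y → G y * H y Y)) S ≈ ∑± (∑pick H) S
  ∑±-even G H S even GG = trans (∑±-pick _ S) (trans (∑pick-cong S step) (sym (∑±-pick _ S)))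
    where
    step : ∀ e S' → S ↭ e ∷ S' → ∑± (λ Y → G e * H e Y + G (Z.- e) * H (Z.- e) Y) S' ≈ ∑± (λ Y → H e Y + H (Z.- e) Y) S'
    step e S' p = ∑±-cong S' (λ Y _ → begin
      G e * H e Y + G (Z.- e) * H (Z.- e) Y ≈⟨ +-congˡ (*-congˡ (even e Y)) ⟩
      G e * H e Y + G (Z.- e) * H e Y ≈⟨ sym (distribʳ _ _ _) ⟩
      (G e + G (Z.- e)) * H e Y ≈⟨ *-congʳ (GG e S' p) ⟩
      (1# + 1#) * H e Y ≈⟨ trans (distribʳ _ _ _) (+-cong (*-identityˡ _) (*-identityˡ _)) ⟩
      H e Y + H e Y ≈⟨ +-congˡ (sym (even e Y)) ⟩
      H e Y + H (Z.- e) Y ∎)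

-- A product formula for hyperoctahedral sums

module HyperoctahedralSum (L : LaurentRing) (t : LaurentRing.CR L .CommutativeRing.Carrier) where
  open SignSums L public

  φ : ℤ → C
  φ d = mix t (τ d)

  pairs : List ℤ → C
  pairs [] = 1#
  pairs (y ∷ Y) = ∏ (λ y' → φ (y Z.+ y')) Y * pairs Y

  -- ∏ (1 - c xʸ)/(1 - xʸ) times ∏ (1 - t xʸxʸ')/(1 - xʸxʸ') over pairs: the product side of the
  -- Littlewood identities, with c = 0 for the classical one and c = -s for the one of the theorem.
  U : C → List ℤ → C
  U c Y = ∏ (λ y → mix c (τ y)) Y * pairs Y

  pairs-↭ : ∀ {Y Y'} → Y ↭ Y' → pairs Y ≈ pairs Y'
  pairs-↭ ↭-refl = refl
  pairs-↭ (prep x p) = *-cong (∏-↭ _ p) (pairs-↭ p)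
  pairs-↭ (swap {xs} {ys} x y p) = begin
    (φ (x Z.+ y) * ∏ (λ y' → φ (x Z.+ y')) xs) * (∏ (λ y' → φ (y Z.+ y')) xs * pairs xs)
      ≈⟨ solve 4 (λ a b c d → (a :* b) :* (c :* d) := (a :* c) :* (b :* d)) refl _ _ _ _ ⟩
    (φ (x Z.+ y) * ∏ (λ y' → φ (y Z.+ y')) xs) * (∏ (λ y' → φ (x Z.+ y')) xs * pairs xs)
      ≈⟨ *-cong (*-cong (cong≈ φ (ZP.+-comm x y)) (∏-↭ _ p)) (*-cong (∏-↭ _ p) (pairs-↭ p)) ⟩
    (φ (y Z.+ x) * ∏ (λ y' → φ (y Z.+ y')) ys) * (∏ (λ y' → φ (x Z.+ y')) ys * pairs ys) ∎
  pairs-↭ (↭-trans p q) = trans (pairs-↭ p) (pairs-↭ q)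

  U-↭ : ∀ c {Y Y'} → Y ↭ Y' → U c Y ≈ U c Y'
  U-↭ c p = *-cong (∏-↭ _ p) (pairs-↭ p)

  module _ {A : Set} (val : A → ℤ) where
    -- Poles are labelled by an arbitrary type with positions `val`, because the applications need
    -- an additional pole at 0 and also lists with all positions negated.
    Apart : A → A → Set
    Apart i j = val j Z.- val i ≢ 0ℤ

    τ' : A → A → C
    τ' i j = τ (val j Z.- val i)

    compatible : ∀ z i j → val i Z.- z ≢ 0ℤ → val j Z.- z ≢ 0ℤ → Apart i j →
      τ (val i Z.- z) * τ (val j Z.- z) ≈ τ' i j * τ (val i Z.- z) + τ' j i * τ (val j Z.- z)
    compatible z i j p q r = begin
      τ (val i Z.- z) * τ (val j Z.- z) ≡⟨ P.cong (λ k → τ (val i Z.- z) * τ k) e₁ ⟩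
      τ (val i Z.- z) * τ (val i Z.- z Z.+ (val j Z.- val i))
        ≈⟨ τ-product (val i Z.- z) (val j Z.- val i) p r (λ e → q (P.trans e₁ e)) ⟩
      τ' i j * τ (val i Z.- z) + τ (Z.- (val j Z.- val i)) * τ (val i Z.- z Z.+ (val j Z.- val i))
        ≡⟨ P.cong₂ (λ k l → τ' i j * τ (val i Z.- z) + τ k * τ l) (e₂ (val i) (val j)) (P.sym e₁) ⟩
      τ' i j * τ (val i Z.- z) + τ' j i * τ (val j Z.- z) ∎
      where
      identity : ∀ a b z → b Z.- z ≡ a Z.- z Z.+ (b Z.- a)
      identity = solve-∀
      e₁ = identity (val i) (val j) z
      e₂ : ∀ a b → Z.- (b Z.- a) ≡ a Z.- b
      e₂ = solve-∀

    compatible-all : ∀ z {xs} → All (λ i → val i Z.- z ≢ 0ℤ) xs → AllPairs Apart xs →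
      AllPairs (Compatible (λ _ → t) τ' (λ i → τ (val i Z.- z))) xs
    compatible-all z [] [] = []
    compatible-all z (p ∷ ps) (d ∷ ds) =
      All.zipWith (λ {j} (q , r) → compatible z _ j p q r) (ps , d) ∷ compatible-all z ps ds

    compatible-1 : ∀ {xs} → AllPairs Apart xs → AllPairs (Compatible (λ _ → t) τ' (λ _ → 1#)) xs
    compatible-1 [] = []
    compatible-1 {i ∷ _} (d ∷ ds) = All.map (λ {j} r → begin
      1# * 1# ≈⟨ *-identityˡ 1# ⟩
      1# ≈⟨ sym (τ-reflect _ r) ⟩
      τ' i j + τ (Z.- (val j Z.- val i)) ≡⟨ P.cong (λ k → τ' i j + τ k) (e (val i) (val j)) ⟩
      τ' i j + τ' j i ≈⟨ sym (+-cong (*-identityʳ _) (*-identityʳ _)) ⟩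
      τ' i j * 1# + τ' j i * 1# ∎) d ∷ compatible-1 ds
      where
      e : ∀ a b → Z.- (b Z.- a) ≡ a Z.- b
      e = solve-∀

    family : ∀ {xs} → AllPairs Apart xs → Family (λ _ → t) τ' xs
    family [] = []
    family (d ∷ ds) = compatible-all _ d ds ∷ family ds

    module _ (c : A → C) where
      recolour : ∀ {xs} → Family (λ _ → t) τ' xs → Family c τ' xs
      recolour [] = []
      recolour (p ∷ f) = p ∷ recolour f

      ∏-mix-τ : ∀ z xs → All (λ i → val i Z.- z ≢ 0ℤ) xs → AllPairs Apart xs →
        ∏ (λ i → mix (c i) (τ (val i Z.- z))) xs ≈ ∏ c xs + residues c τ' (λ i → τ (val i Z.- z)) xs
      ∏-mix-τ z xs p d = partial-fractions c τ' xs (recolour (family d)) _ (compatible-all z p d)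

      -- The limit of `∏-mix-τ` at infinity, where every simple pole has the value 1. It evaluates
      -- the total of all residues.
      ∏-mix-1 : ∀ xs → AllPairs Apart xs → 1# ≈ ∏ c xs + residues c τ' (λ _ → 1#) xs
      ∏-mix-1 xs d = trans (sym (trans (∏-cong xs (λ i → solve 1 (λ c → c :+ (con (+ 1) :- c) :* con (+ 1) := con (+ 1)) refl (c i))) (∏-1 xs)))
        (partial-fractions c τ' xs (recolour (family d)) _ (compatible-1 d))

  module _ (c : C) where
    private
      val : Maybe ℤ → ℤ
      val nothing = 0ℤ
      val (just y) = y

      col : Maybe ℤ → C
      col nothing = c
      col (just _) = t

      -- As a function of a new entry z, the factor `mix c (τ z)` has its pole at exponent 0 and
      -- colour c, and each φ (z + y) has colour t. The label `nothing` merges both kinds into one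
      -- product.
      poles : List ℤ → List (Maybe ℤ)
      poles Y = nothing ∷ map just Y

      apart : ∀ {Y} → Good Y → AllPairs (Apart val) (poles Y)
      apart (u , z) = Allₚ.map⁺ (All.map (λ {y} n e → abs≢0 n (P.trans (P.sym (ZP.+-identityʳ y)) e)) z) ∷ go u
        where
        go : ∀ {Y} → AllPairs (λ a b → ∣ a ∣ ≢ ∣ b ∣) Y → AllPairs (Apart val) (map just Y)
        go [] = []
        go (p ∷ ps) = Allₚ.map⁺ (All.map (λ {y} n → abs≢⇒-≢0 {y} (λ e → n (P.sym e))) p) ∷ go ps

      avoid : ∀ {z Y} → Good (z ∷ Y) → All (λ i → val i Z.- z ≢ 0ℤ) (poles Y)
      avoid {z} (u ∷ _ , n ∷ _) = (λ e → neg≢0 {z} (abs≢0 n) (P.trans (P.sym (ZP.+-identityˡ _)) e))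
        ∷ Allₚ.map⁺ (All.map (λ {y} m → abs≢⇒-≢0 {y} (λ e → m (P.sym e))) u)

      F : ℤ → List ℤ → C
      F z Y = ∏ (λ i → mix (col i) (τ (val i Z.- z))) (poles Y)

      U-cons : ∀ z Y → U c (z ∷ Y) ≈ U c Y * F (Z.- z) Y
      U-cons z Y = begin
        (mix c (τ z) * ∏ (λ y → mix c (τ y)) Y) * (∏ (λ y' → φ (z Z.+ y')) Y * pairs Y)
          ≈⟨ solve 4 (λ a b c d → (a :* b) :* (c :* d) := (b :* d) :* (a :* c)) refl _ _ _ _ ⟩
        U c Y * (mix c (τ z) * ∏ (λ y' → φ (z Z.+ y')) Y)
          ≈⟨ *-congˡ (*-cong (cong≈ (λ k → mix c (τ k)) (e₀ z))
               (trans (∏-cong Y (λ y → cong≈ φ (e₁ z y))) (sym (∏-map _ just Y)))) ⟩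
        U c Y * F (Z.- z) Y ∎
        where
        e₀ : ∀ z → z ≡ 0ℤ Z.- (Z.- z)
        e₀ = solve-∀
        e₁ : ∀ z y → z Z.+ y ≡ y Z.- (Z.- z)
        e₁ = solve-∀

      R₀ : List ℤ → C
      R₀ Y = ∏ (λ j → mix (col j) (τ' val nothing j)) (map just Y)

      -- The residue of `F` at the pole y, without the factor that depends on z.
      K : ℤ → List ℤ → C
      K y ys = (1# - t) * (mix c (τ (0ℤ Z.- y)) * ∏ (λ y' → φ (y' Z.- y)) ys)

      pc : List ℤ → C
      pc Y = c * t ^ length Y

      ∏-col : ∀ Y → ∏ col (poles Y) ≈ pc Y
      ∏-col Y = *-congˡ (trans (∏-map col just Y) (∏-const t Y))

      residues-K : ∀ g Y → residues col (τ' val) g (poles Y) ≈ (1# - c) * g nothing * R₀ Y + ∑pick (λ y ys → g (just y) * K y ys) Y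
      residues-K g Y = +-congˡ (trans (∑pick-map _ just Y) (∑pick-cong Y (λ y ys _ → begin
        (1# - t) * g (just y) * (mix c (τ (0ℤ Z.- y)) * ∏ (λ j → mix (col j) (τ' val (just y) j)) (map just ys))
          ≈⟨ *-congˡ (*-congˡ (∏-map _ just ys)) ⟩
        (1# - t) * g (just y) * (mix c (τ (0ℤ Z.- y)) * ∏ (λ y' → φ (y' Z.- y)) ys)
          ≈⟨ xy∙z≈y∙xz _ _ _ ⟩
        g (just y) * K y ys ∎)))

      F-expand : ∀ z Y → Good (z ∷ Y) → F z Y ≈
        pc Y + ((1# - c) * τ (0ℤ Z.- z) * R₀ Y + ∑pick (λ y ys → τ (y Z.- z) * K y ys) Y)
      F-expand z Y g@(_ ∷ u , _ ∷ n) = trans (∏-mix-τ val col z (poles Y) (avoid g) (apart (u , n)))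
        (+-cong (∏-col Y) (residues-K _ Y))

      1-expand : ∀ Y → Good Y → 1# ≈ pc Y + ((1# - c) * 1# * R₀ Y + ∑pick (λ y ys → 1# * K y ys) Y)
      1-expand Y g = trans (∏-mix-1 val col (poles Y) (apart g)) (+-cong (∏-col Y) (residues-K _ Y))

      G : ℤ → ℤ → C
      G z y = τ (y Z.- z) + τ (y Z.- (Z.- z))

      H : ℤ → List ℤ → C
      H y ys = U c (y ∷ ys) * K y ys

      -- `U c (y ∷ ys)` supplies the factors at y and `K` those at -y, so the sign change merely
      -- exchanges them.
      H-even : ∀ e ys → H (Z.- e) ys ≈ H e ys
      H-even e ys = begin
        (mix c (τ (Z.- e)) * a) * (∏ (λ y' → φ (Z.- e Z.+ y')) ys * b) * ((1# - t) * (mix c (τ (0ℤ Z.- (Z.- e))) * ∏ (λ y' → φ (y' Z.- (Z.- e))) ys))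
          ≈⟨ *-cong (*-congˡ (*-congʳ (∏-cong ys (λ y → cong≈ φ (e₁ e y)))))
               (*-congˡ (*-cong (cong≈ (λ k → mix c (τ k)) (e₂ e)) (∏-cong ys (λ y → cong≈ φ (e₃ e y))))) ⟩
        (mix c (τ (Z.- e)) * a) * (∏ (λ y' → φ (y' Z.- e)) ys * b) * ((1# - t) * (mix c (τ e) * ∏ (λ y' → φ (e Z.+ y')) ys))
          ≈⟨ solve 7 (λ m a p b r n q → (m :* a) :* (p :* b) :* (r :* (n :* q)) := (n :* a) :* (q :* b) :* (r :* (m :* p))) refl _ _ _ _ _ _ _ ⟩
        (mix c (τ e) * a) * (∏ (λ y' → φ (e Z.+ y')) ys * b) * ((1# - t) * (mix c (τ (Z.- e)) * ∏ (λ y' → φ (y' Z.- e)) ys))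
          ≈⟨ *-congˡ (*-congˡ (*-congʳ (cong≈ (λ k → mix c (τ k)) (e₄ e)))) ⟩
        H e ys ∎
        where
        a = ∏ (λ y → mix c (τ y)) ys
        b = pairs ys
        e₁ : ∀ e y → Z.- e Z.+ y ≡ y Z.- e
        e₁ = solve-∀
        e₂ : ∀ e → 0ℤ Z.- (Z.- e) ≡ e
        e₂ = solve-∀
        e₃ : ∀ e y → y Z.- (Z.- e) ≡ e Z.+ y
        e₃ = solve-∀
        e₄ : ∀ e → Z.- e ≡ 0ℤ Z.- e
        e₄ = solve-∀

      G-sum : ∀ {z e S} → Good (z ∷ e ∷ S) → G z e + G z (Z.- e) ≈ 1# + 1#
      G-sum {z} {e} ((n ∷ _) ∷ _ , _) = begin
        (τ (e Z.- z) + τ (e Z.- (Z.- z))) + (τ (Z.- e Z.- z) + τ (Z.- e Z.- (Z.- z)))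
          ≡⟨ P.cong₂ (λ k l → (τ (e Z.- z) + τ (e Z.- (Z.- z))) + (τ k + τ l)) (e₁ e z) (e₂ e z) ⟩
        (τ (e Z.- z) + τ (e Z.- (Z.- z))) + (τ (Z.- (e Z.- (Z.- z))) + τ (Z.- (e Z.- z)))
          ≈⟨ solve 4 (λ a b c d → (a :+ b) :+ (c :+ d) := (a :+ d) :+ (b :+ c)) refl _ _ _ _ ⟩
        _ ≈⟨ +-cong (τ-reflect _ (abs≢⇒-≢0 {e} n')) (τ-reflect _ (abs≢⇒-≢0 {e} (λ p → n' (P.trans p (∣-i∣≡∣i∣ z))))) ⟩
        1# + 1# ∎
        where
        n' = λ p → n (P.sym p)
        e₁ : ∀ e z → Z.- e Z.- z ≡ Z.- (e Z.- (Z.- z))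
        e₁ = solve-∀
        e₂ : ∀ e z → Z.- e Z.- (Z.- z) ≡ Z.- (e Z.- z)
        e₂ = solve-∀

      -- Adding the two signs of z makes the pole at 0 independent of z by `τ-reflect`; only `G z y`
      -- still depends on z.
      pair-expand : ∀ z Y → Good (z ∷ Y) → U c (z ∷ Y) + U c ((Z.- z) ∷ Y) ≈
        U c Y * (pc Y + pc Y + (1# - c) * R₀ Y) + ∑pick (λ y ys → G z y * H y ys) Y
      pair-expand z Y g = begin
        U c (z ∷ Y) + U c (z' ∷ Y)
          ≈⟨ +-cong (trans (U-cons z Y) (*-congˡ (F-expand z' Y g')))
                    (trans (U-cons z' Y) (*-congˡ (trans (cong≈ (λ k → F k Y) (neg-involutive z)) (F-expand z Y g)))) ⟩
        u * (p + ((1# - c) * τ (0ℤ Z.- z') * r + ∑pick (λ y ys → τ (y Z.- z') * K y ys) Y)) +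
        u * (p + ((1# - c) * τ (0ℤ Z.- z) * r + ∑pick (λ y ys → τ (y Z.- z) * K y ys) Y))
          ≈⟨ solve 8 (λ u p c r a b s s' → u :* (p :+ ((con (+ 1) :- c) :* a :* r :+ s')) :+ u :* (p :+ ((con (+ 1) :- c) :* b :* r :+ s)) :=
               u :* (p :+ p :+ (con (+ 1) :- c) :* (a :+ b) :* r) :+ u :* (s :+ s')) refl u p c r _ _ _ _ ⟩
        u * (p + p + (1# - c) * (τ (0ℤ Z.- z') + τ (0ℤ Z.- z)) * r) + u * (∑pick (λ y ys → τ (y Z.- z) * K y ys) Y + ∑pick (λ y ys → τ (y Z.- z') * K y ys) Y)
          ≈⟨ +-cong (*-congˡ (+-congˡ (*-congʳ (trans (*-congˡ zero-pole) (*-identityʳ _)))))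
               (trans (*-congˡ (sym (∑pick-+ _ _ Y))) (trans (sym (∑pick-*ˡ u _ Y)) (∑pick-cong Y collect))) ⟩
        u * (p + p + (1# - c) * r) + ∑pick (λ y ys → G z y * H y ys) Y ∎
        where
        z' = Z.- z
        u = U c Y
        p = pc Y
        r = R₀ Y
        g' : Good (z' ∷ Y)
        g' = Good-abs (z ∷ Y) (z' ∷ Y) (P.cong (_∷ map ∣_∣ Y) (P.sym (∣-i∣≡∣i∣ z))) g
        e₁ : ∀ z → 0ℤ Z.- (Z.- z) ≡ z
        e₁ = solve-∀
        zero-pole : τ (0ℤ Z.- z') + τ (0ℤ Z.- z) ≈ 1#
        zero-pole = trans (reflexive (P.cong₂ (λ k l → τ k + τ l) (e₁ z) (ZP.+-identityˡ z'))) (τ-reflect z (abs≢0 (All.head (proj₂ g))))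
        collect : ∀ y ys → Y ↭ y ∷ ys → u * (τ (y Z.- z) * K y ys + τ (y Z.- z') * K y ys) ≈ G z y * H y ys
        collect y ys q = begin
          u * (τ (y Z.- z) * K y ys + τ (y Z.- z') * K y ys)
            ≈⟨ solve 4 (λ u a b k → u :* (a :* k :+ b :* k) := (a :+ b) :* (u :* k)) refl _ _ _ _ ⟩
          G z y * (u * K y ys) ≈⟨ *-congˡ (*-congʳ (U-↭ c q)) ⟩
          G z y * H y ys ∎

    -- Symmetrising over the sign of y replaces `G z y` by its mean 1. What is left is the expansion
    -- of 1 at infinity together with a second copy of the constant term c t^|S|, and z has
    -- disappeared.
    ∑±-U : ∀ z S → Good (z ∷ S) → ∑± (U c) (z ∷ S) ≈ (1# + c * t ^ length S) * ∑± (U c) S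
    ∑±-U z S g = begin
      ∑± (λ Y → U c (z ∷ Y)) S + ∑± (λ Y → U c ((Z.- z) ∷ Y)) S ≈⟨ sym (∑±-+ _ _ S) ⟩
      ∑± (λ Y → U c (z ∷ Y) + U c ((Z.- z) ∷ Y)) S
        ≈⟨ ∑±-cong S (λ Y q → pair-expand z Y (Good-abs (z ∷ S) (z ∷ Y) (P.cong (∣ z ∣ ∷_) (P.sym q)) g)) ⟩
      ∑± (λ Y → U c Y * (pc Y + pc Y + (1# - c) * R₀ Y) + ∑pick (λ y ys → G z y * H y ys) Y) S
        ≈⟨ trans (∑±-+ _ _ S) (+-congˡ (∑±-even (G z) H S H-even (λ e S' q → G-sum {z} {e} {S'} (Good-↭ (prep z q) g)))) ⟩
      ∑± (λ Y → U c Y * (pc Y + pc Y + (1# - c) * R₀ Y)) S + ∑± (∑pick H) S ≈⟨ sym (∑±-+ _ _ S) ⟩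
      ∑± (λ Y → U c Y * (pc Y + pc Y + (1# - c) * R₀ Y) + ∑pick H Y) S
        ≈⟨ ∑±-cong S (λ Y q → resum Y (Good-abs S Y (P.sym q) (drop-good g)) (P.trans (P.sym (Lₚ.length-map ∣_∣ Y)) (P.trans (P.cong length q) (Lₚ.length-map ∣_∣ S)))) ⟩
      ∑± (λ Y → (1# + c * t ^ length S) * U c Y) S ≈⟨ ∑±-*ˡ _ _ S ⟩
      (1# + c * t ^ length S) * ∑± (U c) S ∎
      where
      drop-good : ∀ {z S} → Good (z ∷ S) → Good S
      drop-good (_ ∷ u , _ ∷ n) = u , n
      resum : ∀ Y → Good Y → length Y ≡ length S →
        U c Y * (pc Y + pc Y + (1# - c) * R₀ Y) + ∑pick H Y ≈ (1# + c * t ^ length S) * U c Y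
      resum Y gY l = begin
        u * (p + p + (1# - c) * R₀ Y) + ∑pick H Y
          ≈⟨ +-congˡ (trans (∑pick-cong Y (λ y ys q → trans (*-congʳ (sym (U-↭ c q))) (*-congˡ (sym (*-identityˡ _))))) (∑pick-*ˡ u _ Y)) ⟩
        u * (p + p + (1# - c) * R₀ Y) + u * ∑pick (λ y ys → 1# * K y ys) Y
          ≈⟨ solve 5 (λ u p c r s → u :* (p :+ p :+ (con (+ 1) :- c) :* r) :+ u :* s :=
               (p :+ (p :+ ((con (+ 1) :- c) :* con (+ 1) :* r :+ s))) :* u) refl u p c _ _ ⟩
        (p + (p + ((1# - c) * 1# * R₀ Y + ∑pick (λ y ys → 1# * K y ys) Y))) * u
          ≈⟨ *-congʳ (+-congˡ (sym (1-expand Y gY))) ⟩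
        (p + 1#) * u ≈⟨ *-congʳ (+-comm _ _) ⟩
        (1# + p) * u ≡⟨ P.cong (λ k → (1# + c * t ^ k) * u) l ⟩
        (1# + c * t ^ length S) * u ∎
        where
        u = U c Y
        p = pc Y

-- The shuffle algebra of set functions

AllPairs-++⁻ : ∀ {A : Set} {R : A → A → Set} xs {ys} → AllPairs R (xs ++ ys) → AllPairs R xs × AllPairs R ys
AllPairs-++⁻ [] ps = [] , ps
AllPairs-++⁻ (x ∷ xs) (p ∷ ps) = (Allₚ.++⁻ˡ xs p ∷ proj₁ (AllPairs-++⁻ xs ps)) , proj₂ (AllPairs-++⁻ xs ps)

Good-++⁻ : ∀ I {J} → Good (I ++ J) → Good I × Good J
Good-++⁻ I (u , z) = (proj₁ (AllPairs-++⁻ I u) , Allₚ.++⁻ˡ I z) , (proj₂ (AllPairs-++⁻ I u) , Allₚ.++⁻ʳ I z)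

length-↭ : ∀ {A : Set} {xs ys : List A} → xs ↭ ys → length xs ≡ length ys
length-↭ ↭-refl = P.refl
length-↭ (prep x p) = P.cong suc (length-↭ p)
length-↭ (swap x y p) = P.cong (suc ∘ suc) (length-↭ p)
length-↭ (↭-trans p q) = P.trans (length-↭ p) (length-↭ q)

module Shuffle (L : LaurentRing) (t : LaurentRing.CR L .CommutativeRing.Carrier) where
  open HyperoctahedralSum L t public

  ∑split-cong : ∀ {A : Set} {g h : List A → List A → C} S → (∀ I J → S ↭ I ++ J → g I J ≈ h I J) → ∑split g S ≈ ∑split h S
  ∑split-cong [] e = e [] [] ↭-refl
  ∑split-cong (x ∷ S) e = +-cong
    (∑split-cong S (λ I J p → e (x ∷ I) J (prep x p)))
    (∑split-cong S (λ I J p → e I (x ∷ J) (↭-trans (prep x p) (↭-sym (shift x I J)))))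

  ∑split-+ : ∀ {A : Set} (g h : List A → List A → C) S → ∑split (λ I J → g I J + h I J) S ≈ ∑split g S + ∑split h S
  ∑split-+ g h [] = refl
  ∑split-+ g h (x ∷ S) = trans (+-cong (∑split-+ _ _ S) (∑split-+ _ _ S)) (+-interchange _ _ _ _)

  ∑split-*ˡ : ∀ {A : Set} c (g : List A → List A → C) S → ∑split (λ I J → c * g I J) S ≈ c * ∑split g S
  ∑split-*ˡ c g [] = refl
  ∑split-*ˡ c g (x ∷ S) = trans (+-cong (∑split-*ˡ c _ S) (∑split-*ˡ c _ S)) (sym (distribˡ _ _ _))

  ∑split-assoc : ∀ {A : Set} (g : List A → List A → List A → C) S →
    ∑split (λ I J → ∑split (λ I₁ I₂ → g I₁ I₂ J) I) S ≈ ∑split (λ I J → ∑split (λ J₁ J₂ → g I J₁ J₂) J) S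
  ∑split-assoc g [] = refl
  ∑split-assoc g (x ∷ S) = begin
    ∑split (λ I J → ∑split (λ I₁ I₂ → g (x ∷ I₁) I₂ J) I + ∑split (λ I₁ I₂ → g I₁ (x ∷ I₂) J) I) S
      + ∑split (λ I J → ∑split (λ I₁ I₂ → g I₁ I₂ (x ∷ J)) I) S
      ≈⟨ +-congʳ (∑split-+ _ _ S) ⟩
    _ + _ + _ ≈⟨ +-cong (+-cong (∑split-assoc _ S) (∑split-assoc _ S)) (∑split-assoc _ S) ⟩
    _ + _ + _ ≈⟨ +-assoc _ _ _ ⟩
    _ + (_ + _) ≈⟨ +-congˡ (sym (∑split-+ _ _ S)) ⟩
    ∑split (λ I J → ∑split (λ J₁ J₂ → g (x ∷ I) J₁ J₂) J) S
      + ∑split (λ I J → ∑split (λ J₁ J₂ → g I (x ∷ J₁) J₂) J + ∑split (λ J₁ J₂ → g I J₁ (x ∷ J₂)) J) S ∎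

  ∑split-∏ : ∀ {A : Set} (p : A → C) (g : List A → List A → C) S →
    ∑split (λ I J → (∏ p I * ∏ p J) * g I J) S ≈ ∏ p S * ∑split g S
  ∑split-∏ p g S = trans (∑split-cong S (λ I J q → *-congʳ (trans (sym (∏-++ p I J)) (sym (∏-↭ p q))))) (∑split-*ˡ _ g S)

  ∑split-pickʳ : ∀ {A : Set} (k : A → List A → List A → C) S →
    ∑split (λ I J → ∑pick (λ l J' → k l I J') J) S ≈ ∑pick (λ l → ∑split (k l)) S
  ∑split-pickʳ k [] = refl
  ∑split-pickʳ k (x ∷ S) = begin
    ∑split (λ I J → ∑pick (λ l J' → k l (x ∷ I) J') J) S + ∑split (λ I J → k x I J + ∑pick (λ l J' → k l I (x ∷ J')) J) S
      ≈⟨ +-cong (∑split-pickʳ _ S) (trans (∑split-+ _ _ S) (+-congˡ (∑split-pickʳ _ S))) ⟩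
    _ + (_ + _) ≈⟨ solve 3 (λ a b c → a :+ (b :+ c) := b :+ (a :+ c)) refl _ _ _ ⟩
    _ + (_ + _) ≈⟨ +-congˡ (sym (∑pick-+ _ _ S)) ⟩
    ∑split (k x) S + ∑pick (λ l S' → ∑split (λ I J → k l (x ∷ I) J) S' + ∑split (λ I J → k l I (x ∷ J)) S') S ∎

  ∑split-pickˡ : ∀ {A : Set} (k : A → List A → List A → C) S →
    ∑split (λ I J → ∑pick (λ l I' → k l I' J) I) S ≈ ∑pick (λ l → ∑split (k l)) S
  ∑split-pickˡ k [] = refl
  ∑split-pickˡ k (x ∷ S) = begin
    ∑split (λ I J → k x I J + ∑pick (λ l I' → k l (x ∷ I') J) I) S + ∑split (λ I J → ∑pick (λ l I' → k l I' (x ∷ J)) I) S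
      ≈⟨ +-cong (trans (∑split-+ _ _ S) (+-congˡ (∑split-pickˡ _ S))) (∑split-pickˡ _ S) ⟩
    _ + _ + _ ≈⟨ +-assoc _ _ _ ⟩
    _ + (_ + _) ≈⟨ +-congˡ (sym (∑pick-+ _ _ S)) ⟩
    ∑split (k x) S + ∑pick (λ l S' → ∑split (λ I J → k l (x ∷ I) J) S' + ∑split (λ I J → k l I (x ∷ J)) S') S ∎

  -- In the variables xⁱ this is ∏ (xⁱ - t xʲ)/(xⁱ - xʲ), the Hall-Littlewood factor between a block
  -- of variables I and a block J of smaller exponent in the monomial.
  𝒜 : List ℤ → List ℤ → C
  𝒜 I J = ∏ (λ i → ∏ (λ j → φ (j Z.- i)) J) I

  𝒜-↭ˡ : ∀ {I I'} J → I ↭ I' → 𝒜 I J ≈ 𝒜 I' J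
  𝒜-↭ˡ J p = ∏-↭ _ p

  𝒜-↭ʳ : ∀ I {J J'} → J ↭ J' → 𝒜 I J ≈ 𝒜 I J'
  𝒜-↭ʳ I p = ∏-cong I (λ i → ∏-↭ _ p)

  𝒜-++ˡ : ∀ I I' J → 𝒜 (I ++ I') J ≈ 𝒜 I J * 𝒜 I' J
  𝒜-++ˡ I I' J = ∏-++ _ I I'

  𝒜-++ʳ : ∀ I J J' → 𝒜 I (J ++ J') ≈ 𝒜 I J * 𝒜 I J'
  𝒜-++ʳ I J J' = trans (∏-cong I (λ i → ∏-++ _ J J')) (∏-* _ _ I)

  𝒜-∷ʳ : ∀ I z J → 𝒜 I (z ∷ J) ≈ ∏ (λ i → φ (z Z.- i)) I * 𝒜 I J
  𝒜-∷ʳ I z J = ∏-* _ _ I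

  infixl 7 _⋆_
  _⋆_ : (List ℤ → C) → (List ℤ → C) → List ℤ → C
  (u ⋆ v) S = ∑split (λ I J → 𝒜 I J * (u I * v J)) S

  infix 4 _≐_
  -- Equality is asked for on `Good` alphabets only, where no factor φ has a vanishing denominator.
  _≐_ : (List ℤ → C) → (List ℤ → C) → Set
  u ≐ v = ∀ S → Good S → u S ≈ v S

  ≐-refl : ∀ {u} → u ≐ u
  ≐-refl S g = refl

  ≐-sym : ∀ {u v} → u ≐ v → v ≐ u
  ≐-sym e S g = sym (e S g)

  ≐-trans : ∀ {u v w} → u ≐ v → v ≐ w → u ≐ w
  ≐-trans e f S g = trans (e S g) (f S g)

  ⋆-cong : ∀ {u u' v v'} → u ≐ u' → v ≐ v' → u ⋆ v ≐ u' ⋆ v'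
  ⋆-cong e f S g = ∑split-cong S (λ I J p →
    *-congˡ (*-cong (e I (proj₁ (Good-++⁻ I (Good-↭ p g)))) (f J (proj₂ (Good-++⁻ I (Good-↭ p g))))))

  ⋆-assoc : ∀ u v w → (u ⋆ v) ⋆ w ≐ u ⋆ (v ⋆ w)
  ⋆-assoc u v w S _ = begin
    ∑split (λ I J → 𝒜 I J * ((u ⋆ v) I * w J)) S
      ≈⟨ ∑split-cong S (λ I J _ → trans (x∙yz≈xz∙y _ _ _)
           (trans (sym (∑split-*ˡ _ _ I)) (∑split-cong I (λ I₁ I₂ p → begin
             𝒜 I J * w J * (𝒜 I₁ I₂ * (u I₁ * v I₂))
               ≈⟨ *-congʳ (*-congʳ (trans (𝒜-↭ˡ J p) (𝒜-++ˡ I₁ I₂ J))) ⟩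
             𝒜 I₁ J * 𝒜 I₂ J * w J * (𝒜 I₁ I₂ * (u I₁ * v I₂))
               ≈⟨ solve 6 (λ a b c d e f → a :* b :* f :* (c :* (d :* e)) := c :* a :* b :* (d :* e :* f)) refl _ _ _ _ _ _ ⟩
             𝒜 I₁ I₂ * 𝒜 I₁ J * 𝒜 I₂ J * (u I₁ * v I₂ * w J) ∎)))) ⟩
    ∑split (λ I J → ∑split (λ I₁ I₂ → 𝒜 I₁ I₂ * 𝒜 I₁ J * 𝒜 I₂ J * (u I₁ * v I₂ * w J)) I) S
      ≈⟨ ∑split-assoc (λ I J K → 𝒜 I J * 𝒜 I K * 𝒜 J K * (u I * v J * w K)) S ⟩
    ∑split (λ I J → ∑split (λ J₁ J₂ → 𝒜 I J₁ * 𝒜 I J₂ * 𝒜 J₁ J₂ * (u I * v J₁ * w J₂)) J) S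
      ≈⟨ ∑split-cong S (λ I J _ → sym (trans (solve 3 (λ a b c → a :* (b :* c) := (a :* b) :* c) refl _ _ _)
           (trans (sym (∑split-*ˡ _ _ J)) (∑split-cong J (λ J₁ J₂ p → begin
             𝒜 I J * u I * (𝒜 J₁ J₂ * (v J₁ * w J₂))
               ≈⟨ *-congʳ (*-congʳ (trans (𝒜-↭ʳ I p) (𝒜-++ʳ I J₁ J₂))) ⟩
             𝒜 I J₁ * 𝒜 I J₂ * u I * (𝒜 J₁ J₂ * (v J₁ * w J₂))
               ≈⟨ solve 6 (λ a b c d e f → a :* b :* d :* (c :* (e :* f)) := a :* b :* c :* (d :* e :* f)) refl _ _ _ _ _ _ ⟩
             𝒜 I J₁ * 𝒜 I J₂ * 𝒜 J₁ J₂ * (u I * v J₁ * w J₂) ∎))))) ⟩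
    ∑split (λ I J → 𝒜 I J * (u I * (v ⋆ w) J)) S ∎

  infixr 8 _·_
  _·_ : (ℤ → C) → (List ℤ → C) → List ℤ → C
  (p · u) S = ∏ p S * u S

  ·-cong : ∀ {u v} p → u ≐ v → p · u ≐ p · v
  ·-cong p e S g = *-congˡ (e S g)

  -- The product of p over S factors along every splitting, so weighting by it is an endomorphism.
  -- In this way powers of x are moved through products of levels.
  ·-⋆ : ∀ p u v → p · (u ⋆ v) ≐ (p · u) ⋆ (p · v)
  ·-⋆ p u v S g = trans (sym (∑split-∏ p _ S)) (∑split-cong S (λ I J _ →
    solve 5 (λ a b c d e → (a :* b) :* (c :* (d :* e)) := c :* ((a :* d) :* (b :* e))) refl _ _ _ _ _))

  𝟙 : List ℤ → C
  𝟙 _ = 1#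

  ∑±-split : ∀ (g : List ℤ → C) S → (∀ {Y Y'} → Y ↭ Y' → g Y ≈ g Y') →
    ∑± g S ≈ ∑split (λ J K → g (map Z.-_ J ++ K)) S
  ∑±-split g [] inv = refl
  ∑±-split g (x ∷ S) inv = trans (+-comm _ _) (+-cong (∑±-split _ S (λ p → inv (prep _ p)))
    (trans (∑±-split _ S (λ p → inv (prep _ p))) (∑split-cong S (λ J K _ → inv (↭-sym (shift x (map Z.-_ J) K))))))

  pairs-++ : ∀ X Y → pairs (X ++ Y) ≈ pairs X * pairs Y * ∏ (λ x → ∏ (λ y → φ (x Z.+ y)) Y) X
  pairs-++ [] Y = sym (trans (*-identityʳ _) (*-identityˡ _))
  pairs-++ (x ∷ X) Y = trans (*-cong (∏-++ _ X Y) (pairs-++ X Y))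
    (solve 5 (λ a b c d e → (a :* b) :* (c :* d :* e) := (a :* c) :* d :* (b :* e)) refl _ _ _ _ _)

  U⁻ : C → List ℤ → C
  U⁻ c J = U c (map Z.-_ J)

  -- A sign choice is the splitting into the negated entries J and the remaining entries K, and the
  -- mixed factors φ (k - j) are exactly `𝒜 J K`.
  ∑±-U-⋆ : ∀ c S → ∑± (U c) S ≈ (U⁻ c ⋆ U c) S
  ∑±-U-⋆ c S = trans (∑±-split (U c) S (U-↭ c)) (∑split-cong S (λ J K _ → begin
    U c (map Z.-_ J ++ K) ≈⟨ *-cong (∏-++ _ (map Z.-_ J) K) (pairs-++ (map Z.-_ J) K) ⟩
    _ ≈⟨ solve 5 (λ a b c d e → (a :* b) :* (c :* d :* e) := e :* ((a :* c) :* (b :* d))) refl _ _ _ _ _ ⟩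
    ∏ (λ x → ∏ (λ y → φ (x Z.+ y)) K) (map Z.-_ J) * (U⁻ c J * U c K)
      ≈⟨ *-congʳ (trans (∏-map _ Z.-_ J) (∏-cong J (λ j → ∏-cong K (λ k → cong≈ φ (ZP.+-comm (Z.- j) k))))) ⟩
    𝒜 J K * (U⁻ c J * U c K) ∎))

-- Splitting sums and Gaussian binomials

module Pascal (L : LaurentRing) (t : LaurentRing.CR L .CommutativeRing.Carrier) where
  open Shuffle L t public

  module Exchange (p : ℤ → C) (β : C) (g : ℕ → ℕ → C) (z : ℤ) where
    private
      Rʳ Rˡ : ℤ → List ℤ → C
      Rʳ l J = (1# - t) * ∏ (λ j → φ (j Z.- l)) J
      Rˡ l I = (1# - t) * ∏ (λ i → φ (l Z.- i)) I

      Distinct : List ℤ → Set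
      Distinct = AllPairs (λ a b → b Z.- a ≢ 0ℤ)

      distinct : ∀ {S} → Good S → Distinct S
      distinct ([] , _) = []
      distinct (u ∷ us , _ ∷ n) = All.map (λ {b} m → abs≢⇒-≢0 {b} (λ e → m (P.sym e))) u ∷ distinct (us , n)

      avoid : ∀ {S} → Good (z ∷ S) → All (λ a → a Z.- z ≢ 0ℤ) S
      avoid (u ∷ _ , _) = All.map (λ {b} m → abs≢⇒-≢0 {b} (λ e → m (P.sym e))) u

      tail-good : ∀ {z S} → Good (z ∷ S) → Good S
      tail-good (_ ∷ u , _ ∷ n) = u , n

      expandʳ : ∀ J → Good (z ∷ J) → ∏ (λ j → φ (j Z.- z)) J ≈ t ^ length J + ∑pick (λ l J' → τ (l Z.- z) * Rʳ l J') J
      expandʳ J G = trans (∏-mix-τ id (λ _ → t) z J (avoid G) (distinct (tail-good G)))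
        (+-cong (∏-const t J) (∑pick-cong J (λ l J' _ → xy∙z≈y∙xz _ _ _)))

      1-expandʳ : ∀ J → Good J → 1# ≈ t ^ length J + ∑pick (λ l J' → 1# * Rʳ l J') J
      1-expandʳ J G = trans (∏-mix-1 id (λ _ → t) J (distinct G))
        (+-cong (∏-const t J) (∑pick-cong J (λ l J' _ → xy∙z≈y∙xz _ _ _)))

      flip₁ : ∀ a b → Z.- b Z.- (Z.- a) ≡ a Z.- b
      flip₁ = solve-∀

      flip₂ : ∀ a b → Z.- b Z.- (Z.- a) ≡ Z.- (b Z.- a)
      flip₂ = solve-∀

      neg-apart : ∀ {a b} → b Z.- a ≢ 0ℤ → Z.- b Z.- (Z.- a) ≢ 0ℤ
      neg-apart {a} {b} n e = neg≢0 n (P.trans (P.sym (flip₂ a b)) e)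

      neg-distinct : ∀ {S} → Distinct S → AllPairs (Apart (λ a → Z.- a)) S
      neg-distinct [] = []
      neg-distinct (d ∷ ds) = All.map (λ {b} → neg-apart {b = b}) d ∷ neg-distinct ds

      collectˡ : ∀ (a : ℤ → C) k I → (1# - t) * a k * ∏ (λ i → mix t (τ' (λ a → Z.- a) k i)) I ≈ a k * Rˡ k I
      collectˡ a k I = trans (*-congˡ (∏-cong I (λ i → cong≈ φ (flip₁ k i))))
        (xy∙z≈y∙xz _ _ _)

      -- Here i is subtracted from z, so this is the expansion with all positions negated.
      expandˡ : ∀ I → Good (z ∷ I) → ∏ (λ i → φ (z Z.- i)) I ≈ t ^ length I + ∑pick (λ l I' → τ (z Z.- l) * Rˡ l I') I
      expandˡ I G = begin
        ∏ (λ i → φ (z Z.- i)) I ≈⟨ ∏-cong I (λ i → cong≈ φ (P.sym (flip₁ z i))) ⟩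
        ∏ (λ i → φ (Z.- i Z.- (Z.- z))) I
          ≈⟨ ∏-mix-τ (λ a → Z.- a) (λ _ → t) (Z.- z) I (All.map (λ {b} → neg-apart {b = b}) (avoid G)) (neg-distinct (distinct (tail-good G))) ⟩
        _ ≈⟨ +-cong (∏-const t I) (∑pick-cong I (λ l I' _ → trans (collectˡ (λ l → τ (Z.- l Z.- (Z.- z))) l I') (*-congʳ (cong≈ τ (flip₁ z l))))) ⟩
        t ^ length I + ∑pick (λ l I' → τ (z Z.- l) * Rˡ l I') I ∎

      1-expandˡ : ∀ I → Good I → 1# ≈ t ^ length I + ∑pick (λ l I' → 1# * Rˡ l I') I
      1-expandˡ I G = trans (∏-mix-1 (λ a → Z.- a) (λ _ → t) I (neg-distinct (distinct G)))
        (+-cong (∏-const t I) (∑pick-cong I (λ l I' _ → collectˡ (λ _ → 1#) l I')))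

      w₁ w₂ : List ℤ → List ℤ → C
      w₁ I J = 𝒜 I J * (∏ p I * (p z * g (suc (length I)) (length J)))
      w₂ I J = 𝒜 I J * (∏ p I * g (length I) (suc (length J)))

      -- The residue at l shared by the placements z ∈ I, l ∈ J and l ∈ I, z ∈ J. In both of them
      -- each part has one element more than the I and J of the remaining splitting, hence the two
      -- successors.
      Z : ℤ → List ℤ → List ℤ → C
      Z l I J = ∏ p I * g (suc (length I)) (suc (length J)) * (∏ (λ i → φ (l Z.- i)) I * 𝒜 I J * ((1# - t) * ∏ (λ j → φ (j Z.- l)) J))

      pickʳ : ∀ (a : ℤ → C) S → ∑split (λ I J → w₁ I J * ∑pick (λ l J' → a l * Rʳ l J') J) S
        ≈ ∑pick (λ l → ∑split (λ I J → (a l * p z) * Z l I J)) S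
      pickʳ a S = trans (∑split-cong S (λ I J _ → trans (sym (∑pick-*ˡ _ _ J)) (∑pick-cong J (λ l J' q → begin
        𝒜 I J * (∏ p I * (p z * g (suc (length I)) (length J))) * (a l * Rʳ l J')
          ≈⟨ *-congʳ (*-cong (trans (𝒜-↭ʳ I q) (𝒜-∷ʳ I l J')) (*-congˡ (*-congˡ (cong≈ (g (suc (length I))) (length-↭ q))))) ⟩
        ∏ (λ i → φ (l Z.- i)) I * 𝒜 I J' * (∏ p I * (p z * g (suc (length I)) (suc (length J')))) * (a l * Rʳ l J')
          ≈⟨ solve 7 (λ f A P pz G a R → f :* A :* (P :* (pz :* G)) :* (a :* R) := (a :* pz) :* (P :* G :* (f :* A :* R))) refl _ _ _ _ _ _ _ ⟩
        (a l * p z) * Z l I J' ∎)))) (∑split-pickʳ _ S)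

      pickˡ : ∀ (a : ℤ → C) S → ∑split (λ I J → w₂ I J * ∑pick (λ l I' → a l * Rˡ l I') I) S
        ≈ ∑pick (λ l → ∑split (λ I J → (a l * p l) * Z l I J)) S
      pickˡ a S = trans (∑split-cong S (λ I J _ → trans (sym (∑pick-*ˡ _ _ I)) (∑pick-cong I (λ l I' q → begin
        𝒜 I J * (∏ p I * g (length I) (suc (length J))) * (a l * Rˡ l I')
          ≈⟨ *-congʳ (*-cong (𝒜-↭ˡ J q) (*-cong (∏-↭ p q) (cong≈ (λ k → g k (suc (length J))) (length-↭ q)))) ⟩
        ∏ (λ j → φ (j Z.- l)) J * 𝒜 I' J * (p l * ∏ p I' * g (suc (length I')) (suc (length J))) * (a l * ((1# - t) * ∏ (λ i → φ (l Z.- i)) I'))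
          ≈⟨ solve 8 (λ f A pl P G a T R → f :* A :* (pl :* P :* G) :* (a :* (T :* R)) := (a :* pl) :* (P :* G :* (R :* A :* (T :* f)))) refl _ _ _ _ _ _ _ _ ⟩
        (a l * p l) * Z l I' J ∎)))) (∑split-pickˡ _ S)

    -- Removes z from all interactions. Expanding in z, the residues at l for z ∈ I and for z ∈ J
    -- agree up to their coefficients. The hypothesis replaces these coefficients by values without
    -- `τ`, and the expansions of 1 then sum the residues again, now without z.
    exchange : (∀ l → l Z.- z ≢ 0ℤ → τ (l Z.- z) * p z + τ (z Z.- l) * p l ≈ p z + β * p l) →
      ∀ S → Good (z ∷ S) →
      ∑split (λ I J → 𝒜 I J * (∏ p I * g (length I) (length J))) (z ∷ S) ≈
      ∑split (λ I J → 𝒜 I J * (∏ p I * (p z * g (suc (length I)) (length J)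
        + g (length I) (suc (length J)) * (t ^ length I + β * (1# - t ^ length I))))) S
    exchange hyp S G = begin
      ∑split (λ I J → 𝒜 (z ∷ I) J * (p z * ∏ p I * g (suc (length I)) (length J))) S
        + ∑split (λ I J → 𝒜 I (z ∷ J) * (∏ p I * g (length I) (suc (length J)))) S
        ≈⟨ +-cong (∑split-cong S left) (∑split-cong S right) ⟩
      ∑split (λ I J → w₁ I J * t ^ length J + w₁ I J * ∑pick (λ l J' → τ (l Z.- z) * Rʳ l J') J) S
        + ∑split (λ I J → w₂ I J * t ^ length I + w₂ I J * ∑pick (λ l I' → τ (z Z.- l) * Rˡ l I') I) S
        ≈⟨ +-cong (trans (∑split-+ _ _ S) (+-congˡ (pickʳ (λ l → τ (l Z.- z)) S)))
                  (trans (∑split-+ _ _ S) (+-congˡ (pickˡ (λ l → τ (z Z.- l)) S))) ⟩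
      _ + _ + (_ + _) ≈⟨ +-interchange _ _ _ _ ⟩
      _ + (_ + _) ≈⟨ +-congˡ (trans (sym (∑pick-+ _ _ S)) (trans (∑pick-cong S swapped) (∑pick-+ _ _ S))) ⟩
      _ + (_ + _) ≈⟨ +-interchange _ _ _ _ ⟩
      _ + _ + (_ + _)
        ≈⟨ +-cong (trans (+-congˡ (sym (pickʳ (λ _ → 1#) S))) (sym (∑split-+ _ _ S)))
                  (trans (+-congˡ (sym (pickˡ (λ _ → β) S))) (sym (∑split-+ _ _ S))) ⟩
      ∑split (λ I J → w₁ I J * t ^ length J + w₁ I J * ∑pick (λ l J' → 1# * Rʳ l J') J) S
        + ∑split (λ I J → w₂ I J * t ^ length I + w₂ I J * ∑pick (λ l I' → β * Rˡ l I') I) S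
        ≈⟨ sym (∑split-+ _ _ S) ⟩
      _ ≈⟨ ∑split-cong S final ⟩
      ∑split (λ I J → 𝒜 I J * (∏ p I * (p z * g (suc (length I)) (length J)
        + g (length I) (suc (length J)) * (t ^ length I + β * (1# - t ^ length I))))) S ∎
      where
      good : ∀ {I J} → S ↭ I ++ J → Good (z ∷ I) × Good (z ∷ J)
      good {I} {J} q = proj₁ (Good-++⁻ (z ∷ I) (Good-↭ (prep z q) G))
                     , proj₁ (Good-++⁻ (z ∷ J) (Good-↭ (prep z (↭-trans q (++-comm I J))) G))
      left : ∀ I J → S ↭ I ++ J → _
      left I J q = begin
        ∏ (λ j → φ (j Z.- z)) J * 𝒜 I J * (p z * ∏ p I * g (suc (length I)) (length J))
          ≈⟨ *-congʳ (*-congʳ (expandʳ J (proj₂ (good q)))) ⟩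
        _ ≈⟨ solve 6 (λ x y A pz P G → (x :+ y) :* A :* (pz :* P :* G) := A :* (P :* (pz :* G)) :* x :+ A :* (P :* (pz :* G)) :* y) refl _ _ _ _ _ _ ⟩
        w₁ I J * t ^ length J + w₁ I J * ∑pick (λ l J' → τ (l Z.- z) * Rʳ l J') J ∎
      right : ∀ I J → S ↭ I ++ J → _
      right I J q = begin
        𝒜 I (z ∷ J) * (∏ p I * g (length I) (suc (length J)))
          ≈⟨ *-congʳ (trans (𝒜-∷ʳ I z J) (*-congʳ (expandˡ I (proj₁ (good q))))) ⟩
        _ ≈⟨ solve 4 (λ x y A w → (x :+ y) :* A :* w := A :* w :* x :+ A :* w :* y) refl _ _ _ _ ⟩
        w₂ I J * t ^ length I + w₂ I J * ∑pick (λ l I' → τ (z Z.- l) * Rˡ l I') I ∎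
      swapped : ∀ l S' → S ↭ l ∷ S' →
        ∑split (λ I J → (τ (l Z.- z) * p z) * Z l I J) S' + ∑split (λ I J → (τ (z Z.- l) * p l) * Z l I J) S' ≈
        ∑split (λ I J → (1# * p z) * Z l I J) S' + ∑split (λ I J → (β * p l) * Z l I J) S'
      swapped l S' q = begin
        _ ≈⟨ +-cong (∑split-*ˡ _ _ S') (∑split-*ˡ _ _ S') ⟩
        _ ≈⟨ sym (distribʳ _ _ _) ⟩
        (τ (l Z.- z) * p z + τ (z Z.- l) * p l) * ∑split (Z l) S'
          ≈⟨ *-congʳ (trans (hyp l (All.head (All-resp-↭ q (avoid G)))) (+-congʳ (sym (*-identityˡ _)))) ⟩
        (1# * p z + β * p l) * ∑split (Z l) S' ≈⟨ distribʳ _ _ _ ⟩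
        _ ≈⟨ sym (+-cong (∑split-*ˡ _ _ S') (∑split-*ˡ _ _ S')) ⟩
        _ ∎
      final : ∀ I J → S ↭ I ++ J → _
      final I J q = begin
        (w₁ I J * t ^ length J + w₁ I J * ∑pick (λ l J' → 1# * Rʳ l J') J) + (w₂ I J * t ^ length I + w₂ I J * ∑pick (λ l I' → β * Rˡ l I') I)
          ≈⟨ +-cong (trans (sym (distribˡ _ _ _)) (trans (*-congˡ (sym (1-expandʳ J (tail-good (proj₂ (good q)))))) (*-identityʳ _)))
                    (+-congˡ (*-congˡ (trans (∑pick-cong I (λ l I' _ → *-congˡ (sym (*-identityˡ _)))) (∑pick-*ˡ β _ I)))) ⟩
        w₁ I J + (w₂ I J * t ^ length I + w₂ I J * (β * ∑pick (λ l I' → 1# * Rˡ l I') I))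
          ≈⟨ +-congˡ (+-congˡ (*-congˡ (*-congˡ (begin
               r ≈⟨ solve 2 (λ r x → r := x :+ r :- x) refl r (t ^ length I) ⟩
               t ^ length I + r - t ^ length I ≈⟨ +-congʳ (sym (1-expandˡ I (tail-good (proj₁ (good q))))) ⟩
               1# - t ^ length I ∎)))) ⟩
        w₁ I J + (w₂ I J * t ^ length I + w₂ I J * (β * (1# - t ^ length I)))
          ≈⟨ solve 7 (λ A P pz G H x b → A :* (P :* (pz :* G)) :+ (A :* (P :* H) :* x :+ A :* (P :* H) :* (b :* (con (+ 1) :- x))) :=
               A :* (P :* (pz :* G :+ H :* (x :+ b :* (con (+ 1) :- x))))) refl _ _ _ _ _ _ _ ⟩
        _ ∎
        where r = ∑pick (λ l I' → 1# * Rˡ l I') I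

  -- ∑ₖ [N choose k]ₜ g(k, N-k), through the Pascal recursion for Gaussian binomials.
  gauss : (ℕ → ℕ → C) → ℕ → C
  gauss g zero = g 0 0
  gauss g (suc N) = gauss (λ i j → g (suc i) j) N + gauss (λ i j → t ^ i * g i (suc j)) N

  gauss-cong : ∀ {g h} N → (∀ i j → i N.+ j ≡ N → g i j ≈ h i j) → gauss g N ≈ gauss h N
  gauss-cong zero e = e 0 0 P.refl
  gauss-cong (suc N) e = +-cong (gauss-cong N (λ i j q → e (suc i) j (P.cong suc q)))
    (gauss-cong N (λ i j q → *-congˡ (e i (suc j) (P.trans (+-suc i j) (P.cong suc q)))))

  gauss-+ : ∀ g h N → gauss (λ i j → g i j + h i j) N ≈ gauss g N + gauss h N
  gauss-+ g h zero = refl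
  gauss-+ g h (suc N) = trans (+-cong (gauss-+ _ _ N) (trans (gauss-cong N (λ i j _ → distribˡ _ _ _)) (gauss-+ _ _ N))) (+-interchange _ _ _ _)

  gauss-*ˡ : ∀ c g N → gauss (λ i j → c * g i j) N ≈ c * gauss g N
  gauss-*ˡ c g zero = refl
  gauss-*ˡ c g (suc N) = trans (+-cong (gauss-*ˡ c _ N)
    (trans (gauss-cong N (λ i j _ → x∙yz≈y∙xz _ _ _)) (gauss-*ˡ c _ N))) (sym (distribˡ _ _ _))

  -- The other Pascal rule, which makes the symmetry of the Gaussian binomials available.
  gauss-Pascal' : ∀ g N → gauss g (suc N) ≈ gauss (λ i j → t ^ j * g (suc i) j) N + gauss (λ i j → g i (suc j)) N
  gauss-Pascal' g zero = solve 2 (λ a b → a :+ con (+ 1) :* b := con (+ 1) :* a :+ b) refl _ _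
  gauss-Pascal' g (suc N) = begin
    gauss (λ i j → g (suc i) j) (suc N) + gauss (λ i j → t ^ i * g i (suc j)) (suc N)
      ≈⟨ +-cong (gauss-Pascal' (λ i j → g (suc i) j) N) (gauss-Pascal' (λ i j → t ^ i * g i (suc j)) N) ⟩
    (a + gauss (λ i j → g (suc i) (suc j)) N) + (gauss (λ i j → t ^ j * (t ^ suc i * g (suc i) (suc j))) N + d)
      ≈⟨ +-congˡ (+-congʳ (gauss-cong N (λ i j _ → solve 4 (λ t x y z → y :* (t :* x :* z) := x :* (t :* y :* z)) refl t (t ^ i) (t ^ j) _))) ⟩
    _ ≈⟨ solve 4 (λ a b c d → (a :+ b) :+ (c :+ d) := (a :+ c) :+ (b :+ d)) refl _ _ _ _ ⟩
    (a + gauss (λ i j → t ^ i * (t ^ suc j * g (suc i) (suc j))) N) + (gauss (λ i j → g (suc i) (suc j)) N + d) ∎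
    where
    a = gauss (λ i j → t ^ j * g (suc (suc i)) j) N
    d = gauss (λ i j → t ^ i * g i (suc (suc j))) N

  gauss-symmetric : ∀ g N → gauss g N ≈ gauss (λ i j → g j i) N
  gauss-symmetric g zero = refl
  gauss-symmetric g (suc N) = begin
    gauss (λ i j → g (suc i) j) N + gauss (λ i j → t ^ i * g i (suc j)) N
      ≈⟨ +-cong (gauss-symmetric _ N) (gauss-symmetric _ N) ⟩
    _ + _ ≈⟨ +-comm _ _ ⟩
    gauss (λ i j → t ^ j * g j (suc i)) N + gauss (λ i j → g (suc j) i) N ≈⟨ sym (gauss-Pascal' (λ i j → g j i) N) ⟩
    gauss (λ i j → g j i) (suc N) ∎

  -- With p = 1 and β = 0 the hypothesis of `exchange` is `τ-reflect` and its conclusion is the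
  -- Pascal recursion. Summed over the splittings of a given size, the interactions are therefore a
  -- Gaussian binomial that no longer depends on the variables.
  ∑split-gauss : ∀ g S → Good S → ∑split (λ I J → 𝒜 I J * g (length I) (length J)) S ≈ gauss g (length S)
  ∑split-gauss g [] G = *-identityˡ _
  ∑split-gauss g (z ∷ S) G@(_ ∷ u , _ ∷ n) = begin
    ∑split (λ I J → 𝒜 I J * g (length I) (length J)) (z ∷ S)
      ≈⟨ ∑split-cong {h = λ I J → 𝒜 I J * (∏ (λ _ → 1#) I * g (length I) (length J))} (z ∷ S) (λ I J _ → *-congˡ (sym (trans (*-congʳ (∏-1 I)) (*-identityˡ _)))) ⟩
    _ ≈⟨ Exchange.exchange (λ _ → 1#) 0# g z hyp S G ⟩
    _ ≈⟨ ∑split-cong S (λ I J _ → *-congˡ (trans (*-congʳ (∏-1 I))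
           (solve 3 (λ a b c → con (+ 1) :* (con (+ 1) :* a :+ b :* (c :+ con (+ 0) :* (con (+ 1) :- c))) := a :+ c :* b) refl _ _ _))) ⟩
    ∑split (λ I J → 𝒜 I J * (g (suc (length I)) (length J) + t ^ length I * g (length I) (suc (length J)))) S
      ≈⟨ ∑split-gauss (λ i j → g (suc i) j + t ^ i * g i (suc j)) S (u , n) ⟩
    gauss (λ i j → g (suc i) j + t ^ i * g i (suc j)) (length S) ≈⟨ gauss-+ _ _ (length S) ⟩
    gauss g (suc (length S)) ∎
    where
    e : ∀ a b → Z.- (a Z.- b) ≡ b Z.- a
    e = solve-∀
    hyp : ∀ l → l Z.- z ≢ 0ℤ → τ (l Z.- z) * 1# + τ (z Z.- l) * 1# ≈ 1# + 0# * 1#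
    hyp l q = trans (solve 2 (λ a b → a :* con (+ 1) :+ b :* con (+ 1) := a :+ b) refl _ _)
      (trans (+-congˡ (cong≈ τ (P.sym (e l z)))) (trans (τ-reflect _ q)
        (solve 0 (con (+ 1) := con (+ 1) :+ con (+ 0) :* con (+ 1)) refl)))

  -- With p a = α xᵃ and β = 1, `exchange` splits off the factor 1 + α xᶻ. In Hall-Littlewood terms:
  -- P of a single column is an elementary symmetric function.
  ∑split-elementary : ∀ α S → Good S → ((λ a → α * ξ a) · 𝟙 ⋆ 𝟙) S ≈ ∏ (λ a → 1# + α * ξ a) S
  ∑split-elementary α [] G = solve 0 (con (+ 1) :* (con (+ 1) :* con (+ 1) :* con (+ 1)) := con (+ 1)) refl
  ∑split-elementary α (z ∷ S) G@(_ ∷ u , _ ∷ n) = begin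
    ∑split (λ I J → 𝒜 I J * (∏ p I * 1# * 1#)) (z ∷ S)
      ≈⟨ ∑split-cong {h = λ I J → 𝒜 I J * (∏ p I * 1#)} (z ∷ S) (λ I J _ → *-congˡ (*-identityʳ _)) ⟩
    _ ≈⟨ Exchange.exchange p 1# (λ _ _ → 1#) z hyp S G ⟩
    _ ≈⟨ ∑split-cong S (λ I J _ → solve 4 (λ A P pz x → A :* (P :* (pz :* con (+ 1) :+ con (+ 1) :* (x :+ con (+ 1) :* (con (+ 1) :- x)))) :=
           (con (+ 1) :+ pz) :* (A :* (P :* con (+ 1) :* con (+ 1)))) refl _ _ _ _) ⟩
    _ ≈⟨ ∑split-*ˡ _ _ S ⟩
    (1# + p z) * (p · 𝟙 ⋆ 𝟙) S ≈⟨ *-congˡ (∑split-elementary α S (u , n)) ⟩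
    ∏ (λ a → 1# + α * ξ a) (z ∷ S) ∎
    where
    p = λ a → α * ξ a
    e : ∀ a b → Z.- (a Z.- b) ≡ b Z.- a
    e = solve-∀
    e' : ∀ a b → a ≡ b Z.+ (a Z.- b)
    e' = solve-∀
    hyp : ∀ l → l Z.- z ≢ 0ℤ → τ (l Z.- z) * p z + τ (z Z.- l) * p l ≈ p z + 1# * p l
    hyp l q = begin
      w * (α * ξ z) + τ (z Z.- l) * (α * ξ l) ≈⟨ +-congˡ (*-congʳ w') ⟩
      w * (α * ξ z) + (1# - w) * (α * ξ l) ≈⟨ +-congˡ (*-congˡ (*-congˡ ξl)) ⟩
      w * (α * ξ z) + (1# - w) * (α * (ξ z * ξ d))
        ≈⟨ solve 4 (λ w a x y → w :* (a :* x) :+ (con (+ 1) :- w) :* (a :* (x :* y)) := w :* (a :* x) :+ a :* (x :* y) :- a :* x :* (y :* w)) refl w α (ξ z) (ξ d) ⟩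
      w * (α * ξ z) + α * (ξ z * ξ d) - α * ξ z * (ξ d * w) ≈⟨ +-congˡ (-‿cong (*-congˡ (ξτ d q))) ⟩
      w * (α * ξ z) + α * (ξ z * ξ d) - α * ξ z * (w - 1#)
        ≈⟨ solve 4 (λ w a x y → w :* (a :* x) :+ a :* (x :* y) :- a :* x :* (w :- con (+ 1)) := a :* x :+ con (+ 1) :* (a :* (x :* y))) refl w α (ξ z) (ξ d) ⟩
      α * ξ z + 1# * (α * (ξ z * ξ d)) ≈⟨ +-congˡ (*-congˡ (*-congˡ (sym ξl))) ⟩
      p z + 1# * p l ∎
      where
      d = l Z.- z
      w = τ d
      ξl : ξ l ≈ ξ z * ξ d
      ξl = trans (cong≈ ξ (e' l z)) (ξ-+ z d)
      w' : τ (z Z.- l) ≈ 1# - w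
      w' = begin
        τ (z Z.- l) ≡⟨ P.cong τ (P.sym (e l z)) ⟩
        τ (Z.- d) ≈⟨ solve 2 (λ a b → b := a :+ b :- a) refl w _ ⟩
        w + τ (Z.- d) - w ≈⟨ +-congʳ (τ-reflect d q) ⟩
        1# - w ∎

-- The bounded Littlewood identity

double≢0 : ∀ a → a ≢ 0ℤ → a Z.+ a ≢ 0ℤ
double≢0 (+ zero) n _ = n P.refl
double≢0 (+ suc k) n ()
double≢0 -[1+ k ] n ()

module BoundedLittlewood (L : LaurentRing) (s : LaurentRing.CR L .CommutativeRing.Carrier) where
  private
    module R = CommutativeRing (LaurentRing.CR L)
  open Pascal L (s R.* s) public

  t : C
  t = s * s

  constant : (ℕ → C) → List ℤ → C
  constant f S = f (length S)

  constant-⋆ : ∀ f g → constant f ⋆ constant g ≐ constant (gauss (λ i j → f i * g j))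
  constant-⋆ f g S G = ∑split-gauss (λ i j → f i * g j) S G

  -- In the usual notation (-c;t)ₖ.
  rising : C → ℕ → C
  rising c zero = 1#
  rising c (suc k) = (1# + c * t ^ k) * rising c k

  -- (-s;s)ₖ
  levelWeight : ℕ → C
  levelWeight zero = 1#
  levelWeight (suc k) = levelWeight k * (1# + s ^ suc k)

  σ : List ℤ → C
  σ = constant (s ^_)

  -- In the Pascal recursion the term -s tⁱ from the growth of (s;t) cancels the term tⁱ s from the
  -- growth of the power of s.
  gauss-rising : ∀ N → gauss (λ i j → rising (- s) i * s ^ j) N ≈ 1#
  gauss-rising zero = *-identityˡ _
  gauss-rising (suc N) = begin
    _ ≈⟨ sym (gauss-+ _ _ N) ⟩
    _ ≈⟨ gauss-cong N (λ i j _ → solve 4 (λ s x r y → (con (+ 1) :+ (:- s) :* x) :* r :* y :+ x :* (r :* (s :* y)) := r :* y) refl s (t ^ i) _ _) ⟩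
    gauss (λ i j → rising (- s) i * s ^ j) N ≈⟨ gauss-rising N ⟩
    1# ∎

  -- Because t = s², the second Pascal term tⁱ s^(j+1) is s^(N+1) times sⁱ, and the symmetry of the
  -- binomials turns this into the same sum again.
  gauss-s : ∀ N → gauss (λ i j → 1# * s ^ j) N ≈ levelWeight N
  gauss-s zero = *-identityˡ _
  gauss-s (suc N) = begin
    gauss (λ i j → 1# * s ^ j) N + gauss (λ i j → t ^ i * (1# * s ^ suc j)) N
      ≈⟨ +-congˡ (gauss-cong N step) ⟩
    gauss (λ i j → 1# * s ^ j) N + gauss (λ i j → s ^ suc N * (1# * s ^ i)) N
      ≈⟨ +-congˡ (trans (gauss-*ˡ _ _ N) (*-congˡ (gauss-symmetric (λ i j → 1# * s ^ i) N))) ⟩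
    gauss (λ i j → 1# * s ^ j) N + s ^ suc N * gauss (λ i j → 1# * s ^ j) N
      ≈⟨ +-cong (gauss-s N) (*-congˡ (gauss-s N)) ⟩
    levelWeight N + s ^ suc N * levelWeight N ≈⟨ solve 2 (λ a b → a :+ b :* a := a :* (con (+ 1) :+ b)) refl _ _ ⟩
    levelWeight N * (1# + s ^ suc N) ∎
    where
    step : ∀ i j → i N.+ j ≡ N → t ^ i * (1# * s ^ suc j) ≈ s ^ suc N * (1# * s ^ i)
    step i j P.refl = begin
      (s * s) ^ i * (1# * (s * s ^ j)) ≈⟨ *-congʳ (*-^ s s i) ⟩
      s ^ i * s ^ i * (1# * (s * s ^ j))
        ≈⟨ solve 3 (λ s x y → x :* x :* (con (+ 1) :* (s :* y)) := s :* (x :* y) :* (con (+ 1) :* x)) refl s (s ^ i) (s ^ j) ⟩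
      s * (s ^ i * s ^ j) * (1# * s ^ i) ≈⟨ *-congʳ (*-congˡ (sym (^-+ s i j))) ⟩
      s * s ^ (i N.+ j) * (1# * s ^ i) ∎

  U⁻⋆U : ∀ c → U⁻ c ⋆ U c ≐ constant (rising c)
  U⁻⋆U c S G = trans (sym (∑±-U-⋆ c S)) (go S G)
    where
    go : ∀ S → Good S → ∑± (U c) S ≈ rising c (length S)
    go [] G = *-identityˡ _
    go (z ∷ S) G@(_ ∷ u , _ ∷ n) = trans (∑±-U c z S G) (*-congˡ (go S (u , n)))

  rising-0 : ∀ k → rising 0# k ≈ 1#
  rising-0 zero = refl
  rising-0 (suc k) = trans (*-cong (trans (+-congˡ (zeroˡ _)) (+-identityʳ _)) (rising-0 k)) (*-identityˡ _)

  rising-−1 : ∀ k → rising (- 1#) (suc k) ≈ 0#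
  rising-−1 zero = solve 0 ((con (+ 1) :+ (:- con (+ 1)) :* con (+ 1)) :* con (+ 1) := con (+ 0)) refl
  rising-−1 (suc k) = trans (*-congˡ (rising-−1 k)) (zeroʳ _)

  B B̄ F F̄ : List ℤ → C
  B = U 0#
  B̄ = U⁻ 0#
  F = U (- s)
  F̄ = U⁻ (- s)

  δ : List ℤ → C
  δ [] = 1#
  δ (_ ∷ _) = 0#

  1+ξ : ℤ → C
  1+ξ a = 1# + ξ a

  1+sξ : ℤ → C
  1+sξ a = 1# + s * ξ a

  nonzero : ∀ {S} → Good S → All (_≢ 0ℤ) S
  nonzero (_ , n) = All.map abs≢0 n

  U-factor : ∀ {p c c'} → (∀ a → a ≢ 0ℤ → mix c (τ a) ≈ p a * mix c' (τ a)) → U c ≐ p · U c'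
  U-factor {p} h S G = trans (*-congʳ (trans (∏-cong∈ (nonzero G) h) (∏-* _ _ S))) (*-assoc _ _ _)

  B̄⋆B : B̄ ⋆ B ≐ 𝟙
  B̄⋆B S G = trans (U⁻⋆U 0# S G) (rising-0 (length S))

  -- U at c = -1 sums to zero; both of its factors are B, B̄ up to the unit ∏ (1 + ξ a) and a shift by ξ.
  B̄⋆ξB : B̄ ⋆ (ξ · B) ≐ δ
  B̄⋆ξB [] G = solve 0 (con (+ 1) :* (con (+ 1) :* con (+ 1) :* (con (+ 1) :* (con (+ 1) :* con (+ 1)))) := con (+ 1)) refl
  B̄⋆ξB S@(_ ∷ S') G = unit-cancel (invert S (nonzero G)) (trans (*-comm _ _) (trans (sym chain) (sym (zeroˡ _))))
    where
    plus : ∀ a → a ≢ 0ℤ → mix (- 1#) (τ a) ≈ 1+ξ a * mix 0# (τ a)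
    plus a n = begin
      - 1# + (1# - - 1#) * τ a ≈⟨ solve 1 (λ v → :- con (+ 1) :+ (con (+ 1) :- :- con (+ 1)) :* v := v :+ (v :- con (+ 1))) refl (τ a) ⟩
      τ a + (τ a - 1#) ≈⟨ +-congˡ (sym (ξτ a n)) ⟩
      τ a + ξ a * τ a ≈⟨ solve 2 (λ u v → v :+ u :* v := (con (+ 1) :+ u) :* (con (+ 0) :+ (con (+ 1) :- con (+ 0)) :* v)) refl (ξ a) (τ a) ⟩
      1+ξ a * mix 0# (τ a) ∎
    minus : ∀ a → a ≢ 0ℤ → ξ a * mix (- 1#) (τ (Z.- a)) ≈ 1+ξ a * mix 0# (τ (Z.- a))
    minus a n = begin
      ξ a * mix (- 1#) v ≈⟨ solve 3 (λ u v w → u :* (:- con (+ 1) :+ (con (+ 1) :- :- con (+ 1)) :* v) :=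
          u :* v :- u :* w :+ u :* (v :+ w :- con (+ 1))) refl (ξ a) v (τ a) ⟩
      ξ a * v - ξ a * τ a + ξ a * (v + τ a - 1#) ≈⟨ +-cong (+-congˡ (-‿cong (ξτ a n))) (*-congˡ (+-congʳ v+w)) ⟩
      ξ a * v - (τ a - 1#) + ξ a * (1# - 1#) ≈⟨ +-congʳ (+-congˡ (-‿cong (+-congˡ (-‿cong (sym v+w))))) ⟩
      ξ a * v - (τ a - (v + τ a)) + ξ a * (1# - 1#)
        ≈⟨ solve 3 (λ u v w → u :* v :- (w :- (v :+ w)) :+ u :* (con (+ 1) :- con (+ 1)) :=
             (con (+ 1) :+ u) :* (con (+ 0) :+ (con (+ 1) :- con (+ 0)) :* v)) refl (ξ a) v (τ a) ⟩
      1+ξ a * mix 0# v ∎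
      where
      v = τ (Z.- a)
      v+w : v + τ a ≈ 1#
      v+w = trans (+-comm _ _) (τ-reflect a n)
    shifted : ξ · U⁻ (- 1#) ≐ 1+ξ · B̄
    shifted T G = trans (sym (*-assoc _ _ _)) (trans (*-congʳ (begin
      ∏ ξ T * ∏ (λ y → mix (- 1#) (τ y)) (map Z.-_ T) ≈⟨ *-congˡ (∏-map _ Z.-_ T) ⟩
      ∏ ξ T * ∏ (λ y → mix (- 1#) (τ (Z.- y))) T ≈⟨ trans (sym (∏-* _ _ T)) (∏-cong∈ (nonzero G) minus) ⟩
      ∏ (λ y → 1+ξ y * mix 0# (τ (Z.- y))) T ≈⟨ trans (∏-* _ _ T) (*-congˡ (sym (∏-map _ Z.-_ T))) ⟩
      ∏ 1+ξ T * ∏ (λ y → mix 0# (τ y)) (map Z.-_ T) ∎)) (*-assoc _ _ _))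
    chain : 0# ≈ ∏ 1+ξ S * (B̄ ⋆ (ξ · B)) S
    chain = begin
      0# ≈⟨ sym (trans (*-congˡ (rising-−1 (length S'))) (zeroʳ _)) ⟩
      ∏ ξ S * rising (- 1#) (length S) ≈⟨ *-congˡ (sym (U⁻⋆U (- 1#) S G)) ⟩
      (ξ · (U⁻ (- 1#) ⋆ U (- 1#))) S ≈⟨ ·-⋆ ξ (U⁻ (- 1#)) (U (- 1#)) S G ⟩
      ((ξ · U⁻ (- 1#)) ⋆ (ξ · U (- 1#))) S
        ≈⟨ ⋆-cong shifted (λ T G → trans (*-congˡ (U-factor plus T G)) (x∙yz≈y∙xz _ _ _)) S G ⟩
      ((1+ξ · B̄) ⋆ (1+ξ · (ξ · B))) S ≈⟨ sym (·-⋆ 1+ξ B̄ (ξ · B) S G) ⟩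
      ∏ 1+ξ S * (B̄ ⋆ (ξ · B)) S ∎
    invert : ∀ S → All (_≢ 0ℤ) S → ∏ (λ a → (1# - ξ a) * τ (a Z.+ a)) S * ∏ 1+ξ S ≈ 1#
    invert S n = trans (sym (∏-* _ _ S)) (trans (∏-cong∈ n (λ a m → begin
      (1# - ξ a) * τ (a Z.+ a) * (1# + ξ a) ≈⟨ solve 2 (λ u v → (con (+ 1) :- u) :* v :* (con (+ 1) :+ u) := v :* (con (+ 1) :- u :* u)) refl _ _ ⟩
      τ (a Z.+ a) * (1# - ξ a * ξ a) ≈⟨ *-congˡ (+-congˡ (-‿cong (sym (ξ-+ a a)))) ⟩
      τ (a Z.+ a) * (1# - ξ (a Z.+ a)) ≈⟨ τ-inverse _ (double≢0 a m) ⟩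
      1# ∎)) (∏-1 S))

  ∑split-0 : ∀ {A : Set} (S : List A) → ∑split (λ _ _ → 0#) S ≈ 0#
  ∑split-0 [] = refl
  ∑split-0 (x ∷ S) = trans (+-cong (∑split-0 S) (∑split-0 S)) (+-identityˡ _)

  ∑split-top : ∀ {A : Set} (h : List A → List A → C) S →
    (∀ x I J → S ↭ x ∷ I ++ J → h (x ∷ I) J ≈ 0#) → ∑split h S ≈ h [] S
  ∑split-top h [] v = refl
  ∑split-top h (x ∷ S) v = trans (+-cong
      (trans (∑split-cong S (λ I J p → v x I J (prep x p))) (∑split-0 S))
      (∑split-top (λ I J → h I (x ∷ J)) S (λ y I J p → v y I (x ∷ J) (↭-trans (prep x p) (↭-sym (shift x (y ∷ I) J))))))
    (+-identityˡ _)

  δ⋆ : ∀ u → δ ⋆ u ≐ u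
  δ⋆ u S _ = trans (∑split-top _ S (λ x I J p → trans (*-congˡ (zeroˡ _)) (zeroʳ _))) (trans (*-identityˡ _) (*-identityˡ _))

  ⋆-minus : ∀ u v w → u ⋆ (λ S → v S - w S) ≐ (λ S → (u ⋆ v) S - (u ⋆ w) S)
  ⋆-minus u v w S _ = begin
    _ ≈⟨ ∑split-cong S (λ I J _ → solve 4 (λ a b c d → a :* (b :* (c :- d)) := a :* (b :* c) :+ con -[1+ 0 ] :* (a :* (b :* d))) refl _ _ _ _) ⟩
    _ ≈⟨ trans (∑split-+ _ _ S) (+-congˡ (∑split-*ˡ _ _ S)) ⟩
    _ ≈⟨ solve 2 (λ a b → a :+ con -[1+ 0 ] :* b := a :- b) refl _ _ ⟩
    (u ⋆ v) S - (u ⋆ w) S ∎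

  -- Left multiplication by u is unitriangular with respect to the size of S: every splitting with a
  -- nonempty first part involves d on a smaller set only.
  ⋆-cancelˡ : ∀ u d → u [] ≈ 1# → u ⋆ d ≐ (λ _ → 0#) → d ≐ (λ _ → 0#)
  ⋆-cancelˡ u d u[] z S G = go (length S) S P.refl G
    where
    go : ∀ n S → length S ≡ n → Good S → d S ≈ 0#
    rest : ∀ n S → length S ≡ n → Good S → ∀ x I J → S ↭ x ∷ I ++ J → 𝒜 (x ∷ I) J * (u (x ∷ I) * d J) ≈ 0#
    go n S l G = begin
      d S ≈⟨ sym (trans (*-identityˡ _) (trans (*-congʳ u[]) (*-identityˡ _))) ⟩
      1# * (u [] * d S) ≈⟨ sym (∑split-top _ S (rest n S l G)) ⟩
      (u ⋆ d) S ≈⟨ z S G ⟩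
      0# ∎
    rest zero S l G x I J p with P.trans (P.sym l) (length-↭ p)
    ... | ()
    rest (suc n) S l G x I J p = trans (*-congˡ (trans (*-congˡ vanish) (zeroʳ _))) (zeroʳ _)
      where
      le : length J ≤ n
      le = ≤-trans (m≤n+m (length J) (length I)) (≤-reflexive (P.sym
        (suc-injective (P.trans (P.sym l) (P.trans (length-↭ p) (P.cong suc (Lₚ.length-++ I)))))))
      below : ∀ k → k ≤ n → ∀ T → length T ≡ k → Good T → d T ≈ 0#
      below k q with m≤n⇒m<n∨m≡n q
      ... | inj₂ P.refl = go n
      ... | inj₁ k<n = shrink n k<n
        where
        shrink : ∀ n → k < n → ∀ T → length T ≡ k → Good T → d T ≈ 0#
        shrink (suc n) (s≤s q) with m≤n⇒m<n∨m≡n q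
        ... | inj₂ P.refl = go n
        ... | inj₁ k<n = shrink n k<n
      vanish : d J ≈ 0#
      vanish = below (length J) le J P.refl (proj₂ (Good-++⁻ (x ∷ I) (Good-↭ p G)))

  -- Left multiplication by `B̄` sends both sides to 𝟙, and `B̄` can be cancelled. This is one step
  -- of the Littlewood identity for the sum of all P_λ: the first factor carries the variables with
  -- λ ≥ 1, the second those with λ = 0.
  B-recursion : B ≐ ξ · B ⋆ 𝟙
  B-recursion S G = begin
    B S ≈⟨ solve 2 (λ a b → a := (a :- b) :+ b) refl _ _ ⟩
    (B S - (ξ · B ⋆ 𝟙) S) + (ξ · B ⋆ 𝟙) S ≈⟨ +-congʳ (⋆-cancelˡ B̄ _ (*-identityˡ _) zero-sum S G) ⟩
    0# + (ξ · B ⋆ 𝟙) S ≈⟨ +-identityˡ _ ⟩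
    (ξ · B ⋆ 𝟙) S ∎
    where
    zero-sum : B̄ ⋆ (λ S → B S - (ξ · B ⋆ 𝟙) S) ≐ (λ _ → 0#)
    zero-sum S G = begin
      _ ≈⟨ ⋆-minus B̄ B (ξ · B ⋆ 𝟙) S G ⟩
      (B̄ ⋆ B) S - (B̄ ⋆ (ξ · B ⋆ 𝟙)) S
        ≈⟨ +-cong (B̄⋆B S G) (-‿cong (trans (sym (⋆-assoc B̄ (ξ · B) 𝟙 S G)) (trans (⋆-cong B̄⋆ξB (≐-refl {𝟙}) S G) (δ⋆ 𝟙 S G)))) ⟩
      1# - 1# ≈⟨ -‿inverseʳ 1# ⟩
      0# ∎

  F≐ : F ≐ 1+sξ · B
  F≐ = U-factor (λ a n → begin
    - s + (1# - - s) * τ a ≈⟨ solve 2 (λ s v → :- s :+ (con (+ 1) :- :- s) :* v := v :+ s :* (v :- con (+ 1))) refl s (τ a) ⟩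
    τ a + s * (τ a - 1#) ≈⟨ +-congˡ (*-congˡ (sym (ξτ a n))) ⟩
    τ a + s * (ξ a * τ a) ≈⟨ solve 3 (λ s u v → v :+ s :* (u :* v) := (con (+ 1) :+ s :* u) :* (con (+ 0) :+ (con (+ 1) :- con (+ 0)) :* v)) refl s (ξ a) (τ a) ⟩
    1+sξ a * mix 0# (τ a) ∎)

  ·-swap : ∀ p q u → p · (q · u) ≐ q · (p · u)
  ·-swap p q u S _ = x∙yz≈y∙xz _ _ _

  -- `B-recursion` after applying the endomorphism given by ∏ (1 + s xᵃ).
  F-recursion : F ≐ ξ · F ⋆ (1+sξ · 𝟙)
  F-recursion =
    ≐-trans F≐ (≐-trans (·-cong 1+sξ B-recursion) (≐-trans (·-⋆ 1+sξ (ξ · B) 𝟙)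
      (⋆-cong (≐-trans (·-swap 1+sξ ξ B) (·-cong ξ (≐-sym F≐))) (≐-refl {1+sξ · 𝟙}))))

  ξσ⋆𝟙 : ξ · σ ⋆ 𝟙 ≐ 1+sξ · 𝟙
  ξσ⋆𝟙 = ≐-trans (⋆-cong (λ S _ → begin
      ∏ ξ S * s ^ length S ≈⟨ trans (*-comm _ _) (*-congʳ (sym (∏-const s S))) ⟩
      ∏ (λ _ → s) S * ∏ ξ S ≈⟨ trans (sym (∏-* _ _ S)) (sym (*-identityʳ _)) ⟩
      ∏ (λ a → s * ξ a) S * 1# ∎) (≐-refl {𝟙}))
    (λ S G → trans (∑split-elementary s S G) (sym (*-identityʳ _)))

  -- W m is the hyperoctahedral side of the bounded Littlewood identity, restricted to λ₁ ≤ m.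
  W : ℕ → List ℤ → C
  W m = ((λ a → ξ a ^ m) · F̄) ⋆ F

  W-0 : W 0 ≐ constant (rising (- s))
  W-0 = ≐-trans (⋆-cong (λ S _ → trans (*-congʳ (∏-1 S)) (*-identityˡ _)) (≐-refl {F})) (U⁻⋆U (- s))

  -- Moving ξ inside turns σ ⋆ 𝟙 into the last factor of `F-recursion`. The factor ξ · F is thereby
  -- absorbed into F, and only `F̄` keeps the additional power of x.
  W-suc : ∀ m → ξ · (W m ⋆ σ) ⋆ 𝟙 ≐ W (suc m)
  W-suc m =
    ≐-trans (⋆-cong (·-⋆ ξ (W m) σ) (≐-refl {𝟙}))
    (≐-trans (⋆-assoc (ξ · W m) (ξ · σ) 𝟙)
    (≐-trans (⋆-cong (·-⋆ ξ ((λ a → ξ a ^ m) · F̄) F) ξσ⋆𝟙)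
    (≐-trans (⋆-assoc (ξ · ((λ a → ξ a ^ m) · F̄)) (ξ · F) (1+sξ · 𝟙))
    (⋆-cong (λ S _ → trans (sym (*-assoc _ _ _)) (*-congʳ (sym (∏-* _ _ S)))) (≐-sym F-recursion)))))

  -- The level sets {λ ≥ 1} of the partitions with λ₁ ≤ m + 1: every level k contributes ξᵏ,
  -- and all levels but the top one carry the weight (-s;s).
  levels : ℕ → List ℤ → C
  levels zero = ξ · 𝟙
  levels (suc m) = ξ · (levels m ⋆ constant levelWeight)

  -- The induction starts because W 0 ⋆ σ = 𝟙 (`gauss-rising`), and it continues because the weight
  -- (-s;s) factors as 𝟙 ⋆ σ (`gauss-s`). This factorisation is what singles out the weights of the
  -- theorem.
  levels≐ : ∀ m → levels m ≐ ξ · (W m ⋆ σ)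
  levels≐ zero = ·-cong ξ (≐-sym (≐-trans (⋆-cong W-0 (≐-refl {σ}))
    (≐-trans (constant-⋆ (rising (- s)) (s ^_)) (λ S _ → gauss-rising (length S)))))
  levels≐ (suc m) = ·-cong ξ
    (≐-trans (⋆-cong (≐-refl {levels m}) (≐-sym (≐-trans (constant-⋆ (λ _ → 1#) (s ^_)) (λ S _ → gauss-s (length S)))))
    (≐-trans (≐-sym (⋆-assoc (levels m) 𝟙 σ))
    (⋆-cong (≐-trans (⋆-cong (levels≐ m) (≐-refl {𝟙})) (W-suc m)) (≐-refl {σ}))))

  bounded-Littlewood : ∀ m → levels m ⋆ 𝟙 ≐ W (suc m)
  bounded-Littlewood m = ≐-trans (⋆-cong (levels≐ m) (≐-refl {𝟙})) (W-suc m)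

-- Determinants and the Vandermonde formula

module Determinant (CR : CommutativeRing 0ℓ 0ℓ) where
  open RingKit CR

  private variable A B : Set

  ∑alt : (A → List A → C) → List A → C
  ∑alt h [] = 0#
  ∑alt h (x ∷ xs) = h x xs - ∑alt (λ y ys → h y (x ∷ ys)) xs

  det : (A → B → C) → List A → List B → C
  det M [] [] = 1#
  det M [] (_ ∷ _) = 0#
  det M (a ∷ as) bs = ∑alt (λ b bs' → M a b * det M as bs') bs

  ∑alt-cong : ∀ {h h' : A → List A → C} xs → (∀ y ys → h y ys ≈ h' y ys) → ∑alt h xs ≈ ∑alt h' xs
  ∑alt-cong [] e = refl
  ∑alt-cong (x ∷ xs) e = +-cong (e x xs) (-‿cong (∑alt-cong xs (λ y ys → e y (x ∷ ys))))

  ∑alt-cong∈ : ∀ {P : A → Set} {h h' : A → List A → C} {xs} → All P xs →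
    (∀ y ys → P y → All P ys → h y ys ≈ h' y ys) → ∑alt h xs ≈ ∑alt h' xs
  ∑alt-cong∈ [] e = refl
  ∑alt-cong∈ (p ∷ ps) e = +-cong (e _ _ p ps) (-‿cong (∑alt-cong∈ ps (λ y ys q qs → e y (_ ∷ ys) q (p ∷ qs))))

  ∑alt-+ : ∀ (f g : A → List A → C) xs → ∑alt (λ y ys → f y ys + g y ys) xs ≈ ∑alt f xs + ∑alt g xs
  ∑alt-+ f g [] = sym (+-identityˡ _)
  ∑alt-+ f g (x ∷ xs) = trans (+-congˡ (-‿cong (∑alt-+ _ _ xs)))
    (solve 4 (λ a b c d → (a :+ b) :- (c :+ d) := (a :- c) :+ (b :- d)) refl _ _ _ _)

  ∑alt-*ˡ : ∀ c (f : A → List A → C) xs → ∑alt (λ y ys → c * f y ys) xs ≈ c * ∑alt f xs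
  ∑alt-*ˡ c f [] = sym (zeroʳ c)
  ∑alt-*ˡ c f (x ∷ xs) = trans (+-congˡ (-‿cong (∑alt-*ˡ c _ xs))) (solve 3 (λ c a b → c :* a :- c :* b := c :* (a :- b)) refl _ _ _)

  ∑alt-0 : ∀ (xs : List A) → ∑alt (λ _ _ → 0#) xs ≈ 0#
  ∑alt-0 [] = refl
  ∑alt-0 (x ∷ xs) = trans (+-congˡ (-‿cong (∑alt-0 xs))) (-‿inverseʳ _)

  ∑alt-swap : ∀ (h : A → List A → B → List B → C) xs ys →
    ∑alt (λ x xs' → ∑alt (λ y ys' → h x xs' y ys') ys) xs ≈ ∑alt (λ y ys' → ∑alt (λ x xs' → h x xs' y ys') xs) ys
  ∑alt-swap h [] ys = sym (∑alt-0 ys)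
  ∑alt-swap h (x ∷ xs) ys = begin
    _ ≈⟨ +-congˡ (-‿cong (∑alt-swap _ xs ys)) ⟩
    a - b ≈⟨ solve 2 (λ a b → a :- b := a :+ con -[1+ 0 ] :* b) refl a b ⟩
    _ ≈⟨ +-congˡ (sym (∑alt-*ˡ _ _ ys)) ⟩
    _ ≈⟨ sym (∑alt-+ _ _ ys) ⟩
    _ ≈⟨ ∑alt-cong ys (λ y ys' → solve 2 (λ a b → a :+ con -[1+ 0 ] :* b := a :- b) refl _ _) ⟩
    _ ∎
    where
    a = ∑alt (λ y ys' → h x xs y ys') ys
    b = ∑alt (λ y ys' → ∑alt (λ x' xs' → h x' (x ∷ xs') y ys') xs) ys

  -- Every pair is picked in both orders, with opposite signs.
  ∑alt-symmetric : ∀ (h : A → A → List A → C) xs → (∀ x y zs → h x y zs ≈ h y x zs) →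
    ∑alt (λ x xs' → ∑alt (λ y ys → h x y ys) xs') xs ≈ 0#
  ∑alt-symmetric h [] s = refl
  ∑alt-symmetric h (x ∷ xs) s = begin
    ∑alt (h x) xs - ∑alt (λ y ys → h y x ys - ∑alt (λ z zs → h y z (x ∷ zs)) ys) xs
      ≈⟨ +-congˡ (-‿cong (trans (∑alt-cong xs (λ y ys → solve 2 (λ a b → a :- b := a :+ con -[1+ 0 ] :* b) refl _ _))
           (trans (∑alt-+ _ _ xs) (+-cong (∑alt-cong xs (λ y ys → s y x ys)) (trans (∑alt-*ˡ _ _ xs)
             (*-congˡ (∑alt-symmetric (λ y z zs → h y z (x ∷ zs)) xs (λ y z zs → s y z (x ∷ zs))))))))) ⟩
    ∑alt (h x) xs - (∑alt (h x) xs + _ * 0#)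
      ≈⟨ solve 1 (λ a → a :- (a :+ con -[1+ 0 ] :* con (+ 0)) := con (+ 0)) refl _ ⟩
    0# ∎

  ∑alt-antisymmetric : ∀ (h : A → A → List A → C) xs →
    ∑alt (λ x xs' → ∑alt (λ y ys → h x y ys) xs') xs ≈ - ∑alt (λ x xs' → ∑alt (λ y ys → h y x ys) xs') xs
  ∑alt-antisymmetric h xs = begin
    a ≈⟨ solve 2 (λ a b → a := a :+ b :- b) refl a b ⟩
    a + b - b ≈⟨ +-congʳ (trans (sym (∑alt-+ _ _ xs)) (trans (∑alt-cong xs (λ x xs' → sym (∑alt-+ _ _ xs')))
                   (∑alt-symmetric (λ x y zs → h x y zs + h y x zs) xs (λ x y zs → +-comm _ _)))) ⟩
    0# - b ≈⟨ +-identityˡ _ ⟩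
    - b ∎
    where
    a = ∑alt (λ x xs' → ∑alt (λ y ys → h x y ys) xs') xs
    b = ∑alt (λ x xs' → ∑alt (λ y ys → h y x ys) xs') xs

  det-cong : ∀ {M M' : A → B → C} {P : A → Set} {Q : B → Set} {as bs} → All P as → All Q bs →
    (∀ a b → P a → Q b → M a b ≈ M' a b) → det M as bs ≈ det M' as bs
  det-cong {bs = []} [] q e = refl
  det-cong {bs = _ ∷ _} [] q e = refl
  det-cong (p ∷ ps) q e = ∑alt-cong∈ q (λ b bs qb qbs → *-cong (e _ b p qb) (det-cong ps qbs e))

  det-column : ∀ (M : A → B → C) as b bs → det M as (b ∷ bs) ≈ ∑alt (λ a as' → M a b * det M as' bs) as
  det-column M [] b bs = refl
  det-column M (a ∷ as) b bs = +-congˡ (-‿cong (begin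
    ∑alt (λ b' bs' → M a b' * det M as (b ∷ bs')) bs
      ≈⟨ ∑alt-cong bs (λ b' bs' → trans (*-congˡ (det-column M as b bs')) (sym (∑alt-*ˡ _ _ as))) ⟩
    ∑alt (λ b' bs' → ∑alt (λ a' as' → M a b' * (M a' b * det M as' bs')) as) bs ≈⟨ ∑alt-swap _ bs as ⟩
    ∑alt (λ a' as' → ∑alt (λ b' bs' → M a b' * (M a' b * det M as' bs')) bs) as
      ≈⟨ ∑alt-cong as (λ a' as' → trans (∑alt-cong bs (λ b' bs' → x∙yz≈y∙xz _ _ _)) (∑alt-*ˡ _ _ bs)) ⟩
    ∑alt (λ a' as' → M a' b * det M (a ∷ as') bs) as ∎))

  det-transpose : ∀ (M : A → B → C) as bs → det M as bs ≈ det (λ b a → M a b) bs as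
  det-transpose M [] [] = refl
  det-transpose M (a ∷ as) [] = refl
  det-transpose M as (b ∷ bs) = trans (det-column M as b bs) (∑alt-cong as (λ a as' → *-congˡ (det-transpose M as' bs)))

  det-map-rows : ∀ {R : Set} (M : A → B → C) (f : R → A) rs bs → det M (map f rs) bs ≈ det (λ r b → M (f r) b) rs bs
  det-map-rows M f [] [] = refl
  det-map-rows M f [] (_ ∷ _) = refl
  det-map-rows M f (r ∷ rs) bs = ∑alt-cong bs (λ b bs' → *-congˡ (det-map-rows M f rs bs'))

  ∑-∑alt : ∀ {S : Set} (f : S → A → List A → C) σ xs → ∑ (λ s → ∑alt (f s) xs) σ ≈ ∑alt (λ x xs' → ∑ (λ s → f s x xs') σ) xs
  ∑-∑alt f σ [] = ∑-0 σ
  ∑-∑alt f σ (x ∷ xs) = begin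
    ∑ (λ s → f s x xs - ∑alt (λ y ys → f s y (x ∷ ys)) xs) σ ≈⟨ ∑-cong σ (λ s → solve 2 (λ a b → a :- b := a :+ con -[1+ 0 ] :* b) refl _ _) ⟩
    _ ≈⟨ trans (∑-+ _ _ σ) (+-congˡ (trans (∑-*ˡ _ _ σ) (*-congˡ (∑-∑alt _ σ xs)))) ⟩
    _ ≈⟨ solve 2 (λ a b → a :+ con -[1+ 0 ] :* b := a :- b) refl _ _ ⟩
    _ ∎

  det-scale-columns : ∀ (κ : B → C) (M : A → B → C) as bs → det (λ a b → κ b * M a b) as bs ≈ ∏ κ bs * det M as bs
  det-scale-columns κ M [] [] = sym (*-identityˡ _)
  det-scale-columns κ M [] (b ∷ bs) = sym (zeroʳ _)
  det-scale-columns {B} {A} κ M (a ∷ as) bs = trans (∑alt-cong bs (λ b bs' → *-congˡ (det-scale-columns κ M as bs'))) (go bs (det M as))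
    where
    go : ∀ bs (m : List B → C) → ∑alt (λ b bs' → κ b * M a b * (∏ κ bs' * m bs')) bs ≈ ∏ κ bs * ∑alt (λ b bs' → M a b * m bs') bs
    go [] m = sym (zeroʳ _)
    go (b ∷ bs) m = begin
      κ b * M a b * (∏ κ bs * m bs) - ∑alt (λ b' bs' → κ b' * M a b' * (κ b * ∏ κ bs' * m (b ∷ bs'))) bs
        ≈⟨ +-congˡ (-‿cong (trans (∑alt-cong bs (λ b' bs' → solve 5 (λ a b c d e → a :* b :* (c :* d :* e) := c :* (a :* b :* (d :* e))) refl _ _ _ _ _))
             (trans (∑alt-*ˡ _ _ bs) (*-congˡ (go bs (λ bs' → m (b ∷ bs'))))))) ⟩
      _ ≈⟨ solve 5 (λ k m p x y → k :* m :* (p :* x) :- k :* (p :* y) := k :* p :* (m :* x :- y)) refl _ _ _ _ _ ⟩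
      _ ∎

  det-scale-rows : ∀ (κ : A → C) (M : A → B → C) as bs → det (λ a b → κ a * M a b) as bs ≈ ∏ κ as * det M as bs
  det-scale-rows κ M as bs = trans (det-transpose _ as bs) (trans (det-scale-columns κ (λ b a → M a b) bs as) (*-congˡ (sym (det-transpose M as bs))))

  -- Antisymmetry of the double expansion brings the equal rows next to each other; there the double
  -- expansion is symmetric.
  det-repeated-row : ∀ (M : A → B → C) as y as' bs → det M (y ∷ as ++ y ∷ as') bs ≈ 0#
  det-repeated-row M [] y as' bs = trans
    (∑alt-cong bs (λ b bs' → sym (∑alt-*ˡ _ _ bs')))
    (∑alt-symmetric (λ b c cs → M y b * (M y c * det M as' cs)) bs (λ b c cs → x∙yz≈y∙xz _ _ _))
  det-repeated-row M (a ∷ as) y as' bs = begin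
    det M (y ∷ a ∷ as ++ y ∷ as') bs ≈⟨ ∑alt-cong bs (λ b bs' → sym (∑alt-*ˡ _ _ bs')) ⟩
    _ ≈⟨ ∑alt-antisymmetric (λ b c cs → M y b * (M a c * det M (as ++ y ∷ as') cs)) bs ⟩
    _ ≈⟨ -‿cong (∑alt-cong bs (λ b bs' → trans (∑alt-cong bs' (λ c cs → x∙yz≈y∙xz _ _ _)) (∑alt-*ˡ _ _ bs'))) ⟩
    - ∑alt (λ b bs' → M a b * det M (y ∷ as ++ y ∷ as') bs') bs
      ≈⟨ -‿cong (trans (∑alt-cong bs (λ b bs' → trans (*-congˡ (det-repeated-row M as y as' bs')) (zeroʳ _))) (∑alt-0 bs)) ⟩
    - 0# ≈⟨ -0#≈0# ⟩
    0# ∎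

  -- Polynomial functions of degree at most k with leading coefficient l, described by iterated divided differences.
  Poly : ℕ → (C → C) → C → Set
  Poly zero f l = ∀ x → f x ≈ l
  Poly (suc k) f l = ∀ y → Σ (C → C) λ g → (∀ x → f x - f y ≈ (x - y) * g x) × Poly k g l

  Poly-cong : ∀ k {f f' l l'} → (∀ x → f x ≈ f' x) → l ≈ l' → Poly k f l → Poly k f' l'
  Poly-cong zero e e' p x = trans (sym (e x)) (trans (p x) e')
  Poly-cong (suc k) e e' p y with p y
  ... | g , d , q = g , (λ x → trans (+-cong (sym (e x)) (-‿cong (sym (e y)))) (d x)) , Poly-cong k (λ _ → refl) e' q

  Poly-0 : ∀ k → Poly k (λ _ → 0#) 0#
  Poly-0 zero x = refl
  Poly-0 (suc k) y = (λ _ → 0#) , (λ x → solve 1 (λ a → con (+ 0) :- con (+ 0) := a :* con (+ 0)) refl (x - y)) , Poly-0 k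

  Poly-+ : ∀ k {f g l m} → Poly k f l → Poly k g m → Poly k (λ x → f x + g x) (l + m)
  Poly-+ zero p q x = +-cong (p x) (q x)
  Poly-+ (suc k) p q y with p y | q y
  ... | f' , d , p' | g' , d' , q' = (λ x → f' x + g' x) , (λ x → trans
      (solve 4 (λ a b c d → (a :+ b) :- (c :+ d) := (a :- c) :+ (b :- d)) refl _ _ _ _)
      (trans (+-cong (d x) (d' x)) (sym (distribˡ _ _ _)))) , Poly-+ k p' q'

  Poly-* : ∀ k c {f l} → Poly k f l → Poly k (λ x → f x * c) (l * c)
  Poly-* zero c p x = *-congʳ (p x)
  Poly-* (suc k) c p y with p y
  ... | g , d , q = (λ x → g x * c) , (λ x → trans (solve 3 (λ a b c → a :* c :- b :* c := (a :- b) :* c) refl _ _ _)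
      (trans (*-congʳ (d x)) (*-assoc _ _ _))) , Poly-* k c q

  Poly-raise : ∀ k {f l} → Poly k f l → Poly (suc k) f 0#
  Poly-raise zero p y = (λ _ → 0#) , (λ x → trans (+-cong (p x) (-‿cong (p y))) (trans (-‿inverseʳ _) (sym (zeroʳ _)))) , λ _ → refl
  Poly-raise (suc k) p y with p y
  ... | g , d , q = g , d , Poly-raise k q

  Poly-x : ∀ k {f l} → Poly k f l → Poly (suc k) (λ x → x * f x) l
  Poly-x zero {f} p y = f , (λ x → trans (+-congˡ (-‿cong (*-congˡ (trans (p y) (sym (p x))))))
    (solve 3 (λ x y a → x :* a :- y :* a := (x :- y) :* a) refl _ _ _)) , p
  Poly-x (suc k) {f} p y with p y
  ... | g , d , q = (λ x → f x + g x * y) , (λ x → begin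
        x * f x - y * f y ≈⟨ solve 4 (λ x y a b → x :* a :- y :* b := (x :- y) :* a :+ (a :- b) :* y) refl x y (f x) (f y) ⟩
        (x - y) * f x + (f x - f y) * y ≈⟨ +-congˡ (*-congʳ (d x)) ⟩
        (x - y) * f x + (x - y) * g x * y ≈⟨ solve 4 (λ x y a b → (x :- y) :* a :+ (x :- y) :* b :* y := (x :- y) :* (a :+ b :* y)) refl x y (f x) (g x) ⟩
        (x - y) * (f x + g x * y) ∎)
      , Poly-cong (suc k) (λ _ → refl) (+-identityʳ _) (Poly-+ (suc k) p (Poly-* (suc k) y {l = 0#} (Poly-raise k q)) ▹ zeroˡ y)
    where
    _▹_ : ∀ {h l a b} → Poly (suc k) h (l + a) → a ≈ b → Poly (suc k) h (l + b)
    p ▹ e = Poly-cong (suc k) (λ _ → refl) (+-congˡ e) p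

  -- The ring is not assumed to be a domain, so differences of roots are required to be
  -- non-zero-divisors.
  Regular : C → Set
  Regular d = ∀ z → d * z ≈ 0# → z ≈ 0#

  -- A root y splits off the factor x - y, and by regularity the remaining roots are roots of the
  -- divided difference at y.
  Poly-roots : ∀ ys k {f l} → length ys ≡ k → Poly k f l → (AllPairs (λ x y → Regular (y - x)) ys) → All (λ y → f y ≈ 0#) ys →
    ∀ x → f x ≈ ∏ (λ y → x - y) ys * l
  Poly-roots [] zero e p d r x = trans (p x) (sym (*-identityˡ _))
  Poly-roots (y ∷ ys) (suc k) {f} {l} e p (d ∷ ds) (r ∷ rs) x with p y
  ... | g , dd , q = begin
    f x ≈⟨ factor x ⟩
    (x - y) * g x ≈⟨ *-congˡ (Poly-roots ys k (suc-injective e) q ds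
        (All.zipWith (λ {z} (reg , fz) → reg (g z) (trans (sym (factor z)) fz)) (d , rs)) x) ⟩
    (x - y) * (∏ (λ y → x - y) ys * l) ≈⟨ sym (*-assoc _ _ _) ⟩
    (x - y) * ∏ (λ y → x - y) ys * l ∎
    where
    factor : ∀ z → f z ≈ (z - y) * g z
    factor z = trans (trans (sym (+-identityʳ _)) (+-congˡ (trans (sym -0#≈0#) (-‿cong (sym r))))) (dd z)

  -- Chebyshev : z + 1/z ↦ zʲ + 1/zʲ
  chebyshev : ℕ → C → C
  chebyshev 0 x = 1# + 1#
  chebyshev 1 x = x
  chebyshev (suc (suc j)) x = x * chebyshev (suc j) x - chebyshev j x

  -- `chebyshev 0` is 2, which is not monic; this one column is the source of the factor 2 in
  -- `Θ-determinant`.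
  monicChebyshev : ℕ → C → C
  monicChebyshev 0 x = 1#
  monicChebyshev (suc j) x = chebyshev (suc j) x

  Poly-const : ∀ c → Poly 0 (λ _ → c) c
  Poly-const c x = refl

  Poly-chebyshev : ∀ j → Poly (suc j) (chebyshev (suc j)) 1# × Poly (suc j) (chebyshev j) 0#
  Poly-chebyshev zero = Poly-cong 1 (λ x → *-identityʳ x) refl (Poly-x 0 (Poly-const 1#)) , Poly-raise 0 (Poly-const _)
  Poly-chebyshev (suc j) with Poly-chebyshev j
  ... | p , q = Poly-cong (suc (suc j)) (λ x → solve 2 (λ a b → a :+ b :* (:- con (+ 1)) := a :- b) refl _ _)
                  (solve 0 (con (+ 1) :+ con (+ 0) :* (:- con (+ 1)) := con (+ 1)) refl)
                  (Poly-+ (suc (suc j)) (Poly-x (suc j) p) (Poly-* (suc (suc j)) (- 1#) (Poly-raise (suc j) q)))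
              , Poly-raise (suc j) p

  Poly-monic : ∀ j → Poly j (monicChebyshev j) 1#
  Poly-monic zero x = refl
  Poly-monic (suc j) = proj₁ (Poly-chebyshev j)

  Poly-raise* : ∀ j k {f l} → j < k → Poly j f l → Poly k f 0#
  Poly-raise* j (suc k) (s≤s q) p with m≤n⇒m<n∨m≡n q
  ... | inj₂ P.refl = Poly-raise j p
  ... | inj₁ j<k = Poly-raise k (Poly-raise* j k j<k p)

  Poly-∑alt : ∀ k (m : ℕ → List ℕ → C) js → All (_< k) js → Poly k (λ x → ∑alt (λ j js' → monicChebyshev j x * m j js') js) 0#
  Poly-∑alt k m [] [] = Poly-0 k
  Poly-∑alt k m (j ∷ js) (p ∷ ps) = Poly-cong k (λ x → solve 2 (λ a b → a :+ b :* (:- con (+ 1)) := a :- b) refl _ _)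
    (solve 2 (λ a b → con (+ 0) :* a :+ con (+ 0) :* b := con (+ 0)) refl _ _)
    (Poly-+ k (Poly-* k (m j js) (Poly-raise* j k p (Poly-monic j))) (Poly-* k (- 1#) (Poly-∑alt k (λ j' js' → m j' (j ∷ js')) js ps)))

  ∏₂ : (A → A → C) → List A → C
  ∏₂ f [] = 1#
  ∏₂ f (x ∷ xs) = ∏ (f x) xs * ∏₂ f xs

  downFrom-< : ∀ k → All (_< k) (downFrom k)
  downFrom-< zero = []
  downFrom-< (suc k) = ≤-refl ∷ All.map (λ p → m≤n⇒m≤1+n p) (downFrom-< k)

  -- As a function of its first row the determinant is a polynomial that vanishes at the other rows
  -- and has the smaller determinant as leading coefficient. For this any monic basis is as good as
  -- the monomials.
  vandermonde : ∀ xs → AllPairs (λ x y → Regular (y - x)) xs →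
    det (λ x j → monicChebyshev j x) xs (downFrom (length xs)) ≈ ∏₂ (λ x y → x - y) xs
  vandermonde [] d = refl
  vandermonde (x ∷ xs) (d ∷ ds) = begin
    f x ≈⟨ Poly-roots xs (length xs) P.refl poly ds (roots [] xs) x ⟩
    ∏ (λ y → x - y) xs * det M xs (downFrom (length xs)) ≈⟨ *-congˡ (vandermonde xs ds) ⟩
    ∏ (λ y → x - y) xs * ∏₂ (λ x y → x - y) xs ∎
    where
    M : C → ℕ → C
    M x j = monicChebyshev j x
    k = length xs
    f : C → C
    f x = det M (x ∷ xs) (downFrom (suc k))
    poly : Poly k f (det M xs (downFrom k))
    poly = Poly-cong k (λ x → solve 2 (λ a b → a :+ b :* (:- con (+ 1)) := a :- b) refl _ _)
      (solve 1 (λ a → con (+ 1) :* a :+ con (+ 0) :* (:- con (+ 1)) := a) refl _)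
      (Poly-+ k (Poly-* k _ (Poly-monic k)) (Poly-* k (- 1#) (Poly-∑alt k (λ j js' → det M xs (k ∷ js')) (downFrom k) (downFrom-< k))))
    roots : ∀ as ys → All (λ y → det M (y ∷ as ++ ys) (downFrom (suc k)) ≈ 0#) ys
    roots as [] = []
    roots as (y ∷ ys) = det-repeated-row M as y ys (downFrom (suc k)) ∷
      P.subst (λ zs → All (λ z → det M (z ∷ zs) (downFrom (suc k)) ≈ 0#) ys) (Lₚ.++-assoc as (y ∷ []) ys) (roots (as ++ y ∷ []) ys)

-- Telescoping on runners

module Runners (L : LaurentRing) (P : ℤ) (m : ℕ) where
  open BoundedLittlewood L (LaurentRing.ξ L P) public

  s : C
  s = ξ P

  T : ℤ
  T = P Z.+ P

  ψ : ℤ → C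
  ψ y = mix (- s) (τ y)

  brk : ℤ → C
  brk v = 1# - ξ v

  χ : ℤ → C
  χ c = ξ c + ξ (Z.- c)

  brk≡ : ∀ {u v} → u ≡ v → brk u ≈ brk v
  brk≡ P.refl = refl

  ξ≡ : ∀ {u v} → u ≡ v → ξ u ≈ ξ v
  ξ≡ P.refl = refl

  ξ-T : ξ T ≈ t
  ξ-T = ξ-+ P P

  -- Since t = x^T, φ v is the quotient of two brackets at distance T. Products along a progression
  -- of step T therefore telescope.
  φ-brk : ∀ v → v ≢ 0ℤ → φ v * brk v ≈ brk (v Z.+ T)
  φ-brk v n = begin
    (t + (1# - t) * τ v) * brk v ≈⟨ solve 3 (λ t a b → (t :+ (con (+ 1) :- t) :* a) :* b := t :* b :+ (con (+ 1) :- t) :* (a :* b)) refl t (τ v) (brk v) ⟩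
    t * brk v + (1# - t) * (τ v * brk v) ≈⟨ +-congˡ (*-congˡ (τ-inverse v n)) ⟩
    t * brk v + (1# - t) * 1# ≈⟨ solve 2 (λ t u → t :* (con (+ 1) :- u) :+ (con (+ 1) :- t) :* con (+ 1) := con (+ 1) :- u :* t) refl t (ξ v) ⟩
    1# - ξ v * t ≈⟨ +-congˡ (-‿cong (trans (*-congˡ (sym ξ-T)) (sym (ξ-+ v T)))) ⟩
    brk (v Z.+ T) ∎

  -- The arithmetic progression P + c, P + c + 2P, … of length k, and the position of its end.
  G : ℤ → ℕ → List ℤ
  G c zero = []
  G c (suc k) = (P Z.+ c) ∷ G (c Z.+ T) k

  adv : ℤ → ℕ → ℤ
  adv c zero = c
  adv c (suc k) = adv (c Z.+ T) k

  D : ℤ → List ℤ → C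
  D u Y = ∏ (λ y → φ (u Z.+ y)) Y

  telescope : ∀ u d k → All (λ y → u Z.+ y ≢ 0ℤ) (G d k) → D u (G d k) * brk (u Z.+ (P Z.+ d)) ≈ brk (u Z.+ (P Z.+ adv d k))
  telescope u d zero _ = *-identityˡ _
  telescope u d (suc k) (n ∷ ns) = begin
    φ v * D u (G (d Z.+ T) k) * brk v ≈⟨ xy∙z≈y∙xz _ _ _ ⟩
    D u (G (d Z.+ T) k) * (φ v * brk v) ≈⟨ *-congˡ (trans (φ-brk v n) (brk≡ (e u P d T))) ⟩
    D u (G (d Z.+ T) k) * brk (u Z.+ (P Z.+ (d Z.+ T))) ≈⟨ telescope u (d Z.+ T) k ns ⟩
    brk (u Z.+ (P Z.+ adv (d Z.+ T) k)) ∎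
    where
    v = u Z.+ (P Z.+ d)
    e : ∀ u P d T → u Z.+ (P Z.+ d) Z.+ T ≡ u Z.+ (P Z.+ (d Z.+ T))
    e = solve-∀

  -- The condition is stable under negation and under shifts by T, hence under all flips; it keeps
  -- the denominators between different runners away from 0.
  record Off (v : ℤ) : Set where
    constructor off
    field avoids : ∀ i → v Z.+ i Z.* T ≢ 0ℤ

  Off-≢0 : ∀ {v} → Off v → v ≢ 0ℤ
  Off-≢0 {v} (off o) e = o 0ℤ (P.trans (P.cong (Z._+ 0ℤ Z.* T) e) P.refl)

  Off-shift : ∀ {v w} j → w ≡ v Z.+ j Z.* T → Off v → Off w
  Off-shift {v} {w} j e (off o) = off λ i q → o (j Z.+ i) (P.trans (P.sym (P.trans (P.cong (Z._+ i Z.* T) e) (ring≡ v j i T))) q)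
    where
    ring≡ : ∀ v j i T → v Z.+ j Z.* T Z.+ i Z.* T ≡ v Z.+ (j Z.+ i) Z.* T
    ring≡ = solve-∀

  Off-neg : ∀ {v} → Off v → Off (Z.- v)
  Off-neg {v} (off o) = off λ i q → o (Z.- i) (P.trans (ring≡ v i T) (P.cong Z.-_ q))
    where
    ring≡ : ∀ v i T → v Z.+ (Z.- i) Z.* T ≡ Z.- (Z.- v Z.+ i Z.* T)
    ring≡ = solve-∀

  Off-All : ∀ u d k → Off (u Z.+ (P Z.+ d)) → All (λ y → u Z.+ y ≢ 0ℤ) (G d k)
  Off-All u d zero o = []
  Off-All u d (suc k) o = Off-≢0 o ∷ Off-All u (d Z.+ T) k (Off-shift 1ℤ (ring≡ u P d T) o)
    where
    ring≡ : ∀ u P d T → u Z.+ (P Z.+ (d Z.+ T)) ≡ u Z.+ (P Z.+ d) Z.+ 1ℤ Z.* T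
    ring≡ = solve-∀

  adv≡ : ∀ d k → adv d k ≡ d Z.+ + k Z.* T
  adv≡ d zero = P.sym (ZP.+-identityʳ d)
  adv≡ d (suc k) = P.trans (adv≡ (d Z.+ T) k) (P.trans (ring≡ d (+ k) T) (P.cong (λ z → d Z.+ z Z.* T) (P.sym (pos-+ 1 k))))
    where
    ring≡ : ∀ d k T → d Z.+ T Z.+ k Z.* T ≡ d Z.+ (1ℤ Z.+ k) Z.* T
    ring≡ = solve-∀

  -- A runner with k entries in place and l flipped ones. The flipped entries form the progression
  -- of centre -c, so that both halves telescope.
  conf : ℤ → ℕ → ℕ → List ℤ
  conf c k l = G c k ++ G (Z.- c) l

  -- Flipping the lowest entry P + c amounts to moving the centre from c to c + T, since -(P + c) =
  -- P - (c + T) is where the flipped half then starts.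
  conf-step : ∀ c k l → conf (c Z.+ T) k (suc l) ↭ (Z.- (P Z.+ c)) ∷ (G (c Z.+ T) k ++ G (Z.- c) l)
  conf-step c k l = P.subst₂ (λ x d → conf (c Z.+ T) k (suc l) ↭ x ∷ (G (c Z.+ T) k ++ G d l)) (e₁ c P) (e₂ c T)
    (shift _ (G (c Z.+ T) k) _)
    where
    e₁ : ∀ c P → P Z.+ (Z.- (c Z.+ (P Z.+ P))) ≡ Z.- (P Z.+ c)
    e₁ = solve-∀
    e₂ : ∀ c T → Z.- (c Z.+ T) Z.+ T ≡ Z.- c
    e₂ = solve-∀

  D-conf : ∀ u d p q → D u (conf d p q) ≈ D u (G d p) * D u (G (Z.- d) q)
  D-conf u d p q = ∏-++ _ (G d p) _

  D-conf-telescope : ∀ u d p q → All (λ y → u Z.+ y ≢ 0ℤ) (G d p) → All (λ y → u Z.+ y ≢ 0ℤ) (G (Z.- d) q) →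
    D u (conf d p q) * (brk (u Z.+ (P Z.+ d)) * brk (u Z.+ (P Z.- d))) ≈ brk (u Z.+ (P Z.+ adv d p)) * brk (u Z.+ (P Z.+ adv (Z.- d) q))
  D-conf-telescope u d p q n₁ n₂ = begin
    D u (conf d p q) * _ ≈⟨ *-congʳ (D-conf u d p q) ⟩
    _ ≈⟨ solve 4 (λ a b c d → (a :* b) :* (c :* d) := (a :* c) :* (b :* d)) refl _ _ _ _ ⟩
    _ ≈⟨ *-cong (telescope u d p n₁) (telescope u (Z.- d) q n₂) ⟩
    _ ∎

  cross : List ℤ → List ℤ → C
  cross X Y = ∏ (λ x → D x Y) X

  cross-sym : ∀ X Y → cross X Y ≈ cross Y X
  cross-sym X Y = trans (∏-swap _ X Y) (∏-cong Y (λ y → ∏-cong X (λ x → cong≈ φ (ZP.+-comm x y))))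

  -- A runner of centre d carries its mirror image -d along, so brackets occur in these pairs. This
  -- is the origin of the variables χ of the Vandermonde determinant.
  brk-pair : ∀ c d → brk (c Z.+ d) * brk (c Z.- d) ≈ ξ c * (χ c - χ d)
  brk-pair c d = begin
    (1# - ξ (c Z.+ d)) * (1# - ξ (c Z.- d)) ≈⟨ *-cong (+-congˡ (-‿cong (ξ-+ c d))) (+-congˡ (-‿cong (ξ-+ c (Z.- d)))) ⟩
    (1# - ξ c * ξ d) * (1# - ξ c * ξ (Z.- d))
      ≈⟨ solve 3 (λ c d e → (con (+ 1) :- c :* d) :* (con (+ 1) :- c :* e) := con (+ 1) :+ c :* c :* (d :* e) :- c :* (d :+ e)) refl _ _ _ ⟩
    1# + ξ c * ξ c * (ξ d * ξ (Z.- d)) - ξ c * χ d ≈⟨ +-congʳ (+-cong (sym (ξ-inv c)) (trans (*-congˡ (ξ-inv d)) (*-identityʳ _))) ⟩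
    ξ c * ξ (Z.- c) + ξ c * ξ c - ξ c * χ d ≈⟨ solve 3 (λ a b d → a :* b :+ a :* a :- a :* d := a :* (a :+ b :- d)) refl _ _ _ ⟩
    ξ c * (χ c - χ d) ∎

  -- The part of a flip at c that comes from the far ends of another runner; it tends to 1 when the
  -- ends move to infinity.
  E : ℤ → ℤ → ℤ → C
  E c β⁺ β⁻ = brk (β⁺ Z.- c) * brk (β⁻ Z.- c) * (τ (c Z.+ T Z.+ β⁺) * τ (c Z.+ T Z.+ β⁻))

  E-inverse : ∀ c β⁺ β⁻ → c Z.+ T Z.+ β⁺ ≢ 0ℤ → c Z.+ T Z.+ β⁻ ≢ 0ℤ →
    E c β⁺ β⁻ * (brk (c Z.+ T Z.+ β⁺) * brk (c Z.+ T Z.+ β⁻)) ≈ brk (β⁺ Z.- c) * brk (β⁻ Z.- c)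
  E-inverse c β⁺ β⁻ n₁ n₂ = begin
    _ ≈⟨ solve 5 (λ a x y u v → a :* (x :* y) :* (u :* v) := a :* ((x :* u) :* (y :* v))) refl _ _ _ _ _ ⟩
    _ ≈⟨ *-congˡ (*-cong (τ-inverse _ n₁) (τ-inverse _ n₂)) ⟩
    _ ≈⟨ trans (*-congˡ (*-identityˡ _)) (*-identityʳ _) ⟩
    _ ∎

  cancelʳ : ∀ {u v a b} → v * u ≈ 1# → a * v ≈ b * v → a ≈ b
  cancelʳ e = unit-cancel (trans (*-comm _ _) e)

  -- The interaction of the flipped entry with the other runner telescopes, before and after the
  -- flip. Besides the end factor `E` and a power of x, only the change of χ c - χ d couples the
  -- states of the two runners.
  cross-step : ∀ c k l d p q → Off (c Z.+ d) → Off (c Z.- d) → let c' = c Z.+ T; Y = conf d p q in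
    cross (conf c' k (suc l)) Y * (χ c - χ d) ≈
    cross (conf c (suc k) l) Y * (E c (adv d p) (adv (Z.- d) q) * ξ (c Z.+ c')) * (χ c' - χ d)
  cross-step c k l d p q o⁺ o⁻ = cancelʳ b₁-unit (begin
    X' * (χ c - χ d) * b₁ ≈⟨ *-congʳ (*-congʳ (∏-↭ (λ x → D x Y) (conf-step c k l))) ⟩
    D⁻ * R * (χ c - χ d) * b₁ ≈⟨ *-congˡ (sym D⁺-eq) ⟩
    D⁻ * R * (χ c - χ d) * (D⁺ * (brk (c' Z.+ d) * brk (c' Z.- d)))
      ≈⟨ *-congˡ (*-congˡ (brk-pair c' d)) ⟩
    D⁻ * R * (χ c - χ d) * (D⁺ * (ξ c' * (χ c' - χ d)))
      ≈⟨ *-congʳ (*-congˡ (sym (trans (*-congʳ (ξ-inv c)) (*-identityˡ _)))) ⟩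
    D⁻ * R * (ξ c * ξ (Z.- c) * (χ c - χ d)) * (D⁺ * (ξ c' * (χ c' - χ d)))
      ≈⟨ solve 8 (λ D R c n x E c' x' → D :* R :* (c :* n :* x) :* (E :* (c' :* x')) := D :* (n :* x) :* ((E :* R) :* (c :* c') :* x')) refl _ _ _ _ _ _ _ _ ⟩
    D⁻ * (ξ (Z.- c) * (χ c - χ d)) * (X * (ξ c * ξ c') * (χ c' - χ d)) ≈⟨ *-cong D⁻-eq (*-congʳ (*-congˡ (sym (ξ-+ c c')))) ⟩
    brk (β⁺ Z.- c) * brk (β⁻ Z.- c) * (X * ξ (c Z.+ c') * (χ c' - χ d)) ≈⟨ *-congʳ (sym (E-inverse c β⁺ β⁻ nz⁺ nz⁻)) ⟩
    E c β⁺ β⁻ * b₁ * (X * ξ (c Z.+ c') * (χ c' - χ d))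
      ≈⟨ solve 5 (λ E b X x z → E :* b :* (X :* x :* z) := X :* (E :* x) :* z :* b) refl _ _ _ _ _ ⟩
    X * (E c β⁺ β⁻ * ξ (c Z.+ c')) * (χ c' - χ d) * b₁ ∎)
    where
    c' = c Z.+ T
    y = P Z.+ c
    Y = conf d p q
    β⁺ = adv d p
    β⁻ = adv (Z.- d) q
    b₁ = brk (c' Z.+ β⁺) * brk (c' Z.+ β⁻)
    R = cross (G c' k ++ G (Z.- c) l) Y
    X = cross (conf c (suc k) l) Y
    X' = cross (conf c' k (suc l)) Y
    D⁺ = D y Y
    D⁻ = D (Z.- y) Y
    e₁ : ∀ c P d → P Z.+ c Z.+ (P Z.+ d) ≡ c Z.+ (P Z.+ P) Z.+ d
    e₁ = solve-∀
    e₂ : ∀ c P d → Z.- (P Z.+ c) Z.+ (P Z.+ d) ≡ d Z.- c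
    e₂ = solve-∀
    e₃ : ∀ c T d → c Z.+ T Z.+ d ≡ c Z.+ d Z.+ 1ℤ Z.* T
    e₃ = solve-∀
    e₄ : ∀ c d → d Z.- c ≡ Z.- (c Z.- d)
    e₄ = solve-∀
    e₅ : ∀ c d → Z.- d Z.- c ≡ Z.- (c Z.+ d)
    e₅ = solve-∀
    off₁ : ∀ d → Off (c Z.+ d) → Off (y Z.+ (P Z.+ d))
    off₁ d o = Off-shift 1ℤ (P.trans (e₁ c P d) (e₃ c T d)) o
    off₂ : ∀ d → Off (c Z.- d) → Off (Z.- y Z.+ (P Z.+ d))
    off₂ d o = P.subst Off (P.sym (P.trans (e₂ c P d) (e₄ c d))) (Off-neg o)
    o⁺' : Off (c Z.- (Z.- d))
    o⁺' = P.subst (λ z → Off (c Z.+ z)) (P.sym (neg-involutive d)) o⁺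
    D⁺-eq : D⁺ * (brk (c' Z.+ d) * brk (c' Z.- d)) ≈ b₁
    D⁺-eq = trans (*-congˡ (*-cong (brk≡ (P.sym (e₁ c P d))) (brk≡ (P.sym (e₁ c P (Z.- d))))))
      (trans (D-conf-telescope y d p q (Off-All y d p (off₁ d o⁺)) (Off-All y (Z.- d) q (off₁ (Z.- d) o⁻)))
        (*-cong (brk≡ (e₁ c P β⁺)) (brk≡ (e₁ c P β⁻))))
    D⁻-eq : D⁻ * (ξ (Z.- c) * (χ c - χ d)) ≈ brk (β⁺ Z.- c) * brk (β⁻ Z.- c)
    D⁻-eq = trans (*-congˡ (trans (*-congˡ (+-congʳ (trans (+-comm _ _) (+-congˡ (ξ≡ (P.sym (neg-involutive c))))))) (sym (brk-pair (Z.- c) d))))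
      (trans (*-congˡ (*-cong (brk≡ (P.trans (ZP.+-comm (Z.- c) d) (P.sym (e₂ c P d)))) (brk≡ (P.trans (ZP.+-comm (Z.- c) (Z.- d)) (P.sym (e₂ c P (Z.- d)))))))
      (trans (D-conf-telescope (Z.- y) d p q (Off-All (Z.- y) d p (off₂ d o⁻)) (Off-All (Z.- y) (Z.- d) q (off₂ (Z.- d) o⁺')))
        (*-cong (brk≡ (e₂ c P β⁺)) (brk≡ (e₂ c P β⁻)))))
    e₆ : ∀ c T d k → c Z.+ T Z.+ (d Z.+ k Z.* T) ≡ c Z.+ d Z.+ (1ℤ Z.+ k) Z.* T
    e₆ = solve-∀
    nz : ∀ d p → Off (c Z.+ d) → c' Z.+ adv d p ≢ 0ℤ
    nz d p o = Off-≢0 (Off-shift (1ℤ Z.+ + p) (P.trans (P.cong (λ z → c' Z.+ z) (adv≡ d p)) (e₆ c T d (+ p))) o)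
    nz⁺ = nz d p o⁺
    nz⁻ = nz (Z.- d) q o⁻
    b₁-unit : b₁ * (τ (c' Z.+ β⁺) * τ (c' Z.+ β⁻)) ≈ 1#
    b₁-unit = trans (solve 4 (λ a b c d → (a :* b) :* (c :* d) := (c :* a) :* (d :* b)) refl _ _ _ _)
      (trans (*-cong (τ-inverse _ nz⁺) (τ-inverse _ nz⁻)) (*-identityˡ _))

  -- ρ y = 1 for positive y, and ρ (-y) = ξ (m y).
  ρ : ℤ → C
  ρ (+ _) = 1#
  ρ -[1+ k ] = ξ (+ suc k) ^ m

  ρ-flip : ∀ y → y ≢ 0ℤ → ρ (Z.- y) ≈ ρ y * ξ y ^ m
  ρ-flip (+ zero) n = ⊥-elim (n P.refl)
  ρ-flip (+ suc k) n = sym (*-identityˡ _)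
  ρ-flip -[1+ k ] n = sym (trans (sym (*-^ _ _ m)) (trans (^-cong m (ξ-inv (+ suc k))) (1^ m)))

  -- The summand of `W m` in terms of signed entries: see `∑±-own-W`.
  own : List ℤ → C
  own X = ∏ ρ X * U (- s) X

  own-↭ : ∀ {X Y} → X ↭ Y → own X ≈ own Y
  own-↭ p = *-cong (∏-↭ ρ p) (U-↭ (- s) p)

  ψ-form : ∀ v → v ≢ 0ℤ → ψ v ≈ (1# + s * ξ v) * τ v
  ψ-form v n = begin
    - s + (1# - - s) * τ v ≈⟨ solve 2 (λ s v → :- s :+ (con (+ 1) :- :- s) :* v := v :+ s :* (v :- con (+ 1))) refl s (τ v) ⟩
    τ v + s * (τ v - 1#) ≈⟨ +-congˡ (*-congˡ (sym (ξτ v n))) ⟩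
    τ v + s * (ξ v * τ v) ≈⟨ solve 3 (λ s u v → v :+ s :* (u :* v) := (con (+ 1) :+ s :* u) :* v) refl s (ξ v) (τ v) ⟩
    (1# + s * ξ v) * τ v ∎

  ψ-brk : ∀ y → y ≢ 0ℤ → ψ y * (brk y * brk (P Z.+ y)) ≈ brk (P Z.+ y Z.+ (P Z.+ y))
  ψ-brk y n = begin
    ψ y * (brk y * brk z) ≈⟨ *-congʳ (ψ-form y n) ⟩
    (1# + s * ξ y) * τ y * (brk y * brk z) ≈⟨ solve 4 (λ a t b c → a :* t :* (b :* c) := (t :* b) :* (a :* c)) refl _ _ _ _ ⟩
    τ y * brk y * ((1# + s * ξ y) * brk z) ≈⟨ *-cong (τ-inverse y n) (*-congʳ (+-congˡ (sym (ξ-+ P y)))) ⟩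
    1# * ((1# + ξ z) * (1# - ξ z)) ≈⟨ solve 1 (λ x → con (+ 1) :* ((con (+ 1) :+ x) :* (con (+ 1) :- x)) := con (+ 1) :- x :* x) refl (ξ z) ⟩
    1# - ξ z * ξ z ≈⟨ +-congˡ (-‿cong (sym (ξ-+ z z))) ⟩
    brk (z Z.+ z) ∎
    where z = P Z.+ y

  -- Under y → -y the weight ρ gains xᵐʸ, and ψ gains another xʸ together with a sign; this gives
  -- the exponent m + 1.
  own-flip : ∀ c R → let y = P Z.+ c in y ≢ 0ℤ →
    own ((Z.- y) ∷ R) * (1# + ξ (c Z.+ T)) * D y R ≈ - (own (y ∷ R) * ξ y ^ suc m * (1# + ξ (Z.- c))) * D (Z.- y) R
  own-flip c R n = cancelʳ (τ-inverse y n) (begin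
    own ((Z.- y) ∷ R) * (1# + ξ (c Z.+ T)) * D y R * τ y
      ≈⟨ *-congʳ (*-congʳ (*-congʳ (*-cong (*-congʳ (ρ-flip y n)) (*-congʳ (*-congʳ ψ⁻))))) ⟩
    (ρ y * ξ y ^ m * ∏ ρ R) * (- ((1# + ξ (Z.- c)) * ξ y * τ y) * ∏ψ * (D (Z.- y) R * pairs R)) * (1# + ξ (c Z.+ T)) * D y R * τ y
      ≈⟨ solve 11 (λ r x p a u v w d q b e → (r :* x :* p) :* ((:- ((con (+ 1) :+ a) :* u :* v)) :* w :* (d :* q)) :* b :* e :* v :=
           (:- ((r :* p) :* (b :* v :* w :* (e :* q)) :* (u :* x) :* (con (+ 1) :+ a))) :* d :* v) refl
           (ρ y) (ξ y ^ m) (∏ ρ R) (ξ (Z.- c)) (ξ y) (τ y) ∏ψ (D (Z.- y) R) (pairs R) (1# + ξ (c Z.+ T)) (D y R) ⟩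
    - ((ρ y * ∏ ρ R) * ((1# + ξ (c Z.+ T)) * τ y * ∏ψ * (D y R * pairs R)) * (ξ y * ξ y ^ m) * (1# + ξ (Z.- c))) * D (Z.- y) R * τ y
      ≈⟨ *-congʳ (*-congʳ (-‿cong (*-congʳ (*-congʳ (*-congˡ (*-congʳ (*-congʳ (sym ψ⁺)))))))) ⟩
    - (own (y ∷ R) * ξ y ^ suc m * (1# + ξ (Z.- c))) * D (Z.- y) R * τ y ∎)
    where
    y = P Z.+ c
    ∏ψ = ∏ ψ R
    e₁ : ∀ c P → c Z.+ (P Z.+ P) ≡ P Z.+ (P Z.+ c)
    e₁ = solve-∀
    e₂ : ∀ c P → Z.- c ≡ P Z.- (P Z.+ c)
    e₂ = solve-∀
    ψ⁺ : ψ y ≈ (1# + ξ (c Z.+ T)) * τ y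
    ψ⁺ = trans (ψ-form y n) (*-congʳ (+-congˡ (trans (sym (ξ-+ P y)) (ξ≡ (P.sym (e₁ c P))))))
    ψ⁻ : ψ (Z.- y) ≈ - ((1# + ξ (Z.- c)) * ξ y * τ y)
    ψ⁻ = begin
      ψ (Z.- y) ≈⟨ ψ-form (Z.- y) (neg≢0 n) ⟩
      (1# + s * ξ (Z.- y)) * τ (Z.- y) ≈⟨ *-cong (+-congˡ (trans (sym (ξ-+ P (Z.- y))) (ξ≡ (P.sym (e₂ c P))))) τ⁻ ⟩
      (1# + ξ (Z.- c)) * - (ξ y * τ y) ≈⟨ solve 3 (λ a b c → a :* :- (b :* c) := :- (a :* b :* c)) refl _ _ _ ⟩
      - ((1# + ξ (Z.- c)) * ξ y * τ y) ∎
      where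
      τ⁻ : τ (Z.- y) ≈ - (ξ y * τ y)
      τ⁻ = begin
        τ (Z.- y) ≈⟨ solve 2 (λ a b → b := a :+ b :- a) refl (τ y) _ ⟩
        τ y + τ (Z.- y) - τ y ≈⟨ +-congʳ (τ-reflect y n) ⟩
        1# - τ y ≈⟨ solve 1 (λ a → con (+ 1) :- a := :- (a :- con (+ 1))) refl _ ⟩
        - (τ y - 1#) ≈⟨ -‿cong (sym (ξτ y n)) ⟩
        - (ξ y * τ y) ∎

  1+ξ-unit : ∀ v → v ≢ 0ℤ → (1# + ξ v) * (brk v * τ (v Z.+ v)) ≈ 1#
  1+ξ-unit v n = begin
    (1# + ξ v) * ((1# - ξ v) * τ (v Z.+ v)) ≈⟨ solve 2 (λ u w → (con (+ 1) :+ u) :* ((con (+ 1) :- u) :* w) := w :* (con (+ 1) :- u :* u)) refl _ _ ⟩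
    τ (v Z.+ v) * (1# - ξ v * ξ v) ≈⟨ *-congˡ (+-congˡ (-‿cong (sym (ξ-+ v v)))) ⟩
    τ (v Z.+ v) * brk (v Z.+ v) ≈⟨ τ-inverse _ (double≢0 v n) ⟩
    1# ∎

  brk-double : ∀ v → brk (v Z.+ v) ≈ brk v * (1# + ξ v)
  brk-double v = trans (+-congˡ (-‿cong (ξ-+ v v))) (solve 1 (λ u → con (+ 1) :- u :* u := (con (+ 1) :- u) :* (con (+ 1) :+ u)) refl (ξ v))

-- The abacus and the interaction of two runners

module RunnerSystem (L : LaurentRing) (p m n' Λ : ℕ) (2n'<p : n' N.+ n' < p) where
  open Runners L (+ p) m public
  open Determinant (LaurentRing.CR L) public

  κ : ℕ → ℤ
  κ a = + a Z.+ + a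

  M : ℤ
  M = + Λ Z.* T

  -- Runner a of an abacus with p runners, kept together with its mirror image -a:
  -- c⁰ a + rT is the position reached after r flips, starting from the lowest one.
  c⁰ β⁺ β⁻ : ℕ → ℤ
  c⁰ zero = 0ℤ
  c⁰ (suc a) = κ (suc a) Z.- M
  β⁺ zero = M
  β⁺ (suc a) = κ (suc a) Z.+ M
  β⁻ zero = 0ℤ
  β⁻ (suc a) = M Z.- κ (suc a)

  -- Runner 0 is its own mirror image and has half as many entries. Hence the separate treatment of
  -- index 0 in what follows.
  ℓ : ℕ → ℕ
  ℓ zero = Λ
  ℓ (suc a) = Λ N.+ Λ

  cc : ℕ → ℕ → ℤ
  cc a r = c⁰ a Z.+ + r Z.* T

  bead : ℕ → ℕ → List ℤ
  bead a r = conf (cc a r) (ℓ a N.∸ r) r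

  cc-suc : ∀ a r → cc a (suc r) ≡ cc a r Z.+ T
  cc-suc a r = P.trans (P.cong (λ z → c⁰ a Z.+ z Z.* T) (pos-+ 1 r)) (eq (c⁰ a) (+ r) T)
    where
    eq : ∀ c r T → c Z.+ (1ℤ Z.+ r) Z.* T ≡ c Z.+ r Z.* T Z.+ T
    eq = solve-∀

  c⁰-mod : ∀ a → ∃ λ j → c⁰ a ≡ κ a Z.+ j Z.* T
  c⁰-mod zero = 0ℤ , P.refl
  c⁰-mod (suc a) = Z.- + Λ , eq (κ (suc a)) (+ Λ) T
    where
    eq : ∀ k l T → k Z.- l Z.* T ≡ k Z.+ (Z.- l) Z.* T
    eq = solve-∀

  -- The ends do not depend on the number r of flips, so the end factors seen by one runner are the
  -- same for all states of the other.
  end⁺ : ∀ a r → r ≤ ℓ a → adv (cc a r) (ℓ a N.∸ r) ≡ β⁺ a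
  end⁺ a r r≤ℓ = P.trans (adv≡ (cc a r) (ℓ a N.∸ r)) (P.trans (eq (c⁰ a) (+ r) (+ (ℓ a N.∸ r)) T)
    (P.trans (P.cong (λ z → c⁰ a Z.+ z Z.* T) (P.trans (P.sym (pos-+ r (ℓ a N.∸ r))) (P.cong +_ (m+[n∸m]≡n r≤ℓ)))) (top a)))
    where
    eq : ∀ c r k T → c Z.+ r Z.* T Z.+ k Z.* T ≡ c Z.+ (r Z.+ k) Z.* T
    eq = solve-∀
    eq₂ : ∀ k l T → k Z.- l Z.* T Z.+ (l Z.+ l) Z.* T ≡ k Z.+ l Z.* T
    eq₂ = solve-∀
    top : ∀ a → c⁰ a Z.+ + ℓ a Z.* T ≡ β⁺ a
    top zero = ZP.+-identityˡ M
    top (suc a) = P.trans (P.cong (λ z → c⁰ (suc a) Z.+ z Z.* T) (pos-+ Λ Λ)) (eq₂ (κ (suc a)) (+ Λ) T)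

  end⁻ : ∀ a r → adv (Z.- cc a r) r ≡ β⁻ a
  end⁻ a r = P.trans (adv≡ (Z.- cc a r) r) (P.trans (eq (c⁰ a) (+ r Z.* T)) (bottom a))
    where
    eq : ∀ c x → Z.- (c Z.+ x) Z.+ x ≡ Z.- c
    eq = solve-∀
    eq₂ : ∀ k l → Z.- (k Z.- l) ≡ l Z.- k
    eq₂ = solve-∀
    bottom : ∀ a → Z.- c⁰ a ≡ β⁻ a
    bottom zero = P.refl
    bottom (suc a) = eq₂ (κ (suc a)) M

  Off-κ : ∀ x → 0 < x → x < p → Off (κ x)
  Off-κ x 0<x x<p = off λ i e → go i (*-cancelˡ-≡ (+ 2) _ _ (P.trans (P.sym (eq (+ x) i (+ p))) e))
    where
    eq : ∀ x i p → x Z.+ x Z.+ i Z.* (p Z.+ p) ≡ + 2 Z.* (x Z.+ i Z.* p)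
    eq = solve-∀
    go : ∀ i → + x Z.+ i Z.* + p ≢ 0ℤ
    go (+ i) e = <⇒≢ (≤-trans 0<x (m≤m+n x (i N.* p)))
      (P.sym (+-injective (P.trans (P.trans (pos-+ x (i N.* p)) (P.cong (λ z → + x Z.+ z) (pos-* i p))) e)))
    go -[1+ i ] e = <⇒≱ x<p (≤-trans (m≤m+n p (i N.* p)) (≤-reflexive (+-injective
      (P.trans (pos-* (suc i) p) (P.trans (eq₂ (+ x) (+ suc i) (+ p)) (P.trans (P.cong (Z._+ + x) (P.cong Z.-_ e)) (ZP.+-identityˡ _)))))))
      where
      eq₂ : ∀ x i p → i Z.* p ≡ Z.- (x Z.+ (Z.- i) Z.* p) Z.+ x
      eq₂ = solve-∀

  <p : ∀ {a b} → a ≤ n' → b ≤ n' → a N.+ b < p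
  <p q r = ≤-trans (s≤s (+-mono-≤ q r)) 2n'<p

  private
    κ-+ : ∀ a b → κ (a N.+ b) ≡ κ a Z.+ κ b
    κ-+ a b = P.trans (P.cong (λ z → z Z.+ z) (pos-+ a b)) (eq (+ a) (+ b))
      where
      eq : ∀ a b → (a Z.+ b) Z.+ (a Z.+ b) ≡ (a Z.+ a) Z.+ (b Z.+ b)
      eq = solve-∀

    κ-∸ : ∀ {a b} → b ≤ a → κ (a N.∸ b) ≡ κ a Z.- κ b
    κ-∸ {a} {b} q = P.trans (eq (κ (a N.∸ b)) (κ b)) (P.cong (Z._- κ b) (P.trans (P.sym (κ-+ (a N.∸ b) b)) (P.cong κ (m∸n+n≡m q))))
      where
      eq : ∀ x y → x ≡ x Z.+ y Z.- y
      eq = solve-∀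

    p-pos : 0 < p
    p-pos = ≤-trans (s≤s z≤n) 2n'<p

  Off-plus : ∀ a b → a ≤ n' → b ≤ n' → 0 < a N.+ b → Off (κ a Z.+ κ b)
  Off-plus a b q r pos = P.subst Off (κ-+ a b) (Off-κ (a N.+ b) pos (<p q r))

  Off-minus : ∀ a b → a ≤ n' → b ≤ n' → a ≢ b → Off (κ a Z.- κ b)
  Off-minus a b q r a≢b with NP.≤-total b a
  ... | inj₁ b≤a = P.subst Off (κ-∸ b≤a) (Off-κ (a N.∸ b) (m<n⇒0<n∸m (≤∧≢⇒< b≤a (λ e → a≢b (P.sym e))))
        (≤-<-trans (m∸n≤m a b) (≤-<-trans (m≤m+n a b) (<p q r))))
  ... | inj₂ a≤b = P.subst Off (P.trans (P.cong Z.-_ (κ-∸ a≤b)) (eq (κ a) (κ b))) (Off-neg (Off-κ (b N.∸ a) (m<n⇒0<n∸m (≤∧≢⇒< a≤b a≢b))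
        (≤-<-trans (m∸n≤m b a) (≤-<-trans (m≤n+m b a) (<p q r)))))
    where
    eq : ∀ a b → Z.- (b Z.- a) ≡ a Z.- b
    eq = solve-∀

  -- Here 2n' < p enters: for distinct a, b ≤ n' neither a + b nor a - b is divisible by p.
  Off-cc : ∀ a b r r' → a ≤ n' → b ≤ n' → a ≢ b → Off (cc a r Z.+ cc b r') × Off (cc a r Z.- cc b r')
  Off-cc a b r r' q q' n = Off-shift (j Z.+ + r Z.+ (k Z.+ + r')) (P.trans (P.cong₂ (λ u v → u Z.+ + r Z.* T Z.+ (v Z.+ + r' Z.* T)) ej ek) (eq₁ (κ a) (κ b) j k (+ r) (+ r') T)) (Off-plus a b q q' pos)
                     , Off-shift (j Z.+ + r Z.- (k Z.+ + r')) (P.trans (P.cong₂ (λ u v → u Z.+ + r Z.* T Z.- (v Z.+ + r' Z.* T)) ej ek) (eq₂ (κ a) (κ b) j k (+ r) (+ r') T)) (Off-minus a b q q' n)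
    where
    j = proj₁ (c⁰-mod a)
    ej = proj₂ (c⁰-mod a)
    k = proj₁ (c⁰-mod b)
    ek = proj₂ (c⁰-mod b)
    eq₁ : ∀ a b j k r r' T → a Z.+ j Z.* T Z.+ r Z.* T Z.+ (b Z.+ k Z.* T Z.+ r' Z.* T) ≡ a Z.+ b Z.+ (j Z.+ r Z.+ (k Z.+ r')) Z.* T
    eq₁ = solve-∀
    eq₂ : ∀ a b j k r r' T → a Z.+ j Z.* T Z.+ r Z.* T Z.- (b Z.+ k Z.* T Z.+ r' Z.* T) ≡ a Z.- b Z.+ (j Z.+ r Z.- (k Z.+ r')) Z.* T
    eq₂ = solve-∀
    sum-pos : ∀ a b → a ≢ b → 0 < a N.+ b
    sum-pos zero zero n = ⊥-elim (n P.refl)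
    sum-pos zero (suc b) n = s≤s z≤n
    sum-pos (suc a) b n = s≤s z≤n
    pos = sum-pos a b n

  Off-2cc : ∀ a r → suc a ≤ n' → Off (cc (suc a) r Z.+ cc (suc a) r)
  Off-2cc a r q = Off-shift (j Z.+ + r Z.+ (j Z.+ + r)) (P.trans (P.cong (λ u → u Z.+ + r Z.* T Z.+ (u Z.+ + r Z.* T)) ej) (eq₁ (κ (suc a)) j (+ r) T)) (Off-plus (suc a) (suc a) q q (s≤s z≤n))
    where
    j = proj₁ (c⁰-mod (suc a))
    ej = proj₂ (c⁰-mod (suc a))
    eq₁ : ∀ a j r T → a Z.+ j Z.* T Z.+ r Z.* T Z.+ (a Z.+ j Z.* T Z.+ r Z.* T) ≡ a Z.+ a Z.+ (j Z.+ r Z.+ (j Z.+ r)) Z.* T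
    eq₁ = solve-∀

  T-multiple≢0 : ∀ k → + suc k Z.* T ≢ 0ℤ
  T-multiple≢0 k = positive p p-pos
    where
    positive : ∀ p → 0 < p → + suc k Z.* (+ p Z.+ + p) ≢ 0ℤ
    positive (suc p') _ ()

  All-positive : ∀ u d k j → u Z.+ ((+ p) Z.+ d) ≡ + suc j Z.* T → All (λ y → u Z.+ y ≢ 0ℤ) (G d k)
  All-positive u d zero j e = []
  All-positive u d (suc k) j e = (λ q → T-multiple≢0 j (P.trans (P.sym e) q)) ∷ All-positive u (d Z.+ T) k (suc j)
    (P.trans (eq₁ u (+ p) d T) (P.trans (P.cong (Z._+ T) e) (eq₂ (+ suc j) T)))
    where
    eq₁ : ∀ u P d T → u Z.+ (P Z.+ (d Z.+ T)) ≡ u Z.+ (P Z.+ d) Z.+ T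
    eq₁ = solve-∀
    eq₂ : ∀ j T → j Z.* T Z.+ T ≡ (1ℤ Z.+ j) Z.* T
    eq₂ = solve-∀

  Invertible : C → Set
  Invertible d = Σ C λ e → d * e ≈ 1#

  cancel : ∀ {d a b} → Invertible d → a * d ≈ b * d → a ≈ b
  cancel (e , q) = cancelʳ q

  Invertible-* : ∀ {a b} → Invertible a → Invertible b → Invertible (a * b)
  Invertible-* (x , p) (y , q) = x * y , trans (*-interchange _ _ _ _) (trans (*-cong p q) (*-identityˡ _))

  brk-invertible : ∀ v → v ≢ 0ℤ → Invertible (brk v)
  brk-invertible v n = τ v , trans (*-comm _ _) (τ-inverse v n)

  χ-invertible : ∀ c d → Off (c Z.+ d) → Off (c Z.- d) → Invertible (χ c - χ d)
  χ-invertible c d o o' with Invertible-* (brk-invertible _ (Off-≢0 o)) (brk-invertible _ (Off-≢0 o'))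
  ... | e , q = ξ c * e , trans (x∙yz≈yx∙z _ _ _) (trans (*-congʳ (sym (brk-pair c d))) q)

  pre : (ℕ → C) → ℕ → C
  pre f zero = 1#
  pre f (suc r) = pre f r * f r

  pre-* : ∀ f g r → pre (λ i → f i * g i) r ≈ pre f r * pre g r
  pre-* f g zero = sym (*-identityˡ _)
  pre-* f g (suc r) = trans (*-congʳ (pre-* f g r)) (*-interchange _ _ _ _)

  pre-cong : ∀ {f g} r R → r ≤ R → (∀ i → i < R → f i ≈ g i) → pre f r ≈ pre g r
  pre-cong zero R q e = refl
  pre-cong (suc r) R q e = *-cong (pre-cong r R (≤-trans (n≤1+n r) q) e) (e r q)

  pre-∏ : ∀ {A : Set} (f : A → ℕ → C) xs r → ∏ (λ x → pre (f x) r) xs ≈ pre (λ i → ∏ (λ x → f x i) xs) r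
  pre-∏ f xs zero = ∏-1 xs
  pre-∏ f xs (suc r) = trans (∏-* _ _ xs) (*-congʳ (pre-∏ f xs r))

  -- When the two indices are coupled only through the ratio of consecutive values of x r - y r',
  -- the solution is a product of separate factors times one such difference. This is how pair
  -- interactions become a Vandermonde product.
  two-index : ∀ (F : ℕ → ℕ → C) (x y f g : ℕ → C) R R' →
    (∀ r r' → r < R → r' ≤ R' → F (suc r) r' * (x r - y r') ≈ F r r' * f r * (x (suc r) - y r')) →
    (∀ r r' → r ≤ R → r' < R' → F r (suc r') * (x r - y r') ≈ F r r' * g r' * (x r - y (suc r'))) →
    (∀ r r' → r ≤ R → r' ≤ R' → Invertible (x r - y r')) →
    ∀ r r' → r ≤ R → r' ≤ R' → F r r' * (x 0 - y 0) ≈ F 0 0 * (pre f r * pre g r') * (x r - y r')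
  two-index F x y f g R R' sf sg inv zero zero q q' = solve 2 (λ a b → a :* b := a :* (con (+ 1) :* con (+ 1)) :* b) refl _ _
  two-index F x y f g R R' sf sg inv zero (suc r') q q' = cancel (inv 0 r' z≤n q″) (begin
    F 0 (suc r') * (x 0 - y 0) * (x 0 - y r') ≈⟨ xy∙z≈xz∙y _ _ _ ⟩
    F 0 (suc r') * (x 0 - y r') * (x 0 - y 0) ≈⟨ *-congʳ (sg 0 r' z≤n q') ⟩
    F 0 r' * g r' * (x 0 - y (suc r')) * (x 0 - y 0) ≈⟨ solve 4 (λ a b c d → a :* b :* c :* d := a :* d :* (b :* c)) refl _ _ _ _ ⟩
    F 0 r' * (x 0 - y 0) * (g r' * (x 0 - y (suc r'))) ≈⟨ *-congʳ (two-index F x y f g R R' sf sg inv 0 r' z≤n q″) ⟩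
    F 0 0 * (1# * pre g r') * (x 0 - y r') * (g r' * (x 0 - y (suc r')))
      ≈⟨ solve 6 (λ F o a b c d → F :* (o :* a) :* b :* (c :* d) := F :* (o :* (a :* c)) :* d :* b) refl _ _ _ _ _ _ ⟩
    F 0 0 * (1# * (pre g r' * g r')) * (x 0 - y (suc r')) * (x 0 - y r') ∎)
    where q″ = ≤-trans (n≤1+n r') q'
  two-index F x y f g R R' sf sg inv (suc r) r' q q' = cancel (inv r r' q″ q') (begin
    F (suc r) r' * (x 0 - y 0) * (x r - y r') ≈⟨ xy∙z≈xz∙y _ _ _ ⟩
    F (suc r) r' * (x r - y r') * (x 0 - y 0) ≈⟨ *-congʳ (sf r r' q q') ⟩
    F r r' * f r * (x (suc r) - y r') * (x 0 - y 0) ≈⟨ solve 4 (λ a b c d → a :* b :* c :* d := a :* d :* (b :* c)) refl _ _ _ _ ⟩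
    F r r' * (x 0 - y 0) * (f r * (x (suc r) - y r')) ≈⟨ *-congʳ (two-index F x y f g R R' sf sg inv r r' q″ q') ⟩
    F 0 0 * (pre f r * pre g r') * (x r - y r') * (f r * (x (suc r) - y r'))
      ≈⟨ solve 6 (λ F o a b c d → F :* (o :* a) :* b :* (c :* d) := F :* ((o :* c) :* a) :* d :* b) refl _ _ _ _ _ _ ⟩
    F 0 0 * (pre f r * f r * pre g r') * (x (suc r) - y r') * (x r - y r') ∎)
    where q″ = ≤-trans (n≤1+n r) q

  h h̄ : ℕ → ℕ → ℕ → C
  h a b r = E (cc a r) (β⁺ b) (β⁻ b) * ξ (cc a r Z.+ (cc a r Z.+ T))

  -- For runner 0 the value `β⁻ 0` = 0 is the centre and not a far end. The factor belonging to it
  -- would not tend to 1; it is separated here and reappears as `ζ` and `zs`.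
  Ē : ℤ → ℕ → C
  Ē c zero = brk (M Z.- c) * τ (c Z.+ T Z.+ M)
  Ē c (suc b) = E c (β⁺ (suc b)) (β⁻ (suc b))

  h̄ a b r = Ē (cc a r) b * ξ (cc a r Z.+ (cc a r Z.+ T))

  suc-∸ : ∀ a r → r < ℓ a → ℓ a N.∸ r ≡ suc (ℓ a N.∸ suc r)
  suc-∸ a r q = +-∸-assoc 1 q

  bead-suc : ∀ a r → bead a (suc r) ≡ conf (cc a r Z.+ T) (ℓ a N.∸ suc r) (suc r)
  bead-suc a r = P.cong (λ z → conf z (ℓ a N.∸ suc r) (suc r)) (cc-suc a r)

  χ≡ : ∀ {c d} → c ≡ d → χ c ≈ χ d
  χ≡ P.refl = refl

  cross-beads : ∀ a b → a ≤ n' → b ≤ n' → a ≢ b → ∀ r r' → r < ℓ a → r' ≤ ℓ b →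
    cross (bead a (suc r)) (bead b r') * (χ (cc a r) - χ (cc b r')) ≈ cross (bead a r) (bead b r') * h a b r * (χ (cc a (suc r)) - χ (cc b r'))
  cross-beads a b qa qb n r r' q q' = begin
    cross (bead a (suc r)) Y * x ≈⟨ *-congʳ (cong≈ (λ X → cross X Y) (bead-suc a r)) ⟩
    cross (conf (c Z.+ T) k (suc r)) Y * x ≈⟨ cross-step c k r (cc b r') (ℓ b N.∸ r') r' (proj₁ o) (proj₂ o) ⟩
    cross (conf c (suc k) r) Y * (E c (adv (cc b r') (ℓ b N.∸ r')) (adv (Z.- cc b r') r') * ξ (c Z.+ (c Z.+ T))) * (χ (c Z.+ T) - χ (cc b r'))
      ≈⟨ *-cong (*-cong (cong≈ (λ k → cross (conf c k r) Y) (P.sym (suc-∸ a r q)))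
           (*-congʳ (reflexive (P.cong₂ (E c) (end⁺ b r' q') (end⁻ b r'))))) (+-congʳ (χ≡ (P.sym (cc-suc a r)))) ⟩
    cross (bead a r) Y * h a b r * (χ (cc a (suc r)) - χ (cc b r')) ∎
    where
    c = cc a r
    k = ℓ a N.∸ suc r
    Y = bead b r'
    x = χ c - χ (cc b r')
    o = Off-cc a b r r' qa qb n

  cross-formula : ∀ a b → a ≤ n' → b ≤ n' → a ≢ b → ∀ r r' → r ≤ ℓ a → r' ≤ ℓ b →
    cross (bead a r) (bead b r') * (χ (cc a 0) - χ (cc b 0)) ≈
    cross (bead a 0) (bead b 0) * (pre (h a b) r * pre (h b a) r') * (χ (cc a r) - χ (cc b r'))
  cross-formula a b qa qb n = two-index (λ r r' → cross (bead a r) (bead b r')) (λ r → χ (cc a r)) (λ r → χ (cc b r)) (h a b) (h b a) (ℓ a) (ℓ b)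
    (cross-beads a b qa qb n)
    (λ r r' q q' → begin
      cross (bead a r) (bead b (suc r')) * (χ (cc a r) - χ (cc b r')) ≈⟨ *-congʳ (cross-sym (bead a r) (bead b (suc r'))) ⟩
      _ ≈⟨ solve 3 (λ f x y → f :* (x :- y) := :- (f :* (y :- x))) refl _ _ _ ⟩
      _ ≈⟨ -‿cong (cross-beads b a qb qa (λ e → n (P.sym e)) r' r q' q) ⟩
      _ ≈⟨ solve 4 (λ f g x y → :- (f :* g :* (y :- x)) := f :* g :* (x :- y)) refl _ _ _ _ ⟩
      _ ≈⟨ *-congʳ (*-congʳ (cross-sym (bead b r') (bead a r))) ⟩
      cross (bead a r) (bead b r') * h b a r' * (χ (cc a r) - χ (cc b (suc r'))) ∎)
    (λ r r' _ _ → χ-invertible _ _ (proj₁ (Off-cc a b r r' qa qb n)) (proj₂ (Off-cc a b r r' qa qb n)))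

-- The weight of a single runner

module RunnerProducts (L : LaurentRing) (p m n' Λ : ℕ) (2n'<p : n' N.+ n' < p) where
  open RunnerSystem L p m n' Λ 2n'<p public

  -- `v` is the effect of a flip on its own runner, written with the diagonal factor h̄ a a so that
  -- it fits the pair interactions. `dbl` is the value 1 + ξ 0 = 2 met by the first flip on runner
  -- 0, and `zs` compensates the factor that `h̄` leaves out for the pair with runner 0.
  u dbl zs v : ℕ → ℕ → C
  u a r = - (ξ (+ p Z.+ cc a r) ^ suc m * ξ (Z.- (cc a r Z.+ (cc a r Z.+ T))))
  dbl zero zero = 1# + 1#
  dbl zero (suc r) = 1#
  dbl (suc a) r = 1#
  zs zero r = 1#
  zs (suc a) r = brk (Z.- cc (suc a) r) * τ (cc (suc a) r Z.+ T)
  v a r = h̄ a a r * u a r * dbl a r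

  private
    module Core (c : ℤ) (k r : ℕ) (b⁺ b⁻ : ℤ) (e⁺ : adv (c Z.+ T) k ≡ b⁺) (e⁻ : adv (Z.- c) r ≡ b⁻) where
      c' y : ℤ
      c' = c Z.+ T
      y = + p Z.+ c

      O O' : C
      O = own (conf c (suc k) r)
      O' = own (conf c' k (suc r))

      E₁ : ∀ c P d → P Z.+ c Z.+ (P Z.+ d) ≡ c Z.+ (P Z.+ P) Z.+ d
      E₁ = solve-∀
      E₂ : ∀ c P d → Z.- (P Z.+ c) Z.+ (P Z.+ d) ≡ d Z.- c
      E₂ = solve-∀
      E₃ : ∀ c P → P Z.+ c Z.+ (P Z.- c) ≡ 1ℤ Z.* (P Z.+ P)
      E₃ = solve-∀
      E₄ : ∀ c P → Z.- (P Z.+ c) Z.+ (P Z.+ (c Z.+ (P Z.+ P))) ≡ 1ℤ Z.* (P Z.+ P)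
      E₄ = solve-∀

      D-up : All (λ z → y Z.+ z ≢ 0ℤ) (G c' k) → D y (G c' k) * brk (c' Z.+ c') ≈ brk (c' Z.+ b⁺)
      D-up n = trans (*-congˡ (brk≡ (P.sym (E₁ c (+ p) c')))) (trans (telescope y c' k n) (brk≡ (P.trans (E₁ c (+ p) _) (P.cong (λ z → c' Z.+ z) e⁺))))

      D-up' : D y (G (Z.- c) r) * brk T ≈ brk (c' Z.+ b⁻)
      D-up' = trans (*-congˡ (brk≡ (P.sym (P.trans (E₃ c (+ p)) (ZP.*-identityˡ T)))))
        (trans (telescope y (Z.- c) r (All-positive y (Z.- c) r 0 (E₃ c (+ p)))) (brk≡ (P.trans (E₁ c (+ p) _) (P.cong (λ z → c' Z.+ z) e⁻))))

      D-down : D (Z.- y) (G c' k) * brk T ≈ brk (b⁺ Z.- c)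
      D-down = trans (*-congˡ (brk≡ (P.sym (P.trans (E₄ c (+ p)) (ZP.*-identityˡ T)))))
        (trans (telescope (Z.- y) c' k (All-positive (Z.- y) c' k 0 (E₄ c (+ p)))) (brk≡ (P.trans (E₂ c (+ p) (adv c' k)) (P.cong (Z._- c) e⁺))))

      D-down' : All (λ z → Z.- y Z.+ z ≢ 0ℤ) (G (Z.- c) r) → D (Z.- y) (G (Z.- c) r) * brk (Z.- c Z.+ (Z.- c)) ≈ brk (b⁻ Z.- c)
      D-down' n = trans (*-congˡ (brk≡ (P.sym (E₂ c (+ p) (Z.- c)))))
        (trans (telescope (Z.- y) (Z.- c) r n) (brk≡ (P.trans (E₂ c (+ p) (adv (Z.- c) r)) (P.cong (Z._- c) e⁻))))

      flip : y ≢ 0ℤ → O' * (1# + ξ c') * (D y (G c' k) * D y (G (Z.- c) r)) ≈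
        - (O * ξ y ^ suc m * (1# + ξ (Z.- c))) * (D (Z.- y) (G c' k) * D (Z.- y) (G (Z.- c) r))
      flip n = begin
        O' * (1# + ξ c') * (D y (G c' k) * D y (G (Z.- c) r)) ≈⟨ *-cong (*-congʳ (own-↭ (conf-step c k r))) (sym (∏-++ _ (G c' k) _)) ⟩
        _ ≈⟨ own-flip c (G c' k ++ G (Z.- c) r) n ⟩
        _ ≈⟨ *-congˡ (∏-++ _ (G c' k) _) ⟩
        _ ∎

      -- The telescoped self-interaction leaves brackets at 2c' and -2c. They factor by
      -- `brk-double`, and the halves 1 + ξ cancel against those of ψ.
      own-step : c ≢ 0ℤ → c' ≢ 0ℤ → y ≢ 0ℤ → All (λ z → y Z.+ z ≢ 0ℤ) (G c' k) → All (λ z → Z.- y Z.+ z ≢ 0ℤ) (G (Z.- c) r) →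
        O' * (brk (c' Z.+ b⁺) * brk (c' Z.+ b⁻)) * brk (Z.- c) ≈ - (O * ξ y ^ suc m) * (brk (b⁺ Z.- c) * brk (b⁻ Z.- c)) * brk c'
      own-step nc nc' ny n₁ n₂ = cancel (Invertible-* (_ , 1+ξ-unit c' nc') (_ , 1+ξ-unit (Z.- c) (neg≢0 nc))) (begin
        O' * (brk (c' Z.+ b⁺) * brk (c' Z.+ b⁻)) * brk (Z.- c) * ((1# + ξ c') * (1# + ξ (Z.- c)))
          ≈⟨ *-congʳ (*-congʳ (*-congˡ (sym (*-cong (D-up n₁) D-up')))) ⟩
        O' * ((d₁ * b₁) * (d₂ * bT)) * brk (Z.- c) * ((1# + ξ c') * (1# + ξ (Z.- c)))
          ≈⟨ solve 8 (λ O a b d e f g h → O :* ((a :* b) :* (d :* e)) :* f :* (g :* h) := O :* g :* (a :* d) :* (b :* e :* (f :* h))) refl O' d₁ b₁ d₂ bT (brk (Z.- c)) _ _ ⟩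
        O' * (1# + ξ c') * (d₁ * d₂) * (b₁ * bT * (brk (Z.- c) * (1# + ξ (Z.- c))))
          ≈⟨ *-cong (flip ny) (*-congˡ (sym (brk-double (Z.- c)))) ⟩
        - (O * ξ y ^ suc m * (1# + ξ (Z.- c))) * (d₃ * d₄) * (b₁ * bT * brk (Z.- c Z.+ (Z.- c)))
          ≈⟨ solve 8 (λ o f d₃ d₄ a T b x → (:- (o :* f :* x)) :* (d₃ :* d₄) :* (a :* T :* b) := (:- (o :* f)) :* ((d₃ :* T) :* (d₄ :* b)) :* a :* x) refl O (ξ y ^ suc m) d₃ d₄ b₁ bT _ (1# + ξ (Z.- c)) ⟩
        - (O * ξ y ^ suc m) * ((d₃ * bT) * (d₄ * brk (Z.- c Z.+ (Z.- c)))) * b₁ * (1# + ξ (Z.- c))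
          ≈⟨ *-congʳ (*-cong (*-congˡ (*-cong D-down (D-down' n₂))) (brk-double c')) ⟩
        _ ≈⟨ solve 4 (λ a b c d → a :* (b :* c) :* d := a :* b :* (c :* d)) refl _ _ _ _ ⟩
        - (O * ξ y ^ suc m) * (brk (b⁺ Z.- c) * brk (b⁻ Z.- c)) * brk c' * ((1# + ξ c') * (1# + ξ (Z.- c))) ∎)
        where
        d₁ = D y (G c' k)
        d₂ = D y (G (Z.- c) r)
        d₃ = D (Z.- y) (G c' k)
        d₄ = D (Z.- y) (G (Z.- c) r)
        b₁ = brk (c' Z.+ c')
        bT = brk T

  bead-here : ∀ a r → r < ℓ a → bead a r ≡ conf (cc a r) (suc (ℓ a N.∸ suc r)) r
  bead-here a r q = P.cong (λ k → conf (cc a r) k r) (suc-∸ a r q)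

  end⁺' : ∀ a r → r < ℓ a → adv (cc a r Z.+ T) (ℓ a N.∸ suc r) ≡ β⁺ a
  end⁺' a r q = P.trans (P.cong (adv (cc a r)) (P.sym (suc-∸ a r q))) (end⁺ a r (≤-trans (n≤1+n r) q))

  u-cancel : ∀ a r → ξ (cc a r Z.+ (cc a r Z.+ T)) * u a r ≈ - (ξ (+ p Z.+ cc a r) ^ suc m)
  u-cancel a r = trans (solve 3 (λ a b c → a :* :- (b :* c) := :- (b :* (a :* c))) refl _ _ _) (-‿cong (trans (*-congˡ (ξ-inv (cc a r Z.+ (cc a r Z.+ T)))) (*-identityʳ _)))

  own-step⁺ : ∀ a r → suc a ≤ n' → r < ℓ (suc a) → own (bead (suc a) (suc r)) * zs (suc a) r ≈ own (bead (suc a) r) * v (suc a) r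
  own-step⁺ a r qa q = cancel (Invertible-* (Invertible-* (brk-invertible _ nz⁺) (brk-invertible _ nz⁻)) (brk-invertible _ nc')) (begin
    own (bead a₊ (suc r)) * (brk (Z.- c) * τ c') * (brk (c' Z.+ b⁺) * brk (c' Z.+ b⁻) * brk c')
      ≈⟨ *-congʳ (*-congʳ (cong≈ own (bead-suc a₊ r))) ⟩
    O' * (brk (Z.- c) * τ c') * (brk (c' Z.+ b⁺) * brk (c' Z.+ b⁻) * brk c')
      ≈⟨ solve 5 (λ o n t b d → o :* (n :* t) :* (b :* d) := (o :* b :* n) :* (t :* d)) refl _ _ _ _ _ ⟩
    O' * (brk (c' Z.+ b⁺) * brk (c' Z.+ b⁻)) * brk (Z.- c) * (τ c' * brk c')
      ≈⟨ *-cong (own-step nc nc' ny (Off-All y c' k off⁺) (Off-All (Z.- y) (Z.- c) r off⁻)) (τ-inverse c' nc') ⟩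
    - (O * ξ y ^ suc m) * (brk (b⁺ Z.- c) * brk (b⁻ Z.- c)) * brk c' * 1#
      ≈⟨ *-congʳ (*-congʳ (*-congˡ (sym (E-inverse c b⁺ b⁻ nz⁺ nz⁻)))) ⟩
    - (O * ξ y ^ suc m) * (E c b⁺ b⁻ * (brk (c' Z.+ b⁺) * brk (c' Z.+ b⁻))) * brk c' * 1#
      ≈⟨ solve 5 (λ o f e b d → (:- (o :* f)) :* (e :* b) :* d :* con (+ 1) := o :* (e :* (:- f)) :* (b :* d)) refl _ _ _ _ _ ⟩
    O * (E c b⁺ b⁻ * - (ξ y ^ suc m)) * (brk (c' Z.+ b⁺) * brk (c' Z.+ b⁻) * brk c')
      ≈⟨ *-congʳ (*-cong (cong≈ own (P.sym (bead-here a₊ r q))) (trans (*-congˡ (sym (u-cancel a₊ r))) (trans (sym (*-assoc _ _ _)) (sym (*-identityʳ _))))) ⟩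
    own (bead a₊ r) * v a₊ r * (brk (c' Z.+ b⁺) * brk (c' Z.+ b⁻) * brk c') ∎)
    where
    a₊ = suc a
    c = cc a₊ r
    k = ℓ a₊ N.∸ suc r
    b⁺ = β⁺ a₊
    b⁻ = β⁻ a₊
    open Core c k r b⁺ b⁻ (end⁺' a₊ r q) (end⁻ a₊ r)
    o : Off (c Z.+ c)
    o = Off-2cc a r qa
    eq₁ : ∀ c T → c Z.+ T Z.+ (c Z.+ T) ≡ c Z.+ c Z.+ + 2 Z.* T
    eq₁ = solve-∀
    eq₂ : ∀ c → Z.- c Z.- c ≡ Z.- (c Z.+ c)
    eq₂ = solve-∀
    eq₃ : ∀ c P → P Z.+ c Z.+ (P Z.+ c) ≡ c Z.+ c Z.+ 1ℤ Z.* (P Z.+ P)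
    eq₃ = solve-∀
    o' : Off (c' Z.+ c')
    o' = Off-shift (+ 2) (eq₁ c T) o
    half : ∀ {x} → Off (x Z.+ x) → x ≢ 0ℤ
    half oo e = Off-≢0 oo (P.cong (λ z → z Z.+ z) e)
    nc = half o
    nc' = half o'
    ny : y ≢ 0ℤ
    ny = half (Off-shift 1ℤ (eq₃ c (+ p)) o)
    off⁺ : Off (y Z.+ (+ p Z.+ c'))
    off⁺ = P.subst Off (P.sym (E₁ c (+ p) c')) o'
    off⁻ : Off (Z.- y Z.+ (+ p Z.- c))
    off⁻ = P.subst Off (P.sym (P.trans (E₂ c (+ p) (Z.- c)) (eq₂ c))) (Off-neg o)
    eq₄ : ∀ k r l T → k Z.- l Z.* T Z.+ r Z.* T Z.+ T Z.+ (k Z.+ l Z.* T) ≡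
      (k Z.- l Z.* T Z.+ r Z.* T) Z.+ (k Z.- l Z.* T Z.+ r Z.* T) Z.+ (l Z.+ l Z.- r Z.+ 1ℤ) Z.* T
    eq₄ = solve-∀
    nz⁺ : c' Z.+ b⁺ ≢ 0ℤ
    nz⁺ = Off-≢0 (Off-shift (+ Λ Z.+ + Λ Z.- + r Z.+ 1ℤ) (eq₄ (κ a₊) (+ r) (+ Λ) T) o)
    eq₅ : ∀ k r l T → k Z.- l Z.* T Z.+ r Z.* T Z.+ T Z.+ (l Z.* T Z.- k) ≡ (1ℤ Z.+ r) Z.* T
    eq₅ = solve-∀
    nz⁻ : c' Z.+ b⁻ ≢ 0ℤ
    nz⁻ e = T-multiple≢0 r (P.trans (P.cong (Z._* T) (pos-+ 1 r)) (P.trans (P.sym (eq₅ (κ a₊) (+ r) (+ Λ) T)) e))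

  cc₀ : ∀ r → cc 0 r ≡ + r Z.* T
  cc₀ r = ZP.+-identityˡ _

  private
    pos-T : ∀ k → + k Z.* T Z.+ T ≡ + suc k Z.* T
    pos-T k = P.trans (eq (+ k) T) (P.cong (Z._* T) (P.sym (pos-+ 1 k)))
      where
      eq : ∀ k T → k Z.* T Z.+ T ≡ (1ℤ Z.+ k) Z.* T
      eq = solve-∀

    y≢0₀ : ∀ r → + p Z.+ cc 0 r ≢ 0ℤ
    y≢0₀ r e = T-multiple≢0 (r N.+ r) (P.trans (P.cong (Z._* T) (P.trans (pos-+ 1 (r N.+ r)) (P.cong (λ z → 1ℤ Z.+ z) (pos-+ r r))))
      (P.trans (P.sym (eq (+ p) (+ r))) (P.cong (λ z → z Z.+ z) (P.trans (P.cong (λ z → + p Z.+ z) (P.sym (cc₀ r))) e))))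
      where
      eq : ∀ P r → (P Z.+ r Z.* (P Z.+ P)) Z.+ (P Z.+ r Z.* (P Z.+ P)) ≡ (1ℤ Z.+ (r Z.+ r)) Z.* (P Z.+ P)
      eq = solve-∀

    c'≡ : ∀ r → cc 0 r Z.+ T ≡ + suc r Z.* T
    c'≡ r = P.trans (P.cong (Z._+ T) (cc₀ r)) (pos-T r)

    nz₀ : ∀ r → cc 0 r Z.+ T Z.+ M ≢ 0ℤ
    nz₀ r e = T-multiple≢0 (r N.+ Λ) (P.trans (P.trans (P.cong (Z._* T) (pos-+ (suc r) Λ)) (*-distribʳ-+ T (+ suc r) (+ Λ)))
      (P.trans (P.cong (Z._+ M) (P.sym (c'≡ r))) e))

  -- The bound k ≤ j stops the progression before it reaches 0.
  All-negative : ∀ u d k j → k ≤ j → u Z.+ (+ p Z.+ d) ≡ Z.- (+ suc j Z.* T) → All (λ y → u Z.+ y ≢ 0ℤ) (G d k)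
  All-negative u d zero j q e = []
  All-negative u d (suc k) (suc j) (s≤s q) e =
    (λ z → neg≢0 (T-multiple≢0 (suc j)) (P.trans (P.sym e) z)) ∷ All-negative u (d Z.+ T) k j q
      (P.trans (eq₁ u (+ p) d T) (P.trans (P.cong (Z._+ T) e) (P.trans (P.cong (λ z → Z.- (z Z.* T) Z.+ T) (pos-+ 1 (suc j))) (eq₂ (+ suc j) T))))
    where
    eq₁ : ∀ u P d T → u Z.+ (P Z.+ (d Z.+ T)) ≡ u Z.+ (P Z.+ d) Z.+ T
    eq₁ = solve-∀
    eq₂ : ∀ j T → Z.- ((1ℤ Z.+ j) Z.* T) Z.+ T ≡ Z.- (j Z.* T)
    eq₂ = solve-∀

  -- The centre of runner 0 starts at c = 0, where the bracket at -c vanishes and `own-step` does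
  -- not apply. The first flip is therefore computed directly and produces the factor 2; later
  -- centres are nonzero multiples of T.
  own-step₀ : ∀ r → r < ℓ 0 → own (bead 0 (suc r)) ≈ own (bead 0 r) * v 0 r
  own-step₀ zero q = cancel (Invertible-* (Invertible-* (brk-invertible _ (nz₀ 0)) (brk-invertible _ nT)) (_ , 1+ξ-unit c' nc')) (begin
    own (bead 0 1) * (brk (c' Z.+ M) * brk T * (1# + ξ c'))
      ≈⟨ *-congʳ (cong≈ own (bead-suc 0 0)) ⟩
    O' * (brk (c' Z.+ M) * brk T * (1# + ξ c')) ≈⟨ *-congˡ (*-congʳ (*-congʳ (sym (D-up n₁)))) ⟩
    O' * (d₁ * b₁ * brk T * (1# + ξ c')) ≈⟨ solve 5 (λ o d b t x → o :* (d :* b :* t :* x) := o :* x :* (d :* con (+ 1)) :* (b :* t)) refl _ _ _ _ _ ⟩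
    O' * (1# + ξ c') * (d₁ * 1#) * (b₁ * brk T) ≈⟨ *-congʳ (flip (y≢0₀ 0)) ⟩
    - (O * ξ y ^ suc m * (1# + ξ (Z.- c))) * (d₃ * 1#) * (b₁ * brk T)
      ≈⟨ solve 6 (λ o f x d b t → (:- (o :* f :* x)) :* (d :* con (+ 1)) :* (b :* t) := (:- (o :* f :* x)) :* (d :* t) :* b) refl _ _ _ _ _ _ ⟩
    - (O * ξ y ^ suc m * (1# + ξ (Z.- c))) * (d₃ * brk T) * b₁
      ≈⟨ *-cong (*-cong (-‿cong (*-congˡ (+-congˡ ξ-c))) D-down) (trans (brk-double c') (*-congʳ (brk≡ c'T))) ⟩
    - (O * ξ y ^ suc m * (1# + 1#)) * brk (M Z.- c) * (brk T * (1# + ξ c'))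
      ≈⟨ *-congʳ (*-congˡ (sym (trans (*-assoc _ _ _) (trans (*-congˡ (τ-inverse _ (nz₀ 0))) (*-identityʳ _))))) ⟩
    - (O * ξ y ^ suc m * (1# + 1#)) * (brk (M Z.- c) * τ (c' Z.+ M) * brk (c' Z.+ M)) * (brk T * (1# + ξ c'))
      ≈⟨ solve 6 (λ o f e b t x → (:- (o :* f :* (con (+ 1) :+ con (+ 1)))) :* (e :* b) :* (t :* x) := o :* (e :* (:- f) :* (con (+ 1) :+ con (+ 1))) :* (b :* t :* x)) refl _ _ _ _ _ _ ⟩
    O * (brk (M Z.- c) * τ (c' Z.+ M) * - (ξ y ^ suc m) * (1# + 1#)) * (brk (c' Z.+ M) * brk T * (1# + ξ c'))
      ≈⟨ *-congʳ (*-cong (cong≈ own (P.sym (bead-here 0 0 q))) (*-congʳ (trans (*-congˡ (sym (u-cancel 0 0))) (sym (*-assoc _ _ _))))) ⟩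
    own (bead 0 0) * v 0 0 * (brk (c' Z.+ M) * brk T * (1# + ξ c')) ∎)
    where
    c = cc 0 0
    k = ℓ 0 N.∸ 1
    open Core c k 0 (β⁺ 0) (Z.- c) (end⁺' 0 0 q) P.refl
    d₁ = D y (G c' k)
    d₃ = D (Z.- y) (G c' k)
    b₁ = brk (c' Z.+ c')
    c'T : c' ≡ T
    c'T = P.trans (c'≡ 0) (ZP.*-identityˡ T)
    nT : T ≢ 0ℤ
    nT e = T-multiple≢0 0 (P.trans (ZP.*-identityˡ T) e)
    nc' : c' ≢ 0ℤ
    nc' e = nT (P.trans (P.sym c'T) e)
    ξ-c : ξ (Z.- c) ≈ 1#
    ξ-c = trans (ξ≡ (P.cong Z.-_ (P.trans (cc₀ 0) (ZP.*-zeroˡ T)))) ξ-0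
    n₁ = All-positive y c' k 1 (P.trans (E₁ c (+ p) c') (P.trans (P.cong (λ z → z Z.+ z) c'T) (eq T)))
      where
      eq : ∀ T → T Z.+ T ≡ + 2 Z.* T
      eq = solve-∀
  own-step₀ (suc r₀) q = cancel (Invertible-* (Invertible-* (brk-invertible _ (nz₀ r)) (brk-invertible _ nz')) (brk-invertible _ (neg≢0 nc))) (begin
    own (bead 0 (suc r)) * (brk (c' Z.+ M) * brk (c' Z.+ 0ℤ) * brk (Z.- c))
      ≈⟨ *-congʳ (cong≈ own (bead-suc 0 r)) ⟩
    O' * (brk (c' Z.+ M) * brk (c' Z.+ 0ℤ) * brk (Z.- c)) ≈⟨ sym (*-assoc _ _ _) ⟩
    O' * (brk (c' Z.+ M) * brk (c' Z.+ 0ℤ)) * brk (Z.- c) ≈⟨ own-step nc nc' (y≢0₀ r) n₁ n₂ ⟩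
    - (O * ξ y ^ suc m) * (brk (M Z.- c) * brk (0ℤ Z.- c)) * brk c'
      ≈⟨ *-cong (*-congˡ (*-cong (sym (trans (*-assoc _ _ _) (trans (*-congˡ (τ-inverse _ (nz₀ r))) (*-identityʳ _))))
           (brk≡ (ZP.+-identityˡ (Z.- c))))) (brk≡ (P.sym (ZP.+-identityʳ c'))) ⟩
    - (O * ξ y ^ suc m) * (brk (M Z.- c) * τ (c' Z.+ M) * brk (c' Z.+ M) * brk (Z.- c)) * brk (c' Z.+ 0ℤ)
      ≈⟨ solve 6 (λ o f e b n x → (:- (o :* f)) :* (e :* b :* n) :* x := o :* (e :* (:- f) :* con (+ 1)) :* (b :* x :* n)) refl _ _ _ _ _ _ ⟩
    O * (brk (M Z.- c) * τ (c' Z.+ M) * - (ξ y ^ suc m) * 1#) * (brk (c' Z.+ M) * brk (c' Z.+ 0ℤ) * brk (Z.- c))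
      ≈⟨ *-congʳ (*-cong (cong≈ own (P.sym (bead-here 0 r q))) (*-congʳ (trans (*-congˡ (sym (u-cancel 0 r))) (sym (*-assoc _ _ _))))) ⟩
    own (bead 0 r) * v 0 r * (brk (c' Z.+ M) * brk (c' Z.+ 0ℤ) * brk (Z.- c)) ∎)
    where
    r = suc r₀
    c = cc 0 r
    k = ℓ 0 N.∸ suc r
    open Core c k r (β⁺ 0) (β⁻ 0) (end⁺' 0 r q) (end⁻ 0 r)
    nc : c ≢ 0ℤ
    nc e = T-multiple≢0 r₀ (P.trans (P.sym (cc₀ r)) e)
    nc' : c' ≢ 0ℤ
    nc' e = T-multiple≢0 r (P.trans (P.sym (c'≡ r)) e)
    nz' : c' Z.+ 0ℤ ≢ 0ℤ
    nz' e = nc' (P.trans (P.sym (ZP.+-identityʳ c')) e)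
    n₁ = All-positive y c' k (r N.+ suc r) (P.trans (E₁ c (+ p) c') (P.trans (P.cong (λ z → z Z.+ z) (c'≡ r))
      (P.trans (P.sym (*-distribʳ-+ T (+ suc r) (+ suc r))) (P.cong (Z._* T) (P.sym (pos-+ (suc r) (suc r)))))))
    n₂ = All-negative (Z.- y) (Z.- c) r (r₀ N.+ r) (m≤n+m r r₀) (P.trans (E₂ c (+ p) (Z.- c)) (P.trans (P.cong (λ z → Z.- z Z.- z) (cc₀ r))
      (P.trans (eq (+ r) T) (P.cong (λ z → Z.- (z Z.* T)) (P.sym (pos-+ r r))))))
      where
      eq : ∀ r T → Z.- (r Z.* T) Z.- r Z.* T ≡ Z.- ((r Z.+ r) Z.* T)
      eq = solve-∀

  own-formula : ∀ a r → a ≤ n' → r ≤ ℓ a → own (bead a r) * pre (zs a) r ≈ own (bead a 0) * pre (v a) r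
  own-formula a zero qa q = refl
  own-formula a (suc r) qa q = begin
    own (bead a (suc r)) * (pre (zs a) r * zs a r) ≈⟨ x∙yz≈xz∙y _ _ _ ⟩
    own (bead a (suc r)) * zs a r * pre (zs a) r ≈⟨ *-congʳ (step a qa q) ⟩
    own (bead a r) * v a r * pre (zs a) r ≈⟨ xy∙z≈xz∙y _ _ _ ⟩
    own (bead a r) * pre (zs a) r * v a r ≈⟨ *-congʳ (own-formula a r qa (≤-trans (n≤1+n r) q)) ⟩
    own (bead a 0) * pre (v a) r * v a r ≈⟨ *-assoc _ _ _ ⟩
    own (bead a 0) * (pre (v a) r * v a r) ∎
    where
    step : ∀ a → a ≤ n' → r < ℓ a → own (bead a (suc r)) * zs a r ≈ own (bead a r) * v a r
    step zero qa q = trans (*-identityʳ _) (own-step₀ r q)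
    step (suc a) qa q = own-step⁺ a r qa q

-- The sign sum as a determinant

module RunnerDeterminant (L : LaurentRing) (p m n' Λ : ℕ) (2n'<p : n' N.+ n' < p) where
  open RunnerProducts L p m n' Λ 2n'<p public

  Choice : Set
  Choice = ℕ × ℕ

  Bd : Choice → List ℤ
  Bd (a , r) = bead a r

  base : Choice → Choice
  base (a , _) = a , 0

  x : Choice → C
  x (a , r) = χ (cc a r)

  -- The list ends with runner 0, so that every other runner meets it exactly once when the
  -- separated factors are collected.
  data Runs : List Choice → Set where
    last : ∀ {r} → r ≤ ℓ 0 → Runs ((0 , r) ∷ [])
    next : ∀ {a r ss} → suc a ≤ n' → r ≤ ℓ (suc a) → All (λ σ → proj₁ σ < suc a) ss → Runs ss → Runs ((suc a , r) ∷ ss)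

  Valid : Choice → Set
  Valid (a , r) = a ≤ n' × r ≤ ℓ a

  Separate : Choice → Choice → Set
  Separate σ σ' = Valid σ × Valid σ' × proj₁ σ ≢ proj₁ σ'

  valid : ∀ {ss} → Runs ss → All Valid ss
  valid (last q) = (z≤n , q) ∷ []
  valid (next qa q _ R) = (qa , q) ∷ valid R

  separate : ∀ {ss} → Runs ss → AllPairs Separate ss
  separate (last q) = [] ∷ []
  separate (next qa q lt R) = All.zipWith (λ (v , l) → (qa , q) , v , (λ e → <⇒≢ l (P.sym e))) (valid R , lt) ∷ separate R

  ∏₂-cong : ∀ {A : Set} {R : A → A → Set} {f g : A → A → C} {xs} → AllPairs R xs → (∀ x y → R x y → f x y ≈ g x y) → ∏₂ f xs ≈ ∏₂ g xs
  ∏₂-cong [] e = refl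
  ∏₂-cong (r ∷ rs) e = *-cong (∏-cong∈ r (e _)) (∏₂-cong rs e)

  ∏₂-* : ∀ {A : Set} (f g : A → A → C) xs → ∏₂ (λ x y → f x y * g x y) xs ≈ ∏₂ f xs * ∏₂ g xs
  ∏₂-* f g [] = sym (*-identityˡ _)
  ∏₂-* f g (x ∷ xs) = trans (*-cong (∏-* _ _ xs) (∏₂-* f g xs)) (*-interchange _ _ _ _)

  ∏₂-map : ∀ {A B : Set} (f : B → B → C) (g : A → B) xs → ∏₂ f (map g xs) ≈ ∏₂ (λ x y → f (g x) (g y)) xs
  ∏₂-map f g [] = refl
  ∏₂-map f g (x ∷ xs) = *-cong (∏-map _ g xs) (∏₂-map f g xs)

  -- Self-interactions and pair interactions fill a square, so that each runner receives one product
  -- over all runners, of the same form for all of them.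
  ∏₂-square : ∀ {A : Set} (f : A → A → C) xs → ∏ (λ x → f x x) xs * ∏₂ (λ x y → f x y * f y x) xs ≈ ∏ (λ x → ∏ (f x) xs) xs
  ∏₂-square f [] = *-identityˡ _
  ∏₂-square f (x ∷ xs) = begin
    f x x * ∏ (λ x → f x x) xs * (∏ (λ y → f x y * f y x) xs * ∏₂ (λ x y → f x y * f y x) xs)
      ≈⟨ *-congˡ (*-congʳ (∏-* _ _ xs)) ⟩
    _ ≈⟨ solve 5 (λ a b c d e → a :* b :* (c :* d :* e) := a :* c :* (d :* (b :* e))) refl _ _ _ _ _ ⟩
    _ ≈⟨ *-congˡ (trans (*-congˡ (∏₂-square f xs)) (sym (∏-* _ _ xs))) ⟩
    ∏ (λ y → ∏ (f y) (x ∷ xs)) (x ∷ xs) ∎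

  cross-concat : ∀ {A : Set} X (f : A → List ℤ) ss → cross X (concatMap f ss) ≈ ∏ (λ σ → cross X (f σ)) ss
  cross-concat X f ss = trans (∏-cong X (λ x → ∏-concatMap _ f ss)) (∏-swap _ X ss)

  own-concat : ∀ {A : Set} (f : A → List ℤ) ss → own (concatMap f ss) ≈ ∏ (λ σ → own (f σ)) ss * ∏₂ (λ σ σ' → cross (f σ) (f σ')) ss
  own-concat f [] = *-congˡ (*-identityˡ _)
  own-concat f (σ ∷ ss) = begin
    ∏ ρ (f σ ++ Y) * (∏ ψ (f σ ++ Y) * pairs (f σ ++ Y)) ≈⟨ *-cong (∏-++ _ (f σ) Y) (*-cong (∏-++ _ (f σ) Y) (pairs-++ (f σ) Y)) ⟩
    _ ≈⟨ solve 7 (λ a b c d e f g → (a :* b) :* ((c :* d) :* (e :* f :* g)) := (a :* (c :* e)) :* g :* (b :* (d :* f))) refl _ _ _ _ _ _ _ ⟩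
    own (f σ) * cross (f σ) Y * own Y ≈⟨ *-cong (*-congˡ (cross-concat (f σ) f ss)) (own-concat f ss) ⟩
    _ ≈⟨ *-interchange _ _ _ _ ⟩
    _ ∎
    where Y = concatMap f ss

  ζ : ℕ → ℕ → ℕ → C
  ζ a zero r = brk (Z.- cc a r) * τ (cc a r Z.+ T)
  ζ a (suc b) r = 1#

  h-split : ∀ a b r → h a b r ≈ h̄ a b r * ζ a b r
  h-split a zero r = trans (*-congʳ (trans (*-congʳ (*-congˡ (brk≡ (ZP.+-identityˡ _)))) (*-congˡ (*-congˡ (cong≈ τ (ZP.+-identityʳ _))))))
    (solve 5 (λ a b c d x → (a :* b :* (c :* d)) :* x := a :* c :* x :* (b :* d)) refl _ _ _ _ _)
  h-split a (suc b) r = sym (*-identityʳ _)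

  pre-1 : ∀ r → pre (λ _ → 1#) r ≈ 1#
  pre-1 zero = refl
  pre-1 (suc r) = trans (*-identityʳ _) (pre-1 r)

  Ζ : Choice → Choice → C
  Ζ (a , r) (b , _) = pre (ζ a b) r

  Ζ-row : ∀ a r {ss} → Runs ss → ∏ (λ σ → Ζ (suc a , r) σ * Ζ σ (suc a , r)) ss ≈ pre (zs (suc a)) r
  Ζ-row a r (last {r₀} q) = trans (*-identityʳ _) (trans (*-congˡ (pre-1 r₀)) (*-identityʳ _))
  Ζ-row a r (next {r = r'} qa q lt R) = trans (*-cong (trans (*-cong (pre-1 r) (pre-1 r')) (*-identityˡ _)) (Ζ-row a r R)) (*-identityˡ _)

  -- Only pairs with runner 0 contribute, and there the separated factor is exactly the denominator
  -- `zs` of the other runner.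
  Ζ-all : ∀ {ss} → Runs ss → ∏₂ (λ σ σ' → Ζ σ σ' * Ζ σ' σ) ss ≈ ∏ (λ (a , r) → pre (zs a) r) ss
  Ζ-all (last {r₀} q) = *-congʳ (sym (pre-1 r₀))
  Ζ-all (next {a} {r} qa q lt R) = *-cong (Ζ-row a r R) (Ζ-all R)

  H H̄ : Choice → Choice → C
  H (a , r) (b , _) = pre (h a b) r
  H̄ (a , r) (b , _) = pre (h̄ a b) r

  H-split : ∀ σ σ' → H σ σ' ≈ H̄ σ σ' * Ζ σ σ'
  H-split (a , r) (b , r') = trans (pre-cong r r ≤-refl (λ i _ → h-split a b i)) (pre-* (h̄ a b) (ζ a b) r)

  g : List ℕ → ℕ → ℕ → C
  g bs a i = ∏ (λ b → h̄ a b i) bs * (u a i * dbl a i)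

  weight : List ℕ → Choice → C
  weight bs (a , r) = pre (g bs a) r

  -- With the unflipped state as reference, everything separates into one weight per runner, except
  -- for the differences of the χ.
  product-formula : ∀ {ss} → Runs ss →
    own (concatMap Bd ss) * ∏₂ (λ σ σ' → x (base σ) - x (base σ')) ss ≈
    own (concatMap (Bd ∘ base) ss) * (∏ (weight (map proj₁ ss)) ss * ∏₂ (λ σ σ' → x σ - x σ') ss)
  product-formula {ss} R = begin
    own (concatMap Bd ss) * ∏₂ X⁰ ss ≈⟨ *-congʳ (own-concat Bd ss) ⟩
    ∏ (own ∘ Bd) ss * ∏₂ (λ σ σ' → cross (Bd σ) (Bd σ')) ss * ∏₂ X⁰ ss ≈⟨ *-assoc _ _ _ ⟩
    ∏ (own ∘ Bd) ss * (∏₂ (λ σ σ' → cross (Bd σ) (Bd σ')) ss * ∏₂ X⁰ ss)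
      ≈⟨ *-congˡ (trans (sym (∏₂-* _ _ ss)) (∏₂-cong (separate R) pair)) ⟩
    ∏ (own ∘ Bd) ss * ∏₂ (λ σ σ' → cross⁰ σ σ' * (H̄² σ σ' * Ζ² σ σ' * (x σ - x σ'))) ss
      ≈⟨ *-congˡ (trans (∏₂-* _ _ ss) (*-congˡ (trans (∏₂-* _ _ ss) (*-congʳ (trans (∏₂-* _ _ ss) (*-congˡ (Ζ-all R))))))) ⟩
    ∏ (own ∘ Bd) ss * (∏₂ cross⁰ ss * (∏₂ H̄² ss * ∏ (λ (a , r) → pre (zs a) r) ss * ∏₂ (λ σ σ' → x σ - x σ') ss))
      ≈⟨ solve 5 (λ o c h z v → o :* (c :* (h :* z :* v)) := (o :* z) :* (c :* h :* v)) refl _ _ _ _ _ ⟩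
    ∏ (own ∘ Bd) ss * ∏ (λ (a , r) → pre (zs a) r) ss * (∏₂ cross⁰ ss * ∏₂ H̄² ss * ∏₂ (λ σ σ' → x σ - x σ') ss)
      ≈⟨ *-congʳ (trans (sym (∏-* _ _ ss)) (trans (∏-cong∈ (valid R) (λ (a , r) (qa , q) → own-formula a r qa q)) (∏-* _ _ ss))) ⟩
    ∏ (own ∘ Bd ∘ base) ss * ∏ (λ (a , r) → pre (v a) r) ss * (∏₂ cross⁰ ss * ∏₂ H̄² ss * ∏₂ (λ σ σ' → x σ - x σ') ss)
      ≈⟨ solve 5 (λ o w c h v → o :* w :* (c :* h :* v) := (o :* c) :* ((w :* h) :* v)) refl _ _ _ _ _ ⟩
    (∏ (own ∘ Bd ∘ base) ss * ∏₂ cross⁰ ss) * (∏ (λ (a , r) → pre (v a) r) ss * ∏₂ H̄² ss * ∏₂ (λ σ σ' → x σ - x σ') ss)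
      ≈⟨ *-cong (sym (own-concat (Bd ∘ base) ss)) (*-congʳ weights) ⟩
    own (concatMap (Bd ∘ base) ss) * (∏ (weight (map proj₁ ss)) ss * ∏₂ (λ σ σ' → x σ - x σ') ss) ∎
    where
    X⁰ cross⁰ H̄² Ζ² : Choice → Choice → C
    X⁰ σ σ' = x (base σ) - x (base σ')
    cross⁰ σ σ' = cross (Bd (base σ)) (Bd (base σ'))
    H̄² σ σ' = H̄ σ σ' * H̄ σ' σ
    Ζ² σ σ' = Ζ σ σ' * Ζ σ' σ
    pair : ∀ σ σ' → Separate σ σ' → cross (Bd σ) (Bd σ') * X⁰ σ σ' ≈ cross⁰ σ σ' * (H̄² σ σ' * Ζ² σ σ' * (x σ - x σ'))
    pair σ@(a , r) σ'@(b , r') ((qa , q) , (qb , q') , n) = trans (cross-formula a b qa qb n r r' q q') (trans (*-congʳ (*-congˡ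
      (trans (*-cong (H-split σ σ') (H-split σ' σ)) (*-interchange _ _ _ _)))) (*-assoc _ _ _))
    weights : ∏ (λ (a , r) → pre (v a) r) ss * ∏₂ H̄² ss ≈ ∏ (weight (map proj₁ ss)) ss
    weights = begin
      ∏ (λ (a , r) → pre (v a) r) ss * ∏₂ H̄² ss
        ≈⟨ *-congʳ (trans (∏-cong ss (λ (a , r) → trans (pre-cong r r ≤-refl (λ i _ → *-assoc _ _ _)) (pre-* _ _ r))) (∏-* _ _ ss)) ⟩
      ∏ (λ σ → H̄ σ σ) ss * ∏ (λ (a , r) → pre (λ i → u a i * dbl a i) r) ss * ∏₂ H̄² ss
        ≈⟨ xy∙z≈xz∙y _ _ _ ⟩
      ∏ (λ σ → H̄ σ σ) ss * ∏₂ H̄² ss * ∏ (λ (a , r) → pre (λ i → u a i * dbl a i) r) ss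
        ≈⟨ *-congʳ (∏₂-square H̄ ss) ⟩
      ∏ (λ σ → ∏ (H̄ σ) ss) ss * ∏ (λ (a , r) → pre (λ i → u a i * dbl a i) r) ss ≈⟨ sym (∏-* _ _ ss) ⟩
      ∏ (λ σ → ∏ (H̄ σ) ss * pre (λ i → u (proj₁ σ) i * dbl (proj₁ σ) i) (proj₂ σ)) ss
        ≈⟨ ∏-cong ss (λ (a , r) → trans (*-congʳ (trans (pre-∏ (λ σ → h̄ a (proj₁ σ)) ss r)
             (pre-cong r r ≤-refl (λ i _ → sym (∏-map (λ b → h̄ a b i) proj₁ ss))))) (sym (pre-* _ _ r))) ⟩
      ∏ (weight (map proj₁ ss)) ss ∎

  from : ℕ → ℕ → List ℕ
  from r zero = r ∷ []
  from r (suc k) = r ∷ from (suc r) k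

  from-≤ : ∀ r k n → r N.+ k ≡ n → All (_≤ n) (from r k)
  from-≤ r zero n e = ≤-reflexive (P.trans (P.sym (NP.+-identityʳ r)) e) ∷ []
  from-≤ r (suc k) n e = ≤-trans (m≤m+n r (suc k)) (≤-reflexive e) ∷ from-≤ (suc r) k n (P.trans (P.sym (+-suc r k)) e)

  -- `vanish` abstracts the zero φ(-T) = 0. It applies when an entry of a progression is kept while
  -- the next higher one is negated.
  record Symmetric (f : List ℤ → C) : Set where
    field
      permute : ∀ {Y Y'} → Y ↭ Y' → f Y ≈ f Y'
      vanish : ∀ x y Y → x Z.+ y ≡ Z.- T → f (x ∷ y ∷ Y) ≈ 0#
  open Symmetric

  private
    prefix : ∀ X {f} → Symmetric f → Symmetric (λ Y → f (X ++ Y))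
    prefix X S .permute p = permute S (++⁺ˡ X p)
    prefix X S .vanish x y Y e = trans (permute S (++-comm X (x ∷ y ∷ Y))) (vanish S x y (Y ++ X) e)

    suffix : ∀ Z {f} → Symmetric f → Symmetric (λ Y → f (Y ++ Z))
    suffix Z S .permute p = permute S (++⁺ʳ Z p)
    suffix Z S .vanish x y Y e = vanish S x y (Y ++ Z) e

    inner : ∀ S {f} → Symmetric f → Symmetric (λ A → ∑± (λ B → f (A ++ B)) S)
    inner S F .permute p = ∑±-cong S (λ B _ → permute F (++⁺ʳ B p))
    inner S F .vanish x y A e = trans (∑±-cong S (λ B _ → vanish F x y (A ++ B) e)) (∑±-0 S)

  -- If an entry is kept, negating its successor gives 0; so all later entries are kept as well.
  all-plus : ∀ f y c k → Symmetric f → y ≡ + p Z.+ c → ∑± (λ Y → f (y ∷ Y)) (G (c Z.+ T) k) ≈ f (y ∷ G (c Z.+ T) k)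
  all-plus f y c zero S e = refl
  all-plus f y c (suc k) S e = trans (+-cong
      (all-plus (λ Z → f (y ∷ Z)) _ (c Z.+ T) k (prefix (y ∷ []) S) P.refl)
      (trans (∑±-cong (G (c Z.+ T Z.+ T) k) (λ Y _ → vanish S y _ Y (P.trans (P.cong (λ z → z Z.- (+ p Z.+ (c Z.+ T))) e) (eq (+ p) c T)))) (∑±-0 (G (c Z.+ T Z.+ T) k))))
    (+-identityʳ _)
    where
    eq : ∀ P c T → P Z.+ c Z.- (P Z.+ (c Z.+ T)) ≡ Z.- T
    eq = solve-∀

  -- A sign choice on a runner that is not of the form (-,…,-,+,…,+) has two neighbouring values with sum -2P.
  thresholds : ∀ f a r k → Symmetric f → r N.+ k ≡ ℓ a →
    ∑± (λ Y → f (Y ++ G (Z.- cc a r) r)) (G (cc a r) k) ≈ ∑ (λ r → f (bead a r)) (from r k)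
  thresholds f a r zero S e = trans (cong≈ (λ k → f (conf (cc a r) k r))
      (P.sym (m≤n⇒m∸n≡0 (≤-reflexive (P.trans (P.sym e) (NP.+-identityʳ r)))))) (sym (+-identityʳ _))
  thresholds f a r (suc k) S e = +-cong
    (trans (all-plus (λ Y → f (Y ++ Acc)) y c k (suffix Acc S) P.refl) (cong≈ (λ k → f (conf c k r)) (P.sym rest)))
    (begin
      ∑± (λ Y → f ((Z.- y) ∷ Y ++ Acc)) (G (c Z.+ T) k)
        ≈⟨ ∑±-cong (G (c Z.+ T) k) (λ Y _ → trans (permute S (↭-sym (shift (Z.- y) Y Acc))) (cong≈ (λ Z → f (Y ++ Z)) acc)) ⟩
      ∑± (λ Y → f (Y ++ G (Z.- cc a (suc r)) (suc r))) (G (c Z.+ T) k)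
        ≡⟨ P.cong (λ z → ∑± (λ Y → f (Y ++ G (Z.- cc a (suc r)) (suc r))) (G z k)) (P.sym (cc-suc a r)) ⟩
      ∑± (λ Y → f (Y ++ G (Z.- cc a (suc r)) (suc r))) (G (cc a (suc r)) k)
        ≈⟨ thresholds f a (suc r) k S (P.trans (P.sym (+-suc r k)) e) ⟩
      ∑ (λ r → f (bead a r)) (from (suc r) k) ∎)
    where
    c = cc a r
    y = + p Z.+ c
    Acc = G (Z.- c) r
    rest : ℓ a N.∸ r ≡ suc k
    rest = P.trans (P.cong (N._∸ r) (P.sym e)) (m+n∸m≡n r (suc k))
    eq₁ : ∀ P c → Z.- (P Z.+ c) ≡ P Z.+ (Z.- (c Z.+ (P Z.+ P)))
    eq₁ = solve-∀
    eq₂ : ∀ c T → Z.- c ≡ Z.- (c Z.+ T) Z.+ T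
    eq₂ = solve-∀
    acc : (Z.- y) ∷ Acc ≡ G (Z.- cc a (suc r)) (suc r)
    acc = P.trans (P.cong₂ (λ z w → z ∷ G w r) (eq₁ (+ p) c) (eq₂ c T)) (P.cong (λ z → G (Z.- z) (suc r)) (P.sym (cc-suc a r)))

  ∑choice : (List Choice → C) → List ℕ → C
  ∑choice f [] = f []
  ∑choice f (a ∷ as) = ∑ (λ r → ∑choice (λ ss → f ((a , r) ∷ ss)) as) (from 0 (ℓ a))

  runnerList : List ℕ → List ℤ
  runnerList = concatMap (λ a → G (c⁰ a) (ℓ a))

  ∑±-++ : ∀ f X Y → ∑± f (X ++ Y) ≈ ∑± (λ A → ∑± (λ B → f (A ++ B)) Y) X
  ∑±-++ f [] Y = refl
  ∑±-++ f (x ∷ X) Y = +-cong (∑±-++ _ X Y) (∑±-++ _ X Y)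

  ∑±-choice : ∀ f as → Symmetric f → ∑± f (runnerList as) ≈ ∑choice (λ ss → f (concatMap Bd ss)) as
  ∑±-choice f [] S = refl
  ∑±-choice f (a ∷ as) S = begin
    ∑± f (G (c⁰ a) (ℓ a) ++ runnerList as) ≈⟨ ∑±-++ f (G (c⁰ a) (ℓ a)) (runnerList as) ⟩
    ∑± k (G (c⁰ a) (ℓ a)) ≡⟨ P.cong (λ z → ∑± k (G z (ℓ a))) (P.sym (P.trans (P.cong (λ z → c⁰ a Z.+ z) (ZP.*-zeroˡ T)) (ZP.+-identityʳ _))) ⟩
    ∑± k (G (cc a 0) (ℓ a)) ≈⟨ ∑±-cong (G (cc a 0) (ℓ a)) (λ Y _ → cong≈ k (P.sym (Lₚ.++-identityʳ Y))) ⟩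
    ∑± (λ Y → k (Y ++ [])) (G (cc a 0) (ℓ a)) ≈⟨ thresholds k a 0 (ℓ a) (inner (runnerList as) S) P.refl ⟩
    ∑ (λ r → k (bead a r)) (from 0 (ℓ a)) ≈⟨ ∑-cong (from 0 (ℓ a)) (λ r → ∑±-choice (λ B → f (bead a r ++ B)) as (prefix (bead a r) S)) ⟩
    ∑choice (λ ss → f (concatMap Bd ss)) (a ∷ as) ∎
    where
    k = λ A → ∑± (λ B → f (A ++ B)) (runnerList as)

  own-symmetric : Symmetric own
  own-symmetric .permute = own-↭
  own-symmetric .vanish x y Y e = trans (*-congˡ (trans (*-congˡ (trans (*-congʳ (trans (*-congʳ φ-vanishes) (zeroˡ _))) (zeroˡ _))) (zeroʳ _))) (zeroʳ _)
    where
    nT : T ≢ 0ℤ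
    nT q = T-multiple≢0 0 (P.trans (ZP.*-identityˡ T) q)
    φ-vanishes : φ (x Z.+ y) ≈ 0#
    φ-vanishes = cancel (brk-invertible (Z.- T) (neg≢0 nT)) (begin
      φ (x Z.+ y) * brk (Z.- T) ≡⟨ P.cong (λ z → φ z * brk (Z.- T)) e ⟩
      φ (Z.- T) * brk (Z.- T) ≈⟨ φ-brk (Z.- T) (neg≢0 nT) ⟩
      1# - ξ (Z.- T Z.+ T) ≈⟨ +-congˡ (-‿cong (trans (ξ≡ (+-inverseˡ T)) ξ-0)) ⟩
      1# - 1# ≈⟨ trans (-‿inverseʳ _) (sym (zeroˡ _)) ⟩
      0# * brk (Z.- T) ∎)

  ∑choice-cong : ∀ {f f' : List Choice → C} as →
    (∀ ss → map proj₁ ss ≡ as → All (λ σ → proj₂ σ ≤ ℓ (proj₁ σ)) ss → f ss ≈ f' ss) → ∑choice f as ≈ ∑choice f' as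
  ∑choice-cong [] e = e [] P.refl []
  ∑choice-cong (a ∷ as) e = ∑-cong∈ (from-≤ 0 (ℓ a) (ℓ a) P.refl)
    (λ r q → ∑choice-cong as (λ ss p v → e ((a , r) ∷ ss) (P.cong (a ∷_) p) (q ∷ v)))

  ∑choice-+ : ∀ f f' as → ∑choice (λ ss → f ss + f' ss) as ≈ ∑choice f as + ∑choice f' as
  ∑choice-+ f f' [] = refl
  ∑choice-+ f f' (a ∷ as) = trans (∑-cong (from 0 (ℓ a)) (λ r → ∑choice-+ _ _ as)) (∑-+ _ _ (from 0 (ℓ a)))

  ∑choice-*ˡ : ∀ c f as → ∑choice (λ ss → c * f ss) as ≈ c * ∑choice f as
  ∑choice-*ˡ c f [] = refl
  ∑choice-*ˡ c f (a ∷ as) = trans (∑-cong (from 0 (ℓ a)) (λ r → ∑choice-*ˡ c _ as)) (∑-*ˡ c _ (from 0 (ℓ a)))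

  ∑choice-∑alt : ∀ {A : Set} (f : List Choice → A → List A → C) as js →
    ∑choice (λ ss → ∑alt (f ss) js) as ≈ ∑alt (λ j js' → ∑choice (λ ss → f ss j js') as) js
  ∑choice-∑alt f as [] = zeros as
    where
    zeros : ∀ as → ∑choice (λ _ → 0#) as ≈ 0#
    zeros [] = refl
    zeros (a ∷ as) = trans (∑-cong (from 0 (ℓ a)) (λ _ → zeros as)) (∑-0 (from 0 (ℓ a)))
  ∑choice-∑alt f as (j ∷ js) = begin
    ∑choice (λ ss → f ss j js - ∑alt (λ y ys → f ss y (j ∷ ys)) js) as
      ≈⟨ ∑choice-cong as (λ ss _ _ → solve 2 (λ a b → a :- b := a :+ con -[1+ 0 ] :* b) refl _ _) ⟩
    _ ≈⟨ trans (∑choice-+ _ _ as) (+-congˡ (trans (∑choice-*ˡ _ _ as) (*-congˡ (∑choice-∑alt _ as js)))) ⟩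
    _ ≈⟨ solve 2 (λ a b → a :+ con -[1+ 0 ] :* b := a :- b) refl _ _ ⟩
    _ ∎

  -- Each row depends on the choice for its own runner only, so the determinant can be summed row by
  -- row.
  ∑choice-det : ∀ (w : Choice → C) (N : Choice → ℕ → C) as js →
    ∑choice (λ ss → ∏ w ss * det N ss js) as ≈ det (λ a j → ∑ (λ r → w (a , r) * N (a , r) j) (from 0 (ℓ a))) as js
  ∑choice-det w N [] [] = *-identityˡ _
  ∑choice-det w N [] (j ∷ js) = zeroʳ _
  ∑choice-det w N (a ∷ as) js = begin
    ∑ (λ r → ∑choice (λ ss → w (a , r) * ∏ w ss * ∑alt (λ j js' → N (a , r) j * det N ss js') js) as) (from 0 (ℓ a))
      ≈⟨ ∑-cong (from 0 (ℓ a)) (λ r → trans (∑choice-cong as (λ ss _ _ → trans (sym (∑alt-*ˡ _ _ js))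
           (∑alt-cong js (λ j js' → solve 4 (λ a b c d → a :* b :* (c :* d) := (a :* c) :* (b :* d)) refl _ _ _ _))))
           (∑choice-∑alt _ as js)) ⟩
    ∑ (λ r → ∑alt (λ j js' → ∑choice (λ ss → w (a , r) * N (a , r) j * (∏ w ss * det N ss js')) as) js) (from 0 (ℓ a))
      ≈⟨ ∑-∑alt _ (from 0 (ℓ a)) js ⟩
    ∑alt (λ j js' → ∑ (λ r → ∑choice (λ ss → w (a , r) * N (a , r) j * (∏ w ss * det N ss js')) as) (from 0 (ℓ a))) js
      ≈⟨ ∑alt-cong js (λ j js' → trans (∑-cong (from 0 (ℓ a)) (λ r → trans (∑choice-*ˡ _ _ as) (*-congˡ (∑choice-det w N as js')))) (∑-*ʳ _ _ (from 0 (ℓ a)))) ⟩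
    _ ∎

  runs : ∀ k → k ≤ n' → ∀ ss → map proj₁ ss ≡ downFrom (suc k) → All (λ σ → proj₂ σ ≤ ℓ (proj₁ σ)) ss → Runs ss
  runs zero q ((_ , r) ∷ []) P.refl (v ∷ []) = last v
  runs (suc k) q ((_ , r) ∷ ss) e (v ∷ vs) with Lₚ.∷-injective e
  ... | P.refl , e' = next q v (Allₚ.map⁻ (P.subst (All (_< suc k)) (P.sym e') (downFrom-< (suc k)))) (runs k (≤-trans (n≤1+n k) q) ss e' vs)

  runners : List ℕ
  runners = downFrom (suc n')

  entry : ℕ → ℕ → C
  entry a j = ∑ (λ r → weight runners (a , r) * monicChebyshev j (χ (cc a r))) (from 0 (ℓ a))

  -- After `product-formula` the runners are coupled only by a Vandermonde product, which is a
  -- determinant whose rows belong to the single runners.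
  sign-sum : ∑± own (runnerList runners) * ∏₂ (λ a b → χ (cc a 0) - χ (cc b 0)) runners ≈
    own (concatMap (λ a → bead a 0) runners) * det entry runners (downFrom (suc n'))
  sign-sum = begin
    ∑± own (runnerList runners) * V ≈⟨ trans (*-congʳ (∑±-choice own runners own-symmetric)) (*-comm _ _) ⟩
    V * ∑choice (λ ss → own (concatMap Bd ss)) runners ≈⟨ sym (∑choice-*ˡ V (λ ss → own (concatMap Bd ss)) runners) ⟩
    ∑choice (λ ss → V * own (concatMap Bd ss)) runners ≈⟨ ∑choice-cong runners each ⟩
    ∑choice (λ ss → Z * (∏ (weight runners) ss * det N ss (downFrom (suc n')))) runners ≈⟨ ∑choice-*ˡ Z (λ ss → ∏ (weight runners) ss * det N ss (downFrom (suc n'))) runners ⟩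
    Z * ∑choice (λ ss → ∏ (weight runners) ss * det N ss (downFrom (suc n'))) runners ≈⟨ *-congˡ (∑choice-det (weight runners) N runners (downFrom (suc n'))) ⟩
    Z * det entry runners (downFrom (suc n')) ∎
    where
    V = ∏₂ (λ a b → χ (cc a 0) - χ (cc b 0)) runners
    Z = own (concatMap (λ a → bead a 0) runners)
    N : Choice → ℕ → C
    N σ j = monicChebyshev j (x σ)
    each : ∀ ss → map proj₁ ss ≡ runners → All (λ σ → proj₂ σ ≤ ℓ (proj₁ σ)) ss →
      V * own (concatMap Bd ss) ≈ Z * (∏ (weight runners) ss * det N ss (downFrom (suc n')))
    each ss e vs = begin
      V * own (concatMap Bd ss) ≈⟨ *-comm _ _ ⟩
      own (concatMap Bd ss) * V ≈⟨ *-congˡ (trans (cong≈ (∏₂ (λ a b → χ (cc a 0) - χ (cc b 0))) (P.sym e)) (∏₂-map _ proj₁ ss)) ⟩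
      own (concatMap Bd ss) * ∏₂ (λ σ σ' → x (base σ) - x (base σ')) ss ≈⟨ product-formula R ⟩
      own (concatMap (Bd ∘ base) ss) * (∏ (weight (map proj₁ ss)) ss * ∏₂ (λ σ σ' → x σ - x σ') ss)
        ≈⟨ *-cong (cong≈ own (P.trans (P.sym (Lₚ.concatMap-map (λ a → bead a 0) proj₁ ss)) (P.cong (concatMap (λ a → bead a 0)) e)))
             (*-cong (cong≈ (λ as → ∏ (weight as) ss) e) vdm) ⟩
      Z * (∏ (weight runners) ss * det N ss (downFrom (suc n'))) ∎
      where
      R = runs n' ≤-refl ss e vs
      regular : ∀ {ss} → AllPairs Separate ss → AllPairs (λ x y → Regular (y - x)) (map x ss)
      regular [] = []
      regular {(a , r) ∷ _} (s ∷ ss) = Allₚ.map⁺ (All.map (λ { {b , r'} ((qa , _) , (qb , _) , n) z e →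
        cancel (χ-invertible (cc b r') (cc a r) (proj₁ (Off-cc b a r' r qb qa (λ q → n (P.sym q)))) (proj₂ (Off-cc b a r' r qb qa (λ q → n (P.sym q)))))
          (trans (*-comm _ _) (trans e (sym (zeroˡ _)))) }) s) ∷ regular ss
      len : length (map x ss) ≡ suc n'
      len = P.trans (Lₚ.length-map x ss) (P.trans (P.sym (Lₚ.length-map proj₁ ss)) (P.trans (P.cong length e) (Lₚ.length-downFrom (suc n'))))
      vdm : ∏₂ (λ σ σ' → x σ - x σ') ss ≈ det N ss (downFrom (suc n'))
      vdm = trans (sym (∏₂-map _ x ss)) (trans (sym (vandermonde (map x ss) (regular (separate R))))
        (trans (det-map-rows _ x ss _) (cong≈ (λ k → det N ss (downFrom k)) len)))

-- Normalisation at the all-positive state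

module NormalisedSignSum (L : LaurentRing) (p m n' Λ : ℕ) (2n'<p : n' N.+ n' < p) where
  open RunnerDeterminant L p m n' Λ 2n'<p public

  -- A flip at y contributes (m + 1)y from ρ and ψ and 2y from each of the n' other runners; the
  -- diagonal power in h̄ a a is cancelled by `u`.
  Q : ℕ
  Q = suc m N.+ (n' N.+ n')

  step : ℤ → C
  step c = - (ξ (+ p Z.+ c) ^ Q) * ∏ (Ē c) runners

  -- Outward from the all-positive configuration, the k-th flip on the runner centred at c has weight step (c + kT).
  up : ℤ → ℕ → C
  up c k = pre (λ i → step (c Z.+ + i Z.* T)) k

  private
    g≈ : ∀ a i → g runners a i ≈ step (cc a i) * dbl a i
    g≈ a i = trans (sym (*-assoc _ _ _)) (*-congʳ (begin
      ∏ (λ b → Ē c b * ξ 2y) runners * - (ξ y ^ suc m * ξ (Z.- 2y))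
        ≈⟨ *-congʳ (trans (∏-* _ _ runners) (*-congˡ (trans (∏-const _ runners) (cong≈ (ξ 2y ^_) (Lₚ.length-downFrom (suc n')))))) ⟩
      ∏ (Ē c) runners * (ξ 2y * ξ 2y ^ n') * - (ξ y ^ suc m * ξ (Z.- 2y))
        ≈⟨ solve 5 (λ e a b f g → e :* (a :* b) :* :- (f :* g) := (:- (f :* (b :* (a :* g)))) :* e) refl _ _ _ _ _ ⟩
      - (ξ y ^ suc m * (ξ 2y ^ n' * (ξ 2y * ξ (Z.- 2y)))) * ∏ (Ē c) runners
        ≈⟨ *-congʳ (-‿cong (trans (*-congˡ (trans (*-congˡ (ξ-inv 2y)) (trans (*-identityʳ _) (trans (^-cong n' ξ2y) (trans (*-^ _ _ n') (sym (^-+ (ξ y) n' n'))))))) (sym (^-+ (ξ y) (suc m) (n' N.+ n'))))) ⟩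
      step c ∎))
      where
      c = cc a i
      y = + p Z.+ c
      2y = c Z.+ (c Z.+ T)
      eq : ∀ c P → c Z.+ (c Z.+ (P Z.+ P)) ≡ (P Z.+ c) Z.+ (P Z.+ c)
      eq = solve-∀
      ξ2y : ξ 2y ≈ ξ y * ξ y
      ξ2y = trans (ξ≡ (eq c (+ p))) (ξ-+ y y)

    far : ∀ x j → ∣ x ∣ < p → x Z.+ x Z.+ + suc j Z.* T ≢ 0ℤ
    far x j q e = <⇒≱ q (≤-trans (m≤m+n p (j N.* p)) (≤-reflexive (P.sym (P.trans (P.cong ∣_∣ x≡) (P.trans (∣-i∣≡∣i∣ (+ suc j Z.* + p)) (abs-* (+ suc j) (+ p)))))))
      where
      eq : ∀ x k p → x Z.+ x Z.+ k Z.* (p Z.+ p) ≡ + 2 Z.* (x Z.+ k Z.* p)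
      eq = solve-∀
      eq₂ : ∀ x z → x ≡ (x Z.+ z) Z.- z
      eq₂ = solve-∀
      x≡ : x ≡ Z.- (+ suc j Z.* + p)
      x≡ = P.trans (eq₂ x (+ suc j Z.* + p)) (P.trans (P.cong (Z._- (+ suc j Z.* + p)) (*-cancelˡ-≡ (+ 2) _ 0ℤ (P.trans (P.sym (eq x (+ suc j) (+ p))) e))) (ZP.+-identityˡ _))

    bound : ∀ a b → a ≤ n' → b ≤ n' → ∀ x y → ∣ x ∣ ≡ a → ∣ y ∣ ≡ b → ∣ x Z.+ y ∣ < p
    bound a b qa qb x y P.refl P.refl = ≤-<-trans (∣i+j∣≤∣i∣+∣j∣ x y) (<p qa qb)

    abs-neg : ∀ a → ∣ Z.- + a ∣ ≡ a
    abs-neg a = ∣-i∣≡∣i∣ (+ a)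

    -- Flipping back: the steps at c and -c - 2P are mutually inverse.
    step-reflect : ∀ a k → a ≤ n' → k < Λ → let c = κ a Z.+ -[1+ k ] Z.* T in step (Z.- (c Z.+ T)) * step c ≈ 1#
    step-reflect a k qa q = begin
      - (ξ (+ p Z.+ c̃) ^ Q) * ∏ (Ē c̃) runners * (- (ξ (+ p Z.+ c) ^ Q) * ∏ (Ē c) runners)
        ≈⟨ solve 4 (λ x e y f → (:- x) :* e :* ((:- y) :* f) := (y :* x) :* (e :* f)) refl _ _ _ _ ⟩
      ξ (+ p Z.+ c) ^ Q * ξ (+ p Z.+ c̃) ^ Q * (∏ (Ē c̃) runners * ∏ (Ē c) runners)
        ≈⟨ *-cong (trans (sym (*-^ _ _ Q)) (trans (^-cong Q (trans (*-congˡ (ξ≡ (eq c (+ p)))) (ξ-inv (+ p Z.+ c)))) (1^ Q)))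
             (trans (sym (∏-* _ _ runners)) (trans (∏-cong∈ (downFrom-< (suc n')) (λ b q → inverse b (≤-pred q))) (∏-1 runners))) ⟩
      1# * 1# ≈⟨ *-identityˡ 1# ⟩
      1# ∎
      where
      c = κ a Z.+ -[1+ k ] Z.* T
      c̃ = Z.- (c Z.+ T)
      eq : ∀ c P → P Z.+ (Z.- (c Z.+ (P Z.+ P))) ≡ Z.- (P Z.+ c)
      eq = solve-∀
      e₁ : ∀ c T β → β Z.- (Z.- (c Z.+ T)) ≡ c Z.+ T Z.+ β
      e₁ = solve-∀
      e₂ : ∀ c T β → Z.- (c Z.+ T) Z.+ T Z.+ β ≡ β Z.- c
      e₂ = solve-∀
      one : ∀ β → β Z.- c ≢ 0ℤ → c Z.+ T Z.+ β ≢ 0ℤ → (brk (β Z.- c̃) * τ (c Z.+ T Z.+ β)) * (τ (c̃ Z.+ T Z.+ β) * brk (β Z.- c)) ≈ 1#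
      one β n₁ n₂ = trans (*-cong (trans (*-comm _ _) (trans (*-congˡ (brk≡ (e₁ c T β))) (τ-inverse _ n₂)))
        (trans (*-congʳ (cong≈ τ (e₂ c T β))) (τ-inverse _ n₁))) (*-identityˡ _)
      e₃ : ∀ a x k l T → (x Z.+ x) Z.+ l Z.* T Z.- ((a Z.+ a) Z.+ (Z.- k) Z.* T) ≡ (x Z.- a) Z.+ (x Z.- a) Z.+ (k Z.+ l) Z.* T
      e₃ = solve-∀
      e₄ : ∀ a x k l T → ((a Z.+ a) Z.+ (Z.- (1ℤ Z.+ k)) Z.* T) Z.+ T Z.+ ((x Z.+ x) Z.+ l Z.* T) ≡ (a Z.+ x) Z.+ (a Z.+ x) Z.+ (l Z.- k) Z.* T
      e₄ = solve-∀
      below : + Λ Z.- + k ≡ + suc (Λ N.∸ suc k)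
      below = P.trans (m-n≡m⊖n Λ k) (P.trans (⊖-≥ (≤-trans (n≤1+n k) q)) (P.cong +_ (+-∸-assoc 1 q)))
      low : ∀ b x → b ≤ n' → ∣ x ∣ ≡ b → (x Z.+ x) Z.+ M Z.- c ≢ 0ℤ
      low b x qb e z = far (x Z.- + a) (k N.+ Λ) (bound b a qb qa x (Z.- + a) e (abs-neg a))
        (P.trans (P.cong (λ w → x Z.- + a Z.+ (x Z.- + a) Z.+ w Z.* T) (pos-+ (suc k) Λ)) (P.trans (P.sym (e₃ (+ a) x (+ suc k) (+ Λ) T)) z))
      high : ∀ b x → b ≤ n' → ∣ x ∣ ≡ b → c Z.+ T Z.+ ((x Z.+ x) Z.+ M) ≢ 0ℤ
      high b x qb e z = far (+ a Z.+ x) (Λ N.∸ suc k) (bound a b qa qb (+ a) x P.refl e)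
        (P.trans (P.cong (λ w → + a Z.+ x Z.+ (+ a Z.+ x) Z.+ w Z.* T) (P.sym below)) (P.trans (P.sym (P.trans (P.cong (λ w → (κ a Z.+ (Z.- w) Z.* T) Z.+ T Z.+ ((x Z.+ x) Z.+ M)) (pos-+ 1 k)) (e₄ (+ a) x (+ k) (+ Λ) T))) z))
      e₅ : ∀ b M → M Z.- (b Z.+ b) ≡ (Z.- b Z.+ (Z.- b)) Z.+ M
      e₅ = solve-∀
      e₆ : ∀ M → M ≡ (0ℤ Z.+ 0ℤ) Z.+ M
      e₆ = solve-∀
      inverse : ∀ b → b ≤ n' → Ē c̃ b * Ē c b ≈ 1#
      inverse zero qb = trans (solve 4 (λ a b c d → (a :* b) :* (c :* d) := (a :* d) :* (b :* c)) refl _ _ _ _)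
        (one M (λ z → low 0 0ℤ qb P.refl (P.trans (P.cong (Z._- c) (P.sym (e₆ M))) z)) (λ z → high 0 0ℤ qb P.refl (P.trans (P.cong (λ w → c Z.+ T Z.+ w) (P.sym (e₆ M))) z)))
      inverse b@(suc _) qb = trans (solve 8 (λ a b c d e f g h → (a :* b :* (c :* d)) :* (e :* f :* (g :* h)) := ((a :* g) :* (c :* e)) :* ((b :* h) :* (d :* f))) refl _ _ _ _ _ _ _ _)
        (trans (*-cong (one (β⁺ b) (low b (+ b) qb P.refl) (high b (+ b) qb P.refl))
          (one (β⁻ b) (λ z → low b (Z.- + b) qb (abs-neg b) (P.trans (P.cong (Z._- c) (P.sym (e₅ (+ b) M))) z))
                      (λ z → high b (Z.- + b) qb (abs-neg b) (P.trans (P.cong (λ w → c Z.+ T Z.+ w) (P.sym (e₅ (+ b) M))) z)))) (*-identityˡ _))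

  -- The weight at signed distance i from the centre κ a. Undoing k flips is the same as doing k
  -- flips from the mirror image -κ a, because by `step-reflect` reflected steps are reciprocal.
  signed : ℕ → ℤ → C
  signed a (+ k) = up (κ a) k
  signed a -[1+ k ] = up (Z.- κ a) (suc k)

  signed-suc : ∀ a i → a ≤ n' → (∀ k → i ≡ -[1+ k ] → k < Λ) → signed a (1ℤ Z.+ i) ≈ signed a i * step (κ a Z.+ i Z.* T)
  signed-suc a (+ k) qa b = refl
  signed-suc a -[1+ zero ] qa b = sym (trans (*-congʳ (trans (*-identityˡ _) (cong≈ step (eq (κ a) T)))) (step-reflect a 0 qa (b 0 P.refl)))
    where
    eq : ∀ c T → Z.- c Z.+ 0ℤ Z.* T ≡ Z.- (c Z.+ (Z.- 1ℤ) Z.* T Z.+ T)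
    eq = solve-∀
  signed-suc a -[1+ suc k ] qa b = sym (trans (*-assoc _ _ _) (trans (*-congˡ
      (trans (*-congʳ (cong≈ step (P.trans (eq (κ a) (+ suc k) T) (P.cong (λ w → Z.- (κ a Z.+ (Z.- w) Z.* T Z.+ T)) (P.sym (pos-+ 1 (suc k))))))) (step-reflect a (suc k) qa (b (suc k) P.refl)))) (*-identityʳ _)))
    where
    eq : ∀ c k T → Z.- c Z.+ k Z.* T ≡ Z.- (c Z.+ (Z.- (1ℤ Z.+ k)) Z.* T Z.+ T)
    eq = solve-∀

  -- The weights rescaled to the value 1 at `reference a`; the 2 on runner 0 is the accumulated
  -- `dbl`.
  ω : ℕ → ℕ → C
  ω zero zero = 1#
  ω zero (suc r) = up 0ℤ (suc r) * (1# + 1#)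
  ω (suc a) r = signed (suc a) (+ r Z.- + Λ)

  reference : ℕ → ℕ
  reference zero = 0
  reference (suc a) = Λ

  private
    cc-signed : ∀ a r → cc (suc a) r ≡ κ (suc a) Z.+ (+ r Z.- + Λ) Z.* T
    cc-signed a r = eq (κ (suc a)) (+ r) (+ Λ) T
      where
      eq : ∀ k r l T → k Z.- l Z.* T Z.+ r Z.* T ≡ k Z.+ (r Z.- l) Z.* T
      eq = solve-∀

    suc-minus : ∀ r l → + suc r Z.- l ≡ 1ℤ Z.+ (+ r Z.- l)
    suc-minus r l = P.trans (P.cong (Z._- l) (pos-+ 1 r)) (ZP.+-assoc 1ℤ (+ r) (Z.- l))

    ω-suc : ∀ a r → a ≤ n' → ω a (suc r) ≈ ω a r * g runners a r
    ω-suc a r qa = trans (go a r qa) (*-congˡ (sym (g≈ a r)))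
      where
      go : ∀ a r → a ≤ n' → ω a (suc r) ≈ ω a r * (step (cc a r) * dbl a r)
      go zero zero qa = *-assoc _ _ _
      go zero (suc r) qa = solve 3 (λ u s d → u :* s :* d := u :* d :* (s :* con (+ 1))) refl _ _ _
      go (suc a) r qa = begin
        signed (suc a) (+ suc r Z.- + Λ) ≡⟨ P.cong (signed (suc a)) (suc-minus r (+ Λ)) ⟩
        signed (suc a) (1ℤ Z.+ (+ r Z.- + Λ)) ≈⟨ signed-suc (suc a) (+ r Z.- + Λ) qa (λ k e → bounded r k (+-injective (solved (+ r) (+ Λ) (+ suc k) e))) ⟩
        ω (suc a) r * step (κ (suc a) Z.+ (+ r Z.- + Λ) Z.* T) ≈⟨ *-congˡ (trans (cong≈ step (P.sym (cc-signed a r))) (sym (*-identityʳ _))) ⟩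
        ω (suc a) r * (step (cc (suc a) r) * 1#) ∎
        where
        bounded : ∀ r k → r N.+ suc k ≡ Λ → k < Λ
        bounded r k e = ≤-trans (m≤n+m (suc k) r) (≤-reflexive e)
        solved : ∀ r l k → r Z.- l ≡ Z.- k → r Z.+ k ≡ l
        solved r l k e = P.trans (eq r l k) (P.trans (P.cong (λ w → w Z.+ k Z.+ l) e) (eq₂ k l))
          where
          eq : ∀ r l k → r Z.+ k ≡ (r Z.- l) Z.+ k Z.+ l
          eq = solve-∀
          eq₂ : ∀ k l → Z.- k Z.+ k Z.+ l ≡ l
          eq₂ = solve-∀

    ω-weight : ∀ a r → a ≤ n' → ω a r ≈ ω a 0 * weight runners (a , r)
    ω-weight a zero qa = sym (*-identityʳ _)
    ω-weight a (suc r) qa = trans (ω-suc a r qa) (trans (*-congʳ (ω-weight a r qa)) (*-assoc _ _ _))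

    ω-reference : ∀ a → ω a (reference a) ≈ 1#
    ω-reference zero = refl
    ω-reference (suc a) = cong≈ (signed (suc a)) (+-inverseʳ (+ Λ))

  centred : ℕ → List ℤ
  centred a = bead a (reference a)

  entry' : ℕ → ℕ → C
  entry' a j = ∑ (λ r → ω a r * monicChebyshev j (χ (cc a r))) (from 0 (ℓ a))

  cc-reference : ∀ a → cc a (reference a) ≡ κ a
  cc-reference zero = P.trans (ZP.+-identityˡ _) (ZP.*-zeroˡ T)
  cc-reference (suc a) = eq (κ (suc a)) M
    where
    eq : ∀ k M → k Z.- M Z.+ M ≡ k
    eq = solve-∀

  -- The unflipped state is not the alphabet, as it has entries on both sides of 0. Applying
  -- `product-formula` to the reference choice itself expresses its weight by that of the
  -- all-positive state, and rescaling the rows absorbs the difference.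
  normalised : ∑± own (runnerList runners) * ∏₂ (λ a b → χ (κ a) - χ (κ b)) runners ≈
    own (concatMap centred runners) * det entry' runners runners
  normalised = cancel V⁰-invertible (begin
    S * V * V⁰ ≈⟨ xy∙z≈xz∙y _ _ _ ⟩
    S * V⁰ * V ≈⟨ *-congʳ sign-sum ⟩
    Z * det entry runners runners * V ≈⟨ *-congʳ (sym (*-identityʳ _)) ⟩
    Z * det entry runners runners * 1# * V
      ≈⟨ *-congʳ (*-congˡ (sym (trans (sym (∏-* _ _ runners)) (trans (∏-cong∈ (downFrom-< (suc n'))
           (λ a q → trans (sym (ω-weight a (reference a) (≤-pred q))) (ω-reference a))) (∏-1 runners))))) ⟩
    Z * det entry runners runners * (∏ (λ a → ω a 0) runners * W₀) * V
      ≈⟨ solve 5 (λ z d o w v → z :* d :* (o :* w) :* v := z :* (w :* v) :* (o :* d)) refl _ _ _ _ _ ⟩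
    Z * (W₀ * V) * (∏ (λ a → ω a 0) runners * det entry runners runners)
      ≈⟨ *-cong (sym at-reference) (trans (sym (det-scale-rows _ entry runners runners))
           (det-cong {P = _< suc n'} {Q = _< suc n'} (downFrom-< (suc n')) (downFrom-< (suc n')) (λ a j q _ → trans (sym (∑-*ˡ _ _ (from 0 (ℓ a))))
             (∑-cong (from 0 (ℓ a)) (λ r → trans (sym (*-assoc _ _ _)) (*-congʳ (sym (ω-weight a r (≤-pred q))))))))) ⟩
    own (concatMap centred runners) * V⁰ * det entry' runners runners ≈⟨ xy∙z≈xz∙y _ _ _ ⟩
    own (concatMap centred runners) * det entry' runners runners * V⁰ ∎)
    where
    S = ∑± own (runnerList runners)
    V = ∏₂ (λ a b → χ (κ a) - χ (κ b)) runners
    V⁰ = ∏₂ (λ a b → χ (cc a 0) - χ (cc b 0)) runners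
    Z = own (concatMap (λ a → bead a 0) runners)
    ss : List Choice
    ss = map (λ a → a , reference a) runners
    W₀ = ∏ (λ a → weight runners (a , reference a)) runners
    names : ∀ as → map proj₁ (map (λ a → a , reference a) as) ≡ as
    names as = P.trans (P.sym (Lₚ.map-∘ as)) (Lₚ.map-id as)
    ref-≤ : ∀ a → reference a ≤ ℓ a
    ref-≤ zero = z≤n
    ref-≤ (suc a) = m≤m+n Λ Λ
    R : Runs ss
    R = runs n' ≤-refl ss (names runners) (Allₚ.map⁺ (All.universal ref-≤ runners))
    at-reference : own (concatMap centred runners) * V⁰ ≈ Z * (W₀ * V)
    at-reference = begin
      own (concatMap centred runners) * V⁰
        ≈⟨ *-cong (cong≈ own (P.sym (Lₚ.concatMap-map Bd (λ a → a , reference a) runners))) (sym (∏₂-map _ (λ a → a , reference a) runners)) ⟩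
      own (concatMap Bd ss) * ∏₂ (λ σ σ' → x (base σ) - x (base σ')) ss ≈⟨ product-formula R ⟩
      own (concatMap (Bd ∘ base) ss) * (∏ (weight (map proj₁ ss)) ss * ∏₂ (λ σ σ' → x σ - x σ') ss)
        ≈⟨ *-cong (cong≈ own (Lₚ.concatMap-map (Bd ∘ base) (λ a → a , reference a) runners))
             (*-cong (trans (cong≈ (λ as → ∏ (weight as) ss) (names runners)) (∏-map _ (λ a → a , reference a) runners))
               (trans (∏₂-map _ (λ a → a , reference a) runners) (reflexive-∏₂ runners))) ⟩
      Z * (W₀ * V) ∎
      where
      reflexive-∏₂ : ∀ as → ∏₂ (λ a b → χ (cc a (reference a)) - χ (cc b (reference b))) as ≈ ∏₂ (λ a b → χ (κ a) - χ (κ b)) as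
      reflexive-∏₂ [] = refl
      reflexive-∏₂ (a ∷ as) = *-cong (∏-cong as (λ b → +-cong (χ≡ (cc-reference a)) (-‿cong (χ≡ (cc-reference b))))) (reflexive-∏₂ as)
    V⁰-invertible : Invertible V⁰
    V⁰-invertible = P.subst (λ as → Invertible (∏₂ (λ a b → χ (cc a 0) - χ (cc b 0)) as)) (names runners) (invert (separate R))
      where
      invert : ∀ {σs} → AllPairs Separate σs → Invertible (∏₂ (λ a b → χ (cc a 0) - χ (cc b 0)) (map proj₁ σs))
      row : ∀ {σ σs} → All (Separate σ) σs → Invertible (∏ (λ b → χ (cc (proj₁ σ) 0) - χ (cc b 0)) (map proj₁ σs))
      row [] = 1# , *-identityˡ _
      row {a , _} {(b , _) ∷ _} (((qa , _) , (qb , _) , n) ∷ ps) =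
        Invertible-* (χ-invertible _ _ (proj₁ (Off-cc a b 0 0 qa qb n)) (proj₂ (Off-cc a b 0 0 qa qb n))) (row ps)
      invert [] = 1# , *-identityˡ _
      invert (p ∷ ps) = Invertible-* (row p) (invert ps)

-- Two-sided sums and the matrix Θ

module BalancedSignSum (L : LaurentRing) (p m n' Λ : ℕ) (2n'<p : n' N.+ n' < p) where
  open NormalisedSignSum L p m n' Λ 2n'<p public

  flips : ℕ → (ℤ → C) → ℤ → C
  flips zero f c = 0#
  flips (suc k) f c = up c (suc k) * f (c Z.+ + suc k Z.* T) + flips k f c

  -- Sum over the r-th position to the right (r ≥ 0) and to the left (r ≥ 1) of the centre κ a.
  two-sided : (ℤ → C) → ℕ → C
  two-sided f a = f (κ a) + flips Λ f (κ a) + flips Λ f (Z.- κ a)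

  private
    from-suc : ∀ (f : ℕ → C) r k → ∑ f (from (suc r) k) ≈ ∑ (λ i → f (suc i)) (from r k)
    from-suc f r zero = refl
    from-suc f r (suc k) = +-congˡ (from-suc f (suc r) k)

    from-snoc : ∀ (f : ℕ → C) r k → ∑ f (from r (suc k)) ≈ ∑ f (from r k) + f (r N.+ suc k)
    from-snoc f r zero = trans (+-congˡ (+-identityʳ _)) (+-cong (sym (+-identityʳ _)) (cong≈ f (P.sym (P.trans (+-suc r 0) (P.cong suc (NP.+-identityʳ r))))))
    from-snoc f r (suc k) = trans (+-congˡ (from-snoc f (suc r) k)) (trans (sym (+-assoc _ _ _)) (+-congˡ (cong≈ f (P.sym (+-suc r (suc k))))))

    right : ∀ f c k → ∑ (λ i → up c i * f (c Z.+ + i Z.* T)) (from 0 k) ≈ f c + flips k f c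
    right f c zero = trans (+-congʳ (trans (*-identityˡ _) (cong≈ f (P.trans (P.cong (λ z → c Z.+ z) (ZP.*-zeroˡ T)) (ZP.+-identityʳ c))))) refl
    right f c (suc k) = trans (from-snoc _ 0 k) (trans (+-congʳ (right f c k)) (solve 3 (λ a b c → a :+ b :+ c := a :+ (c :+ b)) refl _ _ _))

    shift-from : ∀ (f : ℕ → C) d k → ∑ f (from d k) ≈ ∑ (λ i → f (d N.+ i)) (from 0 k)
    shift-from f zero k = refl
    shift-from f (suc d) k = trans (from-suc f d k) (shift-from (λ i → f (suc i)) d k)

    centre-out : ∀ a (f : ℤ → C) → (∀ c → f (Z.- c) ≈ f c) → ∀ r k → r N.+ k ≡ Λ →
      ∑ (λ r → signed a (+ r Z.- + Λ) * f (κ a Z.+ (+ r Z.- + Λ) Z.* T)) (from r (k N.+ Λ)) ≈ f (κ a) + flips Λ f (κ a) + flips k f (Z.- κ a)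
    centre-out a f even r zero e = begin
      _ ≈⟨ shift-from _ r Λ ⟩
      ∑ (λ i → signed a (+ (r N.+ i) Z.- + Λ) * f (κ a Z.+ (+ (r N.+ i) Z.- + Λ) Z.* T)) (from 0 Λ)
        ≈⟨ ∑-cong (from 0 Λ) (λ i → cong≈ (λ z → signed a z * f (κ a Z.+ z Z.* T))
             (P.trans (P.cong₂ (λ u v → u Z.- v) (pos-+ r i) (P.cong +_ (P.trans (P.sym e) (NP.+-identityʳ r)))) (eq (+ r) (+ i)))) ⟩
      _ ≈⟨ right f (κ a) Λ ⟩
      f (κ a) + flips Λ f (κ a) ≈⟨ sym (+-identityʳ _) ⟩
      f (κ a) + flips Λ f (κ a) + 0# ∎
      where
      eq : ∀ r i → r Z.+ i Z.- r ≡ i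
      eq = solve-∀
    centre-out a f even r (suc k) e = begin
      signed a (+ r Z.- + Λ) * f (κ a Z.+ (+ r Z.- + Λ) Z.* T) + _
        ≈⟨ +-cong (trans (cong≈ (λ z → signed a z * f (κ a Z.+ z Z.* T)) diff) (*-congˡ (trans (cong≈ f (eq (κ a) (+ suc k) T)) (even _))))
             (centre-out a f even (suc r) k (P.trans (P.sym (+-suc r k)) e)) ⟩
      _ ≈⟨ solve 3 (λ a b c → a :+ (b :+ c) := b :+ (a :+ c)) refl _ _ _ ⟩
      f (κ a) + flips Λ f (κ a) + flips (suc k) f (Z.- κ a) ∎
      where
      eq₀ : ∀ r k → r Z.- (r Z.+ k) ≡ Z.- k
      eq₀ = solve-∀
      diff : + r Z.- + Λ ≡ -[1+ k ]
      diff = P.trans (P.cong (λ z → + r Z.- z) (P.trans (P.cong +_ (P.sym e)) (pos-+ r (suc k)))) (eq₀ (+ r) (+ suc k))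
      eq : ∀ c k T → c Z.+ (Z.- k) Z.* T ≡ Z.- (Z.- c Z.+ k Z.* T)
      eq = solve-∀

    -- The factor 2 in `ω` provides the two equal halves of a two-sided sum, which brings runner 0
    -- into the general form.
    zero-runner : ∀ (f : ℤ → C) k → ∑ (λ r → ω 0 r * f (cc 0 r)) (from 0 k) ≈ f 0ℤ + flips k f 0ℤ + flips k f 0ℤ
    zero-runner f zero = trans (+-congʳ (trans (*-identityˡ _) (cong≈ f (cc-reference 0)))) (sym (+-identityʳ _))
    zero-runner f (suc k) = trans (from-snoc _ 0 k) (trans (+-congʳ (zero-runner f k))
      (solve 4 (λ a b u v → a :+ b :+ b :+ u :* (con (+ 1) :+ con (+ 1)) :* v := a :+ (u :* v :+ b) :+ (u :* v :+ b)) refl _ _ _ _))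

  entry'-two-sided : ∀ f → (∀ c → f (Z.- c) ≈ f c) → ∀ a → ∑ (λ r → ω a r * f (cc a r)) (from 0 (ℓ a)) ≈ two-sided f a
  entry'-two-sided f even zero = zero-runner f Λ
  entry'-two-sided f even (suc a) = trans (∑-cong (from 0 (Λ N.+ Λ)) (λ r → *-congˡ (cong≈ f (eq (κ (suc a)) (+ r) (+ Λ) T)))) (centre-out (suc a) f even 0 Λ P.refl)
    where
    eq : ∀ k r l T → k Z.- l Z.* T Z.+ r Z.* T ≡ k Z.+ (r Z.- l) Z.* T
    eq = solve-∀

  χ-even : ∀ c → χ (Z.- c) ≈ χ c
  χ-even c = trans (+-congˡ (ξ≡ (neg-involutive c))) (+-comm _ _)

  chebyshev-χ : ∀ j c → chebyshev j (χ c) ≈ χ (+ j Z.* c)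
  chebyshev-χ zero c = sym (trans (+-cong (ξ≡ (ZP.*-zeroˡ c)) (ξ≡ (P.cong Z.-_ (ZP.*-zeroˡ c)))) (+-cong ξ-0 ξ-0))
  chebyshev-χ (suc zero) c = χ≡ (P.sym (ZP.*-identityˡ c))
  chebyshev-χ (suc (suc j)) c = begin
    χ c * chebyshev (suc j) (χ c) - chebyshev j (χ c) ≈⟨ +-cong (*-congˡ (chebyshev-χ (suc j) c)) (-‿cong (chebyshev-χ j c)) ⟩
    χ c * χ d - χ (+ j Z.* c) ≈⟨ +-cong (solve 4 (λ a b c d → (a :+ b) :* (c :+ d) := a :* c :+ a :* d :+ b :* c :+ b :* d) refl _ _ _ _)
        (-‿cong (+-cong (trans (ξ≡ e₁) (ξ-+ (Z.- c) d)) (trans (ξ≡ e₂) (ξ-+ c (Z.- d))))) ⟩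
    ξ c * ξ d + ξ c * ξ (Z.- d) + ξ (Z.- c) * ξ d + ξ (Z.- c) * ξ (Z.- d) - (ξ (Z.- c) * ξ d + ξ c * ξ (Z.- d))
      ≈⟨ solve 4 (λ a b c d → a :+ b :+ c :+ d :- (c :+ b) := a :+ d) refl _ _ _ _ ⟩
    ξ c * ξ d + ξ (Z.- c) * ξ (Z.- d) ≈⟨ sym (+-cong (trans (ξ≡ e₃) (ξ-+ c d)) (trans (ξ≡ e₄) (ξ-+ (Z.- c) (Z.- d)))) ⟩
    χ (+ suc (suc j) Z.* c) ∎
    where
    d = + suc j Z.* c
    s₁ : + suc j ≡ 1ℤ Z.+ + j
    s₁ = pos-+ 1 j
    s₂ : + suc (suc j) ≡ 1ℤ Z.+ + suc j
    s₂ = pos-+ 1 (suc j)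
    i₁ : ∀ j c → j Z.* c ≡ Z.- c Z.+ (1ℤ Z.+ j) Z.* c
    i₁ = solve-∀
    i₃ : ∀ j c → (1ℤ Z.+ j) Z.* c ≡ c Z.+ j Z.* c
    i₃ = solve-∀
    e₁ : + j Z.* c ≡ Z.- c Z.+ d
    e₁ = P.trans (i₁ (+ j) c) (P.cong (λ z → Z.- c Z.+ z Z.* c) (P.sym s₁))
    e₂ : Z.- (+ j Z.* c) ≡ c Z.+ (Z.- d)
    e₂ = P.trans (P.cong Z.-_ e₁) (i₂ c d)
      where
      i₂ : ∀ c d → Z.- (Z.- c Z.+ d) ≡ c Z.+ (Z.- d)
      i₂ = solve-∀
    e₃ : + suc (suc j) Z.* c ≡ c Z.+ d
    e₃ = P.trans (P.cong (Z._* c) s₂) (i₃ (+ suc j) c)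
    e₄ : Z.- (+ suc (suc j) Z.* c) ≡ Z.- c Z.+ (Z.- d)
    e₄ = P.trans (P.cong Z.-_ e₃) (neg-distrib-+ c d)

  Θ : ℕ → ℕ → C
  Θ a j = two-sided (λ c → χ (+ j Z.* c)) a

  private
    twice : ℕ → C
    twice zero = 1# + 1#
    twice (suc j) = 1#

    chebyshev-twice : ∀ j x → chebyshev j x ≈ twice j * monicChebyshev j x
    chebyshev-twice zero x = sym (*-identityʳ _)
    chebyshev-twice (suc j) x = sym (*-identityˡ _)

    ∏-twice : ∀ k → ∏ twice (downFrom (suc k)) ≈ 1# + 1#
    ∏-twice zero = *-identityʳ _
    ∏-twice (suc k) = trans (*-identityˡ _) (∏-twice k)

    χ-even* : ∀ j c → χ (+ j Z.* (Z.- c)) ≈ χ (+ j Z.* c)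
    χ-even* j c = trans (χ≡ (P.sym (neg-distribʳ-* (+ j) c))) (χ-even _)

  -- Passing from the monic polynomials to `chebyshev`, which has the clean value χ (j c) at χ c,
  -- changes only the column j = 0, by the factor 2.
  Θ-determinant : (1# + 1#) * (∑± own (runnerList runners) * ∏₂ (λ a b → χ (κ a) - χ (κ b)) runners) ≈
    own (concatMap centred runners) * det Θ runners runners
  Θ-determinant = begin
    (1# + 1#) * (∑± own (runnerList runners) * ∏₂ (λ a b → χ (κ a) - χ (κ b)) runners)
      ≈⟨ *-cong (sym (∏-twice n')) normalised ⟩
    ∏ twice runners * (own (concatMap centred runners) * det entry' runners runners)
      ≈⟨ x∙yz≈y∙xz _ _ _ ⟩
    own (concatMap centred runners) * (∏ twice runners * det entry' runners runners)
      ≈⟨ *-congˡ (trans (sym (det-scale-columns twice entry' runners runners))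
           (det-cong {P = λ _ → ℕ} {Q = λ _ → ℕ} (All.universal id runners) (All.universal id runners) (λ a j _ _ → same a j))) ⟩
    own (concatMap centred runners) * det Θ runners runners ∎
    where
    same : ∀ a j → twice j * entry' a j ≈ Θ a j
    same a j = begin
      twice j * entry' a j ≈⟨ sym (∑-*ˡ _ _ (from 0 (ℓ a))) ⟩
      _ ≈⟨ ∑-cong (from 0 (ℓ a)) (λ r → begin
             twice j * (ω a r * monicChebyshev j (χ (cc a r))) ≈⟨ x∙yz≈y∙xz _ _ _ ⟩
             ω a r * (twice j * monicChebyshev j (χ (cc a r))) ≈⟨ *-congˡ (trans (sym (chebyshev-twice j _)) (chebyshev-χ j (cc a r))) ⟩
             ω a r * χ (+ j Z.* cc a r) ∎) ⟩
      _ ≈⟨ entry'-two-sided (λ c → χ (+ j Z.* c)) (χ-even* j) a ⟩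
      Θ a j ∎

  ∑±-↭ : ∀ {g X Y} → (∀ {Y Y'} → Y ↭ Y' → g Y ≈ g Y') → X ↭ Y → ∑± g X ≈ ∑± g Y
  ∑±-↭ inv ↭-refl = refl
  ∑±-↭ inv (prep x q) = +-cong (∑±-↭ (λ r → inv (prep _ r)) q) (∑±-↭ (λ r → inv (prep _ r)) q)
  ∑±-↭ {g} inv (swap {xs} {ys} x y q) = trans
      (+-cong (+-cong (two x y) (two x (Z.- y))) (+-cong (two (Z.- x) y) (two (Z.- x) (Z.- y))))
      (+-interchange _ _ _ _)
    where
    two : ∀ a b → ∑± (λ Y → g (a ∷ b ∷ Y)) xs ≈ ∑± (λ Y → g (b ∷ a ∷ Y)) ys
    two a b = trans (∑±-cong xs (λ Y _ → inv (swap a b ↭-refl))) (∑±-↭ (λ r → inv (prep b (prep a r))) q)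
  ∑±-↭ inv (↭-trans q r) = trans (∑±-↭ inv q) (∑±-↭ inv r)

  absolute : List ℤ → List ℤ
  absolute = map (λ e → + ∣ e ∣)

  ∑±-abs : ∀ g S → ∑± g S ≈ ∑± g (absolute S)
  ∑±-abs g [] = refl
  ∑±-abs g (+ k ∷ S) = +-cong (∑±-abs _ S) (∑±-abs _ S)
  ∑±-abs g (-[1+ k ] ∷ S) = trans (+-comm _ _) (+-cong (∑±-abs _ S) (∑±-abs _ S))

  absolute-++ : ∀ X Y → absolute (X ++ Y) ≡ absolute X ++ absolute Y
  absolute-++ X Y = Lₚ.map-++ _ X Y

  absolute-bead : ∀ a r → r ≤ ℓ a → absolute (bead a r) ↭ absolute (bead a 0)
  absolute-bead a zero q = ↭-refl
  absolute-bead a (suc r) q = ↭-trans (↭-trans (↭-reflexive (P.cong absolute (bead-suc a r)))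
      (↭-trans (map⁺ _ (conf-step (cc a r) (ℓ a N.∸ suc r) r)) (↭-reflexive (P.trans
        (P.cong (λ z → + z ∷ absolute (G (cc a r Z.+ T) (ℓ a N.∸ suc r) ++ G (Z.- cc a r) r)) (∣-i∣≡∣i∣ (+ p Z.+ cc a r)))
        (P.cong absolute (P.sym (bead-here a r q)))))))
    (absolute-bead a r (≤-trans (n≤1+n r) q))

  absolute-runners : ∀ as → absolute (concatMap centred as) ↭ absolute (runnerList as)
  absolute-runners [] = ↭-refl
  absolute-runners (a ∷ as) = P.subst₂ _↭_ (P.sym (absolute-++ (centred a) _)) (P.sym (absolute-++ (G (c⁰ a) (ℓ a)) _))
    (↭-++ (P.subst (λ X → absolute (centred a) ↭ absolute X) base≡ (absolute-bead a (reference a) (ref-≤ a))) (absolute-runners as))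
    where
    ref-≤ : ∀ a → reference a ≤ ℓ a
    ref-≤ zero = z≤n
    ref-≤ (suc a) = m≤m+n Λ Λ
    base≡ : bead a 0 ≡ G (c⁰ a) (ℓ a)
    base≡ = P.trans (Lₚ.++-identityʳ _) (P.cong (λ z → G z (ℓ a)) (P.trans (P.cong (λ z → c⁰ a Z.+ z) (ZP.*-zeroˡ T)) (ZP.+-identityʳ _)))

  Positive : ℤ → Set
  Positive e = ∃ λ k → e ≡ + suc k

  -- A sign sum sees absolute values only, and flips preserve them; the runners may thus be replaced
  -- by the positive alphabet.
  ∑±-own-runners : ∀ S → All Positive S → S ↭ concatMap centred runners → ∑± own (runnerList runners) ≈ ∑± own S
  ∑±-own-runners S pos q = trans (∑±-abs own (runnerList runners)) (∑±-↭ own-↭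
    (↭-trans (↭-sym (absolute-runners runners)) (↭-trans (map⁺ _ (↭-sym q)) (↭-reflexive (same pos)))))
    where
    same : ∀ {S} → All Positive S → absolute S ≡ S
    same [] = P.refl
    same ((k , P.refl) ∷ ps) = P.cong (_ ∷_) (same ps)

  ∑±-own-W : ∀ S → All Positive S → ∑± own S ≈ W m S
  ∑±-own-W S pos = trans (∑±-split own S own-↭) (∑split-cong S (λ J K q → begin
    own (map Z.-_ J ++ K)
      ≈⟨ *-cong (∏-++ ρ (map Z.-_ J) K) (*-cong (∏-++ ψ (map Z.-_ J) K) (pairs-++ (map Z.-_ J) K)) ⟩
    _ ≈⟨ *-cong (trans (*-cong (trans (∏-map ρ Z.-_ J) (∏-cong∈ (Allₚ.++⁻ˡ J (All-resp-↭ q pos)) (λ { _ (k , P.refl) → refl })))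
           (trans (∏-cong∈ (Allₚ.++⁻ʳ J (All-resp-↭ q pos)) (λ { _ (k , P.refl) → refl })) (∏-1 K))) (*-identityʳ _))
           (*-congˡ (*-congˡ (trans (∏-map _ Z.-_ J) (∏-cong J (λ j → ∏-cong K (λ k → cong≈ φ (ZP.+-comm (Z.- j) k))))))) ⟩
    ∏ (λ a → ξ a ^ m) J * ((∏ ψ (map Z.-_ J) * ∏ ψ K) * (pairs (map Z.-_ J) * pairs K * 𝒜 J K))
      ≈⟨ solve 6 (λ r a b c d e → r :* ((a :* b) :* (c :* d :* e)) := e :* ((r :* (a :* c)) :* (b :* d))) refl _ _ _ _ _ _ ⟩
    𝒜 J K * ((∏ (λ a → ξ a ^ m) J * F̄ J) * F K) ∎))

  own-F : ∀ S → All Positive S → own S ≈ F S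
  own-F S pos = trans (*-congʳ (trans (∏-cong∈ pos (λ { _ (k , P.refl) → refl })) (∏-1 S))) (*-identityˡ _)

  theta-determinant : ∀ S → All Positive S → S ↭ concatMap centred runners →
    (1# + 1#) * (W m S * ∏₂ (λ a b → χ (κ a) - χ (κ b)) runners) ≈ F S * det Θ runners runners
  theta-determinant S pos q = begin
    (1# + 1#) * (W m S * V) ≈⟨ *-congˡ (*-congʳ (trans (sym (∑±-own-W S pos)) (sym (∑±-own-runners S pos q)))) ⟩
    (1# + 1#) * (∑± own (runnerList runners) * V) ≈⟨ Θ-determinant ⟩
    own (concatMap centred runners) * det Θ runners runners ≈⟨ *-congʳ (trans (own-↭ (↭-sym q)) (own-F S pos)) ⟩
    F S * det Θ runners runners ∎
    where V = ∏₂ (λ a b → χ (κ a) - χ (κ b)) runners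

-- The alphabet formed by the runners

oddsFrom : ℕ → ℕ → List ℕ
oddsFrom x zero = []
oddsFrom x (suc k) = x ∷ oddsFrom (x N.+ 2) k

oddsFrom-++ : ∀ x k l → oddsFrom x k ++ oddsFrom (x N.+ (k N.+ k)) l ≡ oddsFrom x (k N.+ l)
oddsFrom-++ x zero l = P.cong (λ y → oddsFrom y l) (NP.+-identityʳ x)
oddsFrom-++ x (suc k) l = P.cong (x ∷_) (P.trans (P.cong (λ y → oddsFrom (x N.+ 2) k ++ oddsFrom y l)
  (P.trans (P.cong (λ z → x N.+ suc z) (+-suc k k)) (P.sym (NP.+-assoc x 2 (k N.+ k))))) (oddsFrom-++ (x N.+ 2) k l))

oddsFrom-≥ : ∀ x k → All (x ≤_) (oddsFrom x k)
oddsFrom-≥ x zero = []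
oddsFrom-≥ x (suc k) = ≤-refl ∷ All.map (≤-trans (m≤m+n x 2)) (oddsFrom-≥ (x N.+ 2) k)

oddsFrom-< : ∀ x k → All (_< x N.+ (k N.+ k)) (oddsFrom x k)
oddsFrom-< x zero = []
oddsFrom-< x (suc k) = P.subst (x <_) (P.sym (+-suc x (k N.+ suc k))) (s≤s (m≤m+n x _))
  ∷ P.subst (λ z → All (_< z) (oddsFrom (x N.+ 2) k)) (P.trans (NP.+-assoc x 2 (k N.+ k)) (P.cong (λ z → x N.+ suc z) (P.sym (+-suc k k)))) (oddsFrom-< (x N.+ 2) k)

oddsFrom-ascending : ∀ x k → AllPairs _<_ (oddsFrom x k)
oddsFrom-ascending x zero = []
oddsFrom-ascending x (suc k) = All.map (≤-trans (≤-trans (≤-reflexive (NP.+-comm 1 x)) (+-monoʳ-≤ x (s≤s z≤n)))) (oddsFrom-≥ (x N.+ 2) k) ∷ oddsFrom-ascending (x N.+ 2) k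

AllPairs-++⁺ : ∀ {A : Set} {R : A → A → Set} {xs ys} → AllPairs R xs → All (λ x → All (R x) ys) xs → AllPairs R ys → AllPairs R (xs ++ ys)
AllPairs-++⁺ [] [] q = q
AllPairs-++⁺ (p ∷ ps) (r ∷ rs) q = Allₚ.++⁺ p r ∷ AllPairs-++⁺ ps rs q

-- Blocks of w consecutive odd (or even) numbers whose starting points have distance 2p.
blocks : ℕ → ℕ → ℕ → ℕ → List ℕ
blocks p w x zero = []
blocks p w x (suc k) = oddsFrom x w ++ blocks p w (x N.+ (p N.+ p)) k

blocks-≥ : ∀ p w x k → All (x ≤_) (blocks p w x k)
blocks-≥ p w x zero = []
blocks-≥ p w x (suc k) = Allₚ.++⁺ (oddsFrom-≥ x w) (All.map (≤-trans (m≤m+n x _)) (blocks-≥ p w (x N.+ (p N.+ p)) k))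

blocks-ascending : ∀ p w x k → w ≤ p → AllPairs _<_ (blocks p w x k)
blocks-ascending p w x zero w≤p = []
blocks-ascending p w x (suc k) w≤p = AllPairs-++⁺ (oddsFrom-ascending x w)
  (All.map (λ {y} y< → All.map (≤-trans (≤-trans y< (+-monoʳ-≤ x (+-mono-≤ w≤p w≤p)))) (blocks-≥ p w (x N.+ (p N.+ p)) k)) (oddsFrom-< x w))
  (blocks-ascending p w (x N.+ (p N.+ p)) k w≤p)

-- If the width equals p the blocks leave no gaps. This is the reason for p = 2n' + 1 on the side of
-- the theorem.
blocks-contiguous : ∀ w x k → blocks w w x k ≡ oddsFrom x (k N.* w)
blocks-contiguous w x zero = P.refl
blocks-contiguous w x (suc k) = P.trans (P.cong (oddsFrom x w ++_) (blocks-contiguous w _ k)) (oddsFrom-++ x w (k N.* w))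

pos⁺ : List ℕ → List ℤ
pos⁺ = map +_

ascending-Good : ∀ {xs} → AllPairs _<_ xs → All (1 ≤_) xs → Good (pos⁺ xs)
ascending-Good {xs} asc p = pairs asc , Allₚ.map⁺ (All.map (λ q e → <⇒≢ q (P.sym e)) p)
  where
  pairs : ∀ {xs} → AllPairs _<_ xs → AllPairs (λ a b → ∣ a ∣ ≢ ∣ b ∣) (pos⁺ xs)
  pairs [] = []
  pairs (q ∷ qs) = Allₚ.map⁺ (All.map (λ l → <⇒≢ l) q) ∷ pairs qs

centre-pairs : ℕ → List ℤ
centre-pairs zero = 0ℤ ∷ []
centre-pairs (suc a) = (+ suc a Z.+ + suc a) ∷ (Z.- (+ suc a Z.+ + suc a)) ∷ centre-pairs a

module Positions (L : LaurentRing) (p m n' Λ : ℕ) (2n'<p : n' N.+ n' < p) where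
  open BalancedSignSum L p m n' Λ 2n'<p public

  private
    concatMap-↭ : ∀ {A B : Set} (f : A → List B) {xs ys} → xs ↭ ys → concatMap f xs ↭ concatMap f ys
    concatMap-↭ f ↭-refl = ↭-refl
    concatMap-↭ f (prep x q) = ++⁺ˡ (f x) (concatMap-↭ f q)
    concatMap-↭ f (swap x y q) = ↭-trans (shifts (f x) (f y)) (++⁺ˡ (f y) (++⁺ˡ (f x) (concatMap-↭ f q)))
    concatMap-↭ f (↭-trans q r) = ↭-trans (concatMap-↭ f q) (concatMap-↭ f r)

    evens : ℤ → ℕ → List ℤ
    evens c zero = []
    evens c (suc k) = c ∷ evens (c Z.+ + 2) k

    evens-snoc : ∀ c k → evens c (suc k) ≡ evens c k ++ (c Z.+ κ k) ∷ []
    evens-snoc c zero = P.cong (_∷ []) (P.sym (ZP.+-identityʳ c))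
    evens-snoc c (suc k) = P.cong (c ∷_) (P.trans (evens-snoc (c Z.+ + 2) k) (P.cong (λ z → evens (c Z.+ + 2) k ++ z ∷ [])
      (P.trans (eq c (+ k)) (P.cong (λ z → c Z.+ (z Z.+ z)) (P.sym (pos-+ 1 k))))))
      where
      eq : ∀ c k → c Z.+ + 2 Z.+ (k Z.+ k) ≡ c Z.+ ((1ℤ Z.+ k) Z.+ (1ℤ Z.+ k))
      eq = solve-∀

    centre-pairs-↭ : ∀ a → centre-pairs a ↭ evens (Z.- κ a) (suc (a N.+ a))
    centre-pairs-↭ zero = ↭-refl
    centre-pairs-↭ (suc a) = ↭-trans (prep _ (prep _ (centre-pairs-↭ a))) (↭-trans (++-comm (κ (suc a) ∷ []) ((Z.- κ (suc a)) ∷ evens (Z.- κ a) (suc (a N.+ a))))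
      (↭-reflexive (P.cong (λ Z → (Z.- κ (suc a)) ∷ Z) (P.trans (P.cong₂ (λ u v → evens u (suc (a N.+ a)) ++ v ∷ [])
        (P.trans (eq₁ (+ a)) (P.cong (λ z → Z.- (z Z.+ z) Z.+ + 2) (P.sym (pos-+ 1 a)))) last≡)
        (P.trans (P.sym (evens-snoc _ (suc (a N.+ a)))) (P.cong (λ k → evens (Z.- κ (suc a) Z.+ + 2) (suc k)) (P.sym (+-suc a a))))))))
      where
      eq₁ : ∀ a → Z.- (a Z.+ a) ≡ Z.- ((1ℤ Z.+ a) Z.+ (1ℤ Z.+ a)) Z.+ + 2
      eq₁ = solve-∀
      eq₂ : ∀ a → (1ℤ Z.+ a) Z.+ (1ℤ Z.+ a) ≡ Z.- ((1ℤ Z.+ a) Z.+ (1ℤ Z.+ a)) Z.+ + 2 Z.+ ((1ℤ Z.+ (a Z.+ a)) Z.+ (1ℤ Z.+ (a Z.+ a)))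
      eq₂ = solve-∀
      last≡ : κ (suc a) ≡ Z.- κ (suc a) Z.+ + 2 Z.+ κ (suc (a N.+ a))
      last≡ = P.trans (P.cong (λ z → z Z.+ z) (pos-+ 1 a)) (P.trans (eq₂ (+ a))
        (P.cong₂ (λ u v → Z.- (u Z.+ u) Z.+ + 2 Z.+ (v Z.+ v)) (P.sym (pos-+ 1 a))
          (P.trans (P.cong (λ z → 1ℤ Z.+ z) (P.sym (pos-+ a a))) (P.sym (pos-+ 1 (a N.+ a))))))

    centred-pairs : ∀ a → concatMap centred (downFrom (suc a)) ≡ concatMap (λ c → G c Λ) (centre-pairs a)
    centred-pairs zero = P.cong (_++ []) (P.trans (Lₚ.++-identityʳ _) (P.cong (λ c → G c Λ) (cc-reference 0)))
    centred-pairs (suc a) = P.trans (P.cong₂ _++_ (P.trans (P.cong (λ k → conf (cc (suc a) Λ) k Λ) (m+n∸n≡m Λ Λ)) (P.cong (λ c → conf c Λ Λ) (cc-reference (suc a)))) (centred-pairs a))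
      (Lₚ.++-assoc (G (κ (suc a)) Λ) _ _)

    transpose-heads : ∀ cs k → concatMap (λ c → G c (suc k)) cs ↭ map (λ z → + p Z.+ z) cs ++ concatMap (λ c → G (c Z.+ T) k) cs
    transpose-heads [] k = ↭-refl
    transpose-heads (c ∷ cs) k = prep _ (↭-trans (++⁺ˡ (G (c Z.+ T) k) (transpose-heads cs k)) (shifts (G (c Z.+ T) k) (map (λ z → + p Z.+ z) cs)))

    shifted-evens : ∀ c w k → concatMap (λ c → G (c Z.+ T) k) (evens c w) ≡ concatMap (λ c → G c k) (evens (c Z.+ T) w)
    shifted-evens c zero k = P.refl
    shifted-evens c (suc w) k = P.cong (G (c Z.+ T) k ++_) (P.trans (shifted-evens (c Z.+ + 2) w k) (P.cong (λ z → concatMap (λ c → G c k) (evens z w)) (eq c T)))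
      where
      eq : ∀ c T → c Z.+ + 2 Z.+ T ≡ c Z.+ T Z.+ + 2
      eq = solve-∀

    heads : ∀ x c w → + p Z.+ c ≡ + x → map (λ z → + p Z.+ z) (evens c w) ≡ pos⁺ (oddsFrom x w)
    heads x c zero e = P.refl
    heads x c (suc w) e = P.cong₂ _∷_ e (heads (x N.+ 2) (c Z.+ + 2) w (P.trans (P.sym (ZP.+-assoc (+ p) c (+ 2))) (P.cong (Z._+ + 2) e)))

    -- A transposition: runners read the array of positions by columns, blocks by rows.
    into-blocks : ∀ x c w k → + p Z.+ c ≡ + x → concatMap (λ c → G c k) (evens c w) ↭ pos⁺ (blocks p w x k)
    into-blocks x c w zero e = ↭-reflexive (none (evens c w))
      where
      none : ∀ cs → concatMap (λ c → G c 0) cs ≡ []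
      none [] = P.refl
      none (_ ∷ cs) = none cs
    into-blocks x c w (suc k) e = ↭-trans (transpose-heads (evens c w) k) (↭-trans
      (↭-++ (↭-reflexive (heads x c w e)) (↭-trans (↭-reflexive (shifted-evens c w k))
        (into-blocks (x N.+ (p N.+ p)) (c Z.+ T) w k (P.trans (P.sym (ZP.+-assoc (+ p) c T)) (P.cong (Z._+ T) e)))))
      (↭-reflexive (P.sym (Lₚ.map-++ +_ (oddsFrom x w) _))))

  first : ℕ
  first = p N.∸ (n' N.+ n')

  1≤first : 1 ≤ first
  1≤first = m<n⇒0<n∸m 2n'<p

  width : ℕ
  width = suc (n' N.+ n')

  positions : List ℕ
  positions = blocks p width first Λ

  positions-↭ : pos⁺ positions ↭ concatMap centred runners
  positions-↭ = ↭-sym (↭-trans (↭-reflexive (centred-pairs n')) (↭-trans (concatMap-↭ _ (centre-pairs-↭ n'))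
    (into-blocks first (Z.- κ n') width Λ (P.trans (m-n≡m⊖n p (n' N.+ n')) (⊖-≥ (≤-trans (n≤1+n _) 2n'<p))))))

  1≤positions : All (1 ≤_) positions
  1≤positions = All.map (≤-trans 1≤first) (blocks-≥ p width first Λ)

  positions-positive : All Positive (pos⁺ positions)
  positions-positive = Allₚ.map⁺ (All.map positive 1≤positions)
    where
    positive : ∀ {k} → 1 ≤ k → Positive (+ k)
    positive (s≤s {n = k} _) = k , P.refl

  positions-Good : Good (pos⁺ positions)
  positions-Good = ascending-Good (blocks-ascending p width first Λ 2n'<p) 1≤positions

  positions-theta : (1# + 1#) * (W m (pos⁺ positions) * ∏₂ (λ a b → χ (κ a) - χ (κ b)) runners) ≈ F (pos⁺ positions) * det Θ runners runners
  positions-theta = theta-determinant (pos⁺ positions) positions-positive positions-↭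

  centre-list : List ℤ
  centre-list = centre-pairs n'

  F-positions : F (pos⁺ positions) ≈ ∏ (λ c → own (G c Λ)) centre-list * ∏₂ (λ c d → cross (G c Λ) (G d Λ)) centre-list
  F-positions = trans (sym (own-F (pos⁺ positions) positions-positive)) (trans (own-↭ (↭-trans positions-↭ (↭-reflexive (centred-pairs n')))) (own-concat (λ c → G c Λ) (centre-pairs n')))

-- The ring of power series, its truncations, and its localisation at x

shift₁ : Series → Series
shift₁ f N = f (suc N)

sum-upTo : (ℕ → ℤ) → ℕ → ℤ
sum-upTo h zero = 0ℤ
sum-upTo h (suc n) = h 0 Z.+ sum-upTo (λ k → h (suc k)) n

sumℤ-applyUpTo : ∀ h (f : ℕ → ℕ) n → sumℤ (map h (applyUpTo f n)) ≡ sum-upTo (λ k → h (f k)) n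
sumℤ-applyUpTo h f zero = P.refl
sumℤ-applyUpTo h f (suc n) = P.cong (λ z → h (f 0) Z.+ z) (sumℤ-applyUpTo h (λ k → f (suc k)) n)

⊗-sum : ∀ f g N → (f ⊗ g) N ≡ sum-upTo (λ k → f k Z.* g (N N.∸ k)) (suc N)
⊗-sum f g N = sumℤ-applyUpTo (λ k → f k Z.* g (N N.∸ k)) id (suc N)

⊗-zero : ∀ f g → (f ⊗ g) 0 ≡ f 0 Z.* g 0
⊗-zero f g = ZP.+-identityʳ _

⊗-sucˡ : ∀ f g N → (f ⊗ g) (suc N) ≡ f 0 Z.* g (suc N) Z.+ (shift₁ f ⊗ g) N
⊗-sucˡ f g N = P.trans (⊗-sum f g (suc N)) (P.cong (λ z → f 0 Z.* g (suc N) Z.+ z) (P.sym (⊗-sum (shift₁ f) g N)))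

⊗-cong-at : ∀ N f f' g g' → (∀ k → k ≤ N → f k ≡ f' k) → (∀ k → k ≤ N → g k ≡ g' k) → (f ⊗ g) N ≡ (f' ⊗ g') N
⊗-cong-at zero f f' g g' e e' = P.trans (⊗-zero f g) (P.trans (P.cong₂ Z._*_ (e 0 z≤n) (e' 0 z≤n)) (P.sym (⊗-zero f' g')))
⊗-cong-at (suc N) f f' g g' e e' = P.trans (⊗-sucˡ f g N) (P.trans (P.cong₂ Z._+_
  (P.cong₂ Z._*_ (e 0 z≤n) (e' (suc N) ≤-refl))
  (⊗-cong-at N (shift₁ f) (shift₁ f') g g' (λ k q → e (suc k) (s≤s q)) (λ k q → e' k (m≤n⇒m≤1+n q)))) (P.sym (⊗-sucˡ f' g' N)))

⊗-sucʳ : ∀ f g N → (f ⊗ g) (suc N) ≡ f (suc N) Z.* g 0 Z.+ (f ⊗ shift₁ g) N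
⊗-sucʳ f g zero = P.trans (⊗-sucˡ f g 0) (P.trans (P.cong (λ z → f 0 Z.* g 1 Z.+ z) (⊗-zero (shift₁ f) g))
  (P.trans (ZP.+-comm (f 0 Z.* g 1) (f 1 Z.* g 0)) (P.cong (λ z → f 1 Z.* g 0 Z.+ z) (P.sym (⊗-zero f (shift₁ g))))))
⊗-sucʳ f g (suc N) = P.trans (⊗-sucˡ f g (suc N)) (P.trans (P.cong (λ z → f 0 Z.* g (suc (suc N)) Z.+ z) (⊗-sucʳ (shift₁ f) g N))
  (P.trans (comm₃ (f 0 Z.* g (suc (suc N))) (f (suc (suc N)) Z.* g 0) _) (P.cong (λ z → f (suc (suc N)) Z.* g 0 Z.+ z) (P.sym (⊗-sucˡ f (shift₁ g) N)))))
  where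
  comm₃ : ∀ a b c → a Z.+ (b Z.+ c) ≡ b Z.+ (a Z.+ c)
  comm₃ = solve-∀

⊗-comm : ∀ N f g → (f ⊗ g) N ≡ (g ⊗ f) N
⊗-comm zero f g = P.trans (⊗-zero f g) (P.trans (ZP.*-comm (f 0) (g 0)) (P.sym (⊗-zero g f)))
⊗-comm (suc N) f g = P.trans (⊗-sucˡ f g N) (P.trans (P.cong₂ Z._+_ (ZP.*-comm (f 0) _) (⊗-comm N (shift₁ f) g)) (P.sym (⊗-sucʳ g f N)))

⊗-distribʳ : ∀ N f g h → ((g ⊕ h) ⊗ f) N ≡ (g ⊗ f) N Z.+ (h ⊗ f) N
⊗-distribʳ zero f g h = P.trans (⊗-zero (g ⊕ h) f) (P.trans (*-distribʳ-+ (f 0) (g 0) (h 0)) (P.sym (P.cong₂ Z._+_ (⊗-zero g f) (⊗-zero h f))))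
⊗-distribʳ (suc N) f g h = P.trans (⊗-sucˡ (g ⊕ h) f N) (P.trans (P.cong (λ z → (g 0 Z.+ h 0) Z.* f (suc N) Z.+ z) (⊗-distribʳ N f (shift₁ g) (shift₁ h)))
  (P.trans (rearrange (g 0) (h 0) (f (suc N)) _ _) (P.sym (P.cong₂ Z._+_ (⊗-sucˡ g f N) (⊗-sucˡ h f N)))))
  where
  rearrange : ∀ a b c x y → (a Z.+ b) Z.* c Z.+ (x Z.+ y) ≡ a Z.* c Z.+ x Z.+ (b Z.* c Z.+ y)
  rearrange = solve-∀

⊗-·S : ∀ N c f g → ((c ·S f) ⊗ g) N ≡ c Z.* (f ⊗ g) N
⊗-·S zero c f g = P.trans (⊗-zero (c ·S f) g) (P.trans (ZP.*-assoc c (f 0) (g 0)) (P.cong (λ z → c Z.* z) (P.sym (⊗-zero f g))))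
⊗-·S (suc N) c f g = P.trans (⊗-sucˡ (c ·S f) g N) (P.trans (P.cong₂ Z._+_ (ZP.*-assoc c (f 0) (g (suc N))) (⊗-·S N c (shift₁ f) g))
  (P.trans (P.sym (*-distribˡ-+ c _ _)) (P.cong (λ z → c Z.* z) (P.sym (⊗-sucˡ f g N)))))

⊗-assoc : ∀ N f g h → ((f ⊗ g) ⊗ h) N ≡ (f ⊗ (g ⊗ h)) N
⊗-assoc zero f g h = P.trans (⊗-zero (f ⊗ g) h) (P.trans (P.cong (Z._* h 0) (⊗-zero f g)) (P.trans (ZP.*-assoc (f 0) (g 0) (h 0))
  (P.sym (P.trans (⊗-zero f (g ⊗ h)) (P.cong (f 0 Z.*_) (⊗-zero g h))))))
⊗-assoc (suc N) f g h = P.trans (⊗-sucˡ (f ⊗ g) h N) (P.trans (P.cong₂ Z._+_ (P.cong (Z._* h (suc N)) (⊗-zero f g)) tail)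
  (P.trans (regroup (f 0) (g 0) (h (suc N)) _ _) (P.trans (P.cong (λ z → f 0 Z.* z Z.+ (shift₁ f ⊗ (g ⊗ h)) N) (P.sym (⊗-sucˡ g h N))) (P.sym (⊗-sucˡ f (g ⊗ h) N)))))
  where
  regroup : ∀ a b c x y → a Z.* b Z.* c Z.+ (a Z.* x Z.+ y) ≡ a Z.* (b Z.* c Z.+ x) Z.+ y
  regroup = solve-∀
  tail : (shift₁ (f ⊗ g) ⊗ h) N ≡ f 0 Z.* (shift₁ g ⊗ h) N Z.+ (shift₁ f ⊗ (g ⊗ h)) N
  tail = P.trans (⊗-cong-at N (shift₁ (f ⊗ g)) ((f 0 ·S shift₁ g) ⊕ (shift₁ f ⊗ g)) h h (λ k _ → ⊗-sucˡ f g k) (λ _ _ → P.refl))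
    (P.trans (⊗-distribʳ N h (f 0 ·S shift₁ g) (shift₁ f ⊗ g)) (P.cong₂ Z._+_ (⊗-·S N (f 0) (shift₁ g) h) (⊗-assoc N (shift₁ f) g h)))

⊗-zeroˡ : ∀ N f → (zeroS ⊗ f) N ≡ 0ℤ
⊗-zeroˡ zero f = P.refl
⊗-zeroˡ (suc N) f = P.trans (⊗-sucˡ zeroS f N) (P.trans (ZP.+-identityˡ _) (⊗-zeroˡ N f))

⊗-identityˡ : ∀ N f → (oneS ⊗ f) N ≡ f N
⊗-identityˡ zero f = P.trans (⊗-zero oneS f) (ZP.*-identityˡ _)
⊗-identityˡ (suc N) f = P.trans (⊗-sucˡ oneS f N) (P.trans (P.cong₂ Z._+_ (ZP.*-identityˡ (f (suc N))) (⊗-zeroˡ N f)) (ZP.+-identityʳ (f (suc N))))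

negS : Series → Series
negS f N = Z.- f N

-- Power series up to the coefficients that satisfy P, where P is closed downwards.
module SeriesRing (P : ℕ → Set) (down : ∀ {k N} → k ≤ N → P N → P k) where
  ring : CommutativeRing 0ℓ 0ℓ
  ring = record
    { Carrier = Series
    ; _≈_ = λ f g → ∀ N → P N → f N ≡ g N
    ; _+_ = _⊕_
    ; _*_ = _⊗_
    ; -_ = negS
    ; 0# = zeroS
    ; 1# = oneS
    ; isCommutativeRing = record
      { isRing = record
        { +-isAbelianGroup = record
          { isGroup = record
            { isMonoid = record
              { isSemigroup = record
                { isMagma = record
                  { isEquivalence = record { refl = λ N _ → P.refl ; sym = λ e N p → P.sym (e N p) ; trans = λ e f N p → P.trans (e N p) (f N p) }
                  ; ∙-cong = λ e f N p → P.cong₂ Z._+_ (e N p) (f N p) }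
                ; assoc = λ f g h N _ → ZP.+-assoc (f N) (g N) (h N) }
              ; identity = (λ f N _ → ZP.+-identityˡ (f N)) , (λ f N _ → ZP.+-identityʳ (f N)) }
            ; inverse = (λ f N _ → +-inverseˡ (f N)) , (λ f N _ → +-inverseʳ (f N))
            ; ⁻¹-cong = λ e N p → P.cong Z.-_ (e N p) }
          ; comm = λ f g N _ → ZP.+-comm (f N) (g N) }
        ; *-cong = λ {f} {f'} {g} {g'} e e' N p → ⊗-cong-at N f f' g g' (λ k q → e k (down q p)) (λ k q → e' k (down q p))
        ; *-assoc = λ f g h N _ → ⊗-assoc N f g h
        ; *-identity = (λ f N _ → ⊗-identityˡ N f) , (λ f N _ → P.trans (⊗-comm N f oneS) (⊗-identityˡ N f))
        ; distrib = (λ f g h N _ → P.trans (⊗-comm N f (g ⊕ h)) (P.trans (⊗-distribʳ N f g h) (P.cong₂ Z._+_ (⊗-comm N g f) (⊗-comm N h f))))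
                  , (λ f g h N _ → ⊗-distribʳ N f g h) }
      ; *-comm = λ f g N _ → ⊗-comm N f g } }

powerSeries : CommutativeRing 0ℓ 0ℓ
powerSeries = SeriesRing.ring (λ _ → ⊤) (λ _ _ → tt)

truncated : ℕ → CommutativeRing 0ℓ 0ℓ
truncated N = SeriesRing.ring (_< N) (λ k≤M M<N → ≤-<-trans k≤M M<N)

mono-shift : ∀ a f N → (mono a ⊗ f) (a N.+ N) ≡ f N
mono-shift zero f N = ⊗-identityˡ N f
mono-shift (suc a) f N = P.trans (⊗-sucˡ (mono (suc a)) f (a N.+ N)) (P.trans (ZP.+-identityˡ _) (mono-shift a f N))

mono-below : ∀ a f N → N < a → (mono a ⊗ f) N ≡ 0ℤ
mono-below (suc a) f zero q = P.refl
mono-below (suc a) f (suc N) (s≤s q) = P.trans (⊗-sucˡ (mono (suc a)) f N) (P.trans (ZP.+-identityˡ _) (mono-below a f N q))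

mono-+ : ∀ a b → mono (a N.+ b) ≋ (mono a ⊗ mono b)
mono-+ zero b N = P.sym (⊗-identityˡ N (mono b))
mono-+ (suc a) b zero = P.refl
mono-+ (suc a) b (suc N) = P.sym (P.trans (⊗-sucˡ (mono (suc a)) (mono b) N) (P.trans (ZP.+-identityˡ _) (P.sym (mono-+ a b N))))

mono-cancel : ∀ a N {f g} → (∀ i → i < a N.+ N → (mono a ⊗ f) i ≡ (mono a ⊗ g) i) → ∀ i → i < N → f i ≡ g i
mono-cancel a N {f} {g} e i q = P.trans (P.sym (mono-shift a f i)) (P.trans (e (a N.+ i) (+-monoʳ-< a q)) (mono-shift a g i))

invRev-values : ∀ f N → invRev f N ≡ map (λ k → invU f (N N.∸ k)) (upTo (suc N))
invRev-values f zero = P.refl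
invRev-values f (suc N) = P.cong (invU f (suc N) ∷_) (P.trans (invRev-values f N) (P.trans (Lₚ.map-applyUpTo id (λ k → invU f (N N.∸ k)) (suc N))
  (P.sym (Lₚ.map-applyUpTo suc (λ k → invU f (suc N N.∸ k)) (suc N)))))

zipWith-map : ∀ {A : Set} (g h : A → ℤ) xs → zipWith Z._*_ (map g xs) (map h xs) ≡ map (λ k → g k Z.* h k) xs
zipWith-map g h [] = P.refl
zipWith-map g h (x ∷ xs) = P.cong (g x Z.* h x ∷_) (zipWith-map g h xs)

invU-inverse : ∀ f → f 0 ≡ 1ℤ → (f ⊗ invU f) ≋ oneS
invU-inverse f f0 zero = P.trans (⊗-zero f (invU f)) (P.trans (ZP.*-identityʳ (f 0)) f0)
invU-inverse f f0 (suc N) = P.trans (⊗-sucˡ f (invU f) N) (P.trans (P.cong (λ z → z Z.* invU f (suc N) Z.+ (shift₁ f ⊗ invU f) N) f0)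
  (P.trans (P.cong (λ z → 1ℤ Z.* z Z.+ (shift₁ f ⊗ invU f) N) (P.cong Z.-_ (P.cong sumℤ (P.trans (P.cong (zipWith Z._*_ (map (λ i → f (suc i)) (upTo (suc N)))) (invRev-values f N))
    (zipWith-map (λ i → f (suc i)) (λ k → invU f (N N.∸ k)) (upTo (suc N))))))) (cancels ((shift₁ f ⊗ invU f) N))))
  where
  cancels : ∀ z → 1ℤ Z.* (Z.- z) Z.+ z ≡ 0ℤ
  cancels = solve-∀

-- Localisation at the powers of x

record Denominators : Set₁ where
  field
    CR : CommutativeRing 0ℓ 0ℓ
  open CommutativeRing CR
  field
    pow : ℕ → Carrier
    pow-0 : pow 0 ≈ 1#
    pow-+ : ∀ m n → pow (m N.+ n) ≈ pow m * pow n
    pow-cancel : ∀ n {f g} → pow n * f ≈ pow n * g → f ≈ g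

module Localisation (D : Denominators) where
  open Denominators D
  open RingKit CR

  private
    Frac : Set
    Frac = C × ℕ

    infix 4 _~_
    -- Powers are cancellable, so cross-multiplied numerators can be compared directly; transitivity
    -- is where the cancellation enters.
    _~_ : Frac → Frac → Set
    (f , n) ~ (g , m) = pow m * f ≈ pow n * g

    _⊞_ _⊠_ : Frac → Frac → Frac
    (f , n) ⊞ (g , m) = pow m * f + pow n * g , n N.+ m
    (f , n) ⊠ (g , m) = f * g , n N.+ m

    same : ∀ {f g n m} → n ≡ m → f ≈ g → (f , n) ~ (g , m)
    same P.refl e = *-congˡ e

    ~-trans : ∀ {a b c} → a ~ b → b ~ c → a ~ c
    ~-trans {f , n} {g , m} {h , k} e₁ e₂ = pow-cancel m (begin
      pow m * (pow k * f) ≈⟨ x∙yz≈y∙xz _ _ _ ⟩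
      pow k * (pow m * f) ≈⟨ *-congˡ e₁ ⟩
      pow k * (pow n * g) ≈⟨ x∙yz≈y∙xz _ _ _ ⟩
      pow n * (pow k * g) ≈⟨ *-congˡ e₂ ⟩
      pow n * (pow m * h) ≈⟨ x∙yz≈y∙xz _ _ _ ⟩
      pow m * (pow n * h) ∎)

    ⊞-cong : ∀ {a b c d} → a ~ b → c ~ d → (a ⊞ c) ~ (b ⊞ d)
    ⊞-cong {f , n} {f' , n'} {g , m} {g' , m'} e₁ e₂ = begin
      pow (n' N.+ m') * (pow m * f + pow n * g) ≈⟨ *-congʳ (pow-+ n' m') ⟩
      _ ≈⟨ solve 6 (λ n' m' m n f g → n' :* m' :* (m :* f :+ n :* g) := m' :* m :* (n' :* f) :+ n' :* n :* (m' :* g)) refl _ _ _ _ _ _ ⟩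
      _ ≈⟨ +-cong (*-congˡ e₁) (*-congˡ e₂) ⟩
      _ ≈⟨ solve 6 (λ n' m' m n f g → m' :* m :* (n :* f) :+ n' :* n :* (m :* g) := n :* m :* (m' :* f :+ n' :* g)) refl _ _ _ _ _ _ ⟩
      _ ≈⟨ *-congʳ (sym (pow-+ n m)) ⟩
      pow (n N.+ m) * (pow m' * f' + pow n' * g') ∎

    ⊠-cong : ∀ {a b c d} → a ~ b → c ~ d → (a ⊠ c) ~ (b ⊠ d)
    ⊠-cong {f , n} {f' , n'} {g , m} {g' , m'} e₁ e₂ = trans (*-congʳ (pow-+ n' m')) (trans (*-interchange _ _ _ _)
      (trans (*-cong e₁ e₂) (trans (*-interchange _ _ _ _) (*-congʳ (sym (pow-+ n m))))))

    ⊞-comm : ∀ a b → (a ⊞ b) ~ (b ⊞ a)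
    ⊞-comm (f , n) (g , m) = same (NP.+-comm n m) (+-comm _ _)

    ⊞-assoc : ∀ a b c → ((a ⊞ b) ⊞ c) ~ (a ⊞ (b ⊞ c))
    ⊞-assoc (f , n) (g , m) (h , k) = same (NP.+-assoc n m k) (trans (+-congˡ (*-congʳ (pow-+ n m)))
      (trans (solve 6 (λ n m k f g h → k :* (m :* f :+ n :* g) :+ n :* m :* h := m :* k :* f :+ n :* (k :* g :+ m :* h)) refl _ _ _ _ _ _)
        (+-congʳ (*-congʳ (sym (pow-+ m k))))))

    ⊞-identityˡ : ∀ a → ((0# , 0) ⊞ a) ~ a
    ⊞-identityˡ (f , n) = same P.refl (trans (+-cong (zeroʳ _) (trans (*-congʳ pow-0) (*-identityˡ _))) (+-identityˡ _))

    ⊞-inverseˡ : ∀ a → ((- proj₁ a , proj₂ a) ⊞ a) ~ (0# , 0)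
    ⊞-inverseˡ (f , n) = trans (*-congˡ (solve 2 (λ p f → p :* :- f :+ p :* f := con (+ 0)) refl _ _)) (trans (zeroʳ _) (sym (zeroʳ _)))

    ⊠-comm : ∀ a b → (a ⊠ b) ~ (b ⊠ a)
    ⊠-comm (f , n) (g , m) = same (NP.+-comm n m) (*-comm _ _)

    ⊠-distribʳ : ∀ a b c → ((b ⊞ c) ⊠ a) ~ ((b ⊠ a) ⊞ (c ⊠ a))
    ⊠-distribʳ (f , n) (g , m) (h , k) = begin
      pow (m N.+ n N.+ (k N.+ n)) * ((pow k * g + pow m * h) * f) ≈⟨ *-congʳ (trans (pow-+ (m N.+ n) (k N.+ n)) (*-cong (pow-+ m n) (pow-+ k n))) ⟩
      _ ≈⟨ solve 6 (λ n m k f g h → m :* n :* (k :* n) :* ((k :* g :+ m :* h) :* f) := m :* k :* n :* (k :* n :* (g :* f) :+ m :* n :* (h :* f))) refl _ _ _ _ _ _ ⟩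
      _ ≈⟨ sym (*-cong (trans (pow-+ (m N.+ k) n) (*-congʳ (pow-+ m k))) (+-cong (*-congʳ (pow-+ k n)) (*-congʳ (pow-+ m n)))) ⟩
      pow (m N.+ k N.+ n) * (pow (k N.+ n) * (g * f) + pow (m N.+ n) * (h * f)) ∎

  localised : CommutativeRing 0ℓ 0ℓ
  localised = record
    { Carrier = Frac
    ; _≈_ = _~_
    ; _+_ = _⊞_
    ; _*_ = _⊠_
    ; -_ = λ (f , n) → - f , n
    ; 0# = 0# , 0
    ; 1# = 1# , 0
    ; isCommutativeRing = record
      { isRing = record
        { +-isAbelianGroup = record
          { isGroup = record
            { isMonoid = record
              { isSemigroup = record
                { isMagma = record
                  { isEquivalence = record { refl = refl ; sym = sym ; trans = λ {a} {b} {c} → ~-trans {a} {b} {c} }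
                  ; ∙-cong = λ {a} {b} {c} {d} → ⊞-cong {a} {b} {c} {d} }
                ; assoc = ⊞-assoc }
              ; identity = ⊞-identityˡ , λ a → ~-trans {a ⊞ (0# , 0)} {(0# , 0) ⊞ a} {a} (⊞-comm a (0# , 0)) (⊞-identityˡ a) }
            ; inverse = ⊞-inverseˡ , λ a → ~-trans {a ⊞ (- proj₁ a , proj₂ a)} {(- proj₁ a , proj₂ a) ⊞ a} {0# , 0} (⊞-comm a (- proj₁ a , proj₂ a)) (⊞-inverseˡ a)
            ; ⁻¹-cong = λ {(f , n)} {(g , m)} e → trans (sym (-‿distribʳ-* _ _)) (trans (-‿cong e) (-‿distribʳ-* _ _)) }
          ; comm = ⊞-comm }
        ; *-cong = λ {a} {b} {c} {d} → ⊠-cong {a} {b} {c} {d}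
        ; *-assoc = λ (f , n) (g , m) (h , k) → same (NP.+-assoc n m k) (*-assoc f g h)
        ; *-identity = (λ (f , n) → same P.refl (*-identityˡ f)) , (λ (f , n) → same (NP.+-identityʳ n) (*-identityʳ f))
        ; distrib = (λ a b c → ~-trans {a ⊠ (b ⊞ c)} {(b ⊞ c) ⊠ a} {(a ⊠ b) ⊞ (a ⊠ c)} (⊠-comm a (b ⊞ c))
                      (~-trans {(b ⊞ c) ⊠ a} {(b ⊠ a) ⊞ (c ⊠ a)} {(a ⊠ b) ⊞ (a ⊠ c)} (⊠-distribʳ a b c) (⊞-cong {b ⊠ a} {a ⊠ b} {c ⊠ a} {a ⊠ c} (⊠-comm b a) (⊠-comm c a))))
                  , ⊠-distribʳ }
      ; *-comm = ⊠-comm } }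

-- 1/(1 - 1/X) = -X/(1 - X) gives the inverses for negative exponents without a pole.
reflected-inverse : (CR : CommutativeRing 0ℓ 0ℓ) → let open CommutativeRing CR in
  ∀ X I Y → X * Y ≈ 1# → I * (1# - X) ≈ 1# → - (X * I) * (1# - Y) ≈ 1#
reflected-inverse CR X I Y XY I1 = begin
  - (X * I) * (1# - Y) ≈⟨ solve 3 (λ x i y → (:- (x :* i)) :* (con (+ 1) :- y) := i :* (x :* y) :- x :* i) refl X I Y ⟩
  I * (X * Y) - X * I ≈⟨ +-congʳ (*-congˡ XY) ⟩
  I * 1# - X * I ≈⟨ solve 2 (λ x i → i :* con (+ 1) :- x :* i := i :* (con (+ 1) :- x)) refl X I ⟩
  I * (1# - X) ≈⟨ I1 ⟩
  1# ∎
  where open RingKit CR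

record Reciprocals : Set₁ where
  field
    denominators : Denominators
  open Denominators denominators public
  open CommutativeRing CR
  field
    recip : ℕ → Carrier
    recip-inverse : ∀ k → recip k * (1# - pow (suc k)) ≈ 1#

module LaurentLocalisation (Rc : Reciprocals) where
  open Reciprocals Rc
  module R = RingKit CR
  module K = RingKit (Localisation.localised denominators)

  ι : R.C → K.C
  ι f = f , 0

  ι-cong : ∀ {f g} → f R.≈ g → ι f K.≈ ι g
  ι-cong e = R.*-congˡ e

  ι-injective : ∀ {f g} → ι f K.≈ ι g → f R.≈ g
  ι-injective e = pow-cancel 0 e

  ι-+ : ∀ f g → ι (f R.+ g) K.≈ ι f K.+ ι g
  ι-+ f g = R.*-congˡ (R.sym (R.+-cong (R.trans (R.*-congʳ pow-0) (R.*-identityˡ f)) (R.trans (R.*-congʳ pow-0) (R.*-identityˡ g))))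

  ξ τ : ℤ → K.C
  ξ (+ k) = ι (pow k)
  ξ -[1+ k ] = R.1# , suc k

  -- A default value: `τ-inverse` excludes the exponent 0.
  τ (+ zero) = ι R.0#
  τ (+ suc k) = ι (recip k)
  τ -[1+ k ] = ι (R.- (pow (suc k) R.* recip k))

  ξ-⊖ : ∀ m n → ξ (m Z.⊖ n) K.≈ (pow m , n)
  ξ-⊖ m zero = R.refl
  ξ-⊖ zero (suc n) = R.*-congˡ (R.sym pow-0)
  ξ-⊖ (suc m) (suc n) = K.trans {ξ (suc m Z.⊖ suc n)} {pow m , n} {pow (suc m) , suc n}
    (K.trans {ξ (suc m Z.⊖ suc n)} {ξ (m Z.⊖ n)} {pow m , n} (K.reflexive (P.cong ξ ([1+m]⊖[1+n]≡m⊖n m n))) (ξ-⊖ m n))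
    (R.trans (R.sym (pow-+ (suc n) m)) (R.trans (R.reflexive (P.cong pow (P.sym (+-suc n m)))) (pow-+ n (suc m))))

  ξ-+ : ∀ a b → ξ (a Z.+ b) K.≈ ξ a K.* ξ b
  ξ-+ (+ m) (+ n) = ι-cong (pow-+ m n)
  ξ-+ (+ m) -[1+ n ] = K.trans {ξ (m Z.⊖ suc n)} {pow m , suc n} {ξ (+ m) K.* ξ -[1+ n ]} (ξ-⊖ m (suc n)) (R.*-congˡ (R.sym (R.*-identityʳ (pow m))))
  ξ-+ -[1+ m ] (+ n) = K.trans {ξ (n Z.⊖ suc m)} {pow n , suc m} {ξ -[1+ m ] K.* ξ (+ n)} (ξ-⊖ n (suc m))
    (R.*-cong (R.reflexive (P.cong pow (NP.+-identityʳ (suc m)))) (R.sym (R.*-identityˡ (pow n))))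
  ξ-+ -[1+ m ] -[1+ n ] = R.*-cong (R.reflexive (P.cong pow (P.cong suc (+-suc m n)))) (R.sym (R.*-identityˡ R.1#))

  τ-inverse : ∀ d → d ≢ 0ℤ → τ d K.* (K.1# K.- ξ d) K.≈ K.1#
  τ-inverse (+ zero) n = ⊥-elim (n P.refl)
  τ-inverse (+ suc k) n = K.trans {τ (+ suc k) K.* (K.1# K.- ξ (+ suc k))} {ι (recip k R.* (R.1# R.- pow (suc k)))} {K.1#}
    (K.*-congˡ {τ (+ suc k)} {K.1# K.- ξ (+ suc k)} {ι (R.1# R.- pow (suc k))} (K.sym {ι (R.1# R.- pow (suc k))} {K.1# K.- ξ (+ suc k)} (ι-+ R.1# (R.- pow (suc k)))))
    (ι-cong (recip-inverse k))
  τ-inverse d@(-[1+ k ]) n = reflected-inverse (Localisation.localised denominators) (ι (pow (suc k))) (ι (recip k)) (ξ d)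
    (K.trans {ι (pow (suc k)) K.* ξ d} {ξ (+ suc k Z.+ d)} {K.1#} (K.sym {ξ (+ suc k Z.+ d)} {ι (pow (suc k)) K.* ξ d} (ξ-+ (+ suc k) d))
      (K.trans {ξ (+ suc k Z.+ d)} {ξ 0ℤ} {K.1#} (K.reflexive (P.cong ξ (+-inverseʳ (+ suc k)))) (R.*-congˡ pow-0)))
    (τ-inverse (+ suc k) (λ ()))

  laurent : LaurentRing
  laurent = record { CR = Localisation.localised denominators ; ξ = ξ ; ξ-+ = ξ-+ ; ξ-0 = R.*-congˡ pow-0 ; τ = τ ; τ-inverse = τ-inverse }

-- A Laurent ring containing the power series, with ξ k = xᵏ.
record SeriesExtension : Set₁ where
  field
    L : LaurentRing
  open LaurentRing L public using (CR; ξ; τ)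
  open CommutativeRing CR
  field
    ι : Series → Carrier
    ι-cong : ∀ {f g} → f ≋ g → ι f ≈ ι g
    ι-injective : ∀ {f g} → ι f ≈ ι g → f ≋ g
    ι-+ : ∀ f g → ι (f ⊕ g) ≈ ι f + ι g
    ι-* : ∀ f g → ι (f ⊗ g) ≈ ι f * ι g
    ι-neg : ∀ f → ι (negS f) ≈ - ι f
    ι-0 : ι zeroS ≈ 0#
    ι-1 : ι oneS ≈ 1#
    ι-mono : ∀ k → ι (mono k) ≈ ξ (+ k)

unit : ℕ → Series
unit k = oneS ⊖ mono (suc k)

unit-inverse : ∀ k → (invU (unit k) ⊗ unit k) ≋ oneS
unit-inverse k N = P.trans (⊗-comm N (invU (unit k)) (unit k)) (invU-inverse (unit k) P.refl N)

reciprocals : Reciprocals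
reciprocals = record
  { denominators = record
    { CR = powerSeries ; pow = mono ; pow-0 = λ _ _ → P.refl
    ; pow-+ = λ m n N _ → mono-+ m n N
    ; pow-cancel = λ n {f} {g} e i _ → mono-cancel n (suc i) {f} {g} (λ j _ → e j tt) i ≤-refl }
  ; recip = λ k → invU (unit k) ; recip-inverse = λ k N _ → unit-inverse k N }

laurentSeries : SeriesExtension
laurentSeries = record
  { L = laurent ; ι = ι ; ι-cong = λ {f} {g} e → ι-cong {f} {g} (λ N _ → e N) ; ι-injective = λ {f} {g} e N → ι-injective {f} {g} e N tt
  ; ι-+ = ι-+ ; ι-* = λ f g → K.refl {ι (f ⊗ g)} ; ι-neg = λ f → K.refl {ι (negS f)} ; ι-0 = K.refl {K.0#} ; ι-1 = K.refl {K.1#} ; ι-mono = λ k → K.refl {ι (mono k)} }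
  where open LaurentLocalisation reciprocals

-- Partitions through their multiplicities

≡ᵇ-refl : ∀ k → (k N.≡ᵇ k) ≡ true
≡ᵇ-refl zero = P.refl
≡ᵇ-refl (suc k) = ≡ᵇ-refl k

≡ᵇ-other : ∀ {i k} → i < k → (k N.≡ᵇ i) ≡ false
≡ᵇ-other {zero} {suc k} q = P.refl
≡ᵇ-other {suc i} {suc k} (s≤s q) = ≡ᵇ-other q

<ᵇ-true : ∀ {a b} → a < b → (a N.<ᵇ b) ≡ true
<ᵇ-true {zero} {suc b} q = P.refl
<ᵇ-true {suc a} {suc b} (s≤s q) = <ᵇ-true q

<ᵇ-false : ∀ {a b} → b ≤ a → (a N.<ᵇ b) ≡ false
<ᵇ-false {a} {zero} q = P.refl
<ᵇ-false {suc a} {suc b} (s≤s q) = <ᵇ-false q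

perms-↭ : ∀ S → All (_↭ S) (perms S)
perms-↭ [] = ↭-refl ∷ []
perms-↭ (x ∷ S) = Allₚ.concat⁺ (Allₚ.map⁺ (All.map (λ {σ} q → All.map (λ r → ↭-trans r (prep x q)) (inserted x σ)) (perms-↭ S)))
  where
  inserted : ∀ x σ → All (_↭ x ∷ σ) (insertions x σ)
  inserted x [] = ↭-refl ∷ []
  inserted x (y ∷ ys) = ↭-refl ∷ Allₚ.map⁺ (All.map (λ r → ↭-trans (prep y r) (swap y x ↭-refl)) (inserted x ys))

-- The partition with c copies of each part m, m - 1, …, 1, where cs lists the multiplicities in this order.
word : ℕ → List ℕ → List ℕ
word (suc m) (c ∷ cs) = replicate c (suc m) ++ word m cs
word _ _ = []

word-length : ∀ m cs → length cs ≡ m → length (word m cs) ≡ sumℕ cs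
word-length zero [] l = P.refl
word-length (suc m) (c ∷ cs) l = P.trans (Lₚ.length-++ (replicate c (suc m))) (P.cong₂ N._+_ (Lₚ.length-replicate c) (word-length m cs (suc-injective l)))

word-≤ : ∀ m cs → All (_≤ m) (word m cs)
word-≤ zero cs = []
word-≤ (suc m) [] = []
word-≤ (suc m) (c ∷ cs) = Allₚ.++⁺ (Allₚ.replicate⁺ c ≤-refl) (All.map m≤n⇒m≤1+n (word-≤ m cs))

mult-above : ∀ i xs → All (_< i) xs → mult i xs ≡ 0
mult-above i [] _ = P.refl
mult-above i (x ∷ xs) (q ∷ qs) with x N.≡ᵇ i in e
... | true = ⊥-elim (<⇒≢ q (≡ᵇ⇒≡ x i (P.subst Data.Bool.T (P.sym e) tt)))
... | false = mult-above i xs qs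

mult-same : ∀ k c xs → mult k (replicate c k ++ xs) ≡ c N.+ mult k xs
mult-same k zero xs = P.refl
mult-same k (suc c) xs rewrite ≡ᵇ-refl k = P.cong suc (mult-same k c xs)

mult-other : ∀ i k c xs → i < k → mult i (replicate c k ++ xs) ≡ mult i xs
mult-other i k zero xs q = P.refl
mult-other i k (suc c) xs q rewrite ≡ᵇ-other q = mult-other i k c xs q

-- Hall-Littlewood functions in the shuffle algebra

module HallLittlewoodSums (L : LaurentRing) (s : LaurentRing.CR L .CommutativeRing.Carrier) (v : ℕ → ℤ) where
  open BoundedLittlewood L s public

  -- `perms` inserts the head everywhere, whereas the symmetriser is peeled off from the first
  -- letter of the permutation; this changes from one recursion to the other.
  perms-pick : ∀ (f : List ℕ → C) x S → ∑ f (perms (x ∷ S)) ≈ ∑pick (λ y S' → ∑ (λ σ → f (y ∷ σ)) (perms S')) (x ∷ S)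
  perms-pick f x [] = sym (+-identityʳ _)
  perms-pick f x S@(y₀ ∷ S₀) = begin
    ∑ f (concatMap (insertions x) (perms S)) ≈⟨ ∑-concatMap f (insertions x) (perms S) ⟩
    ∑ (λ σ → ∑ f (insertions x σ)) (perms S) ≈⟨ perms-pick (λ σ → ∑ f (insertions x σ)) y₀ S₀ ⟩
    ∑pick (λ y S' → ∑ (λ σ → f (x ∷ y ∷ σ) + ∑ f (map (y ∷_) (insertions x σ))) (perms S')) S
      ≈⟨ ∑pick-cong S (λ y S' _ → trans (∑-+ _ _ (perms S')) (+-congˡ (trans (∑-cong (perms S') (λ σ → ∑-map f (y ∷_) (insertions x σ))) (sym (∑-concatMap _ (insertions x) (perms S')))))) ⟩
    ∑pick (λ y S' → ∑ (λ σ → f (x ∷ y ∷ σ)) (perms S') + ∑ (λ τ → f (y ∷ τ)) (perms (x ∷ S'))) S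
      ≈⟨ trans (∑pick-+ (λ y S' → ∑ (λ σ → f (x ∷ y ∷ σ)) (perms S')) (λ y S' → ∑ (λ τ → f (y ∷ τ)) (perms (x ∷ S'))) S) (+-congʳ (sym (perms-pick (λ σ → f (x ∷ σ)) y₀ S₀))) ⟩
    ∑pick (λ y S' → ∑ (λ σ → f (y ∷ σ)) (perms S')) (x ∷ S) ∎

  PP : List ℕ → C
  PP [] = 1#
  PP (a ∷ r) = ∏ (λ b → φ (v b Z.- v a)) r * PP r

  monomial : List ℕ → List ℕ → C
  monomial (a ∷ σ) (k ∷ w) = ξ (v a) ^ k * monomial σ w
  monomial _ _ = 1#

  symmetrised : List ℕ → List ℤ → C
  symmetrised [] S = δ S
  symmetrised (k ∷ w) S = ∑pick (λ x S' → ξ x ^ k * ∏ (λ b → φ (b Z.- x)) S' * symmetrised w S') S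

  perms-symmetrised : ∀ w S → length S ≡ length w → ∑ (λ σ → monomial σ w * PP σ) (perms S) ≈ symmetrised w (map v S)
  perms-symmetrised [] [] e = solve 0 (con (+ 1) :* con (+ 1) :+ con (+ 0) := con (+ 1)) refl
  perms-symmetrised (k ∷ w) S@(x ∷ S₀) e = begin
    ∑ (λ σ → monomial σ (k ∷ w) * PP σ) (perms S) ≈⟨ perms-pick _ x S₀ ⟩
    ∑pick (λ y S' → ∑ (λ σ → ξ (v y) ^ k * monomial σ w * (∏ (λ b → φ (v b Z.- v y)) σ * PP σ)) (perms S')) S
      ≈⟨ ∑pick-cong S (λ y S' q → begin
           _ ≈⟨ ∑-cong∈ (perms-↭ S') (λ σ r → trans (*-congˡ (*-congʳ (∏-↭ _ r)))
                  (solve 4 (λ a b c d → a :* b :* (c :* d) := a :* c :* (b :* d)) refl _ _ _ _)) ⟩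
           _ ≈⟨ ∑-*ˡ _ _ (perms S') ⟩
           _ ≈⟨ *-cong (*-congˡ (sym (∏-map _ v S'))) (perms-symmetrised w S' (suc-injective (P.trans (P.sym (length-↭ q)) e))) ⟩
           ξ (v y) ^ k * ∏ (λ b → φ (b Z.- v y)) (map v S') * symmetrised w (map v S') ∎) ⟩
    ∑pick (λ y S' → ξ (v y) ^ k * ∏ (λ b → φ (b Z.- v y)) (map v S') * symmetrised w (map v S')) S
      ≈⟨ sym (∑pick-map (λ x S' → ξ x ^ k * ∏ (λ b → φ (b Z.- x)) S' * symmetrised w S') v S) ⟩
    symmetrised (k ∷ w) (map v S) ∎

  ind : ℕ → ℕ → C
  ind c k = if c N.≡ᵇ k then 1# else 0#

  ind-same : ∀ c → ind c c ≡ 1#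
  ind-same zero = P.refl
  ind-same (suc c) = ind-same c

  ind-other : ∀ c k → c ≢ k → ind c k ≡ 0#
  ind-other zero zero n = ⊥-elim (n P.refl)
  ind-other zero (suc k) n = P.refl
  ind-other (suc c) zero n = P.refl
  ind-other (suc c) (suc k) n = ind-other c k (λ e → n (P.cong suc e))

  -- The t-integers and t-factorials, free of division by 1 - t.
  qint qfact : ℕ → C
  qint zero = 0#
  qint (suc c) = 1# + t * qint c
  qfact zero = 1#
  qfact (suc c) = qfact c * qint (suc c)

  gauss-0 : ∀ N → gauss (λ _ _ → 0#) N ≈ 0#
  gauss-0 N = trans (gauss-cong N (λ _ _ _ → sym (zeroˡ 0#))) (trans (gauss-*ˡ 0# (λ _ _ → 0#) N) (zeroˡ _))

  gauss-ind₀ : ∀ (h : ℕ → C) N → gauss (λ i j → ind 0 i * h j) N ≈ h N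
  gauss-ind₀ h zero = *-identityˡ _
  gauss-ind₀ h (suc N) = trans (+-cong (trans (gauss-cong N (λ _ _ _ → zeroˡ _)) (gauss-0 N))
      (trans (gauss-cong N (λ { zero j _ → *-identityˡ _ ; (suc i) j _ → trans (*-congˡ (zeroˡ _)) (trans (zeroʳ _) (sym (zeroˡ _))) })) (gauss-ind₀ (λ j → h (suc j)) N)))
    (+-identityˡ _)

  gauss-ind₁ : ∀ c N → gauss (λ i j → ind 1 i * ind c j) N ≈ qint (suc c) * ind (suc c) N
  gauss-ind₁ c zero = trans (zeroˡ _) (sym (zeroʳ _))
  gauss-ind₁ zero (suc N) = trans (+-cong (gauss-ind₀ (ind 0) N) (trans (gauss-cong N (λ i j _ → trans (*-congˡ (zeroʳ _)) (zeroʳ _))) (gauss-0 N)))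
    (solve 2 (λ a t → a :+ con (+ 0) := (con (+ 1) :+ t :* con (+ 0)) :* a) refl _ t)
  gauss-ind₁ (suc c) (suc N) = trans (+-cong (gauss-ind₀ (ind (suc c)) N)
      (trans (gauss-cong N (λ { zero j _ → trans (*-congˡ (zeroˡ _)) (trans (zeroʳ _) (sym (trans (*-congˡ (zeroˡ _)) (zeroʳ _)))) ; (suc zero) j _ → *-congʳ (*-identityʳ t)
          ; (suc (suc i)) j _ → trans (*-congˡ (zeroˡ _)) (trans (zeroʳ _) (sym (trans (*-congˡ (zeroˡ _)) (zeroʳ _)))) }))
        (trans (gauss-*ˡ t (λ i j → ind 1 i * ind c j) N) (*-congˡ (gauss-ind₁ c N)))))
    (solve 3 (λ a t q → a :+ t :* (q :* a) := (con (+ 1) :+ t :* q) :* a) refl _ _ _)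

  lev : ℕ → ℕ → List ℤ → C
  lev k c = (λ a → ξ a ^ k) · constant (ind c)

  scale : C → (List ℤ → C) → List ℤ → C
  scale q u S = q * u S

  ⋆-scaleˡ : ∀ q u w → scale q u ⋆ w ≐ scale q (u ⋆ w)
  ⋆-scaleˡ q u w S _ = trans (∑split-cong S (λ I J _ → solve 4 (λ a b c d → a :* (b :* c :* d) := b :* (a :* (c :* d))) refl _ _ _ _)) (∑split-*ˡ q _ S)

  ⋆-scaleʳ : ∀ q u w → u ⋆ scale q w ≐ scale q (u ⋆ w)
  ⋆-scaleʳ q u w S _ = trans (∑split-cong S (λ I J _ → solve 4 (λ a b c d → a :* (b :* (c :* d)) := c :* (a :* (b :* d))) refl _ _ _ _)) (∑split-*ˡ q _ S)

  scale-cong : ∀ {p q u w} → p ≈ q → u ≐ w → scale p u ≐ scale q w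
  scale-cong e f S g = *-cong e (f S g)

  ∑split-one : ∀ {A : Set} (g : List A → List A → C) S → (∀ I J → length I ≢ 1 → g I J ≈ 0#) → ∑split g S ≈ ∑pick (λ x S' → g (x ∷ []) S') S
  ∑split-one g [] z = z [] [] (λ ())
  ∑split-one g (x ∷ S) z = +-cong (∑split-top _ S (λ y I J _ → z (x ∷ y ∷ I) J (λ ()))) (∑split-one (λ I J → g I (x ∷ J)) S (λ I J → z I (x ∷ J)))

  symmetrised-∷ : ∀ k w → symmetrised (k ∷ w) ≐ lev k 1 ⋆ symmetrised w
  symmetrised-∷ k w S _ = sym (trans (∑split-one _ S (λ I J n → trans (*-congˡ (trans (*-congʳ (trans (*-congˡ (reflexive (ind-other 1 (length I) (λ e → n (P.sym e))))) (zeroʳ _))) (zeroˡ _))) (zeroʳ _)))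
    (∑pick-cong S (λ x S' _ → solve 3 (λ a b c → b :* con (+ 1) :* (a :* con (+ 1) :* con (+ 1) :* c) := a :* b :* c) refl (ξ x ^ k) _ _)))

  -- Singling out one variable in a block of c + 1 equal parts counts the block with multiplicity
  -- [c + 1]; iterated, this gives the factorials that make up v_λ(t).
  lev-merge : ∀ k c → lev k 1 ⋆ lev k c ≐ scale (qint (suc c)) (lev k (suc c))
  lev-merge k c S G = begin
    (lev k 1 ⋆ lev k c) S ≈⟨ sym (·-⋆ (λ a → ξ a ^ k) (constant (ind 1)) (constant (ind c)) S G) ⟩
    ∏ (λ a → ξ a ^ k) S * (constant (ind 1) ⋆ constant (ind c)) S ≈⟨ *-congˡ (trans (constant-⋆ (ind 1) (ind c) S G) (gauss-ind₁ c (length S))) ⟩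
    ∏ (λ a → ξ a ^ k) S * (qint (suc c) * ind (suc c) (length S)) ≈⟨ x∙yz≈y∙xz _ _ _ ⟩
    qint (suc c) * lev k (suc c) S ∎

  lev-0 : ∀ k → lev k 0 ≐ δ
  lev-0 k [] _ = *-identityˡ _
  lev-0 k (_ ∷ _) _ = zeroʳ _

  symmetrised-replicate : ∀ c k w → symmetrised (replicate c k ++ w) ≐ scale (qfact c) (lev k c ⋆ symmetrised w)
  symmetrised-replicate zero k w = ≐-trans (≐-sym (δ⋆ (symmetrised w))) (≐-trans (⋆-cong (≐-sym (lev-0 k)) (≐-refl {symmetrised w})) (λ S _ → sym (*-identityˡ _)))
  symmetrised-replicate (suc c) k w =
    ≐-trans (symmetrised-∷ k (replicate c k ++ w))
    (≐-trans (⋆-cong (≐-refl {lev k 1}) (symmetrised-replicate c k w))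
    (≐-trans (⋆-scaleʳ (qfact c) (lev k 1) (lev k c ⋆ symmetrised w))
    (≐-trans (scale-cong refl (≐-trans (≐-sym (⋆-assoc (lev k 1) (lev k c) (symmetrised w)))
      (≐-trans (⋆-cong (lev-merge k c) (≐-refl {symmetrised w})) (⋆-scaleˡ (qint (suc c)) (lev k (suc c)) (symmetrised w)))))
    (λ S _ → sym (*-assoc _ _ _)))))

  -- The Hall-Littlewood function as a product of its level sets, the set for exponent k having the
  -- prescribed size; u receives the variables of exponent 0.
  chain : ℕ → List ℕ → (List ℤ → C) → List ℤ → C
  chain (suc m) (c ∷ cs) u = lev (suc m) c ⋆ chain m cs u
  chain _ _ u = u

  chain-cong : ∀ m cs {u w} → u ≐ w → chain m cs u ≐ chain m cs w
  chain-cong zero cs e = e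
  chain-cong (suc m) [] e = e
  chain-cong (suc m) (c ∷ cs) e = ⋆-cong (≐-refl {lev (suc m) c}) (chain-cong m cs e)

  symmetrised-word : ∀ m cs w → length cs ≡ m → symmetrised (word m cs ++ w) ≐ scale (∏ qfact cs) (chain m cs (symmetrised w))
  symmetrised-word zero [] w e = λ S _ → sym (*-identityˡ _)
  symmetrised-word (suc m) (c ∷ cs) w e =
    ≐-trans (λ S _ → cong≈ (λ z → symmetrised z S) (Lₚ.++-assoc (replicate c (suc m)) (word m cs) w))
    (≐-trans (symmetrised-replicate c (suc m) (word m cs ++ w))
    (≐-trans (scale-cong refl (≐-trans (⋆-cong (≐-refl {lev (suc m) c}) (symmetrised-word m cs w (suc-injective e))) (⋆-scaleʳ (∏ qfact cs) (lev (suc m) c) (chain m cs (symmetrised w)))))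
    (λ S _ → sym (*-assoc _ _ _))))

  ∑split-bottom : ∀ {A : Set} (h : List A → List A → C) S → (∀ I x J → h I (x ∷ J) ≈ 0#) → ∑split h S ≈ h S []
  ∑split-bottom h [] z = refl
  ∑split-bottom h (x ∷ S) z = trans (+-cong (∑split-bottom (λ I J → h (x ∷ I) J) S (λ I → z (x ∷ I)))
    (trans (∑split-cong S (λ I J _ → z I x J)) (∑split-0 S))) (+-identityʳ _)

  ⋆δ : ∀ u → u ⋆ δ ≐ u
  ⋆δ u S _ = trans (∑split-bottom _ S (λ I x J → trans (*-congˡ (zeroʳ _)) (zeroʳ _))) (trans (*-cong (∏-1 S) (*-identityʳ _)) (*-identityˡ _))

  symmetrised-zeros : ∀ c → symmetrised (replicate c 0) ≐ scale (qfact c) (lev 0 c)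
  symmetrised-zeros c = ≐-trans (λ S _ → cong≈ (λ z → symmetrised z S) (P.sym (Lₚ.++-identityʳ (replicate c 0))))
    (≐-trans (symmetrised-replicate c 0 []) (scale-cong refl (⋆δ (lev 0 c))))

  -- The sizes of the other levels already determine the size of the last one. With 𝟙 at the end the
  -- expression makes sense uniformly in the number of variables.
  chain-zeros : ∀ m cs c₀ S → length S ≡ sumℕ cs N.+ c₀ → length cs ≡ m → chain m cs (lev 0 c₀) S ≈ chain m cs 𝟙 S
  chain-zeros zero [] c₀ S e _ = trans (*-cong (∏-1 S) (reflexive (P.trans (P.cong (ind c₀) e) (ind-same c₀)))) (*-identityˡ _)
  chain-zeros (suc m) (c ∷ cs) c₀ S e l = ∑split-cong S step
    where
    step : ∀ I J → S ↭ I ++ J → 𝒜 I J * (lev (suc m) c I * chain m cs (lev 0 c₀) J) ≈ 𝒜 I J * (lev (suc m) c I * chain m cs 𝟙 J)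
    step I J q with c N.≟ length I
    ... | no n = *-congˡ (trans (*-congʳ zero-lev) (trans (zeroˡ _) (sym (trans (*-congʳ zero-lev) (zeroˡ _)))))
      where
      zero-lev : lev (suc m) c I ≈ 0#
      zero-lev = trans (*-congˡ (reflexive (ind-other c (length I) n))) (zeroʳ _)
    ... | yes P.refl = *-congˡ (*-congˡ (chain-zeros m cs c₀ J
      (+-cancelˡ-≡ (length I) (length J) (sumℕ cs N.+ c₀) (P.trans (P.sym (Lₚ.length-++ I)) (P.trans (P.sym (length-↭ q)) (P.trans e (NP.+-assoc (length I) (sumℕ cs) c₀))))) (suc-injective l)))

  -- The sum over all perms of the padded word, up to the factor v_λ(t)/…: the K-variable Hall-Littlewood polynomial.
  perms-word : ∀ m cs S → length cs ≡ m → length (map v S) ≡ length S → Good (map v S) → sumℕ cs ≤ length S →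
    ∑ (λ σ → monomial σ (word m cs ++ replicate (length S N.∸ sumℕ cs) 0) * PP σ) (perms S) ≈
    ∏ qfact cs * qfact (length S N.∸ sumℕ cs) * chain m cs 𝟙 (map v S)
  perms-word m cs S l lv G le = begin
    _ ≈⟨ perms-symmetrised (word m cs ++ replicate c₀ 0) S (P.sym (P.trans (Lₚ.length-++ (word m cs)) (P.trans (P.cong₂ N._+_ (word-length m cs l) (Lₚ.length-replicate c₀)) (m+[n∸m]≡n le)))) ⟩
    symmetrised (word m cs ++ replicate c₀ 0) (map v S) ≈⟨ symmetrised-word m cs (replicate c₀ 0) l (map v S) G ⟩
    ∏ qfact cs * chain m cs (symmetrised (replicate c₀ 0)) (map v S) ≈⟨ *-congˡ (chain-cong m cs (symmetrised-zeros c₀) (map v S) G) ⟩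
    ∏ qfact cs * chain m cs (scale (qfact c₀) (lev 0 c₀)) (map v S) ≈⟨ *-congˡ (pull m cs (map v S) G) ⟩
    ∏ qfact cs * (qfact c₀ * chain m cs (lev 0 c₀) (map v S))
      ≈⟨ *-congˡ (*-congˡ (chain-zeros m cs c₀ (map v S) (P.trans lv (P.sym (m+[n∸m]≡n le))) l)) ⟩
    ∏ qfact cs * (qfact c₀ * chain m cs 𝟙 (map v S)) ≈⟨ sym (*-assoc _ _ _) ⟩
    ∏ qfact cs * qfact c₀ * chain m cs 𝟙 (map v S) ∎
    where
    c₀ = length S N.∸ sumℕ cs
    pull : ∀ m cs → chain m cs (scale (qfact c₀) (lev 0 c₀)) ≐ scale (qfact c₀) (chain m cs (lev 0 c₀))
    pull zero cs = ≐-refl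
    pull (suc m) [] = ≐-refl
    pull (suc m) (c ∷ cs) = ≐-trans (⋆-cong (≐-refl {lev (suc m) c}) (pull m cs)) (⋆-scaleʳ (qfact c₀) (lev (suc m) c) (chain m cs (lev 0 c₀)))

  ∑split-∑ : ∀ {A B : Set} (f : B → List A → List A → C) xs S → ∑split (λ I J → ∑ (λ x → f x I J) xs) S ≈ ∑ (λ x → ∑split (f x) S) xs
  ∑split-∑ f xs [] = refl
  ∑split-∑ f xs (y ∷ S) = trans (+-cong (∑split-∑ _ xs S) (∑split-∑ _ xs S)) (sym (∑-+ _ _ xs))

  ∑-ind : ∀ (f : ℕ → C) N k → k ≤ N → ∑ (λ c → f c * ind c k) (upTo (suc N)) ≈ f k
  ∑-ind f N k q = trans (go (suc N) (λ c → f c) k id (s≤s q)) refl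
    where
    zeros : ∀ n (g : ℕ → ℕ) → ∑ (λ c → f c * ind c 0) (applyUpTo (λ i → suc (g i)) n) ≈ 0#
    zeros zero g = refl
    zeros (suc n) g = trans (+-cong (zeroʳ _) (zeros n (λ i → g (suc i)))) (+-identityˡ _)
    map-form : ∀ (h : ℕ → C) (g : ℕ → ℕ) n → ∑ h (applyUpTo g n) ≈ ∑ (λ i → h (g i)) (upTo n)
    map-form h g n = trans (cong≈ (∑ h) (P.sym (Lₚ.map-upTo g n))) (∑-map h g (upTo n))
    go : ∀ n (f : ℕ → C) k (_ : ℕ → ℕ) → k < n → ∑ (λ c → f c * ind c k) (upTo n) ≈ f k
    go (suc n) f zero _ q = trans (+-cong (*-identityʳ _) (trans (map-form _ suc n) (trans (∑-cong (upTo n) (λ i → zeroʳ _)) (∑-0 (upTo n))))) (+-identityʳ _)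
    go (suc n) f (suc k) _ (s≤s q) = trans (+-cong (zeroʳ _) (trans (map-form _ suc n) (go n (λ i → f (suc i)) k id q))) (+-identityˡ _)

  ∑counts-split : ∀ {A : Set} N m (f : List ℕ → List A → List A → C) S → ∑counts N m (λ cs → ∑split (f cs) S) ≈ ∑split (λ I J → ∑counts N m (λ cs → f cs I J)) S
  ∑counts-split N zero f S = refl
  ∑counts-split N (suc m) f S = trans (∑-cong (upTo (suc N)) (λ c → ∑counts-split N m _ S)) (sym (∑split-∑ _ (upTo (suc N)) S))

  -- Iterated product of the level functions ξᵏ · w k for k = m, …, 1.
  tower : (ℕ → ℕ → C) → ℕ → (List ℤ → C) → List ℤ → C
  tower w zero u = u
  tower w (suc m) u = ((λ a → ξ a ^ suc m) · constant (w (suc m))) ⋆ tower w m u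

  countWeight : (ℕ → ℕ → C) → ℕ → List ℕ → C
  countWeight w (suc m) (c ∷ cs) = w (suc m) c * countWeight w m cs
  countWeight w _ _ = 1#

  -- Summing over all multiplicities removes the constraints on the sizes: for each splitting
  -- exactly one multiplicity survives at each level, and its weight becomes a function of the size.
  ∑counts-chain : ∀ w N m u S → length S ≤ N → ∑counts N m (λ cs → countWeight w m cs * chain m cs u S) ≈ tower w m u S
  ∑counts-chain w N zero u S q = *-identityˡ _
  ∑counts-chain w N (suc m) u S q = begin
    ∑ (λ c → ∑counts N m (λ cs → w (suc m) c * countWeight w m cs * (lev (suc m) c ⋆ chain m cs u) S)) (upTo (suc N))
      ≈⟨ ∑-cong (upTo (suc N)) (λ c → trans (∑counts-cong N m (λ cs _ _ → sym (∑split-*ˡ _ _ S))) (∑counts-split N m _ S)) ⟩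
    ∑ (λ c → ∑split (λ I J → ∑counts N m (λ cs → w (suc m) c * countWeight w m cs * (𝒜 I J * (lev (suc m) c I * chain m cs u J)))) S) (upTo (suc N))
      ≈⟨ sym (∑split-∑ _ (upTo (suc N)) S) ⟩
    ∑split (λ I J → ∑ (λ c → ∑counts N m (λ cs → w (suc m) c * countWeight w m cs * (𝒜 I J * (lev (suc m) c I * chain m cs u J)))) (upTo (suc N))) S
      ≈⟨ ∑split-cong S each ⟩
    tower w (suc m) u S ∎
    where
    each : ∀ I J → S ↭ I ++ J → _
    each I J p = begin
      ∑ (λ c → ∑counts N m (λ cs → w (suc m) c * countWeight w m cs * (𝒜 I J * (lev (suc m) c I * chain m cs u J)))) (upTo (suc N))
        ≈⟨ ∑-cong (upTo (suc N)) (λ c → trans (∑counts-cong N m (λ cs _ _ →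
             solve 6 (λ w W A X i u → w :* W :* (A :* (X :* i :* u)) := (w :* i) :* (A :* X) :* (W :* u)) refl (w (suc m) c) _ _ _ _ _)) (∑counts-*ˡ N m _ _)) ⟩
      ∑ (λ c → (w (suc m) c * ind c (length I)) * (𝒜 I J * ∏ (λ a → ξ a ^ suc m) I) * ∑counts N m (λ cs → countWeight w m cs * chain m cs u J)) (upTo (suc N))
        ≈⟨ trans (∑-*ʳ _ _ (upTo (suc N))) (*-congʳ (∑-*ʳ _ _ (upTo (suc N)))) ⟩
      _ ≈⟨ *-cong (*-congʳ (∑-ind (w (suc m)) N (length I) (≤-trans (m≤m+n (length I) (length J)) sizes)))
             (∑counts-chain w N m u J (≤-trans (m≤n+m (length J) (length I)) sizes)) ⟩
      w (suc m) (length I) * (𝒜 I J * ∏ (λ a → ξ a ^ suc m) I) * tower w m u J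
        ≈⟨ solve 4 (λ w A X u → w :* (A :* X) :* u := A :* (X :* w :* u)) refl _ _ _ _ ⟩
      𝒜 I J * (∏ (λ a → ξ a ^ suc m) I * w (suc m) (length I) * tower w m u J) ∎
      where
      sizes : length I N.+ length J ≤ N
      sizes = ≤-trans (≤-reflexive (P.trans (P.sym (Lₚ.length-++ I)) (P.sym (length-↭ p)))) q

  ξ-power : ℕ → ℤ → C
  ξ-power j a = ξ a ^ j

  power-· : ∀ j u → ξ-power j · (ξ · u) ≐ ξ-power (suc j) · u
  power-· j u S _ = trans (sym (*-assoc _ _ _)) (*-congʳ (trans (sym (∏-* _ _ S)) (∏-cong S (λ a → *-comm _ _))))

  shifted-tower : ℕ → ℕ → (List ℤ → C) → List ℤ → C
  shifted-tower zero j u = u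
  shifted-tower (suc m) j u = (ξ-power (suc m N.+ j) · constant levelWeight) ⋆ shifted-tower m j u

  shifted-tower-snoc : ∀ m j u → shifted-tower m (suc j) ((ξ-power (suc j) · constant levelWeight) ⋆ u) ≐ shifted-tower (suc m) j u
  shifted-tower-snoc zero j u = ≐-refl
  shifted-tower-snoc (suc m) j u = ⋆-cong (λ S _ → cong≈ (λ k → (ξ-power k · constant levelWeight) S) (P.cong suc (+-suc m j))) (shifted-tower-snoc m j u)

  -- `levels` multiplies everything above a level by one more ξ, while a tower gives each level its
  -- full power; j counts the powers of ξ still to be distributed.
  unroll : ∀ m j u → (ξ-power j · levels m) ⋆ u ≐ (ξ-power (suc m N.+ j) · 𝟙) ⋆ shifted-tower m j u
  unroll zero j u = ⋆-cong (power-· j 𝟙) ≐-refl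
  unroll (suc m) j u =
    ≐-trans (⋆-cong (≐-trans (power-· j (levels m ⋆ constant levelWeight)) (·-⋆ (ξ-power (suc j)) (levels m) (constant levelWeight))) (≐-refl {u}))
    (≐-trans (⋆-assoc (ξ-power (suc j) · levels m) (ξ-power (suc j) · constant levelWeight) u)
    (≐-trans (unroll m (suc j) ((ξ-power (suc j) · constant levelWeight) ⋆ u))
    (⋆-cong (λ S _ → cong≈ (λ k → (ξ-power k · 𝟙) S) (P.cong suc (+-suc m j))) (shifted-tower-snoc m j u))))

  -- The product in the theorem stops at m - 1, so the top level m has weight 1.
  bounded-weight : ℕ → ℕ → ℕ → C
  bounded-weight m k c = if m N.≡ᵇ k then 1# else levelWeight c

  tower-bounded : ∀ m → tower (bounded-weight (suc m)) (suc m) 𝟙 ≐ W (suc m)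
  tower-bounded m = ≐-trans (⋆-cong (λ S _ → *-congˡ (cong≈ (λ b → if b then 1# else levelWeight (length S)) (≡ᵇ-refl m)))
      (lower m m ≤-refl))
    (≐-trans (≐-sym (≐-trans (⋆-cong (λ S _ → sym (trans (*-congʳ (∏-1 S)) (*-identityˡ _))) (≐-refl {𝟙}))
      (≐-trans (unroll m 0 𝟙) (⋆-cong (λ S _ → cong≈ (λ k → (ξ-power (suc k) · 𝟙) S) (NP.+-identityʳ m)) ≐-refl))))
    (bounded-Littlewood m))
    where
    lower : ∀ m k → k ≤ m → tower (bounded-weight (suc m)) k 𝟙 ≐ shifted-tower k 0 𝟙
    lower m zero q = ≐-refl
    lower m (suc k) q = ⋆-cong (λ S _ → *-cong (∏-cong S (λ a → cong≈ (λ j → ξ a ^ suc j) (P.sym (NP.+-identityʳ k))))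
      (cong≈ (λ b → if b then 1# else levelWeight (length S)) (≡ᵇ-other q))) (lower m k (≤-trans (n≤1+n k) q))

-- Translation of the power series definitions

module SeriesHallLittlewood (SE : SeriesExtension) (p : ℕ) where
  open SeriesExtension SE using (L; ι; ι-cong; ι-injective; ι-+; ι-*; ι-neg; ι-0; ι-1; ι-mono)
  -- x^(2i+1) = q^(1/2) qⁱ: by homogeneity the factor q^(|λ|/2) is absorbed into the alphabet, which
  -- becomes the odd powers of x.
  v : ℕ → ℤ
  v i = + suc (i N.+ i)

  open HallLittlewoodSums L (LaurentRing.ξ L (+ p)) v public

  s : C
  s = ξ (+ p)

  ι-sumS : ∀ {A : Set} (f : A → Series) xs → ι (sumS (map f xs)) ≈ ∑ (λ x → ι (f x)) xs
  ι-sumS f [] = ι-0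
  ι-sumS f (x ∷ xs) = trans (ι-+ _ _) (+-congˡ (ι-sumS f xs))

  ι-prodS : ∀ {A : Set} (f : A → Series) xs → ι (prodS (map f xs)) ≈ ∏ (λ x → ι (f x)) xs
  ι-prodS f [] = ι-1
  ι-prodS f (x ∷ xs) = trans (ι-* _ _) (*-congˡ (ι-prodS f xs))

  ι-powS : ∀ f k → ι (powS f k) ≈ ι f ^ k
  ι-powS f zero = ι-1
  ι-powS f (suc k) = trans (ι-* _ _) (*-congˡ (ι-powS f k))

  ι-⊖ : ∀ f g → ι (f ⊖ g) ≈ ι f - ι g
  ι-⊖ f g = trans (ι-+ f (negS g)) (+-congˡ (ι-neg g))

  ι-1-mono : ∀ k → ι (oneS ⊖ mono k) ≈ 1# - ξ (+ k)
  ι-1-mono k = trans (ι-⊖ oneS (mono k)) (+-cong ι-1 (-‿cong (ι-mono k)))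

  ι-inverse : ∀ f → f 0 ≡ 1ℤ → ι f * ι (invU f) ≈ 1#
  ι-inverse f e = trans (sym (ι-* f (invU f))) (trans (ι-cong (invU-inverse f e)) ι-1)

  ι-recip : ∀ k → ι (invU (oneS ⊖ mono (suc k))) ≈ τ (+ suc k)
  ι-recip k = unit-cancel (τ-inverse (+ suc k) (λ ())) (trans (*-comm _ _) (trans (*-congʳ (sym (ι-1-mono (suc k))))
    (trans (ι-inverse (oneS ⊖ mono (suc k)) P.refl) (sym (τ-inverse (+ suc k) (λ ()))))))

  ξ-multiple : ∀ k n → ξ (+ (k N.* n)) ≈ ξ (+ n) ^ k
  ξ-multiple zero n = ξ-0
  ξ-multiple (suc k) n = trans (ξ-ℕ n (k N.* n)) (*-congˡ (ξ-multiple k n))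

  ξ-2p : ξ (+ (2 N.* p)) ≈ t
  ξ-2p = trans (ξ-multiple 2 p) (*-congˡ (*-identityʳ s))

  φ-fraction : ∀ d → d ≢ 0ℤ → φ d ≈ (1# - t * ξ d) * τ d
  φ-fraction d n = begin
    t + (1# - t) * τ d ≈⟨ +-congʳ (sym (trans (*-congˡ (τ-inverse d n)) (*-identityʳ t))) ⟩
    t * (τ d * (1# - ξ d)) + (1# - t) * τ d ≈⟨ solve 3 (λ t w x → t :* (w :* (con (+ 1) :- x)) :+ (con (+ 1) :- t) :* w := (con (+ 1) :- t :* x) :* w) refl t (τ d) (ξ d) ⟩
    (1# - t * ξ d) * τ d ∎

  φ-fraction⁻ : ∀ d → d ≢ 0ℤ → φ (Z.- d) ≈ (t - ξ d) * τ d
  φ-fraction⁻ d n = begin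
    t + (1# - t) * τ (Z.- d) ≈⟨ +-congˡ (*-congˡ (solve 2 (λ a b → b := (a :+ b) :- a) refl (τ d) (τ (Z.- d)))) ⟩
    t + (1# - t) * (τ d + τ (Z.- d) - τ d) ≈⟨ +-congˡ (*-congˡ (+-congʳ (trans (τ-reflect d n) (sym (τ-inverse d n))))) ⟩
    t + (1# - t) * (τ d * (1# - ξ d) - τ d)
      ≈⟨ solve 3 (λ t w x → t :+ (con (+ 1) :- t) :* (w :* (con (+ 1) :- x) :- w) := t :* con (+ 1) :+ (con (+ 1) :- t) :* (:- (w :* x))) refl t (τ d) (ξ d) ⟩
    t * 1# + (1# - t) * - (τ d * ξ d) ≈⟨ +-congʳ (*-congˡ (sym (τ-inverse d n))) ⟩
    t * (τ d * (1# - ξ d)) + (1# - t) * - (τ d * ξ d)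
      ≈⟨ solve 3 (λ t w x → t :* (w :* (con (+ 1) :- x)) :+ (con (+ 1) :- t) :* (:- (w :* x)) := (t :- x) :* w) refl t (τ d) (ξ d) ⟩
    (t - ξ d) * τ d ∎

  v-diff : ∀ a d → v (a N.+ d) Z.- v a ≡ + (2 N.* d)
  v-diff a d = P.trans (P.cong₂ Z._-_ (P.trans (pos-+ 1 (a N.+ d N.+ (a N.+ d))) (P.cong (λ z → 1ℤ Z.+ z) (P.trans (pos-+ (a N.+ d) (a N.+ d)) (P.cong (λ z → z Z.+ z) (pos-+ a d)))))
      (P.trans (pos-+ 1 (a N.+ a)) (P.cong (λ z → 1ℤ Z.+ z) (pos-+ a a))))
    (P.trans (eq (+ a) (+ d)) (P.sym (P.trans (pos-+ d (d N.+ 0)) (P.cong (λ z → + d Z.+ z) (P.cong +_ (NP.+-identityʳ d))))))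
    where
    eq : ∀ a d → 1ℤ Z.+ (a Z.+ d Z.+ (a Z.+ d)) Z.- (1ℤ Z.+ (a Z.+ a)) ≡ d Z.+ d
    eq = solve-∀

  v-diff⁻ : ∀ a d → v a Z.- v (a N.+ d) ≡ Z.- + (2 N.* d)
  v-diff⁻ a d = P.trans (eq (v a) (v (a N.+ d))) (P.cong Z.-_ (v-diff a d))
    where
    eq : ∀ a b → a Z.- b ≡ Z.- (b Z.- a)
    eq = solve-∀

  positive-gap : ∀ {a b} → a < b → ∃ λ k → ∃ λ d → b ≡ a N.+ d × 2 N.* (b N.∸ a) ≡ suc k × 2 N.* d ≡ suc k
  positive-gap {a} {b} q = 2 N.* d N.∸ 1 , d , P.sym (m+[n∸m]≡n (<⇒≤ q)) , e , e
    where
    d = b N.∸ a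
    e : 2 N.* d ≡ suc (2 N.* d N.∸ 1)
    e = P.sym (m+[n∸m]≡n (≤-trans (m<n⇒0<n∸m q) (m≤m+n d _)))

  ι-pairF : ∀ a b → a ≢ b → ι (pairF 2 (2 N.* p) a b) ≈ φ (v b Z.- v a)
  ι-pairF a b n with <-cmp a b
  ... | tri≈ _ e _ = ⊥-elim (n e)
  ... | tri< q _ _ with positive-gap q
  ...   | k , d , P.refl , e₁ , e₂ rewrite <ᵇ-true q | e₁ = begin
    ι ((oneS ⊖ mono (2 N.* p N.+ suc k)) ⊗ invU (oneS ⊖ mono (suc k))) ≈⟨ ι-* _ _ ⟩
    _ ≈⟨ *-cong (trans (ι-1-mono _) (+-congˡ (-‿cong (trans (ξ-ℕ (2 N.* p) (suc k)) (*-congʳ ξ-2p))))) (ι-recip k) ⟩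
    (1# - t * ξ (+ suc k)) * τ (+ suc k) ≈⟨ sym (φ-fraction (+ suc k) (λ ())) ⟩
    φ (+ suc k) ≡⟨ P.cong φ (P.trans (P.cong +_ (P.sym e₂)) (P.sym (v-diff a d))) ⟩
    φ (v (a N.+ d) Z.- v a) ∎
  ι-pairF a b n | tri> _ _ q with positive-gap q
  ...   | k , d , P.refl , e₁ , e₂ rewrite <ᵇ-false (<⇒≤ q) | e₁ = begin
    ι ((mono (2 N.* p) ⊖ mono (suc k)) ⊗ invU (oneS ⊖ mono (suc k))) ≈⟨ ι-* _ _ ⟩
    _ ≈⟨ *-cong (trans (ι-⊖ _ _) (+-cong (trans (ι-mono _) ξ-2p) (-‿cong (ι-mono (suc k))))) (ι-recip k) ⟩
    (t - ξ (+ suc k)) * τ (+ suc k) ≈⟨ sym (φ-fraction⁻ (+ suc k) (λ ())) ⟩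
    φ (Z.- + suc k) ≡⟨ P.cong φ (P.trans (P.cong (λ z → Z.- + z) (P.sym e₂)) (P.sym (v-diff⁻ b d))) ⟩
    φ (v b Z.- v (b N.+ d)) ∎

  ι-pairProd : ∀ σ → AllPairs _≢_ σ → ι (pairProd 2 (2 N.* p) σ) ≈ PP σ
  ι-pairProd [] _ = ι-1
  ι-pairProd (a ∷ r) (n ∷ ns) = trans (ι-* _ _) (*-cong (trans (ι-prodS _ r) (∏-cong∈ n (λ b q → ι-pairF a b q))) (ι-pairProd r ns))

  ι-monomial : ∀ σ w → length σ ≡ length w → ι (mono (sumℕ w N.+ 2 N.* sumℕ (zipWith N._*_ σ w))) ≈ monomial σ w
  ι-monomial [] [] e = ι-1
  ι-monomial (a ∷ σ) (k ∷ w) e = begin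
    ι (mono (k N.+ sumℕ w N.+ 2 N.* (a N.* k N.+ Z))) ≡⟨ P.cong (λ z → ι (mono z)) (eq k (sumℕ w) a Z) ⟩
    ι (mono (k N.* suc (a N.+ a) N.+ (sumℕ w N.+ 2 N.* Z))) ≈⟨ trans (ι-mono _) (ξ-ℕ (k N.* suc (a N.+ a)) _) ⟩
    ξ (+ (k N.* suc (a N.+ a))) * ξ (+ (sumℕ w N.+ 2 N.* Z))
      ≈⟨ *-cong (ξ-multiple k (suc (a N.+ a))) (trans (sym (ι-mono _)) (ι-monomial σ w (suc-injective e))) ⟩
    ξ (v a) ^ k * monomial σ w ∎
    where
    Z = sumℕ (zipWith N._*_ σ w)
    eq : ∀ k w a z → k N.+ w N.+ 2 N.* (a N.* k N.+ z) ≡ k N.* suc (a N.+ a) N.+ (w N.+ 2 N.* z)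
    eq = ℕ-solve-∀

  qint-geometric : ∀ c → qint c * (1# - t) ≈ 1# - t ^ c
  qint-geometric zero = trans (zeroˡ _) (sym (-‿inverseʳ 1#))
  qint-geometric (suc c) = begin
    (1# + t * qint c) * (1# - t) ≈⟨ solve 2 (λ t q → (con (+ 1) :+ t :* q) :* (con (+ 1) :- t) := (con (+ 1) :- t) :+ t :* (q :* (con (+ 1) :- t))) refl t (qint c) ⟩
    (1# - t) + t * (qint c * (1# - t)) ≈⟨ +-congˡ (*-congˡ (qint-geometric c)) ⟩
    (1# - t) + t * (1# - t ^ c) ≈⟨ solve 2 (λ t x → (con (+ 1) :- t) :+ t :* (con (+ 1) :- x) := con (+ 1) :- t :* x) refl t (t ^ c) ⟩
    1# - t ^ suc c ∎

  ι-poch-t : ∀ c → ι (poch 1ℤ (2 N.* p) (2 N.* p) c) ≈ (1# - t) ^ c * qfact c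
  ι-poch-t c = trans (ι-prodS _ (upTo c)) (go c)
    where
    factor : ∀ j → ι (oneS ⊖ (1ℤ ·S mono (2 N.* p N.+ 2 N.* p N.* j))) ≈ 1# - t ^ suc j
    factor j = trans (ι-⊖ _ _) (+-cong ι-1 (-‿cong (trans (ι-cong (λ N → ZP.*-identityˡ _)) (trans (ι-mono _)
      (trans (cong≈ (λ z → ξ (+ z)) (P.trans (P.cong (2 N.* p N.+_) (NP.*-comm (2 N.* p) j)) P.refl)) (trans (ξ-multiple (suc j) (2 N.* p)) (^-cong (suc j) ξ-2p)))))))
    go : ∀ c → ∏ (λ j → ι (oneS ⊖ (1ℤ ·S mono (2 N.* p N.+ 2 N.* p N.* j)))) (upTo c) ≈ (1# - t) ^ c * qfact c
    go zero = sym (*-identityˡ _)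
    go (suc c) = trans (∏-upTo-snoc _ c) (trans (*-cong (go c) (trans (factor c) (sym (qint-geometric (suc c)))))
      (solve 4 (λ a b q d → a :* b :* (q :* d) := d :* a :* (b :* q)) refl _ _ _ _))

  ι-poch-s : ∀ c → ι (poch (Z.- 1ℤ) p p c) ≈ levelWeight c
  ι-poch-s c = trans (ι-prodS _ (upTo c)) (go c)
    where
    factor : ∀ j → ι (oneS ⊖ ((Z.- 1ℤ) ·S mono (p N.+ p N.* j))) ≈ 1# + s ^ suc j
    factor j = trans (ι-cong (λ N → P.cong (λ z → oneS N Z.+ z) (P.trans (P.cong Z.-_ (-1*i≡-i (mono (p N.+ p N.* j) N))) (neg-involutive _))))
      (trans (ι-+ oneS (mono (p N.+ p N.* j))) (+-cong ι-1 (trans (ι-mono _) (trans (cong≈ (λ z → ξ (+ z)) (P.cong (p N.+_) (NP.*-comm p j))) (ξ-multiple (suc j) p)))))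
    go : ∀ c → ∏ (λ j → ι (oneS ⊖ ((Z.- 1ℤ) ·S mono (p N.+ p N.* j)))) (upTo c) ≈ levelWeight c
    go zero = refl
    go (suc c) = trans (∏-upTo-snoc _ c) (*-cong (go c) (factor c))

-- The left-hand side over a finite alphabet

sumℕ-++ : ∀ xs ys → sumℕ (xs ++ ys) ≡ sumℕ xs N.+ sumℕ ys
sumℕ-++ [] ys = P.refl
sumℕ-++ (x ∷ xs) ys = P.trans (P.cong (x N.+_) (sumℕ-++ xs ys)) (P.sym (NP.+-assoc x _ _))

sumℕ-word : ∀ c m xs → sumℕ (replicate c (suc m) ++ xs) ≡ c N.* suc m N.+ sumℕ xs
sumℕ-word c m xs = P.trans (sumℕ-++ (replicate c (suc m)) xs) (P.cong (N._+ sumℕ xs) (go c))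
  where
  go : ∀ c → sumℕ (replicate c (suc m)) ≡ c N.* suc m
  go zero = P.refl
  go (suc c) = P.cong (suc m N.+_) (go c)

sumℕ-zeros : ∀ k → sumℕ (replicate k 0) ≡ 0
sumℕ-zeros zero = P.refl
sumℕ-zeros (suc k) = sumℕ-zeros k

sumℕ-bound : ∀ xs → All (_≤ sumℕ xs) xs
sumℕ-bound [] = []
sumℕ-bound (x ∷ xs) = m≤m+n x _ ∷ All.map (λ q → ≤-trans q (m≤n+m _ x)) (sumℕ-bound xs)

upTo-unique : ∀ k → AllPairs _≢_ (upTo k)
upTo-unique k = go k id (λ q → q)
  where
  go : ∀ k (f : ℕ → ℕ) → (∀ {i j} → i < j → f i < f j) → AllPairs _≢_ (applyUpTo f k)
  go zero f mono = []
  go (suc k) f mono = Allₚ.applyUpTo⁺₂ _ k (λ i → <⇒≢ (mono (s≤s z≤n))) ∷ go k (λ i → f (suc i)) (λ q → mono (s≤s q))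

One : Series → Set
One f = f 0 ≡ 1ℤ

One-⊗ : ∀ {f g} → One f → One g → One (f ⊗ g)
One-⊗ {f} {g} e e' = P.trans (⊗-zero f g) (P.cong₂ Z._*_ e e')

One-prodS : ∀ {A : Set} (f : A → Series) xs → (∀ x → One (f x)) → One (prodS (map f xs))
One-prodS f [] e = P.refl
One-prodS f (x ∷ xs) e = One-⊗ {f x} {prodS (map f xs)} (e x) (One-prodS f xs e)

One-powS : ∀ f k → One f → One (powS f k)
One-powS f zero e = P.refl
One-powS f (suc k) e = One-⊗ {f} {powS f k} e (One-powS f k e)

One-1-c·mono : ∀ c k → 0 < k → One (oneS ⊖ (c ·S mono k))
One-1-c·mono c (suc k) q = P.cong (λ z → 1ℤ Z.+ Z.- z) (ZP.*-zeroʳ c)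

One-poch : ∀ c e d k → 0 < e → One (poch c e d k)
One-poch c e d k q = One-prodS _ (upTo k) (λ j → One-1-c·mono c (e N.+ d N.* j) (≤-trans q (m≤m+n e _)))

module SeriesTerm (SE : SeriesExtension) (p : ℕ) (0<p : 0 < p) where
  open SeriesHallLittlewood SE p public
  open SeriesExtension SE public using (L; ι; ι-cong; ι-injective; ι-+; ι-*; ι-neg; ι-0; ι-1; ι-mono)

  alphabet : ℕ → List ℤ
  alphabet K = map v (upTo K)

  alphabet-odds : ∀ K → alphabet K ≡ pos⁺ (oddsFrom 1 K)
  alphabet-odds K = P.trans (go K 0 id (λ i → P.refl)) P.refl
    where
    go : ∀ K a (f : ℕ → ℕ) → (∀ i → f i ≡ a N.+ i) → map v (applyUpTo f K) ≡ pos⁺ (oddsFrom (suc (a N.+ a)) K)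
    go zero a f e = P.refl
    go (suc K) a f e = P.cong₂ _∷_ (P.cong v (P.trans (e 0) (NP.+-identityʳ a)))
      (P.trans (go K (suc a) (λ i → f (suc i)) (λ i → P.trans (e (suc i)) (+-suc a i)))
        (P.cong (λ x → pos⁺ (oddsFrom x K)) (eq a)))
      where
      eq : ∀ a → suc (suc a N.+ suc a) ≡ suc (a N.+ a) N.+ 2
      eq = ℕ-solve-∀

  alphabet-Good : ∀ K → Good (alphabet K)
  alphabet-Good K = P.subst Good (P.sym (alphabet-odds K)) (ascending-Good (oddsFrom-ascending 1 K) (oddsFrom-≥ 1 K))

  0<2p : 0 < 2 N.* p
  0<2p = ≤-trans 0<p (m≤m+n p _)

  One-1-t : One (oneS ⊖ mono (2 N.* p))
  One-1-t with 2 N.* p | 0<2p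
  ... | suc k | _ = P.refl

  One-vHL : ∀ K λ' → One (vHL (2 N.* p) K λ')
  One-vHL K λ' = One-⊗ {prodS (map (poch 1ℤ (2 N.* p) (2 N.* p)) ms)} {invU (powS (oneS ⊖ mono (2 N.* p)) (sumℕ ms))}
    (One-prodS (poch 1ℤ (2 N.* p) (2 N.* p)) ms (λ c → One-poch 1ℤ (2 N.* p) (2 N.* p) c 0<2p)) P.refl
    where ms = map (λ i → mult i (padTo K λ')) (upTo (suc (sumℕ λ')))

  ∏-^-sum : ∀ a cs → ∏ (λ c → a ^ c) cs ≈ a ^ sumℕ cs
  ∏-^-sum a [] = refl
  ∏-^-sum a (c ∷ cs) = trans (*-congˡ (∏-^-sum a cs)) (sym (^-+ a c (sumℕ cs)))

  ι-vHL : ∀ K λ' → ι (vHL (2 N.* p) K λ') ≈ ∏ (λ i → qfact (mult i (padTo K λ'))) (upTo (suc (sumℕ λ')))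
  ι-vHL K λ' = begin
    ι (vHL (2 N.* p) K λ') ≈⟨ ι-* _ _ ⟩
    ι (prodS (map (poch 1ℤ (2 N.* p) (2 N.* p)) ms)) * inverse
      ≈⟨ *-congʳ (trans (ι-prodS _ ms) (trans (∏-cong ms ι-poch-t) (trans (∏-* _ _ ms) (*-congʳ (∏-^-sum _ ms))))) ⟩
    (1# - t) ^ sumℕ ms * ∏ qfact ms * inverse ≈⟨ xy∙z≈xz∙y _ _ _ ⟩
    (1# - t) ^ sumℕ ms * inverse * ∏ qfact ms
      ≈⟨ *-congʳ (trans (*-congʳ (trans (^-cong (sumℕ ms) (sym (trans (ι-1-mono _) (+-congˡ (-‿cong ξ-2p))))) (sym (ι-powS _ (sumℕ ms)))))
           (ι-inverse _ (One-powS (oneS ⊖ mono (2 N.* p)) (sumℕ ms) One-1-t))) ⟩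
    1# * ∏ qfact ms ≈⟨ trans (*-identityˡ _) (∏-map qfact _ (upTo (suc (sumℕ λ')))) ⟩
    ∏ (λ i → qfact (mult i (padTo K λ'))) (upTo (suc (sumℕ λ'))) ∎
    where
    ms = map (λ i → mult i (padTo K λ')) (upTo (suc (sumℕ λ')))
    inverse = ι (invU (powS (oneS ⊖ mono (2 N.* p)) (sumℕ ms)))

  ∏-extend : ∀ (f : ℕ → C) a d → (∀ i → a ≤ i → f i ≈ 1#) → ∏ f (upTo (a N.+ d)) ≈ ∏ f (upTo a)
  ∏-extend f a zero e = cong≈ (λ k → ∏ f (upTo k)) (NP.+-identityʳ a)
  ∏-extend f a (suc d) e = trans (cong≈ (λ k → ∏ f (upTo k)) (+-suc a d))
    (trans (∏-upTo-snoc f (a N.+ d)) (trans (*-cong (∏-extend f a d e) (e (a N.+ d) (m≤m+n a d))) (*-identityʳ _)))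

  word-qfact : ∀ m cs c₀ → length cs ≡ m → ∏ (λ i → qfact (mult i (word m cs ++ replicate c₀ 0))) (upTo (suc m)) ≈ ∏ qfact cs * qfact c₀
  word-qfact zero [] c₀ l = trans (*-identityʳ _) (trans (cong≈ qfact (P.trans (P.cong (mult 0) (P.sym (Lₚ.++-identityʳ (replicate c₀ 0)))) (P.trans (mult-same 0 c₀ []) (NP.+-identityʳ c₀)))) (sym (*-identityˡ _)))
  word-qfact (suc m) (c ∷ cs) c₀ l = begin
    ∏ (λ i → qfact (mult i ((replicate c (suc m) ++ word m cs) ++ zs))) (upTo (suc (suc m)))
      ≈⟨ ∏-cong (upTo (suc (suc m))) (λ i → cong≈ (λ w → qfact (mult i w)) (Lₚ.++-assoc (replicate c (suc m)) (word m cs) zs)) ⟩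
    ∏ (λ i → qfact (mult i (replicate c (suc m) ++ rest))) (upTo (suc (suc m))) ≈⟨ ∏-upTo-snoc _ (suc m) ⟩
    _ ≈⟨ *-cong (∏-cong∈ (upTo-< (suc m)) (λ i q → cong≈ qfact (mult-other i (suc m) c rest q)))
           (cong≈ qfact (P.trans (mult-same (suc m) c rest) (P.trans (P.cong (c N.+_) (mult-above (suc m) rest
             (Allₚ.++⁺ (All.map s≤s (word-≤ m cs)) (Allₚ.replicate⁺ c₀ (s≤s z≤n))))) (NP.+-identityʳ c)))) ⟩
    _ ≈⟨ *-congʳ (word-qfact m cs c₀ (suc-injective l)) ⟩
    ∏ qfact cs * qfact c₀ * qfact c ≈⟨ solve 3 (λ a b c → a :* b :* c := c :* a :* b) refl _ _ _ ⟩
    ∏ qfact (c ∷ cs) * qfact c₀ ∎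
    where
    zs = replicate c₀ 0
    rest = word m cs ++ zs

  -- The product in v_λ runs up to |λ|, the list of multiplicities up to m. Both are extended to |λ|
  -- + m, since part sizes that do not occur contribute 1.
  ι-vHL-word : ∀ K m cs → length cs ≡ m → let λ' = word m cs in
    ι (vHL (2 N.* p) K λ') ≈ ∏ qfact cs * qfact (K N.∸ sumℕ cs)
  ι-vHL-word K m cs l = begin
    ι (vHL (2 N.* p) K λ') ≈⟨ ι-vHL K λ' ⟩
    ∏ f (upTo (suc (sumℕ λ'))) ≈⟨ sym (∏-extend f (suc (sumℕ λ')) m (λ i q → absent i (Allₚ.++⁺ (All.map (λ r → ≤-trans (s≤s r) q) (sumℕ-bound λ')) (Allₚ.replicate⁺ c₀ (≤-trans (s≤s z≤n) q))))) ⟩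
    ∏ f (upTo (suc (sumℕ λ' N.+ m))) ≡⟨ P.cong (λ k → ∏ f (upTo (suc k))) (NP.+-comm (sumℕ λ') m) ⟩
    ∏ f (upTo (suc (m N.+ sumℕ λ'))) ≈⟨ ∏-extend f (suc m) (sumℕ λ') (λ i q → absent i (Allₚ.++⁺ (All.map (λ r → ≤-trans (s≤s r) q) (word-≤ m cs)) (Allₚ.replicate⁺ c₀ (≤-trans (s≤s z≤n) q)))) ⟩
    ∏ f (upTo (suc m)) ≈⟨ word-qfact m cs c₀ l ⟩
    ∏ qfact cs * qfact c₀ ≡⟨ P.cong (λ k → ∏ qfact cs * qfact (K N.∸ k)) (word-length m cs l) ⟩
    ∏ qfact cs * qfact (K N.∸ sumℕ cs) ∎
    where
    λ' = word m cs
    c₀ = K N.∸ length λ'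
    f : ℕ → C
    f i = qfact (mult i (padTo K λ'))
    absent : ∀ i → All (_< i) (padTo K λ') → f i ≈ 1#
    absent i q = cong≈ qfact (mult-above i (padTo K λ') q)

  -- v_λ cancels the t-factorials produced by the blocks of equal parts, including the block of
  -- zeros.
  ι-HLspec : ∀ K m cs → length cs ≡ m → sumℕ cs ≤ K →
    ι (mono (sumℕ (word m cs)) ⊗ HLspec 2 (2 N.* p) (word m cs) K) ≈ chain m cs 𝟙 (alphabet K)
  ι-HLspec K m cs l le rewrite <ᵇ-false (P.subst (_≤ K) (P.sym (word-length m cs l)) le) = begin
    ι (mono N ⊗ (invU vh ⊗ sumS (map term (perms (upTo K))))) ≈⟨ trans (ι-* _ _) (*-congˡ (trans (ι-* _ _) (*-congˡ (ι-sumS term (perms (upTo K)))))) ⟩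
    ι (mono N) * (ι (invU vh) * ∑ (λ σ → ι (term σ)) (perms (upTo K))) ≈⟨ x∙yz≈y∙xz _ _ _ ⟩
    ι (invU vh) * (ι (mono N) * ∑ (λ σ → ι (term σ)) (perms (upTo K)))
      ≈⟨ *-congˡ (trans (sym (∑-*ˡ _ _ (perms (upTo K)))) (∑-cong∈ (perms-↭ (upTo K)) each)) ⟩
    ι (invU vh) * ∑ (λ σ → monomial σ (word m cs ++ replicate (K N.∸ sumℕ cs) 0) * PP σ) (perms (upTo K))
      ≡⟨ P.cong (λ k → ι (invU vh) * ∑ (λ σ → monomial σ (word m cs ++ replicate (k N.∸ sumℕ cs) 0) * PP σ) (perms (upTo K))) (P.sym (Lₚ.length-upTo K)) ⟩
    ι (invU vh) * ∑ (λ σ → monomial σ (word m cs ++ replicate (length (upTo K) N.∸ sumℕ cs) 0) * PP σ) (perms (upTo K))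
      ≈⟨ *-congˡ (perms-word m cs (upTo K) l (Lₚ.length-map v (upTo K)) (alphabet-Good K) (P.subst (sumℕ cs ≤_) (P.sym (Lₚ.length-upTo K)) le)) ⟩
    ι (invU vh) * (∏ qfact cs * qfact (length (upTo K) N.∸ sumℕ cs) * chain m cs 𝟙 (alphabet K))
      ≈⟨ *-congˡ (*-congʳ (trans (cong≈ (λ k → ∏ qfact cs * qfact (k N.∸ sumℕ cs)) (Lₚ.length-upTo K)) (sym (ι-vHL-word K m cs l)))) ⟩
    ι (invU vh) * (ι vh * chain m cs 𝟙 (alphabet K)) ≈⟨ x∙yz≈yx∙z _ _ _ ⟩
    ι vh * ι (invU vh) * chain m cs 𝟙 (alphabet K) ≈⟨ *-congʳ (ι-inverse vh (One-vHL K (word m cs))) ⟩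
    1# * chain m cs 𝟙 (alphabet K) ≈⟨ *-identityˡ _ ⟩
    chain m cs 𝟙 (alphabet K) ∎
    where
    N = sumℕ (word m cs)
    vh = vHL (2 N.* p) K (word m cs)
    pad = padTo K (word m cs)
    term : List ℕ → Series
    term σ = mono (2 N.* sumℕ (zipWith N._*_ σ pad)) ⊗ pairProd 2 (2 N.* p) σ
    pad-sum : sumℕ pad ≡ N
    pad-sum = P.trans (sumℕ-++ (word m cs) _) (P.trans (P.cong (N N.+_) (sumℕ-zeros (K N.∸ length (word m cs)))) (NP.+-identityʳ N))
    pad-length : length pad ≡ K
    pad-length = P.trans (Lₚ.length-++ (word m cs)) (P.trans (P.cong (length (word m cs) N.+_) (Lₚ.length-replicate (K N.∸ length (word m cs))))
      (m+[n∸m]≡n (P.subst (_≤ K) (P.sym (word-length m cs l)) le)))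
    each : ∀ σ → σ ↭ upTo K → ι (mono N) * ι (term σ) ≈ monomial σ (word m cs ++ replicate (K N.∸ sumℕ cs) 0) * PP σ
    each σ q = begin
      ι (mono N) * ι (term σ) ≈⟨ *-congˡ (ι-* _ _) ⟩
      ι (mono N) * (ι (mono Z) * ι (pairProd 2 (2 N.* p) σ)) ≈⟨ sym (*-assoc _ _ _) ⟩
      ι (mono N) * ι (mono Z) * ι (pairProd 2 (2 N.* p) σ)
        ≈⟨ *-cong (trans (sym (ι-* _ _)) (trans (ι-cong (λ i → P.sym (mono-+ N Z i))) (cong≈ (λ k → ι (mono (k N.+ Z))) (P.sym pad-sum))))
             (ι-pairProd σ (AllPairs-resp-↭ (λ n e → n (P.sym e)) (↭-sym q) (upTo-unique K))) ⟩
      ι (mono (sumℕ pad N.+ Z)) * PP σ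
        ≈⟨ *-congʳ (ι-monomial σ pad (P.trans (length-↭ q) (P.trans (Lₚ.length-upTo K) (P.sym pad-length)))) ⟩
      monomial σ pad * PP σ ≡⟨ P.cong (λ k → monomial σ (word m cs ++ replicate (K N.∸ k) 0) * PP σ) (word-length m cs l) ⟩
      monomial σ (word m cs ++ replicate (K N.∸ sumℕ cs) 0) * PP σ ∎
      where Z = 2 N.* sumℕ (zipWith N._*_ σ pad)

  -- Matches the convention that P_λ vanishes when λ has more parts than there are variables.
  chain-overfull : ∀ m cs S → length cs ≡ m → length S < sumℕ cs → chain m cs 𝟙 S ≈ 0#
  chain-overfull (suc m) (c ∷ cs) S l q = trans (∑split-cong S each) (∑split-0 S)
    where
    each : ∀ I J → S ↭ I ++ J → 𝒜 I J * (lev (suc m) c I * chain m cs 𝟙 J) ≈ 0#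
    each I J r with c N.≟ length I
    ... | no n = trans (*-congˡ (trans (*-congʳ (trans (*-congˡ (reflexive (ind-other c (length I) n))) (zeroʳ _))) (zeroˡ _))) (zeroʳ _)
    ... | yes P.refl = trans (*-congˡ (trans (*-congˡ (chain-overfull m cs J (suc-injective l)
        (+-cancelˡ-< (length I) _ _ (P.subst (_< length I N.+ sumℕ cs) (P.trans (length-↭ r) (Lₚ.length-++ I)) q)))) (zeroʳ _))) (zeroʳ _)

  levelFactors : ℕ → List ℕ → Series
  levelFactors m λ' = prodS (map (λ i → poch (Z.- 1ℤ) p p (mult i λ')) (range 1 (m N.∸ 1)))

  countWeight-∏ : ∀ w m cs → length cs ≡ m → ∏ (λ i → w (suc i) (mult (suc i) (word m cs))) (upTo m) ≈ countWeight w m cs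
  countWeight-∏ w zero [] l = refl
  countWeight-∏ w (suc m) (c ∷ cs) l = trans (∏-upTo-snoc _ m) (trans (*-cong
      (trans (∏-cong∈ (upTo-< m) (λ i q → cong≈ (w (suc i)) (mult-other (suc i) (suc m) c (word m cs) (s≤s q)))) (countWeight-∏ w m cs (suc-injective l)))
      (cong≈ (w (suc m)) (P.trans (mult-same (suc m) c (word m cs)) (P.trans (P.cong (c N.+_) (mult-above (suc m) (word m cs) (All.map s≤s (word-≤ m cs)))) (NP.+-identityʳ c)))))
    (*-comm _ _))

  ι-levelFactors : ∀ m cs → length cs ≡ suc m → ι (levelFactors (suc m) (word (suc m) cs)) ≈ countWeight (bounded-weight (suc m)) (suc m) cs
  ι-levelFactors m cs l = begin
    ι (levelFactors (suc m) λ') ≈⟨ ι-prodS _ (range 1 m) ⟩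
    ∏ (λ i → ι (poch (Z.- 1ℤ) p p (mult i λ'))) (map (1 N.+_) (upTo m)) ≈⟨ trans (∏-map _ (1 N.+_) (upTo m)) (∏-cong∈ (upTo-< m) (λ i q → trans (ι-poch-s (mult (suc i) λ'))
        (cong≈ (λ b → if b then 1# else levelWeight (mult (suc i) λ')) (P.sym (≡ᵇ-other q))))) ⟩
    ∏ f (upTo m) ≈⟨ sym (*-identityʳ _) ⟩
    ∏ f (upTo m) * 1# ≈⟨ *-congˡ (cong≈ (λ b → if b then 1# else levelWeight (mult (suc m) λ')) (P.sym (≡ᵇ-refl m))) ⟩
    ∏ f (upTo m) * f m ≈⟨ sym (∏-upTo-snoc f m) ⟩
    ∏ f (upTo (suc m)) ≈⟨ countWeight-∏ (bounded-weight (suc m)) (suc m) cs l ⟩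
    countWeight (bounded-weight (suc m)) (suc m) cs ∎
    where
    λ' = word (suc m) cs
    f : ℕ → C
    f i = bounded-weight (suc m) (suc i) (mult (suc i) λ')

  finiteTerm : ℕ → ℕ → List ℕ → Series
  finiteTerm m K λ' = mono (sumℕ λ') ⊗ levelFactors m λ' ⊗ HLspec 2 (2 N.* p) λ' K

  ι-finiteTerm : ∀ m K cs → length cs ≡ suc m →
    ι (finiteTerm (suc m) K (word (suc m) cs)) ≈ countWeight (bounded-weight (suc m)) (suc m) cs * chain (suc m) cs 𝟙 (alphabet K)
  ι-finiteTerm m K cs l = trans (ι-* (mono (sumℕ λ') ⊗ levelFactors (suc m) λ') hl) (trans (*-congʳ (ι-* (mono (sumℕ λ')) (levelFactors (suc m) λ')))
    (trans (xy∙z≈y∙xz _ _ _)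
    (*-cong (ι-levelFactors m cs l) (trans (sym (ι-* (mono (sumℕ λ')) hl)) here))))
    where
    λ' = word (suc m) cs
    hl = HLspec 2 (2 N.* p) λ' K
    here : ι (mono (sumℕ (word (suc m) cs)) ⊗ HLspec 2 (2 N.* p) (word (suc m) cs) K) ≈ chain (suc m) cs 𝟙 (alphabet K)
    here with ≤-<-connex (sumℕ cs) K
    ... | inj₁ le = ι-HLspec K (suc m) cs l le
    ... | inj₂ lt = trans (ι-cong vanish) (trans ι-0 (sym (chain-overfull (suc m) cs (alphabet K) l (P.subst (_< sumℕ cs) (P.sym (P.trans (Lₚ.length-map v (upTo K)) (Lₚ.length-upTo K))) lt))))
      where
      vanish : (mono (sumℕ (word (suc m) cs)) ⊗ HLspec 2 (2 N.* p) (word (suc m) cs) K) ≋ zeroS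
      vanish N rewrite <ᵇ-true (P.subst (K <_) (P.sym (word-length (suc m) cs l)) lt) =
        P.trans (⊗-comm N (mono (sumℕ (word (suc m) cs))) zeroS) (⊗-zeroˡ N (mono (sumℕ (word (suc m) cs))))

  finiteSum : ℕ → ℕ → Series
  finiteSum m K = RingKit.∑counts powerSeries K m (λ cs → finiteTerm m K (word m cs))

  ι-∑counts : ∀ N m f → ι (RingKit.∑counts powerSeries N m f) ≈ ∑counts N m (λ cs → ι (f cs))
  ι-∑counts N zero f = refl
  ι-∑counts N (suc m) f = trans (go (upTo (suc N))) (∑-cong (upTo (suc N)) (λ c → ι-∑counts N m (λ cs → f (c ∷ cs))))
    where
    go : ∀ xs → ι (RingKit.∑ powerSeries (λ c → RingKit.∑counts powerSeries N m (λ cs → f (c ∷ cs))) xs) ≈ ∑ (λ c → ι (RingKit.∑counts powerSeries N m (λ cs → f (c ∷ cs)))) xs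
    go [] = ι-0
    go (x ∷ xs) = trans (ι-+ _ _) (+-congˡ (go xs))

  ι-finiteSum : ∀ m K → ι (finiteSum (suc m) K) ≈ W (suc m) (alphabet K)
  ι-finiteSum m K = begin
    ι (finiteSum (suc m) K) ≈⟨ ι-∑counts K (suc m) (λ cs → finiteTerm (suc m) K (word (suc m) cs)) ⟩
    ∑counts K (suc m) (λ cs → ι (finiteTerm (suc m) K (word (suc m) cs))) ≈⟨ ∑counts-cong K (suc m) (λ cs l _ → ι-finiteTerm m K cs l) ⟩
    ∑counts K (suc m) (λ cs → countWeight (bounded-weight (suc m)) (suc m) cs * chain (suc m) cs 𝟙 (alphabet K))
      ≈⟨ ∑counts-chain (bounded-weight (suc m)) K (suc m) 𝟙 (alphabet K) (≤-reflexive (P.trans (Lₚ.length-map v (upTo K)) (Lₚ.length-upTo K))) ⟩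
    tower (bounded-weight (suc m)) (suc m) 𝟙 (alphabet K) ≈⟨ tower-bounded m (alphabet K) (alphabet-Good K) ⟩
    W (suc m) (alphabet K) ∎

-- Divisibility by powers of x

module Divisibility (SE : SeriesExtension) where
  open SeriesExtension SE using (L; ι; ι-cong; ι-injective; ι-+; ι-*; ι-neg; ι-0; ι-1; ι-mono)
  open LaurentKit L

  -- u lies in xᵏ ℤ[[x]].
  Div : ℕ → C → Set
  Div k u = Σ Series λ f → u ≈ ξ (+ k) * ι f

  Div-cong : ∀ {k u w} → u ≈ w → Div k u → Div k w
  Div-cong e (f , q) = f , trans (sym e) q

  Div-0 : ∀ k → Div k 0#
  Div-0 k = zeroS , sym (trans (*-congˡ ι-0) (zeroʳ _))

  Div-+ : ∀ {k u w} → Div k u → Div k w → Div k (u + w)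
  Div-+ (f , q) (g , r) = f ⊕ g , trans (+-cong q r) (trans (sym (distribˡ _ _ _)) (*-congˡ (sym (ι-+ f g))))

  Div-neg : ∀ {k u} → Div k u → Div k (- u)
  Div-neg (f , q) = negS f , trans (-‿cong q) (trans (-‿distribʳ-* _ _) (*-congˡ (sym (ι-neg f))))

  Div-* : ∀ {k l u w} → Div k u → Div l w → Div (k N.+ l) (u * w)
  Div-* {k} {l} (f , q) (g , r) = f ⊗ g , trans (*-cong q r) (trans (*-interchange _ _ _ _) (*-cong (sym (ξ-ℕ k l)) (sym (ι-* f g))))

  Div-ξ : ∀ k → Div k (ξ (+ k))
  Div-ξ k = oneS , sym (trans (*-congˡ ι-1) (*-identityʳ _))

  Div-ι : ∀ f → Div 0 (ι f)
  Div-ι f = f , sym (trans (*-congʳ ξ-0) (*-identityˡ _))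

  Div-1 : Div 0 1#
  Div-1 = Div-cong ι-1 (Div-ι oneS)

  Div-≤ : ∀ {k l u} → k ≤ l → Div l u → Div k u
  Div-≤ {k} {l} q (f , r) = mono (l N.∸ k) ⊗ f , trans r (trans (*-congʳ (trans (cong≈ (λ z → ξ (+ z)) (P.sym (m+[n∸m]≡n q))) (ξ-ℕ k (l N.∸ k))))
    (trans (*-assoc _ _ _) (*-congˡ (trans (*-congʳ (sym (ι-mono _))) (sym (ι-* _ _))))))

  Div-≡ : ∀ {k l u} → k ≡ l → Div k u → Div l u
  Div-≡ P.refl d = d

  Div-*ˡ : ∀ {k u w} → Div 0 u → Div k w → Div k (u * w)
  Div-*ˡ d e = Div-* d e

  Div-*ʳ : ∀ {k u w} → Div k u → Div 0 w → Div k (u * w)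
  Div-*ʳ {k} d e = Div-≡ (NP.+-identityʳ k) (Div-* d e)

  Div-∏ : ∀ {A : Set} {f : A → C} {xs} → All (λ x → Div 0 (f x)) xs → Div 0 (∏ f xs)
  Div-∏ [] = Div-1
  Div-∏ (d ∷ ds) = Div-* d (Div-∏ ds)

  Div-^ : ∀ {k u} n → Div k u → Div (n N.* k) (u ^ n)
  Div-^ zero d = Div-1
  Div-^ (suc n) d = Div-* d (Div-^ n d)

  Div-vanishes : ∀ k f → Div k (ι f) → ∀ N → N < k → f N ≡ 0ℤ
  Div-vanishes k f (g , q) N r = P.trans (ι-injective (trans q (trans (*-congʳ (sym (ι-mono k))) (sym (ι-* (mono k) g)))) N) (mono-below k g N r)

-- Stability in the number of variables

module Stability (SE : SeriesExtension) (p : ℕ) (0<p : 0 < p) where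
  open SeriesTerm SE p 0<p public
  open Divisibility SE public

  Positive : ℤ → Set
  Positive e = ∃ λ k → e ≡ + suc k

  Div-t : Div 0 t
  Div-t = Div-≤ z≤n (Div-* (Div-ξ p) (Div-ξ p))

  Div-τ : ∀ d → d ≢ 0ℤ → Div 0 (τ d)
  Div-τ (+ zero) n = ⊥-elim (n P.refl)
  Div-τ (+ suc k) n = Div-cong (ι-recip k) (Div-ι _)
  Div-τ -[1+ k ] n = Div-cong (trans (+-congʳ (sym (τ-reflect (+ suc k) (λ ())))) (solve 2 (λ a b → a :+ b :- a := b) refl _ _)) (Div-+ Div-1 (Div-neg (Div-τ (+ suc k) (λ ()))))

  Div-φ : ∀ d → d ≢ 0ℤ → Div 0 (φ d)
  Div-φ d n = Div-+ Div-t (Div-* (Div-+ Div-1 (Div-neg Div-t)) (Div-τ d n))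

  Div-𝒜 : ∀ I J → Good (I ++ J) → Div 0 (𝒜 I J)
  Div-𝒜 [] J g = Div-1
  Div-𝒜 (i ∷ I) J (u ∷ us , n ∷ ns) = Div-* (Div-∏ (All.map (λ {j} q → Div-φ (j Z.- i) (abs≢⇒-≢0 {j} (λ e → q (P.sym e)))) (Allₚ.++⁻ʳ I u))) (Div-𝒜 I J (us , ns))

  Div-∑split : ∀ {A : Set} k (g : List A → List A → C) S → (∀ I J → S ↭ I ++ J → Div k (g I J)) → Div k (∑split g S)
  Div-∑split k g [] d = d [] [] ↭-refl
  Div-∑split k g (x ∷ S) d = Div-+ (Div-∑split k _ S (λ I J q → d (x ∷ I) J (prep x q)))
    (Div-∑split k _ S (λ I J q → d I (x ∷ J) (↭-trans (prep x q) (↭-sym (shift x I J)))))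

  Div-ξ⁺ : ∀ {e} → Positive e → Div 1 (ξ e)
  Div-ξ⁺ (k , P.refl) = Div-≤ (s≤s z≤n) (Div-ξ (suc k))

  Div-powers : ∀ k I → All Positive I → Div (length I N.* k) (∏ (λ a → ξ a ^ k) I)
  Div-powers k [] _ = Div-1
  Div-powers k (i ∷ I) (q ∷ qs) = Div-* (Div-≡ (NP.*-identityʳ k) (Div-^ k (Div-ξ⁺ q))) (Div-powers k I qs)

  Div-lev : ∀ k c I → All Positive I → Div (c N.* k) (lev k c I)
  Div-lev k c I q with c N.≟ length I
  ... | no n = Div-cong (sym (trans (*-congˡ (reflexive (ind-other c (length I) n))) (zeroʳ _))) (Div-0 _)
  ... | yes P.refl = Div-cong (sym (trans (*-congˡ (reflexive (ind-same (length I)))) (*-identityʳ _))) (Div-powers k I q)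

  Div-chain : ∀ m cs S → Good S → All Positive S → Div (sumℕ (word m cs)) (chain m cs 𝟙 S)
  Div-chain zero cs S g q = Div-1
  Div-chain (suc m) [] S g q = Div-1
  Div-chain (suc m) (c ∷ cs) S g q = Div-≡ (P.sym (sumℕ-word c m (word m cs))) (Div-∑split _ _ S (λ I J r →
    Div-*ˡ (Div-𝒜 I J (Good-↭ r g)) (Div-* (Div-lev (suc m) c I (Allₚ.++⁻ˡ I (All-resp-↭ r q))) (Div-chain m cs J (proj₂ (Good-++⁻ I (Good-↭ r g))) (Allₚ.++⁻ʳ I (All-resp-↭ r q))))))

  ∑split-snoc : ∀ {A : Set} (g : List A → List A → C) S z → ∑split g (S ++ z ∷ []) ≈ ∑split (λ I J → g (I ++ z ∷ []) J + g I (J ++ z ∷ [])) S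
  ∑split-snoc g [] z = refl
  ∑split-snoc g (x ∷ S) z = +-cong (∑split-snoc _ S z) (∑split-snoc _ S z)

  Below : ℕ → ℤ → Set
  Below w e = ∃ λ k → e ≡ + suc k × k < w

  Below-Positive : ∀ {w e} → Below w e → Positive e
  Below-Positive (k , e , _) = k , e

  -- φ (w + 1 - i) - 1 is a multiple of x^(w+1-i), which the factor xⁱ raises to x^(w+1); each of
  -- the remaining entries contributes at least one x.
  Div-new-variable : ∀ w I → All (Below w) I → Div (length I N.+ w) ((∏ (λ i → φ (+ suc w Z.- i)) I - 1#) * ∏ ξ I)
  Div-new-variable w [] _ = Div-cong (sym (trans (*-congʳ (-‿inverseʳ 1#)) (zeroˡ _))) (Div-0 _)
  Div-new-variable w (i ∷ I) ((k , P.refl , k<w) ∷ qs) = Div-cong (sym split) (Div-+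
      (Div-≡ eq (Div-* (Div-*ˡ (Div-+ Div-1 (Div-neg Div-t)) (Div-*ʳ (Div-ξ (suc w)) (Div-τ d d≢0))) (Div-*ˡ (Div-∏ (All.map (λ { (k , P.refl , q) → Div-φ _ (gap q) }) qs)) (Div-≡ (NP.*-identityʳ (length I)) (Div-cong (∏-cong I (λ a → *-identityʳ _)) (Div-powers 1 I (All.map Below-Positive qs)))))))
      (Div-* (Div-ξ⁺ (k , P.refl)) (Div-new-variable w I qs)))
    where
    d = + suc w Z.- + suc k
    eq : suc w N.+ length I ≡ suc (length I N.+ w)
    eq = P.cong suc (NP.+-comm w (length I))
    gap : ∀ {k} → k < w → + suc w Z.- + suc k ≢ 0ℤ
    gap {k} q e = <⇒≢ (s≤s q) (P.sym (+-injective (i-j≡0⇒i≡j (+ suc w) (+ suc k) e)))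
    d≢0 = gap k<w
    φ-1 : (φ d - 1#) * ξ (+ suc k) ≈ (1# - t) * (ξ (+ suc w) * τ d)
    φ-1 = begin
      (t + (1# - t) * τ d - 1#) * ξ (+ suc k) ≈⟨ solve 3 (λ t w x → (t :+ (con (+ 1) :- t) :* w :- con (+ 1)) :* x := (con (+ 1) :- t) :* (w :- con (+ 1)) :* x) refl t (τ d) (ξ (+ suc k)) ⟩
      (1# - t) * (τ d - 1#) * ξ (+ suc k) ≈⟨ *-congʳ (*-congˡ (sym (ξτ d d≢0))) ⟩
      (1# - t) * (ξ d * τ d) * ξ (+ suc k) ≈⟨ solve 4 (λ t a b c → t :* (a :* b) :* c := t :* ((a :* c) :* b)) refl _ _ _ _ ⟩
      (1# - t) * ((ξ d * ξ (+ suc k)) * τ d) ≈⟨ *-congˡ (*-congʳ (trans (sym (ξ-+ d (+ suc k))) (cong≈ ξ (eq₂ (+ suc w) (+ suc k))))) ⟩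
      (1# - t) * (ξ (+ suc w) * τ d) ∎
      where
      eq₂ : ∀ a b → a Z.- b Z.+ b ≡ a
      eq₂ = solve-∀
    split : (φ d * ∏ (λ i → φ (+ suc w Z.- i)) I - 1#) * (ξ (+ suc k) * ∏ ξ I) ≈
      (1# - t) * (ξ (+ suc w) * τ d) * (∏ (λ i → φ (+ suc w Z.- i)) I * ∏ ξ I) + ξ (+ suc k) * ((∏ (λ i → φ (+ suc w Z.- i)) I - 1#) * ∏ ξ I)
    split = trans (solve 4 (λ f P x X → (f :* P :- con (+ 1)) :* (x :* X) := (f :- con (+ 1)) :* x :* (P :* X) :+ x :* ((P :- con (+ 1)) :* X)) refl (φ d) _ (ξ (+ suc k)) _)
      (+-congʳ (*-congʳ φ-1))

  -- The new variable lies either in the current level k, where its power x^(k(w+1)) suffices, or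
  -- further down. In the second case it changes the interaction with the current level, which
  -- `Div-new-variable` controls, and the rest of the chain, by induction.
  Div-chain-difference : ∀ m cs S w → Good (S ++ + suc w ∷ []) → All (Below w) S →
    Div (sumℕ (word m cs) N.+ w) (chain m cs 𝟙 (S ++ + suc w ∷ []) - chain m cs 𝟙 S)
  Div-chain-difference zero cs S w g b = Div-cong (sym (-‿inverseʳ 1#)) (Div-0 _)
  Div-chain-difference (suc m) [] S w g b = Div-cong (sym (-‿inverseʳ 1#)) (Div-0 _)
  Div-chain-difference (suc m) (c ∷ cs) S w g b = Div-≡ (P.cong (N._+ w) (P.sym (sumℕ-word c m (word m cs)))) (Div-cong (sym combine) (Div-∑split _ _ S each))
    where
    z = + suc w
    k = suc m
    o = c N.* k N.+ sumℕ (word m cs) N.+ w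
    term : List ℤ → List ℤ → C
    term I J = 𝒜 I J * (lev k c I * chain m cs 𝟙 J)
    combine : ∑split term (S ++ z ∷ []) - ∑split term S ≈
      ∑split (λ I J → term (I ++ z ∷ []) J + (term I (J ++ z ∷ []) - term I J)) S
    combine = begin
      ∑split term (S ++ z ∷ []) - ∑split term S ≈⟨ +-cong (∑split-snoc term S z) (solve 1 (λ a → :- a := con -[1+ 0 ] :* a) refl _) ⟩
      _ ≈⟨ +-congˡ (sym (∑split-*ˡ _ term S)) ⟩
      _ ≈⟨ sym (∑split-+ _ _ S) ⟩
      _ ≈⟨ ∑split-cong S (λ I J _ → solve 3 (λ a b c → a :+ b :+ con -[1+ 0 ] :* c := a :+ (b :- c)) refl _ _ _) ⟩
      _ ∎
    each : ∀ I J → S ↭ I ++ J → Div o (term (I ++ z ∷ []) J + (term I (J ++ z ∷ []) - term I J))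
    each I J r = Div-+ first second
      where
      posI = All.map Below-Positive (Allₚ.++⁻ˡ I (All-resp-↭ r b))
      posJ = All.map Below-Positive (Allₚ.++⁻ʳ I (All-resp-↭ r b))
      goodIJz : Good (I ++ (J ++ z ∷ []))
      goodIJz = P.subst Good (Lₚ.++-assoc I J (z ∷ [])) (Good-↭ (++⁺ʳ (z ∷ []) r) g)
      goodIzJ : Good ((I ++ z ∷ []) ++ J)
      goodIzJ = Good-↭ (↭-trans (++⁺ˡ I (++-comm J (z ∷ []))) (↭-reflexive (P.sym (Lₚ.++-assoc I (z ∷ []) J)))) goodIJz
      goodJ = proj₂ (Good-++⁻ (I ++ z ∷ []) goodIzJ)
      goodIJ : Good (I ++ J)
      goodIJ = proj₁ (Good-++⁻ (I ++ J) (Good-↭ (++⁺ʳ (z ∷ []) r) g))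
      first : Div o (term (I ++ z ∷ []) J)
      first with c N.≟ length (I ++ z ∷ [])
      ... | no n = Div-cong (sym (trans (*-congˡ (trans (*-congʳ (trans (*-congˡ (reflexive (ind-other c _ n))) (zeroʳ _))) (zeroˡ _))) (zeroʳ _))) (Div-0 _)
      ... | yes e = Div-*ˡ (Div-𝒜 (I ++ z ∷ []) J goodIzJ) (Div-≤ size (Div-* (Div-*ʳ (Div-cong (sym (trans (∏-++ _ I (z ∷ [])) (*-congˡ (*-identityʳ _))))
            (Div-* (Div-powers k I posI) (Div-^ k (Div-ξ (suc w))))) (Div-cong (reflexive (P.sym (P.trans (P.cong (ind c) (P.sym e)) (ind-same c)))) Div-1)) (Div-chain m cs J goodJ posJ)))
        where
        X = sumℕ (word m cs)
        size : o ≤ (length I N.* k N.+ k N.* suc w) N.+ X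
        size = ≤-trans (≤-reflexive (P.trans (P.cong (λ c → c N.* k N.+ X N.+ w) (P.trans e (P.trans (Lₚ.length-++ I) (NP.+-comm (length I) 1)))) (eq (length I) m X w)))
          (m≤m+n _ (m N.* w) ▹ eq₂ (length I) m X w)
          where
          eq : ∀ i m X w → suc i N.* suc m N.+ X N.+ w ≡ i N.* suc m N.+ suc m N.+ X N.+ w
          eq = ℕ-solve-∀
          eq₂ : ∀ i m X w → i N.* suc m N.+ suc m N.+ X N.+ w N.+ m N.* w ≡ (i N.* suc m N.+ suc m N.* suc w) N.+ X
          eq₂ = ℕ-solve-∀
          _▹_ : ∀ {a b c} → a ≤ b → b ≡ c → a ≤ c
          q ▹ P.refl = q
      second : Div o (term I (J ++ z ∷ []) - term I J)
      second with c N.≟ length I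
      ... | no n = Div-cong (sym (trans (+-cong (zero-term (J ++ z ∷ [])) (-‿cong (zero-term J))) (-‿inverseʳ 0#))) (Div-0 _)
        where
        zero-term : ∀ J → term I J ≈ 0#
        zero-term J = trans (*-congˡ (trans (*-congʳ (trans (*-congˡ (reflexive (ind-other c _ n))) (zeroʳ _))) (zeroˡ _))) (zeroʳ _)
      ... | yes P.refl = Div-cong (sym parts) (Div-+
          (Div-*ˡ (Div-𝒜 I (J ++ z ∷ []) goodIJz) (Div-≡ (P.sym (NP.+-assoc (length I N.* k) _ w)) (Div-* (Div-lev k (length I) I posI) (Div-chain-difference m cs J w (proj₂ (Good-++⁻ I goodIJz)) (Allₚ.++⁻ʳ I (All-resp-↭ r b))))))
          (Div-≡ (eq (length I) m X w) (Div-*ˡ (Div-𝒜 I J goodIJ) (Div-* (Div-* (Div-new-variable w I (Allₚ.++⁻ˡ I (All-resp-↭ r b))) (Div-powers m I posI)) (Div-*ˡ (Div-cong (reflexive (P.sym (ind-same (length I)))) Div-1) (Div-chain m cs J goodJ posJ))))))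
        where
        X = sumℕ (word m cs)
        eq : ∀ i m X w → (i N.+ w N.+ i N.* m) N.+ X ≡ i N.* suc m N.+ X N.+ w
        eq = ℕ-solve-∀
        Φ = ∏ (λ i → φ (z Z.- i)) I
        parts : term I (J ++ z ∷ []) - term I J ≈
          𝒜 I (J ++ z ∷ []) * (lev k (length I) I * (chain m cs 𝟙 (J ++ z ∷ []) - chain m cs 𝟙 J)) +
          𝒜 I J * ((Φ - 1#) * ∏ ξ I * ∏ (λ a → ξ a ^ m) I * (ind (length I) (length I) * chain m cs 𝟙 J))
        parts = begin
          A' * (lv * c') - A * (lv * c₀) ≈⟨ solve 5 (λ A' A l c' c₀ → A' :* (l :* c') :- A :* (l :* c₀) := A' :* (l :* (c' :- c₀)) :+ (A' :- A) :* (l :* c₀)) refl A' A lv c' c₀ ⟩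
          A' * (lv * (c' - c₀)) + (A' - A) * (lv * c₀)
            ≈⟨ +-congˡ (*-cong (+-congʳ (trans (𝒜-++ʳ I J (z ∷ [])) (*-congˡ (∏-cong I (λ i → *-identityʳ _))))) (*-congʳ (*-congʳ (∏-* _ _ I)))) ⟩
          A' * (lv * (c' - c₀)) + (A * Φ - A) * (∏ ξ I * ∏ (λ a → ξ a ^ m) I * ind (length I) (length I) * c₀)
            ≈⟨ +-congˡ (solve 6 (λ A F x y i c → (A :* F :- A) :* (x :* y :* i :* c) := A :* ((F :- con (+ 1)) :* x :* y :* (i :* c))) refl A Φ (∏ ξ I) _ _ c₀) ⟩
          _ ∎
          where
          A' = 𝒜 I (J ++ z ∷ [])
          A = 𝒜 I J
          lv = lev k (length I) I
          c' = chain m cs 𝟙 (J ++ z ∷ [])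
          c₀ = chain m cs 𝟙 J

  alphabet-snoc : ∀ K → alphabet (suc K) ≡ alphabet K ++ v K ∷ []
  alphabet-snoc K = P.trans (P.cong (map v) (P.sym (Lₚ.upTo-∷ʳ K))) (Lₚ.map-++ v (upTo K) (K ∷ []))

  alphabet-Below : ∀ K → All (Below (K N.+ K)) (alphabet K)
  alphabet-Below K = Allₚ.map⁺ (All.map (λ {i} q → i N.+ i , P.refl , +-mono-< q q) (upTo-< K))

  HLspec-step : ∀ m cs K → length cs ≡ m → sumℕ cs ≤ K → ∀ i → i < K N.+ K →
    HLspec 2 (2 N.* p) (word m cs) (suc K) i ≡ HLspec 2 (2 N.* p) (word m cs) K i
  HLspec-step m cs K l le i q = i-j≡0⇒i≡j _ _ (P.trans (P.sym (mono-shift o (H₁ ⊖ H₀) i))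
    (Div-vanishes (o N.+ (K N.+ K)) (mono o ⊗ (H₁ ⊖ H₀)) (Div-cong (sym difference)
      (Div-chain-difference m cs (alphabet K) (K N.+ K) (P.subst Good (alphabet-snoc K) (alphabet-Good (suc K))) (alphabet-Below K)))
      (o N.+ i) (+-monoʳ-< o q)))
    where
    o = sumℕ (word m cs)
    H₁ = HLspec 2 (2 N.* p) (word m cs) (suc K)
    H₀ = HLspec 2 (2 N.* p) (word m cs) K
    difference : ι (mono o ⊗ (H₁ ⊖ H₀)) ≈ chain m cs 𝟙 (alphabet K ++ v K ∷ []) - chain m cs 𝟙 (alphabet K)
    difference = begin
      ι (mono o ⊗ (H₁ ⊖ H₀)) ≈⟨ trans (ι-* (mono o) (H₁ ⊖ H₀)) (*-congˡ (ι-⊖ H₁ H₀)) ⟩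
      ι (mono o) * (ι H₁ - ι H₀) ≈⟨ solve 3 (λ a b c → a :* (b :- c) := a :* b :- a :* c) refl _ _ _ ⟩
      ι (mono o) * ι H₁ - ι (mono o) * ι H₀ ≈⟨ +-cong (trans (sym (ι-* (mono o) H₁)) (ι-HLspec (suc K) m cs l (m≤n⇒m≤1+n le))) (-‿cong (trans (sym (ι-* (mono o) H₀)) (ι-HLspec K m cs l le))) ⟩
      chain m cs 𝟙 (alphabet (suc K)) - chain m cs 𝟙 (alphabet K) ≡⟨ P.cong (λ S → chain m cs 𝟙 S - chain m cs 𝟙 (alphabet K)) (alphabet-snoc K) ⟩
      chain m cs 𝟙 (alphabet K ++ v K ∷ []) - chain m cs 𝟙 (alphabet K) ∎

  HLspec-stable : ∀ m cs K d → length cs ≡ m → sumℕ cs ≤ K → ∀ i → i < K N.+ K →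
    HLspec 2 (2 N.* p) (word m cs) (K N.+ d) i ≡ HLspec 2 (2 N.* p) (word m cs) K i
  HLspec-stable m cs K zero l le i q = P.cong (λ k → HLspec 2 (2 N.* p) (word m cs) k i) (NP.+-identityʳ K)
  HLspec-stable m cs K (suc d) l le i q = P.trans (P.cong (λ k → HLspec 2 (2 N.* p) (word m cs) k i) (+-suc K d))
    (P.trans (HLspec-step m cs (K N.+ d) l (≤-trans le (m≤m+n K d)) i (≤-trans q (+-mono-≤ (m≤m+n K d) (m≤m+n K d))))
      (HLspec-stable m cs K d l le i q))

  -- `HLinf` takes a different number of variables for each coefficient; stability allows one common
  -- K for all coefficients up to N.
  HLinf-finite : ∀ m cs K N → length cs ≡ m → suc N N.+ sumℕ cs ≤ K → ∀ i → i ≤ N →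
    HLinf 2 (2 N.* p) (word m cs) i ≡ HLspec 2 (2 N.* p) (word m cs) K i
  HLinf-finite m cs K N l q i i≤N = P.sym (P.trans (P.cong (λ k → HLspec 2 (2 N.* p) (word m cs) k i) (P.trans (P.sym (m+[n∸m]≡n enough)) P.refl))
      (HLspec-stable m cs K₀ (K N.∸ K₀) l (≤-trans (≤-reflexive (P.sym (word-length m cs l))) (m≤n+m _ (suc i))) i
        (≤-trans (m≤m+n (suc i) _) (m≤m+n K₀ K₀))))
    where
    K₀ = suc i N.+ length (word m cs)
    enough : K₀ ≤ K
    enough = ≤-trans (+-mono-≤ (s≤s i≤N) (≤-reflexive (word-length m cs l))) q

-- Summation over partitions

module PartitionSums (CR : CommutativeRing 0ℓ 0ℓ) where
  open RingKit CR

  applyUpTo-∑ : ∀ (h : ℕ → C) (f : ℕ → ℕ) n → ∑ h (applyUpTo f n) ≈ ∑ (λ i → h (f i)) (upTo n)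
  applyUpTo-∑ h f n = trans (cong≈ (∑ h) (P.sym (Lₚ.map-upTo f n))) (∑-map h f (upTo n))

  ∑-upTo-suc : ∀ (h : ℕ → C) n → ∑ h (upTo (suc n)) ≈ h 0 + ∑ (λ i → h (suc i)) (upTo n)
  ∑-upTo-suc h n = +-congˡ (applyUpTo-∑ h suc n)

  ∑-extend : ∀ (h : ℕ → C) a d → (∀ i → a ≤ i → h i ≈ 0#) → ∑ h (upTo (a N.+ d)) ≈ ∑ h (upTo a)
  ∑-extend h zero zero e = refl
  ∑-extend h zero (suc d) e = trans (∑-upTo-suc h d) (trans (+-cong (e 0 z≤n) (∑-extend (λ i → h (suc i)) 0 d (λ i _ → e (suc i) z≤n))) (+-identityˡ _))
  ∑-extend h (suc a) d e = trans (∑-upTo-suc h (a N.+ d)) (trans (+-congˡ (∑-extend (λ i → h (suc i)) a d (λ i q → e (suc i) (s≤s q)))) (sym (∑-upTo-suc h a)))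

  ∑-shift : ∀ (h : ℕ → C) a d → ∑ (λ s → if a N.≤ᵇ s then h (s N.∸ a) else 0#) (upTo (a N.+ d)) ≈ ∑ h (upTo d)
  ∑-shift h zero d = refl
  ∑-shift h (suc zero) d = trans (∑-upTo-suc (λ s → if 1 N.≤ᵇ s then h (s N.∸ 1) else 0#) d) (+-identityˡ _)
  ∑-shift h (suc a@(suc _)) d = trans (∑-upTo-suc (λ s → if suc a N.≤ᵇ s then h (s N.∸ suc a) else 0#) (a N.+ d)) (trans (+-identityˡ _) (∑-shift h a d))

  ∑-if : ∀ {A : Set} (b : Bool) (f : A → C) xs → ∑ f (if b then xs else []) ≈ (if b then ∑ f xs else 0#)
  ∑-if true f xs = refl
  ∑-if false f xs = refl

  if-cong : ∀ (b : Bool) {x y} → x ≈ y → (if b then x else 0#) ≈ (if b then y else 0#)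
  if-cong true e = e
  if-cong false e = refl

  ≤ᵇ-false : ∀ {a s} → s < a → (a N.≤ᵇ s) ≡ false
  ≤ᵇ-false {suc zero} {zero} q = P.refl
  ≤ᵇ-false {suc zero} {suc s} (s≤s ())
  ≤ᵇ-false {suc (suc a)} {zero} q = P.refl
  ≤ᵇ-false {suc a@(suc _)} {suc s} (s≤s q) = ≤ᵇ-false {a} {s} q

  -- As g vanishes beyond size N, the size restriction can be traded for independent multiplicities
  -- up to any bound B ≥ N.
  ∑-partitions : ∀ m N B (g : List ℕ → C) → N ≤ B → (∀ xs → N < sumℕ xs → g xs ≈ 0#) →
    ∑ (λ s → ∑ g (partsLE m s)) (upTo (suc N)) ≈ ∑counts B m (λ cs → g (word m cs))
  ∑-partitions zero N B g q z = trans (∑-extend (λ s → ∑ g (partsLE 0 s)) 1 N none) (trans (+-identityʳ _) (+-identityʳ _))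
    where
    none : ∀ i → 1 ≤ i → ∑ g (partsLE 0 i) ≈ 0#
    none (suc i) _ = refl
  ∑-partitions (suc m) N B g q z = begin
    ∑ (λ s → ∑ g (partsLE (suc m) s)) (upTo (suc N)) ≈⟨ ∑-cong∈ (upTo-< (suc N)) (λ s r → trans (∑-concatMap g (lists s) (upTo (suc s))) (trans (∑-cong (upTo (suc s)) (inner s)) (widen s (≤-pred r)))) ⟩
    ∑ (λ s → ∑ (λ c → part c s) (upTo (suc B))) (upTo (suc N)) ≈⟨ ∑-swap (λ s c → part c s) (upTo (suc N)) (upTo (suc B)) ⟩
    ∑ (λ c → ∑ (part c) (upTo (suc N))) (upTo (suc B)) ≈⟨ ∑-cong (upTo (suc B)) column ⟩
    ∑ (λ c → ∑counts B m (λ cs → g (replicate c (suc m) ++ word m cs))) (upTo (suc B)) ∎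
    where
    lists : ℕ → ℕ → List (List ℕ)
    lists s c = if c N.* suc m N.≤ᵇ s then map (replicate c (suc m) ++_) (partsLE m (s N.∸ c N.* suc m)) else []
    h : ℕ → ℕ → C
    h c s = ∑ (λ xs → g (replicate c (suc m) ++ xs)) (partsLE m s)
    part : ℕ → ℕ → C
    part c s = if c N.* suc m N.≤ᵇ s then h c (s N.∸ c N.* suc m) else 0#
    small : ∀ c s → s < c N.* suc m → part c s ≈ 0#
    small c s r = cong≈ (λ b → if b then h c (s N.∸ c N.* suc m) else 0#) (≤ᵇ-false r)
    inner : ∀ s c → ∑ g (lists s c) ≈ part c s
    inner s c = trans (∑-if (c N.* suc m N.≤ᵇ s) g (map (replicate c (suc m) ++_) (partsLE m (s N.∸ c N.* suc m)))) (if-cong (c N.* suc m N.≤ᵇ s) (∑-map g (replicate c (suc m) ++_) (partsLE m (s N.∸ c N.* suc m))))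
    widen : ∀ s → s ≤ N → ∑ (λ c → part c s) (upTo (suc s)) ≈ ∑ (λ c → part c s) (upTo (suc B))
    widen s r = trans (sym (∑-extend (λ c → part c s) (suc s) (B N.∸ s) (λ c r' → small c s (≤-trans r' (m≤m*n c (suc m))))))
      (cong≈ (λ k → ∑ (λ c → part c s) (upTo (suc k))) (m+[n∸m]≡n (≤-trans r q)))
    column : ∀ c → ∑ (part c) (upTo (suc N)) ≈ ∑counts B m (λ cs → g (replicate c (suc m) ++ word m cs))
    column c with ≤-<-connex (c N.* suc m) N
    ... | inj₁ le = trans (cong≈ (λ k → ∑ (part c) (upTo k)) (P.sym (P.trans (+-suc a (N N.∸ a)) (P.cong suc (m+[n∸m]≡n le)))))
        (trans (∑-shift (h c) a (suc (N N.∸ a)))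
        (∑-partitions m (N N.∸ a) B (λ xs → g (replicate c (suc m) ++ xs)) (≤-trans (m∸n≤m N a) q)
          (λ xs r → z _ (P.subst (N <_) (P.sym (sumℕ-word c m xs)) (≤-trans (s≤s (≤-reflexive (P.sym (m+[n∸m]≡n le)))) (+-monoʳ-< a r))))))
      where a = c N.* suc m
    ... | inj₂ lt = trans (trans (∑-cong∈ (upTo-< (suc N)) (λ s r → small c s (≤-trans r lt))) (∑-0 (upTo (suc N))))
        (sym (trans (∑counts-cong B m (λ cs _ _ → z _ (P.subst (N <_) (P.sym (sumℕ-word c m (word m cs))) (≤-trans lt (m≤m+n _ _))))) (∑counts-0 m)))
      where
      ∑counts-0 : ∀ m → ∑counts B m (λ _ → 0#) ≈ 0#
      ∑counts-0 zero = refl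
      ∑counts-0 (suc m) = trans (∑-cong (upTo (suc B)) (λ _ → ∑counts-0 m)) (∑-0 (upTo (suc B)))

module FinitePartitionSum (SE : SeriesExtension) (n : ℕ) (0<p : 0 < 2 N.* n N.∸ 1) where
  open RingKit ZP.+-*-commutativeRing using (∑; ∑counts; ∑-cong; ∑-concatMap; ∑counts-cong)
  open PartitionSums ZP.+-*-commutativeRing

  sumS-at : ∀ {A : Set} (f : A → Series) xs N → sumS (map f xs) N ≡ ∑ (λ x → f x N) xs
  sumS-at f [] N = P.refl
  sumS-at f (x ∷ xs) N = P.cong (λ z → f x N Z.+ z) (sumS-at f xs N)

  ∑counts-at : ∀ B m f N → RingKit.∑counts powerSeries B m f N ≡ ∑counts B m (λ cs → f cs N)
  ∑counts-at B zero f N = P.refl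
  ∑counts-at B (suc m) f N = P.trans (go (upTo (suc B))) (∑-cong (upTo (suc B)) (λ c → ∑counts-at B m (λ cs → f (c ∷ cs)) N))
    where
    go : ∀ xs → RingKit.∑ powerSeries (λ c → RingKit.∑counts powerSeries B m (λ cs → f (c ∷ cs))) xs N ≡ ∑ (λ c → RingKit.∑counts powerSeries B m (λ cs → f (c ∷ cs)) N) xs
    go [] = P.refl
    go (x ∷ xs) = P.cong (λ z → RingKit.∑counts powerSeries B m (λ cs → f (x ∷ cs)) N Z.+ z) (go xs)

  open Stability SE (2 N.* n N.∸ 1) 0<p using (finiteTerm; finiteSum; HLinf-finite; levelFactors)

  p = 2 N.* n N.∸ 1

  word-sum : ∀ m cs → length cs ≡ m → sumℕ cs ≤ sumℕ (word m cs)
  word-sum zero [] l = z≤n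
  word-sum (suc m) (c ∷ cs) l = ≤-trans (+-mono-≤ (m≤m*n c (suc m)) (word-sum m cs (suc-injective l))) (≤-reflexive (P.sym (sumℕ-word c m (word m cs))))

  large : ∀ (f : Series) (g : Series) a N → N < a → (mono a ⊗ f ⊗ g) N ≡ 0ℤ
  large f g a N q = P.trans (⊗-assoc N (mono a) f g) (mono-below a (f ⊗ g) N q)

  lhsTerm-finite : ∀ m K N cs → length cs ≡ m → suc N N.+ N ≤ K → lhsTerm m n (word m cs) N ≡ finiteTerm m K (word m cs) N
  lhsTerm-finite m K N cs l q with ≤-<-connex (sumℕ (word m cs)) N
  ... | inj₂ lt = P.trans (large (levelFactors m (word m cs)) (HLinf 2 (2 N.* p) (word m cs)) (sumℕ (word m cs)) N lt) (P.sym (large (levelFactors m (word m cs)) (HLspec 2 (2 N.* p) (word m cs) K) (sumℕ (word m cs)) N lt))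
  ... | inj₁ le = ⊗-cong-at N (mono (sumℕ (word m cs)) ⊗ levelFactors m (word m cs)) (mono (sumℕ (word m cs)) ⊗ levelFactors m (word m cs))
    (HLinf 2 (2 N.* p) (word m cs)) (HLspec 2 (2 N.* p) (word m cs) K) (λ _ _ → P.refl)
    (λ i r → HLinf-finite m cs K N l (≤-trans (+-monoʳ-≤ (suc N) (≤-trans (word-sum m cs l) le)) q) i r)

  lhs-finite : ∀ m K N → suc N N.+ N ≤ K → lhs m n N ≡ finiteSum m K N
  lhs-finite m K N q = P.trans (sumS-at (lhsTerm m n) (concatMap (partsLE m) (upTo (suc N))) N)
    (P.trans (∑-concatMap (λ xs → lhsTerm m n xs N) (partsLE m) (upTo (suc N)))
    (P.trans (∑-partitions m N K (λ xs → lhsTerm m n xs N) (≤-trans (m≤n+m N (suc N)) q) (λ xs r → large (levelFactors m xs) (HLinf 2 (2 N.* p) xs) (sumℕ xs) N r))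
    (P.trans (∑counts-cong K m (λ cs l _ → lhsTerm-finite m K N cs l q)) (P.sym (∑counts-at K m (λ cs → finiteTerm m K (word m cs)) N)))))

-- Congruences modulo powers of x

NonNeg : ℤ → Set
NonNeg z = ∃ λ k → z ≡ + k

NonNeg-+ : ∀ {a b} → NonNeg a → NonNeg b → NonNeg (a Z.+ b)
NonNeg-+ (k , P.refl) (l , P.refl) = k N.+ l , P.sym (pos-+ k l)

NonNeg-* : ∀ {a b} → NonNeg a → NonNeg b → NonNeg (a Z.* b)
NonNeg-* (k , P.refl) (l , P.refl) = k N.* l , P.sym (pos-* k l)

NonNeg-ℕ : ∀ k → NonNeg (+ k)
NonNeg-ℕ k = k , P.refl

NonNeg-≡ : ∀ {a b} → a ≡ b → NonNeg a → NonNeg b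
NonNeg-≡ P.refl n = n

NonNeg-square : ∀ z → NonNeg (z Z.* z)
NonNeg-square z = ∣ z ∣ N.* ∣ z ∣ , square z
  where
  square : ∀ z → z Z.* z ≡ + (∣ z ∣ N.* ∣ z ∣)
  square (+ k) = P.sym (pos-* k k)
  square -[1+ k ] = P.refl

NonNeg-∸ : ∀ {k l} → k ≤ l → NonNeg (+ l Z.- + k)
NonNeg-∸ {k} {l} q = l N.∸ k , P.trans (m-n≡m⊖n l k) (⊖-≥ q)

record Within (n : ℕ) (y : ℤ) : Set where
  constructor within
  field
    above : NonNeg (y Z.+ + n)
    below : NonNeg (+ n Z.- y)

Within-+ : ∀ {n b} → b ≤ n → Within n (+ b)
Within-+ {n} {b} q = within (NonNeg-+ (NonNeg-ℕ b) (NonNeg-ℕ n)) (NonNeg-∸ q)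

Within-neg : ∀ {n y} → Within n y → Within n (Z.- y)
Within-neg {n} {y} (within u v) = within (NonNeg-≡ (e₁ (+ n) y) v) (NonNeg-≡ (e₂ (+ n) y) u)
  where
  e₁ : ∀ n y → n Z.- y ≡ Z.- y Z.+ n
  e₁ = solve-∀
  e₂ : ∀ n y → y Z.+ n ≡ n Z.- (Z.- y)
  e₂ = solve-∀

module Closeness (SE : SeriesExtension) where
  open SeriesExtension SE using (L; ι; ι-cong; ι-*; ι-+; ι-1; ι-mono)
  open LaurentKit L
  open Divisibility SE
  open Determinant CR using (∑alt; det)

  -- Congruence modulo xᵏ of elements without pole.
  Close : ℕ → C → C → Set
  Close k u w = Div 0 u × Div 0 w × Div k (u - w)

  Close-refl : ∀ {k u} → Div 0 u → Close k u u
  Close-refl d = d , d , Div-cong (sym (-‿inverseʳ _)) (Div-0 _)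

  Close-≤ : ∀ {k l u w} → k ≤ l → Close l u w → Close k u w
  Close-≤ q (a , b , c) = a , b , Div-≤ q c

  Close-cong : ∀ {k u w u' w'} → u ≈ u' → w ≈ w' → Close k u w → Close k u' w'
  Close-cong e f (a , b , c) = Div-cong e a , Div-cong f b , Div-cong (+-cong e (-‿cong f)) c

  Close-trans : ∀ {k u w z} → Close k u w → Close k w z → Close k u z
  Close-trans (a , b , c) (_ , b' , c') = a , b' , Div-cong (solve 3 (λ u w z → (u :- w) :+ (w :- z) := u :- z) refl _ _ _) (Div-+ c c')

  Close-* : ∀ {k u w u' w'} → Close k u w → Close k u' w' → Close k (u * u') (w * w')
  Close-* (a , b , c) (a' , b' , c') = Div-* a a' , Div-* b b' ,
    Div-cong (solve 4 (λ u w u' w' → (u :- w) :* u' :+ w :* (u' :- w') := u :* u' :- w :* w') refl _ _ _ _) (Div-+ (Div-*ʳ c a') (Div-*ˡ b c'))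

  Close-minus : ∀ {k u w u' w'} → Close k u w → Close k u' w' → Close k (u - u') (w - w')
  Close-minus (a , b , c) (a' , b' , c') = Div-+ a (Div-neg a') , Div-+ b (Div-neg b') ,
    Div-cong (solve 4 (λ u w u' w' → (u :- w) :- (u' :- w') := (u :- u') :- (w :- w')) refl _ _ _ _) (Div-+ c (Div-neg c'))

  Close-∏ : ∀ {A : Set} {k} {P : A → Set} {f g : A → C} {xs} → All P xs → (∀ x → P x → Close k (f x) (g x)) → Close k (∏ f xs) (∏ g xs)
  Close-∏ [] e = Close-refl Div-1
  Close-∏ (p ∷ ps) e = Close-* (e _ p) (Close-∏ ps e)

  Close-∑alt : ∀ {A : Set} {k} {P : A → Set} {f g : A → List A → C} {xs} → All P xs →
    (∀ y ys → P y → All P ys → Close k (f y ys) (g y ys)) → Close k (∑alt f xs) (∑alt g xs)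
  Close-∑alt [] e = Close-refl (Div-0 0)
  Close-∑alt (p ∷ ps) e = Close-minus (e _ _ p ps) (Close-∑alt ps (λ y ys q qs → e y (_ ∷ ys) q (p ∷ qs)))

  Close-det : ∀ {A B : Set} {k} {P : A → Set} {Q : B → Set} {M M' : A → B → C} {as bs} → All P as → All Q bs →
    (∀ a b → P a → Q b → Close k (M a b) (M' a b)) → Close k (det M as bs) (det M' as bs)
  Close-det {bs = []} [] qs e = Close-refl Div-1
  Close-det {bs = _ ∷ _} [] qs e = Close-refl (Div-0 0)
  Close-det (p ∷ ps) qs e = Close-∑alt qs (λ b bs q qs' → Close-* (e _ b p q) (Close-det ps qs' e))

  Div-ξ-≥ : ∀ {k z} → NonNeg (z Z.- + k) → Div k (ξ z)
  Div-ξ-≥ {k} {z} (j , e) = Div-≤ (m≤m+n k j) (Div-cong (cong≈ ξ (P.sym z≡)) (Div-ξ (k N.+ j)))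
    where
    eq : ∀ z k → z ≡ k Z.+ (z Z.- k)
    eq = solve-∀
    z≡ : z ≡ + (k N.+ j)
    z≡ = P.trans (eq z (+ k)) (P.trans (P.cong (λ z → + k Z.+ z) e) (P.sym (pos-+ k j)))

  Close-brk : ∀ {k v} → NonNeg (v Z.- + k) → Close k (1# - ξ v) 1#
  Close-brk {k} {v} n = Div-+ Div-1 (Div-neg (Div-≤ z≤n (Div-ξ-≥ {k} {v} n))) , Div-1 ,
    Div-cong (solve 1 (λ x → :- x := con (+ 1) :- x :- con (+ 1)) refl _) (Div-neg (Div-ξ-≥ {k} {v} n))

  Div-τ⁺ : ∀ {v} → NonNeg (v Z.- 1ℤ) → Div 0 (τ v)
  Div-τ⁺ {v} n = Stability.Div-τ SE 1 (s≤s z≤n) v (nonzero n)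
    where
    nonzero : ∀ {v} → NonNeg (v Z.- 1ℤ) → v ≢ 0ℤ
    nonzero (k , ()) P.refl

  Close-τ : ∀ {k v} → NonNeg (v Z.- + suc k) → Close k (τ v) 1#
  Close-τ {k} {v} n = dτ , Div-1 , Div-cong (ξτ v (nonzero n)) (Div-*ʳ (Div-ξ-≥ {k} {v} (NonNeg-≡ (e₁ v (+ k)) (NonNeg-+ (NonNeg-≡ (P.cong (λ w → v Z.- w) (pos-+ 1 k)) n) (NonNeg-ℕ 1)))) dτ)
    where
    e₁ : ∀ v k → v Z.- (1ℤ Z.+ k) Z.+ 1ℤ ≡ v Z.- k
    e₁ = solve-∀
    e₂ : ∀ v k → v Z.- (1ℤ Z.+ k) Z.+ k ≡ v Z.- 1ℤ
    e₂ = solve-∀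
    dτ : Div 0 (τ v)
    dτ = Div-τ⁺ (NonNeg-≡ (e₂ v (+ k)) (NonNeg-+ (NonNeg-≡ (P.cong (λ w → v Z.- w) (pos-+ 1 k)) n) (NonNeg-ℕ k)))
    nonzero : ∀ {v} → NonNeg (v Z.- + suc k) → v ≢ 0ℤ
    nonzero (k , ()) P.refl

-- Theta sums symmetric in p and q

module SymmetricTheta (L : LaurentRing) where
  open LaurentKit L

  module _ (h p q : ℤ) where
    -- Invariant under exchanging (p, s) with (q, y); h is a shift that makes the exponents
    -- nonnegative.
    exponent : ℤ → ℤ → ℤ → ℤ
    exponent k s y = h Z.+ p Z.* q Z.* (k Z.* k) Z.+ (q Z.* k Z.* s Z.+ q Z.* k Z.* s) Z.+ (s Z.* y Z.+ s Z.* y) Z.+ (p Z.* k Z.* y Z.+ p Z.* k Z.* y)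

    sgn : ℕ → C
    sgn zero = 1#
    sgn (suc k) = - sgn k

    mon : ℕ → ℤ → ℤ → C
    mon k s y = ξ (exponent (+ k) s y)

    both : ℕ → ℤ → ℤ → C
    both k s y = sgn k * (mon k s y + mon k s (Z.- y))

    tail : ℕ → ℤ → ℤ → C
    tail zero s y = 0#
    tail (suc k) s y = both (suc k) s y + tail k s y

    θ : ℕ → ℕ → ℕ → C
    θ Λ a j = both 0 (+ a) (+ j) + tail Λ (+ a) (+ j) + tail Λ (Z.- + a) (+ j)

  module _ (h p q : ℤ) where
    private
      swap-mon : ∀ k s y → mon h p q k s y ≈ mon h q p k y s
      swap-mon k s y = cong≈ ξ (eq h p q (+ k) s y)
        where
        eq : ∀ h p q k s y → h Z.+ p Z.* q Z.* (k Z.* k) Z.+ (q Z.* k Z.* s Z.+ q Z.* k Z.* s) Z.+ (s Z.* y Z.+ s Z.* y) Z.+ (p Z.* k Z.* y Z.+ p Z.* k Z.* y) ≡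
          h Z.+ q Z.* p Z.* (k Z.* k) Z.+ (p Z.* k Z.* y Z.+ p Z.* k Z.* y) Z.+ (y Z.* s Z.+ y Z.* s) Z.+ (q Z.* k Z.* s Z.+ q Z.* k Z.* s)
        eq = solve-∀

      negate-mon : ∀ a j → mon h p q 0 a (Z.- j) ≈ mon h q p 0 j (Z.- a)
      negate-mon a j = cong≈ ξ (eq h p q a j)
        where
        eq : ∀ h p q a j → h Z.+ p Z.* q Z.* (0ℤ Z.* 0ℤ) Z.+ (q Z.* 0ℤ Z.* a Z.+ q Z.* 0ℤ Z.* a) Z.+ (a Z.* (Z.- j) Z.+ a Z.* (Z.- j)) Z.+ (p Z.* 0ℤ Z.* (Z.- j) Z.+ p Z.* 0ℤ Z.* (Z.- j)) ≡
          h Z.+ q Z.* p Z.* (0ℤ Z.* 0ℤ) Z.+ (p Z.* 0ℤ Z.* j Z.+ p Z.* 0ℤ Z.* j) Z.+ (j Z.* (Z.- a) Z.+ j Z.* (Z.- a)) Z.+ (q Z.* 0ℤ Z.* (Z.- a) Z.+ q Z.* 0ℤ Z.* (Z.- a))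
        eq = solve-∀

      swap-sgn : ∀ k → sgn h p q k ≈ sgn h q p k
      swap-sgn zero = refl
      swap-sgn (suc k) = -‿cong (swap-sgn k)

      swap-tails : ∀ k a j → tail h p q k a j + tail h p q k (Z.- a) j ≈ tail h q p k j a + tail h q p k (Z.- j) a
      swap-tails zero a j = refl
      swap-tails (suc k) a j = trans (+-interchange _ _ _ _) (trans (+-cong
          (trans (+-cong (*-cong (swap-sgn (suc k)) (+-cong (swap-mon (suc k) a j) (swap-mon (suc k) a (Z.- j))))
             (*-cong (swap-sgn (suc k)) (+-cong (swap-mon (suc k) (Z.- a) j) (swap-mon (suc k) (Z.- a) (Z.- j)))))
            (solve 5 (λ g a b c d → g :* (a :+ b) :+ g :* (c :+ d) := g :* (a :+ c) :+ g :* (b :+ d)) refl _ _ _ _ _))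
          (swap-tails k a j))
        (+-interchange _ _ _ _))

    -- For k ≥ 1 all four signs of (a, j) occur, a set that is stable under the exchange. For k = 0
    -- only the sign of j varies, but there the exponent depends on the product of a and j alone.
    θ-symmetric : ∀ Λ a j → θ h p q Λ a j ≈ θ h q p Λ j a
    θ-symmetric Λ a j = trans (+-assoc _ _ _) (trans (+-cong (*-congˡ (+-cong (swap-mon 0 (+ a) (+ j)) (negate-mon (+ a) (+ j)))) (swap-tails Λ (+ a) (+ j))) (sym (+-assoc _ _ _)))

-- The entries of Θ for long runners

module ThetaEntries (SE : SeriesExtension) (p m n' Λ : ℕ) (2n'<p : n' N.+ n' < p) where
  open SeriesExtension SE using (L)
  open Positions L p m n' Λ 2n'<p public
  open Divisibility SE public
  open Closeness SE public
  open SymmetricTheta L public using (exponent; sgn; mon; both; tail; θ; θ-symmetric)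

  N ps qs : ℤ
  N = + n'
  ps = + p
  qs = + Q

  -- The summand pq completes pqk² to pq(k - 1)² + 2pqk, and 2n'² balances 2sy through (s + n')(y +
  -- n') + (n' - s)(n' - y).
  order : ℤ
  order = N Z.* N Z.+ N Z.* N Z.+ ps Z.* qs

  gap-p : NonNeg (ps Z.- (1ℤ Z.+ (N Z.+ N)))
  gap-p = NonNeg-∸ 2n'<p

  -- p q (k² + 1) ≥ 2 p q k, which leaves the margin k (p (q - 2n') + q (p - 2n')) for the linear terms.
  exponent-≥ : ∀ k {s y} → Within n' s → Within n' y → NonNeg (exponent order ps qs (+ k) s y Z.- + k)
  exponent-≥ k {s} {y} (within u⁺ u⁻) (within w⁺ w⁻) = NonNeg-≡ (P.sym (eq N ps qs (+ k) s y))
    (NonNeg-+ (NonNeg-+ (NonNeg-+ (NonNeg-+ (NonNeg-* (NonNeg-ℕ (p N.* Q) ▹ pos-* p Q) (NonNeg-square (+ k Z.- 1ℤ)))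
      (NonNeg-* (NonNeg-* (NonNeg-ℕ (Q N.+ Q)) (NonNeg-ℕ k)) u⁺)) (NonNeg-* (NonNeg-* (NonNeg-ℕ (p N.+ p)) (NonNeg-ℕ k)) w⁺))
      (NonNeg-+ (NonNeg-* u⁺ w⁺) (NonNeg-* u⁻ w⁻)))
      (NonNeg-* (NonNeg-ℕ k) (NonNeg-+ (NonNeg-+ (NonNeg-+ (NonNeg-+ (NonNeg-* (NonNeg-ℕ p) gap-q) gap-p) (NonNeg-ℕ (n' N.+ n'))) (NonNeg-* (NonNeg-ℕ Q) gap-p)) (NonNeg-ℕ Q))))
    where
    _▹_ : ∀ {a b} → NonNeg a → a ≡ b → NonNeg b
    q ▹ e = NonNeg-≡ e q
    gap-q : NonNeg (qs Z.- (1ℤ Z.+ (N Z.+ N)))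
    gap-q = NonNeg-∸ (s≤s (m≤n+m (n' N.+ n') m))
    eq : ∀ n P Q k s y →
      (n Z.* n Z.+ n Z.* n Z.+ P Z.* Q) Z.+ P Z.* Q Z.* (k Z.* k) Z.+ (Q Z.* k Z.* s Z.+ Q Z.* k Z.* s) Z.+ (s Z.* y Z.+ s Z.* y) Z.+ (P Z.* k Z.* y Z.+ P Z.* k Z.* y) Z.- k
      ≡ P Z.* Q Z.* ((k Z.- 1ℤ) Z.* (k Z.- 1ℤ)) Z.+ (Q Z.+ Q) Z.* k Z.* (s Z.+ n) Z.+ (P Z.+ P) Z.* k Z.* (y Z.+ n) Z.+ ((s Z.+ n) Z.* (y Z.+ n) Z.+ (n Z.- s) Z.* (n Z.- y))
        Z.+ k Z.* (P Z.* (Q Z.- (1ℤ Z.+ (n Z.+ n))) Z.+ (P Z.- (1ℤ Z.+ (n Z.+ n))) Z.+ (n Z.+ n) Z.+ Q Z.* (P Z.- (1ℤ Z.+ (n Z.+ n))) Z.+ Q)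
    eq = solve-∀

  Div-sgn : ∀ k → Div 0 (sgn order ps qs k)
  Div-sgn zero = Div-1
  Div-sgn (suc k) = Div-neg (Div-sgn k)

  Div-both : ∀ k {s y} → Within n' s → Within n' y → Div k (both order ps qs k s y)
  Div-both k s y = Div-*ˡ (Div-sgn k) (Div-+ (Div-ξ-≥ (exponent-≥ k s y)) (Div-ξ-≥ (exponent-≥ k s (Within-neg y))))

  Close-+ : ∀ {k u w u' w'} → Close k u w → Close k u' w' → Close k (u + u') (w + w')
  Close-+ (a , b , c) (a' , b' , c') = Div-+ a a' , Div-+ b b' ,
    Div-cong (solve 4 (λ u w u' w' → (u :- w) :+ (u' :- w') := (u :+ u') :- (w :+ w')) refl _ _ _ _) (Div-+ c c')

  Λ≡ : ∀ {i e} → i N.+ suc e ≡ Λ → + Λ ≡ + i Z.+ (1ℤ Z.+ + e)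
  Λ≡ {i} {e} P.refl = P.trans (pos-+ i (suc e)) (P.cong (λ z → + i Z.+ z) (pos-+ 1 e))

  -- After i flips the end of a runner is still about Λ - i steps of length T away, so its factor is
  -- 1 modulo x^(Λ-1-i) at least.
  ratio : ∀ {s y} i e → i N.+ suc e ≡ Λ → Within n' s → Within n' y → let c = (s Z.+ s) Z.+ + i Z.* T in
    Close e (brk ((y Z.+ y) Z.+ M Z.- c) * τ (c Z.+ T Z.+ ((y Z.+ y) Z.+ M))) 1#
  ratio {s} {y} i e Λ= (within u⁺ u⁻) (within w⁺ w⁻) = Close-cong refl (*-identityˡ 1#) (Close-*
      (Close-brk (NonNeg-≡ (P.trans (P.sym (e₁ ps N (+ i) (+ e) s y)) (P.cong (λ l → (y Z.+ y) Z.+ l Z.* T Z.- ((s Z.+ s) Z.+ + i Z.* T) Z.- + e) (P.sym (Λ≡ Λ=))))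
        (NonNeg-+ (NonNeg-+ (NonNeg-+ w⁺ w⁺) (NonNeg-+ u⁻ u⁻)) margin)))
      (Close-τ (NonNeg-≡ (P.trans (P.sym (e₂ ps N (+ i) (+ e) s y)) (P.trans (P.cong (λ l → (s Z.+ s) Z.+ + i Z.* T Z.+ T Z.+ ((y Z.+ y) Z.+ l Z.* T) Z.- (1ℤ Z.+ + e)) (P.sym (Λ≡ Λ=)))
            (P.cong (λ z → (s Z.+ s) Z.+ + i Z.* T Z.+ T Z.+ ((y Z.+ y) Z.+ M) Z.- z) (P.sym (pos-+ 1 e)))))
        (NonNeg-+ (NonNeg-+ (NonNeg-+ (NonNeg-+ w⁺ w⁺) (NonNeg-+ u⁺ u⁺)) margin) (NonNeg-+ (NonNeg-* (NonNeg-ℕ (i N.+ i)) (NonNeg-ℕ (p N.+ p))) slope)))))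
    where
    slope : NonNeg (ps Z.+ (ps Z.- (1ℤ Z.+ (N Z.+ N))) Z.+ (N Z.+ N))
    slope = NonNeg-+ (NonNeg-+ (NonNeg-ℕ p) gap-p) (NonNeg-ℕ (n' N.+ n'))
    margin : NonNeg ((ps Z.- (1ℤ Z.+ (N Z.+ N))) Z.+ (ps Z.- (1ℤ Z.+ (N Z.+ N))) Z.+ + 2 Z.+ + e Z.* (ps Z.+ (ps Z.- (1ℤ Z.+ (N Z.+ N))) Z.+ (N Z.+ N)))
    margin = NonNeg-+ (NonNeg-+ (NonNeg-+ gap-p gap-p) (NonNeg-ℕ 2)) (NonNeg-* (NonNeg-ℕ e) slope)
    e₁ : ∀ P n i e s y → (y Z.+ y) Z.+ (i Z.+ (1ℤ Z.+ e)) Z.* (P Z.+ P) Z.- ((s Z.+ s) Z.+ i Z.* (P Z.+ P)) Z.- e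
      ≡ (y Z.+ n Z.+ (y Z.+ n)) Z.+ (n Z.- s Z.+ (n Z.- s)) Z.+ ((P Z.- (1ℤ Z.+ (n Z.+ n))) Z.+ (P Z.- (1ℤ Z.+ (n Z.+ n))) Z.+ + 2 Z.+ e Z.* (P Z.+ (P Z.- (1ℤ Z.+ (n Z.+ n))) Z.+ (n Z.+ n)))
    e₁ = solve-∀
    e₂ : ∀ P n i e s y → (s Z.+ s) Z.+ i Z.* (P Z.+ P) Z.+ (P Z.+ P) Z.+ ((y Z.+ y) Z.+ (i Z.+ (1ℤ Z.+ e)) Z.* (P Z.+ P)) Z.- (1ℤ Z.+ e)
      ≡ (y Z.+ n Z.+ (y Z.+ n)) Z.+ (s Z.+ n Z.+ (s Z.+ n)) Z.+ ((P Z.- (1ℤ Z.+ (n Z.+ n))) Z.+ (P Z.- (1ℤ Z.+ (n Z.+ n))) Z.+ + 2 Z.+ e Z.* (P Z.+ (P Z.- (1ℤ Z.+ (n Z.+ n))) Z.+ (n Z.+ n)))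
        Z.+ ((i Z.+ i) Z.* (P Z.+ P) Z.+ (P Z.+ (P Z.- (1ℤ Z.+ (n Z.+ n))) Z.+ (n Z.+ n)))
    e₂ = solve-∀

  Close-Ē : ∀ {s} i e b → i N.+ suc e ≡ Λ → Within n' s → b ≤ n' → Close e (Ē ((s Z.+ s) Z.+ + i Z.* T) b) 1#
  Close-Ē {s} i e zero Λ= w q = Close-cong (*-cong (brk≡ (P.cong (Z._- c) (e₆ M))) (cong≈ τ (P.cong (λ z → c Z.+ T Z.+ z) (e₆ M)))) refl (ratio {y = 0ℤ} i e Λ= w (Within-+ z≤n))
    where
    c = (s Z.+ s) Z.+ + i Z.* T
    e₆ : ∀ M → (0ℤ Z.+ 0ℤ) Z.+ M ≡ M
    e₆ = solve-∀
  Close-Ē {s} i e (suc b) Λ= w q = Close-cong (solve 4 (λ a b c d → (a :* b) :* (c :* d) := (a :* c) :* (b :* d)) refl _ _ _ _) (*-identityˡ 1#)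
      (Close-* (ratio i e Λ= w (Within-+ q)) (Close-cong (*-cong (brk≡ (P.cong (Z._- c) (e₅ (+ suc b) M))) (cong≈ τ (P.cong (λ z → c Z.+ T Z.+ z) (e₅ (+ suc b) M)))) refl
        (ratio {y = Z.- + suc b} i e Λ= w (Within-neg (Within-+ q)))))
    where
    c = (s Z.+ s) Z.+ + i Z.* T
    e₅ : ∀ b M → (Z.- b Z.+ (Z.- b)) Z.+ M ≡ M Z.- (b Z.+ b)
    e₅ = solve-∀

  corrections : ℤ → ℕ → C
  corrections c = pre (λ i → ∏ (Ē (c Z.+ + i Z.* T)) runners)

  Close-pre : ∀ {e f} k → (∀ i → i < k → Close e (f i) 1#) → Close e (pre f k) 1#
  Close-pre zero d = Close-refl Div-1
  Close-pre (suc k) d = Close-cong refl (*-identityˡ 1#) (Close-* (Close-pre k (λ i q → d i (m≤n⇒m≤1+n q))) (d k ≤-refl))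

  Close-corrections : ∀ {s} k → k ≤ Λ → Within n' s → Close (Λ N.∸ k) (corrections (s Z.+ s) k) 1#
  Close-corrections k q w = Close-pre k (λ i r → Close-≤ (∸-monoʳ-≤ Λ r)
    (Close-cong refl (∏-1 runners) (Close-∏ (downFrom-< (suc n')) (λ b b< → Close-Ē i (Λ N.∸ suc i) b (P.trans (+-suc i _) (m+[n∸m]≡n (≤-trans r q))) w (≤-pred b<)))))

  lead : ℤ → ℕ → C
  lead c k = sgn order ps qs k * ξ (qs Z.* (+ k Z.* c Z.+ + k Z.* + k Z.* ps))

  ξ-^ : ∀ y k → ξ y ^ k ≈ ξ (+ k Z.* y)
  ξ-^ y zero = trans (sym ξ-0) (ξ≡ (P.sym (ZP.*-zeroˡ y)))
  ξ-^ y (suc k) = trans (*-congˡ (ξ-^ y k)) (trans (sym (ξ-+ y (+ k Z.* y))) (ξ≡ (P.trans (eq y (+ k)) (P.cong (Z._* y) (P.sym (pos-+ 1 k))))))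
    where
    eq : ∀ y k → y Z.+ k Z.* y ≡ (1ℤ Z.+ k) Z.* y
    eq = solve-∀

  -- The exponent is quadratic because the flipped positions P + c + 2Pi with i < k have the sum kc
  -- + k²P.
  up-lead : ∀ c k → up c k ≈ lead c k * corrections c k
  up-lead c zero = sym (trans (*-identityʳ _) (trans (*-identityˡ _) (trans (ξ≡ (eq qs c ps)) ξ-0)))
    where
    eq : ∀ q c p → q Z.* (0ℤ Z.* c Z.+ 0ℤ Z.* 0ℤ Z.* p) ≡ 0ℤ
    eq = solve-∀
  up-lead c (suc k) = begin
    up c k * (- (ξ y ^ Q) * ∏ (Ē (c Z.+ + k Z.* T)) runners) ≈⟨ *-cong (up-lead c k) (*-congʳ (-‿cong (ξ-^ y Q))) ⟩
    sgn order ps qs k * ξ z * corrections c k * (- ξ (qs Z.* y) * ∏ (Ē (c Z.+ + k Z.* T)) runners)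
      ≈⟨ solve 5 (λ g a e b f → g :* a :* e :* ((:- b) :* f) := (:- g) :* (a :* b) :* (e :* f)) refl _ _ _ _ _ ⟩
    - sgn order ps qs k * (ξ z * ξ (qs Z.* y)) * corrections c (suc k)
      ≈⟨ *-congʳ (*-congˡ (trans (sym (ξ-+ z (qs Z.* y))) (ξ≡ (P.trans (eq qs c ps (+ k)) (P.cong (λ k → qs Z.* (k Z.* c Z.+ k Z.* k Z.* ps)) (P.sym (pos-+ 1 k))))))) ⟩
    lead c (suc k) * corrections c (suc k) ∎
    where
    y = ps Z.+ (c Z.+ + k Z.* T)
    z = qs Z.* (+ k Z.* c Z.+ + k Z.* + k Z.* ps)
    eq : ∀ q c p k → q Z.* (k Z.* c Z.+ k Z.* k Z.* p) Z.+ q Z.* (p Z.+ (c Z.+ k Z.* (p Z.+ p))) ≡ q Z.* ((1ℤ Z.+ k) Z.* c Z.+ (1ℤ Z.+ k) Z.* (1ℤ Z.+ k) Z.* p)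
    eq = solve-∀

  lead-both : ∀ s k y → ξ order * (lead (s Z.+ s) k * χ (y Z.* ((s Z.+ s) Z.+ + k Z.* T))) ≈ both order ps qs k s y
  lead-both s k y = begin
    ξ order * (sgn order ps qs k * ξ z * (ξ d + ξ (Z.- d)))
      ≈⟨ solve 5 (λ h g a b c → h :* (g :* a :* (b :+ c)) := g :* (h :* a :* b :+ h :* a :* c)) refl _ _ _ _ _ ⟩
    sgn order ps qs k * (ξ order * ξ z * ξ d + ξ order * ξ z * ξ (Z.- d)) ≈⟨ *-congˡ (+-cong (three d y P.refl) (three (Z.- d) (Z.- y) (neg-distribˡ-* y _))) ⟩
    both order ps qs k s y ∎
    where
    z = qs Z.* (+ k Z.* (s Z.+ s) Z.+ + k Z.* + k Z.* ps)
    d = y Z.* ((s Z.+ s) Z.+ + k Z.* T)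
    eq : ∀ h q k s p y → h Z.+ q Z.* (k Z.* (s Z.+ s) Z.+ k Z.* k Z.* p) Z.+ y Z.* ((s Z.+ s) Z.+ k Z.* (p Z.+ p))
      ≡ h Z.+ p Z.* q Z.* (k Z.* k) Z.+ (q Z.* k Z.* s Z.+ q Z.* k Z.* s) Z.+ (s Z.* y Z.+ s Z.* y) Z.+ (p Z.* k Z.* y Z.+ p Z.* k Z.* y)
    eq = solve-∀
    three : ∀ d y → d ≡ y Z.* ((s Z.+ s) Z.+ + k Z.* T) → ξ order * ξ z * ξ d ≈ mon order ps qs k s y
    three d y P.refl = trans (*-congʳ (sym (ξ-+ order z))) (trans (sym (ξ-+ (order Z.+ z) d)) (ξ≡ (eq order qs (+ k) s ps y)))

  -- The leading term is divisible by xᵏ and its correction is 1 modulo x^(Λ-k); together the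
  -- precision is Λ for every k.
  Close-term : ∀ {s y} k → k ≤ Λ → Within n' s → Within n' y →
    Close Λ (ξ order * (up (s Z.+ s) k * χ (y Z.* ((s Z.+ s) Z.+ + k Z.* T)))) (both order ps qs k s y)
  Close-term {s} {y} k q w w' = Close-cong (sym whole) refl
      (Div-* (Div-≤ z≤n dX) (proj₁ near) , Div-≤ z≤n dX ,
       Div-cong (solve 2 (λ X E → X :* (E :- con (+ 1)) := X :* E :- X) refl _ _) (Div-≡ (m+[n∸m]≡n q) (Div-* dX (proj₂ (proj₂ near)))))
    where
    dX = Div-both k w w'
    near = Close-corrections {s} k q w
    whole : ξ order * (up (s Z.+ s) k * χ (y Z.* ((s Z.+ s) Z.+ + k Z.* T))) ≈ both order ps qs k s y * corrections (s Z.+ s) k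
    whole = trans (*-congˡ (*-congʳ (up-lead (s Z.+ s) k))) (trans (solve 4 (λ h l e x → h :* (l :* e :* x) := (h :* (l :* x)) :* e) refl _ _ _ _) (*-congʳ (lead-both s k y)))

  Close-flips : ∀ {s y} k → k ≤ Λ → Within n' s → Within n' y →
    Close Λ (ξ order * flips k (λ c → χ (y Z.* c)) (s Z.+ s)) (tail order ps qs k s y)
  Close-flips zero q w w' = Close-cong (sym (zeroʳ _)) refl (Close-refl (Div-0 0))
  Close-flips (suc k) q w w' = Close-cong (sym (distribˡ _ _ _)) refl (Close-+ (Close-term (suc k) q w w') (Close-flips k (≤-trans (n≤1+n k) q) w w'))

  Θ-close : ∀ a j → a ≤ n' → j ≤ n' → Close Λ (ξ order * Θ a j) (θ order ps qs Λ a j)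
  Θ-close a j qa qj = Close-cong (sym (trans (distribˡ _ _ _) (+-congʳ (distribˡ _ _ _)))) refl
    (Close-+ (Close-+ (Close-cong (*-congˡ (trans (*-identityˡ _) (χ≡ (eq (+ j) (κ a) T)))) refl (Close-term 0 z≤n (Within-+ qa) (Within-+ qj)))
      (Close-flips Λ ≤-refl (Within-+ qa) (Within-+ qj)))
      (Close-cong (*-congˡ (cong≈ (flips Λ (λ c → χ (+ j Z.* c))) (P.sym (neg-distrib-+ (+ a) (+ a))))) refl (Close-flips Λ ≤-refl (Within-neg (Within-+ qa)) (Within-+ qj))))
    where
    eq : ∀ j c T → j Z.* (c Z.+ 0ℤ Z.* T) ≡ j Z.* c
    eq = solve-∀

  Div-F : ∀ {S} → All Positive S → Div 0 (F S)
  Div-F {S} pos = Div-* (Div-∏ (All.map (λ {y} q → Div-mix (Div-neg Div-s) (positive q)) pos)) (Div-pairs pos)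
    where
    Div-s : Div 0 s
    Div-s = Div-≤ z≤n (Div-ξ p)
    Div-mix : ∀ {c v} → Div 0 c → NonNeg (v Z.- 1ℤ) → Div 0 (c + (1# - c) * τ v)
    Div-mix d n = Div-+ d (Div-* (Div-+ Div-1 (Div-neg d)) (Div-τ⁺ n))
    positive : ∀ {y} → Positive y → NonNeg (y Z.- 1ℤ)
    positive (k , P.refl) = k , P.refl
    positive-+ : ∀ {x y} → Positive x → Positive y → NonNeg (x Z.+ y Z.- 1ℤ)
    positive-+ {x} (k , P.refl) (l , P.refl) = k N.+ suc l , P.refl
    Div-pairs : ∀ {S} → All Positive S → Div 0 (pairs S)
    Div-pairs [] = Div-1
    Div-pairs (q ∷ qs) = Div-* (Div-∏ (All.map (λ r → Div-mix (Div-* Div-s Div-s) (positive-+ q r)) qs)) (Div-pairs qs)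

-- Comparison of the two abaci

module Comparison (SE : SeriesExtension) (m n' : ℕ) where
  open SeriesExtension SE using (L; ι; ι-cong; ι-+; ι-*; ι-neg; ι-mono)
  open LaurentKit L
  open Divisibility SE
  open Closeness SE
  open Determinant CR

  -- p = 2n - 1 and q = m + 2n - 1 for n = n' + 1. The parameters (p, m) have `Q` = q, and (q, 0)
  -- have `Q` = p.
  p q : ℕ
  p = suc (n' N.+ n')
  q = suc m N.+ (n' N.+ n')

  n'<q : n' N.+ n' < q
  n'<q = s≤s (m≤n+m (n' N.+ n') m)

  height : ℕ
  height = n' N.* n' N.+ n' N.* n' N.+ p N.* q

  χ : ℤ → C
  χ c = ξ c + ξ (Z.- c)

  κ : ℕ → ℤ
  κ a = + a Z.+ + a

  V : ℕ → C
  V k = ∏₂ (λ a b → χ (κ a) - χ (κ b)) (downFrom k)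

  Unit : C → Set
  Unit u = Σ C λ v → Div 0 v × u * v ≈ 1#

  Unit-* : ∀ {u w} → Unit u → Unit w → Unit (u * w)
  Unit-* (u' , d , e) (w' , d' , e') = u' * w' , Div-* d d' , trans (*-interchange _ _ _ _) (trans (*-cong e e') (*-identityˡ _))

  Unit-∏ : ∀ {A : Set} {P : A → Set} {f : A → C} {xs} → All P xs → (∀ x → P x → Unit (f x)) → Unit (∏ f xs)
  Unit-∏ [] e = 1# , Div-1 , *-identityˡ 1#
  Unit-∏ (r ∷ rs) e = Unit-* (e _ r) (Unit-∏ rs e)

  Unit-χ : ∀ a b → b < a → Unit (χ (κ a) - χ (κ b))
  Unit-χ a b b<a = ξ c * (τ (c Z.+ d) * τ (c Z.- d)) ,
      Div-* (Div-ξ-≥ (NonNeg-≡ (P.sym (ZP.+-identityʳ c)) (NonNeg-+ (NonNeg-ℕ a) (NonNeg-ℕ a)))) (Div-* (Div-τ⁺ n⁺) (Div-τ⁺ n⁻)) , (begin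
    (χ c - χ d) * (ξ c * (τ (c Z.+ d) * τ (c Z.- d))) ≈⟨ solve 4 (λ x g u v → x :* (g :* (u :* v)) := (g :* x) :* (u :* v)) refl _ _ _ _ ⟩
    ξ c * (χ c - χ d) * (τ (c Z.+ d) * τ (c Z.- d)) ≈⟨ *-congʳ (sym (Runners.brk-pair L 0ℤ 0 c d)) ⟩
    (1# - ξ (c Z.+ d)) * (1# - ξ (c Z.- d)) * (τ (c Z.+ d) * τ (c Z.- d)) ≈⟨ solve 4 (λ a b u v → a :* b :* (u :* v) := (u :* a) :* (v :* b)) refl _ _ _ _ ⟩
    τ (c Z.+ d) * (1# - ξ (c Z.+ d)) * (τ (c Z.- d) * (1# - ξ (c Z.- d))) ≈⟨ *-cong (τ-inverse _ (nonzero n⁺)) (τ-inverse _ (nonzero n⁻)) ⟩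
    1# * 1# ≈⟨ *-identityˡ 1# ⟩
    1# ∎)
    where
    c = κ a
    d = κ b
    gap : NonNeg (+ a Z.- (1ℤ Z.+ + b))
    gap = NonNeg-≡ (P.cong (λ z → + a Z.- z) (pos-+ 1 b)) (NonNeg-∸ b<a)
    e⁻ : ∀ a b → (a Z.- (1ℤ Z.+ b)) Z.+ (a Z.- (1ℤ Z.+ b)) Z.+ 1ℤ ≡ (a Z.+ a) Z.- (b Z.+ b) Z.- 1ℤ
    e⁻ = solve-∀
    e⁺ : ∀ a b → ((a Z.+ a) Z.- (b Z.+ b) Z.- 1ℤ) Z.+ (b Z.+ b Z.+ (b Z.+ b)) ≡ (a Z.+ a) Z.+ (b Z.+ b) Z.- 1ℤ
    e⁺ = solve-∀
    n⁻ : NonNeg (c Z.- d Z.- 1ℤ)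
    n⁻ = NonNeg-≡ (e⁻ (+ a) (+ b)) (NonNeg-+ (NonNeg-+ gap gap) (NonNeg-ℕ 1))
    n⁺ : NonNeg (c Z.+ d Z.- 1ℤ)
    n⁺ = NonNeg-≡ (e⁺ (+ a) (+ b)) (NonNeg-+ n⁻ (NonNeg-+ (NonNeg-+ (NonNeg-ℕ b) (NonNeg-ℕ b)) (NonNeg-+ (NonNeg-ℕ b) (NonNeg-ℕ b))))
    nonzero : ∀ {v} → NonNeg (v Z.- 1ℤ) → v ≢ 0ℤ
    nonzero (k , ()) P.refl

  -- The Vandermonde factor has to be cancelled without loss of precision, hence by an inverse
  -- without pole.
  Unit-V : ∀ k → Unit (V k)
  Unit-V zero = 1# , Div-1 , *-identityˡ 1#
  Unit-V (suc k) = Unit-* (Unit-∏ (downFrom-< k) (λ b b<k → Unit-χ k b b<k)) (Unit-V k)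

  twice-zero : ∀ z → z Z.+ z ≡ 0ℤ → z ≡ 0ℤ
  twice-zero (+ zero) e = P.refl
  twice-zero (+ suc k) ()
  twice-zero -[1+ k ] ()

  -- The total exponent when each of the n' + 1 rows is multiplied by x^`height`.
  offset : ℕ
  offset = suc n' N.* height

  module _ (Λ : ℕ) where
    module Natural = ThetaEntries SE p m n' Λ ≤-refl
    module Dual = ThetaEntries SE q 0 n' Λ n'<q

    S = pos⁺ Natural.positions
    S' = pos⁺ Dual.positions
    runners = downFrom (suc n')
    X : C
    X = ∏ (λ _ → ξ Natural.order) runners

    order≡ : Natural.order ≡ Dual.order
    order≡ = P.cong (λ z → + n' Z.* + n' Z.+ + n' Z.* + n' Z.+ z) (ZP.*-comm (+ p) (+ q))

    order-ℕ : Natural.order ≡ + height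
    order-ℕ = P.sym (P.trans (pos-+ (n' N.* n' N.+ n' N.* n') (p N.* q)) (P.cong₂ Z._+_ (P.trans (pos-+ (n' N.* n') (n' N.* n')) (P.cong (λ z → z Z.+ z) (pos-* n' n'))) (pos-* p q)))

    X-mono : X ≈ ι (mono offset)
    X-mono = trans (cong≈ (λ o → ∏ (λ _ → ξ o) runners) order-ℕ) (trans (go runners) (cong≈ (λ l → ι (mono (l N.* height))) (Lₚ.length-downFrom (suc n'))))
      where
      go : ∀ xs → ∏ {ℕ} (λ _ → ξ (+ height)) xs ≈ ι (mono (length xs N.* height))
      go [] = trans (sym ξ-0) (sym (ι-mono 0))
      go (_ ∷ xs) = trans (*-congˡ (trans (go xs) (ι-mono _))) (trans (sym (ξ-ℕ height (length xs N.* height))) (sym (ι-mono _)))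

    D D' : C
    D = det (λ a j → ξ Natural.order * Natural.Θ a j) runners runners
    D' = det (λ a j → ξ Natural.order * Dual.Θ a j) runners runners

    D-close : Div Λ (D - D')
    D-close = proj₂ (proj₂ (Close-trans (Close-det (downFrom-< (suc n')) (downFrom-< (suc n')) (λ a j qa qj → Natural.Θ-close a j (≤-pred qa) (≤-pred qj)))
      (Close-cong (sym dual) refl (Close-sym (Close-det (downFrom-< (suc n')) (downFrom-< (suc n')) (λ a j qa qj →
        Close-cong (*-congʳ (cong≈ ξ (P.sym order≡))) refl (Dual.Θ-close a j (≤-pred qa) (≤-pred qj))))))))
      where
      Close-sym : ∀ {k u w} → Close k u w → Close k w u
      Close-sym (a , b , c) = b , a , Div-cong (solve 2 (λ u w → :- (u :- w) := w :- u) refl _ _) (Div-neg c)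
      open SymmetricTheta L
      dual : det (λ a j → θ Natural.order (+ p) (+ q) Λ a j) runners runners ≈ det (λ a j → θ Dual.order (+ q) (+ p) Λ a j) runners runners
      dual = trans (det-transpose _ runners runners) (det-cong {P = λ _ → ℕ} {Q = λ _ → ℕ} (All.universal id runners) (All.universal id runners)
        (λ j a _ _ → trans (θ-symmetric Natural.order (+ p) (+ q) Λ a j) (cong≈ (λ o → θ o (+ q) (+ p) Λ j a) order≡)))

    scaled : ∀ {w f} (Θ : ℕ → ℕ → C) → (1# + 1#) * (w * V (suc n')) ≈ f * det Θ runners runners →
      X * ((1# + 1#) * (w * V (suc n'))) ≈ f * det (λ a j → ξ Natural.order * Θ a j) runners runners
    scaled Θ e = trans (*-congˡ e) (trans (x∙yz≈y∙xz _ _ _) (*-congˡ (sym (det-scale-rows (λ _ → ξ Natural.order) Θ runners runners))))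

    difference : C
    difference = Natural.W m S * Dual.F S' - Dual.W 0 S' * Natural.F S

    Div-difference : Div Λ (X * ((1# + 1#) * difference))
    Div-difference = Div-cong (begin
        f * f' * (D - D') * v ≈⟨ solve 5 (λ f f' d d' v → f :* f' :* (d :- d') :* v := (f' :* (f :* d) :- f :* (f' :* d')) :* v) refl f f' D D' v ⟩
        (f' * (f * D) - f * (f' * D')) * v ≈⟨ *-congʳ (+-cong (*-congˡ (sym (scaled Natural.Θ Natural.positions-theta))) (-‿cong (*-congˡ (sym (scaled Dual.Θ Dual.positions-theta))))) ⟩
        (f' * (X * ((1# + 1#) * (w * V (suc n')))) - f * (X * ((1# + 1#) * (w' * V (suc n'))))) * v
          ≈⟨ solve 7 (λ f f' x w w' V v → (f' :* (x :* (con (+ 2) :* (w :* V))) :- f :* (x :* (con (+ 2) :* (w' :* V)))) :* v := x :* (con (+ 2) :* (w :* f' :- w' :* f)) :* (V :* v)) refl f f' X w w' (V (suc n')) v ⟩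
        X * ((1# + 1#) * difference) * (V (suc n') * v) ≈⟨ trans (*-congˡ (proj₂ (proj₂ (Unit-V (suc n'))))) (*-identityʳ _) ⟩
        X * ((1# + 1#) * difference) ∎)
      (Div-*ʳ (Div-*ˡ (Div-* (Natural.Div-F Natural.positions-positive) (Dual.Div-F Dual.positions-positive)) D-close) (proj₁ (proj₂ (Unit-V (suc n')))))
      where
      f = Natural.F S
      f' = Dual.F S'
      w = Natural.W m S
      w' = Dual.W 0 S'
      v = proj₁ (Unit-V (suc n'))

    -- The row scaling costs `offset` of the Λ coefficients, and the factor 2 is removed
    -- coefficientwise over ℤ.
    agreement : ∀ (w w' f f' : Series) → ι w ≈ Natural.W m S → ι w' ≈ Dual.W 0 S' → ι f ≈ Natural.F S → ι f' ≈ Dual.F S' →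
      ∀ N → offset N.+ N < Λ → (w ⊗ f') N ≡ (w' ⊗ f) N
    agreement w w' f f' ew ew' ef ef' N r = i-j≡0⇒i≡j _ _ (twice-zero (g N) (P.trans (P.sym (mono-shift offset (g ⊕ g) N))
        (Div-vanishes Λ (mono offset ⊗ (g ⊕ g)) (Div-cong (sym same) Div-difference) (offset N.+ N) r)))
      where
      g : Series
      g = (w ⊗ f') ⊕ negS (w' ⊗ f)
      ι-g : ι g ≈ difference
      ι-g = trans (ι-+ (w ⊗ f') (negS (w' ⊗ f))) (+-cong (trans (ι-* w f') (*-cong ew ef')) (trans (ι-neg (w' ⊗ f)) (-‿cong (trans (ι-* w' f) (*-cong ew' ef)))))
      same : ι (mono offset ⊗ (g ⊕ g)) ≈ X * ((1# + 1#) * difference)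
      same = trans (ι-* (mono offset) (g ⊕ g)) (*-cong (sym X-mono) (trans (ι-+ g g) (trans (+-cong ι-g ι-g) (solve 1 (λ d → d :+ d := con (+ 2) :* d) refl difference))))

-- Product formulas for F

ladder : ℤ → ℤ → ℕ → List ℤ
ladder d e zero = []
ladder d e (suc k) = e ∷ ladder d (e Z.+ d) k

ladder-snoc : ∀ d e k → ladder d e (suc k) ≡ ladder d e k ++ (e Z.+ + k Z.* d) ∷ []
ladder-snoc d e zero = P.cong (_∷ []) (P.sym (P.trans (P.cong (λ z → e Z.+ z) (ZP.*-zeroˡ d)) (ZP.+-identityʳ e)))
ladder-snoc d e (suc k) = P.cong (e ∷_) (P.trans (ladder-snoc d (e Z.+ d) k) (P.cong (λ z → ladder d (e Z.+ d) k ++ z ∷ [])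
    (P.trans (eq e d (+ k)) (P.cong (λ z → e Z.+ z Z.* d) (P.sym (pos-+ 1 k))))))
  where
  eq : ∀ e d k → e Z.+ d Z.+ k Z.* d ≡ e Z.+ (1ℤ Z.+ k) Z.* d
  eq = solve-∀

pairLists : {A B : Set} → (A → A → List B) → List A → List B
pairLists f [] = []
pairLists f (x ∷ xs) = concatMap (f x) xs ++ pairLists f xs

module PairListProducts (CR : CommutativeRing 0ℓ 0ℓ) where
  open RingKit CR
  open Determinant CR using (∏₂)

  ∏-pairLists : ∀ {A B : Set} (b : B → C) (f : A → A → List B) xs → ∏ b (pairLists f xs) ≈ ∏₂ (λ x y → ∏ b (f x y)) xs
  ∏-pairLists b f [] = refl
  ∏-pairLists b f (x ∷ xs) = trans (∏-++ b (concatMap (f x) xs) (pairLists f xs)) (*-cong (∏-concatMap b (f x) xs) (∏-pairLists b f xs))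

module ProductFormula (L : LaurentRing) (p m n' Λ : ℕ) (2n'<p : n' N.+ n' < p) where
  open Positions L p m n' Λ 2n'<p public
  open PairListProducts CR

  P : ℤ
  P = + p

  euler : List ℤ → C
  euler = ∏ brk

  euler-++ : ∀ X Y → euler (X ++ Y) ≈ euler X * euler Y
  euler-++ = ∏-++ brk

  positive-≢0 : ∀ {y} → Positive y → y ≢ 0ℤ
  positive-≢0 (k , P.refl) ()

  Positive-T : ∀ {y} → Positive y → Positive (y Z.+ T)
  Positive-T (k , P.refl) = k N.+ (p N.+ p) , P.refl

  Positive-+ : ∀ {x y} → Positive x → Positive y → Positive (x Z.+ y)
  Positive-+ (k , P.refl) (l , P.refl) = k N.+ suc l , P.refl

  Positive-≡ : ∀ {x y} → x ≡ y → Positive x → Positive y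
  Positive-≡ P.refl q = q

  Positive-G : ∀ {c} k → Positive (P Z.+ c) → All Positive (G c k)
  Positive-G zero q = []
  Positive-G {c} (suc k) q = q ∷ Positive-G k (Positive-≡ (ZP.+-assoc P c T) (Positive-T q))

  sums : ∀ {u c} k → Positive u → Positive (P Z.+ c) → All (λ y → u Z.+ y ≢ 0ℤ) (G c k)
  sums k q r = All.map (λ q' → positive-≢0 (Positive-+ q q')) (Positive-G k r)

  top : ℤ → ℤ → List ℤ
  top c d = ladder T (P Z.+ c Z.+ (P Z.+ adv d Λ)) Λ

  low : ℤ → List ℤ
  low c = ladder T (P Z.+ c) Λ ++ ladder T (P Z.+ (P Z.+ c)) Λ

  low₂ : ℤ → ℤ → List ℤ
  low₂ c d = ladder T (P Z.+ c Z.+ (P Z.+ d)) Λ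

  -- `ψ-brk` turns the single-entry factor at y into the bracket at 2(P + y), which is exactly where
  -- the telescoping product of y with the later entries starts.
  F-G : ∀ c k → Positive (P Z.+ c) →
    F (G c k) * (euler (ladder T (P Z.+ c) k) * euler (ladder T (P Z.+ (P Z.+ c)) k)) ≈ euler (ladder T (P Z.+ c Z.+ (P Z.+ adv c k)) k)
  F-G c zero q = solve 0 (con (+ 1) :* con (+ 1) :* (con (+ 1) :* con (+ 1)) := con (+ 1)) refl
  F-G c (suc k) q = begin
    ψ y * Ψ * (Δ * Π) * (brk y * euler (ladder T (y Z.+ T) k) * (brk (P Z.+ y) * euler (ladder T (P Z.+ y Z.+ T) k)))
      ≈⟨ *-congˡ (*-cong (*-congˡ (cong≈ (λ z → euler (ladder T z k)) (ZP.+-assoc P c T))) (*-congˡ (cong≈ (λ z → euler (ladder T z k)) (e₁ P c T)))) ⟩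
    ψ y * Ψ * (Δ * Π) * (brk y * l₁ * (brk (P Z.+ y) * l₂))
      ≈⟨ solve 8 (λ a b c d e f g h → a :* b :* (c :* d) :* (e :* f :* (g :* h)) := (c :* (a :* (e :* g))) :* (b :* d :* (f :* h))) refl _ _ _ _ _ _ _ _ ⟩
    Δ * (ψ y * (brk y * brk (P Z.+ y))) * (F (G (c Z.+ T) k) * (l₁ * l₂))
      ≈⟨ *-cong (trans (*-congˡ (trans (ψ-brk y (positive-≢0 q)) (brk≡ (e₂ P c)))) (telescope y (c Z.+ T) k (sums k q q'))) (F-G (c Z.+ T) k q') ⟩
    brk (y Z.+ (P Z.+ adv (c Z.+ T) k)) * euler (ladder T (P Z.+ (c Z.+ T) Z.+ (P Z.+ adv (c Z.+ T) k)) k)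
      ≈⟨ *-congˡ (cong≈ (λ z → euler (ladder T z k)) (e₃ P c T (adv (c Z.+ T) k))) ⟩
    euler (ladder T (y Z.+ (P Z.+ adv (c Z.+ T) k)) (suc k)) ∎
    where
    y = P Z.+ c
    Ψ = ∏ ψ (G (c Z.+ T) k)
    Δ = D y (G (c Z.+ T) k)
    Π = pairs (G (c Z.+ T) k)
    l₁ = euler (ladder T (P Z.+ (c Z.+ T)) k)
    l₂ = euler (ladder T (P Z.+ (P Z.+ (c Z.+ T))) k)
    q' : Positive (P Z.+ (c Z.+ T))
    q' = Positive-≡ (ZP.+-assoc P c T) (Positive-T q)
    e₁ : ∀ P c T → P Z.+ (P Z.+ c) Z.+ T ≡ P Z.+ (P Z.+ (c Z.+ T))
    e₁ = solve-∀
    e₂ : ∀ P c → P Z.+ (P Z.+ c) Z.+ (P Z.+ (P Z.+ c)) ≡ P Z.+ c Z.+ (P Z.+ (c Z.+ (P Z.+ P)))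
    e₂ = solve-∀
    e₃ : ∀ P c T a → P Z.+ (c Z.+ T) Z.+ (P Z.+ a) ≡ P Z.+ c Z.+ (P Z.+ a) Z.+ T
    e₃ = solve-∀

  cross-G : ∀ c d k → Positive (P Z.+ c) → Positive (P Z.+ d) →
    cross (G c k) (G d Λ) * euler (ladder T (P Z.+ c Z.+ (P Z.+ d)) k) ≈ euler (ladder T (P Z.+ c Z.+ (P Z.+ adv d Λ)) k)
  cross-G c d zero q r = *-identityˡ 1#
  cross-G c d (suc k) q r = trans (*-interchange _ _ _ _) (*-cong (telescope (P Z.+ c) d Λ (sums Λ q r))
    (trans (*-congˡ (cong≈ (λ z → euler (ladder T z k)) (e P c T d)))
      (trans (cross-G (c Z.+ T) d k (Positive-≡ (ZP.+-assoc P c T) (Positive-T q)) r) (cong≈ (λ z → euler (ladder T z k)) (P.sym (e P c T (adv d Λ)))))))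
    where
    e : ∀ P c T d → P Z.+ c Z.+ (P Z.+ d) Z.+ T ≡ P Z.+ (c Z.+ T) Z.+ (P Z.+ d)
    e = solve-∀

  centre-positive : ∀ a → a ≤ n' → All (λ c → Positive (P Z.+ c)) (centre-pairs a)
  centre-positive a q = go a q
    where
    large : ∀ b → b ≤ n' → 1 ≤ p N.∸ (b N.+ b)
    large b q = m<n⇒0<n∸m (≤-<-trans (+-mono-≤ q q) 2n'<p)
    pred : ∀ {k} → 1 ≤ k → Positive (+ k)
    pred (s≤s {n = k} _) = k , P.refl
    go : ∀ a → a ≤ n' → All (λ c → Positive (P Z.+ c)) (centre-pairs a)
    go zero q = Positive-≡ (P.sym (ZP.+-identityʳ P)) (pred (≤-trans (s≤s z≤n) 2n'<p)) ∷ []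
    go (suc a) q = Positive-+ (pred (≤-trans (s≤s z≤n) 2n'<p)) (a N.+ suc a , P.refl) ∷
      Positive-≡ (P.sym (P.trans (m-n≡m⊖n p (suc a N.+ suc a)) (⊖-≥ (<⇒≤ (≤-<-trans (+-mono-≤ q q) 2n'<p))))) (pred (large (suc a) q)) ∷ go a (≤-trans (n≤1+n a) q)

  centres-positive : All (λ c → Positive (P Z.+ c)) centre-list
  centres-positive = centre-positive n' ≤-refl

  -- F is the quotient of the two products; the exponents in `tops` grow with Λ, so that only `lows`
  -- survives in the limit.
  lows tops : List ℤ
  lows = concatMap low centre-list ++ pairLists low₂ centre-list
  tops = concatMap (λ c → top c c) centre-list ++ pairLists top centre-list

  F-euler : F (pos⁺ positions) * euler lows ≈ euler tops
  F-euler = begin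
    F (pos⁺ positions) * euler lows ≈⟨ *-cong F-positions (parts low low₂) ⟩
    ∏ (λ c → own (G c Λ)) centre-list * ∏₂ (λ c d → cross (G c Λ) (G d Λ)) centre-list * (∏ (λ c → euler (low c)) centre-list * ∏₂ (λ c d → euler (low₂ c d)) centre-list)
      ≈⟨ trans (*-interchange _ _ _ _) (*-cong (trans (sym (∏-* _ _ centre-list)) (∏-cong∈ centres-positive one)) (two centres-positive)) ⟩
    ∏ (λ c → euler (top c c)) centre-list * ∏₂ (λ c d → euler (top c d)) centre-list ≈⟨ sym (parts (λ c → top c c) top) ⟩
    euler tops ∎
    where
    parts : ∀ f g → euler (concatMap f centre-list ++ pairLists g centre-list) ≈ ∏ (λ c → euler (f c)) centre-list * ∏₂ (λ c d → euler (g c d)) centre-list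
    parts f g = trans (euler-++ (concatMap f centre-list) _) (*-cong (∏-concatMap brk f centre-list) (∏-pairLists brk g centre-list))
    one : ∀ c → Positive (P Z.+ c) → own (G c Λ) * euler (low c) ≈ euler (top c c)
    one c q = trans (*-cong (own-F (G c Λ) (Positive-G Λ q)) (euler-++ (ladder T (P Z.+ c) Λ) _)) (F-G c Λ q)
    two : ∀ {cs} → All (λ c → Positive (P Z.+ c)) cs → ∏₂ (λ c d → cross (G c Λ) (G d Λ)) cs * ∏₂ (λ c d → euler (low₂ c d)) cs ≈ ∏₂ (λ c d → euler (top c d)) cs
    two [] = *-identityˡ 1#
    two {c ∷ cs} (q ∷ qs) = trans (*-interchange _ _ _ _) (*-cong (trans (sym (∏-* _ _ cs)) (∏-cong∈ qs (λ d r → cross-G c d Λ q r))) (two qs))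

-- One row of l consecutive exponents for each of the numbers x, x + 2, …; row i collects the poles of φ(xᵢ + xⱼ), j > i, that survive telescoping.
windows : ℕ → ℕ → ℕ → List ℤ
windows l x zero = []
windows l x (suc k) = ladder (+ 2) (+ (x N.+ (x N.+ 2))) l ++ windows l (x N.+ 2) k

windowTops : ℕ → ℕ → ℕ → List ℤ
windowTops l x zero = []
windowTops l x (suc k) = ladder (+ 2) (+ (x N.+ (x N.+ 2 N.+ (k N.+ k)))) l ++ windowTops l (x N.+ 2) k

module NaturalOrder (L : LaurentRing) (r : ℕ) where
  open Runners L (+ suc r) 0

  p : ℕ
  p = suc r

  euler : List ℤ → C
  euler = ∏ brk

  naturalLows naturalTops : ℕ → ℕ → List ℤ
  naturalLows x k = ladder (+ 2) (+ x) k ++ ladder (+ 2) (+ (p N.+ x)) k ++ windows p x k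
  naturalTops x k = ladder (+ 4) (+ (p N.+ x N.+ (p N.+ x))) k ++ windowTops p x k

  euler-++ : ∀ X Y → euler (X ++ Y) ≈ euler X * euler Y
  euler-++ = ∏-++ brk

  shifted : ∀ d {x y} k → x ≡ y → euler (ladder d (+ x) k) ≈ euler (ladder d (+ y) k)
  shifted d k P.refl = refl

  -- φ moves a bracket by T = 2p, that is from the bottom of a window of p brackets with step 2 to
  -- its top. Each entry shifts the window by one place.
  slide : ∀ x y k → 1 ≤ x → D (+ x) (pos⁺ (oddsFrom y k)) * euler (ladder (+ 2) (+ (x N.+ y)) p) ≈ euler (ladder (+ 2) (+ (x N.+ (y N.+ (k N.+ k)))) p)
  slide x y zero q = trans (*-identityˡ _) (shifted (+ 2) p (P.cong (x N.+_) (P.sym (NP.+-identityʳ y))))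
  slide x@(suc _) y (suc k) q = begin
    φ v * Δ * (brk v * euler (ladder (+ 2) (v Z.+ + 2) r)) ≈⟨ solve 4 (λ a b c d → a :* b :* (c :* d) := b :* (d :* (a :* c))) refl _ _ _ _ ⟩
    Δ * (euler (ladder (+ 2) (v Z.+ + 2) r) * (φ v * brk v)) ≈⟨ *-congˡ (*-congˡ (trans (φ-brk v (λ ())) (trans (brk≡ last) (sym (*-identityʳ _))))) ⟩
    Δ * (euler (ladder (+ 2) (v Z.+ + 2) r) * euler ((v Z.+ + 2 Z.+ + r Z.* + 2) ∷ [])) ≈⟨ *-congˡ (trans (sym (euler-++ (ladder (+ 2) (v Z.+ + 2) r) _)) (cong≈ euler (P.sym (ladder-snoc (+ 2) (v Z.+ + 2) r)))) ⟩
    Δ * euler (ladder (+ 2) (+ (x N.+ y N.+ 2)) p) ≈⟨ *-congˡ (shifted (+ 2) p (NP.+-assoc x y 2)) ⟩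
    Δ * euler (ladder (+ 2) (+ (x N.+ (y N.+ 2))) p) ≈⟨ slide x (y N.+ 2) k q ⟩
    euler (ladder (+ 2) (+ (x N.+ (y N.+ 2 N.+ (k N.+ k)))) p) ≈⟨ shifted (+ 2) p (e x y k) ⟩
    euler (ladder (+ 2) (+ (x N.+ (y N.+ (suc k N.+ suc k)))) p) ∎
    where
    v = + (x N.+ y)
    Δ = D (+ x) (pos⁺ (oddsFrom (y N.+ 2) k))
    e : ∀ x y k → x N.+ (y N.+ 2 N.+ (k N.+ k)) ≡ x N.+ (y N.+ (suc k N.+ suc k))
    e = ℕ-solve-∀
    e₂ : ∀ z r → z N.+ (suc r N.+ suc r) ≡ z N.+ 2 N.+ r N.* 2
    e₂ = ℕ-solve-∀
    last : v Z.+ T ≡ v Z.+ + 2 Z.+ + r Z.* + 2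
    last = P.trans (P.cong +_ (e₂ (x N.+ y) r)) (P.cong (λ z → v Z.+ + 2 Z.+ z) (pos-* r 2))

  factors : ∀ x k → 1 ≤ x → F (pos⁺ (oddsFrom x k)) * (euler (ladder (+ 2) (+ x) k) * (euler (ladder (+ 2) (+ (p N.+ x)) k) * euler (windows p x k))) ≈
    euler (ladder (+ 4) (+ (p N.+ x N.+ (p N.+ x))) k) * euler (windowTops p x k)
  factors x zero q = solve 0 (con (+ 1) :* con (+ 1) :* (con (+ 1) :* (con (+ 1) :* con (+ 1))) := con (+ 1) :* con (+ 1)) refl
  factors x@(suc _) (suc k) q = begin
    ψ y * Ψ * (Δ * Π) * (brk y * l₁ * (brk (P Z.+ y) * euler (ladder (+ 2) (+ (p N.+ x N.+ 2)) k) * euler (windows p x (suc k))))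
      ≈⟨ *-congˡ (*-congˡ (*-cong (*-congˡ (shifted (+ 2) k (NP.+-assoc p x 2))) (euler-++ (ladder (+ 2) (+ (x N.+ (x N.+ 2))) p) _))) ⟩
    ψ y * Ψ * (Δ * Π) * (brk y * l₁ * (brk (P Z.+ y) * l₂ * (w * euler (windows p (x N.+ 2) k))))
      ≈⟨ solve 10 (λ a b c d e f g h i j → a :* b :* (c :* d) :* (e :* f :* (g :* h :* (i :* j))) := (a :* (e :* g)) :* (c :* i) :* ((b :* d) :* (f :* (h :* j)))) refl _ _ _ _ _ _ _ _ _ _ ⟩
    ψ y * (brk y * brk (P Z.+ y)) * (Δ * w) * (F (pos⁺ (oddsFrom (x N.+ 2) k)) * (l₁ * (l₂ * euler (windows p (x N.+ 2) k))))
      ≈⟨ *-cong (*-cong (ψ-brk y (λ ())) (slide x (x N.+ 2) k q)) (factors (x N.+ 2) k (s≤s z≤n)) ⟩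
    brk (P Z.+ y Z.+ (P Z.+ y)) * w' * (euler (ladder (+ 4) (+ (p N.+ (x N.+ 2) N.+ (p N.+ (x N.+ 2)))) k) * euler (windowTops p (x N.+ 2) k))
      ≈⟨ trans (*-interchange _ _ _ _) (*-cong (*-congˡ (shifted (+ 4) k (e p x))) (sym (euler-++ (ladder (+ 2) (+ (x N.+ (x N.+ 2 N.+ (k N.+ k)))) p) _))) ⟩
    brk (P Z.+ y Z.+ (P Z.+ y)) * euler (ladder (+ 4) (+ (p N.+ x N.+ (p N.+ x) N.+ 4)) k) * euler (windowTops p x (suc k)) ∎
    where
    P = + p
    y = + x
    Y = pos⁺ (oddsFrom (x N.+ 2) k)
    Ψ = ∏ ψ Y
    Δ = D y Y
    Π = pairs Y
    l₁ = euler (ladder (+ 2) (+ (x N.+ 2)) k)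
    l₂ = euler (ladder (+ 2) (+ (p N.+ (x N.+ 2))) k)
    w = euler (ladder (+ 2) (+ (x N.+ (x N.+ 2))) p)
    w' = euler (ladder (+ 2) (+ (x N.+ (x N.+ 2 N.+ (k N.+ k)))) p)
    e : ∀ p x → p N.+ (x N.+ 2) N.+ (p N.+ (x N.+ 2)) ≡ p N.+ x N.+ (p N.+ x) N.+ 4
    e = ℕ-solve-∀

  -- On a contiguous alphabet F is computed along consecutive entries instead of runner by runner,
  -- which yields ladders of steps 2 and 4, that is, products with the bases q and q².
  F-natural : ∀ x k → 1 ≤ x → F (pos⁺ (oddsFrom x k)) * euler (naturalLows x k) ≈ euler (naturalTops x k)
  F-natural x k q = trans (*-congˡ (trans (euler-++ (ladder (+ 2) (+ x) k) _) (*-congˡ (euler-++ (ladder (+ 2) (+ (p N.+ x)) k) _))))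
    (trans (factors x k q) (sym (euler-++ (ladder (+ 4) (+ (p N.+ x N.+ (p N.+ x))) k) _)))

-- Infinite products modulo a power of x

module EulerProducts (CR : CommutativeRing 0ℓ 0ℓ) (b : ℤ → CommutativeRing.Carrier CR) (B : ℕ)
  (big : ∀ e → NonNeg (e Z.- + B) → CommutativeRing._≈_ CR (b e) (CommutativeRing.1# CR)) (Λ : ℕ) (B≤Λ : B ≤ Λ) where
  open RingKit CR
  open Determinant CR using (∏₂)

  euler : List ℤ → C
  euler = ∏ b

  euler-++ : ∀ X Y → euler (X ++ Y) ≈ euler X * euler Y
  euler-++ = ∏-++ b

  AtLeast : ℤ → Set
  AtLeast e = NonNeg (e Z.- + B)

  euler-big : ∀ {X} → All AtLeast X → euler X ≈ 1#
  euler-big {X} q = trans (∏-cong∈ q big) (∏-1 X)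

  AtLeast-+ : ∀ {e d} → NonNeg d → AtLeast e → AtLeast (e Z.+ d)
  AtLeast-+ {e} {d} n q = NonNeg-≡ (eq e d (+ B)) (NonNeg-+ q n)
    where
    eq : ∀ e d B → e Z.- B Z.+ d ≡ e Z.+ d Z.- B
    eq = solve-∀

  AtLeast-ladder : ∀ {d e} k → NonNeg d → AtLeast e → All AtLeast (ladder d e k)
  AtLeast-ladder zero n q = []
  AtLeast-ladder {d} {e} (suc k) n q = q ∷ AtLeast-ladder k n (AtLeast-+ {e} n q)

  shifted : ∀ d {x y} k → x ≡ y → euler (ladder d x k) ≈ euler (ladder d y k)
  shifted d k P.refl = refl

  extend : ∀ d e k l → NonNeg d → AtLeast (e Z.+ + k Z.* d) → euler (ladder d e (k N.+ l)) ≈ euler (ladder d e k)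
  extend d e zero l n q = euler-big (AtLeast-ladder l n (NonNeg-≡ (P.cong (Z._- + B) (eq e d)) q))
    where
    eq : ∀ e d → e Z.+ 0ℤ Z.* d ≡ e
    eq = solve-∀
  extend d e (suc k) l n q = *-congˡ (extend d (e Z.+ d) k l n (NonNeg-≡ (P.cong (Z._- + B) (P.trans (P.cong (λ k → e Z.+ k Z.* d) (pos-+ 1 k)) (eq e d (+ k)))) q))
    where
    eq : ∀ e d k → e Z.+ (1ℤ Z.+ k) Z.* d ≡ e Z.+ d Z.+ k Z.* d
    eq = solve-∀

  stable : ∀ x d k → B ≤ k → euler (ladder (+ suc d) (+ x) k) ≈ euler (ladder (+ suc d) (+ x) Λ)
  stable x d k q = trans (cut k q) (sym (cut Λ B≤Λ))
    where
    far : AtLeast (+ x Z.+ + B Z.* + suc d)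
    far = NonNeg-≡ (P.trans (eq (+ x) (+ B) (+ d)) (P.cong (λ z → + x Z.+ + B Z.* z Z.- + B) (P.sym (pos-+ 1 d)))) (NonNeg-+ (NonNeg-ℕ x) (NonNeg-* (NonNeg-ℕ B) (NonNeg-ℕ d)))
      where
      eq : ∀ x B d → x Z.+ B Z.* d ≡ x Z.+ B Z.* (1ℤ Z.+ d) Z.- B
      eq = solve-∀
    cut : ∀ k → B ≤ k → euler (ladder (+ suc d) (+ x) k) ≈ euler (ladder (+ suc d) (+ x) B)
    cut k q = trans (cong≈ (λ k → euler (ladder (+ suc d) (+ x) k)) (P.sym (m+[n∸m]≡n q))) (extend (+ suc d) (+ x) B (k N.∸ B) (NonNeg-ℕ (suc d)) far)

  first-factor : ∀ x d → euler (ladder (+ suc d) (+ x) Λ) ≈ b (+ x) * euler (ladder (+ suc d) (+ (x N.+ suc d)) Λ)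
  first-factor x d = sym (stable x d (suc Λ) (m≤n⇒m≤1+n B≤Λ))

  interleave : ∀ d x k → euler (ladder (+ (d N.+ d)) (+ x) k) * euler (ladder (+ (d N.+ d)) (+ (x N.+ d)) k) ≈ euler (ladder (+ d) (+ x) (k N.+ k))
  interleave d x zero = *-identityˡ 1#
  interleave d x (suc k) = trans (*-interchange _ _ _ _) (trans (*-assoc _ _ _) (trans (*-congˡ (*-congˡ (trans
      (*-cong (shifted (+ (d N.+ d)) k (P.cong +_ (P.sym (NP.+-assoc x d d)))) (shifted (+ (d N.+ d)) k (P.cong +_ (P.sym (NP.+-assoc (x N.+ d) d d)))))
      (interleave d (x N.+ d N.+ d) k)))) (cong≈ (λ k → b (+ x) * euler (ladder (+ d) (+ (x N.+ d)) k)) (P.sym (+-suc k k)))))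

  ∏-upTo-suc : ∀ (f : ℕ → C) k → ∏ f (upTo (suc k)) ≈ f 0 * ∏ (λ i → f (suc i)) (upTo k)
  ∏-upTo-suc f k = *-congˡ (trans (cong≈ (∏ f) (P.sym (Lₚ.map-upTo suc k))) (∏-map f suc (upTo k)))

  b₂ : ℕ → ℕ → C
  b₂ A j = b (+ (2 N.* (A N.∸ j))) * b (+ (2 N.* (A N.+ j)))

  -- A common factor for numerator and denominator. It completes the ladders of the natural side to
  -- full powers of (q;q) and those of the dual side to theta functions.
  Δ : ℕ → C
  Δ n = ∏ (λ A → ∏ (b₂ A) (upTo A)) (upTo (suc n))

  module Natural where
    R : ℕ → C
    R x = euler (ladder (+ 2) (+ x) Λ)

    R-suc : ∀ x → R x ≈ b (+ x) * R (x N.+ 2)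
    R-suc x = first-factor x 1

    R≡ : ∀ {x y} → x ≡ y → R x ≈ R y
    R≡ P.refl = refl

    falling : ∀ A → R 2 ≈ ∏ (λ j → b (+ (2 N.* (A N.∸ j)))) (upTo A) * R (2 N.* A N.+ 2)
    falling zero = sym (*-identityˡ _)
    falling (suc A) = trans (falling A) (trans (*-congˡ (trans (R-suc _) (*-cong (cong≈ (λ z → b (+ z)) (eq A)) (R≡ (P.cong (N._+ 2) (eq A))))))
      (trans (x∙yz≈yx∙z _ _ _) (*-congʳ (sym (∏-upTo-suc (λ j → b (+ (2 N.* (suc A N.∸ j)))) A)))))
      where
      eq : ∀ A → 2 N.* A N.+ 2 ≡ 2 N.* suc A
      eq = ℕ-solve-∀

    climbing : ∀ A k → R (2 N.* A) ≈ ∏ (λ j → b (+ (2 N.* (A N.+ j)))) (upTo k) * R (2 N.* (A N.+ k))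
    climbing A zero = trans (R≡ (P.cong (2 N.*_) (P.sym (NP.+-identityʳ A)))) (sym (*-identityˡ _))
    climbing A (suc k) = trans (climbing A k) (trans (*-congˡ (trans (R-suc _) (*-congˡ (R≡ (eq A k))))) (trans (sym (*-assoc _ _ _)) (*-congʳ (sym (∏-upTo-snoc (λ j → b (+ (2 N.* (A N.+ j)))) k)))))
      where
      eq : ∀ A k → 2 N.* (A N.+ k) N.+ 2 ≡ 2 N.* (A N.+ suc k)
      eq = ℕ-solve-∀

    -- The factors at 2(A - j) extend R (2A + 2) down to R 2, those at 2(A + j) extend R (4A) down
    -- to R (2A).
    row : ∀ A → R (2 N.* A N.+ 2) * R (2 N.* (A N.+ A)) * ∏ (b₂ A) (upTo A) ≈ R (2 N.* A) * R 2
    row A = begin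
      R (2 N.* A N.+ 2) * R (2 N.* (A N.+ A)) * ∏ (b₂ A) (upTo A) ≈⟨ *-congˡ (∏-* _ _ (upTo A)) ⟩
      _ ≈⟨ solve 4 (λ r q x y → r :* q :* (x :* y) := (y :* q) :* (x :* r)) refl _ _ _ _ ⟩
      _ ≈⟨ *-cong (sym (climbing A A)) (sym (falling A)) ⟩
      R (2 N.* A) * R 2 ∎

    product : ℕ → C
    product n = R (2 N.* n N.+ 2) * ∏ (λ l → R (4 N.* l N.+ 4)) (upTo n)

    product-Δ : ∀ n → product n * Δ n ≈ R 2 ^ suc n
    product-Δ zero = solve 1 (λ r → r :* con (+ 1) :* (con (+ 1) :* con (+ 1)) := r :* con (+ 1)) refl (R 2)
    product-Δ (suc n) = begin
      r * ∏ (λ l → R (4 N.* l N.+ 4)) (upTo (suc n)) * Δ (suc n) ≈⟨ *-cong (*-congˡ (∏-upTo-snoc _ n)) (∏-upTo-snoc _ (suc n)) ⟩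
      r * (Π * R (4 N.* n N.+ 4)) * (Δ n * ∏ (b₂ (suc n)) (upTo (suc n))) ≈⟨ solve 5 (λ r p q d x → r :* (p :* q) :* (d :* x) := (r :* q :* x) :* (p :* d)) refl _ _ _ _ _ ⟩
      r * R (4 N.* n N.+ 4) * ∏ (b₂ (suc n)) (upTo (suc n)) * (Π * Δ n) ≈⟨ *-congʳ (trans (*-congʳ (*-congˡ (R≡ (e₁ n)))) (trans (row (suc n)) (*-congʳ (R≡ (e₂ n))))) ⟩
      R (2 N.* n N.+ 2) * R 2 * (Π * Δ n) ≈⟨ solve 4 (λ a b c d → a :* b :* (c :* d) := b :* (a :* c :* d)) refl _ _ _ _ ⟩
      R 2 * (product n * Δ n) ≈⟨ *-congˡ (product-Δ n) ⟩
      R 2 ^ suc (suc n) ∎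
      where
      r = R (2 N.* suc n N.+ 2)
      Π = ∏ (λ l → R (4 N.* l N.+ 4)) (upTo n)
      e₁ : ∀ n → 4 N.* n N.+ 4 ≡ 2 N.* (suc n N.+ suc n)
      e₁ = ℕ-solve-∀
      e₂ : ∀ n → 2 N.* suc n ≡ 2 N.* n N.+ 2
      e₂ = ℕ-solve-∀

    -- Reads the windows by columns. A column has step 4, and two neighbouring columns interleave to
    -- a ladder of step 2.
    windows-snoc : ∀ l x k → euler (windows (suc l) x k) ≈ euler (windows l x k) * euler (ladder (+ 4) (+ (x N.+ (x N.+ 2) N.+ l N.* 2)) k)
    windows-snoc l x zero = sym (*-identityˡ 1#)
    windows-snoc l x (suc k) = begin
      euler (ladder (+ 2) y (suc l) ++ windows (suc l) (x N.+ 2) k) ≈⟨ trans (euler-++ (ladder (+ 2) y (suc l)) _) (*-cong (trans (cong≈ euler (ladder-snoc (+ 2) y l)) (euler-++ (ladder (+ 2) y l) _)) (windows-snoc l (x N.+ 2) k)) ⟩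
      euler (ladder (+ 2) y l) * (b (y Z.+ + l Z.* + 2) * 1#) * (euler (windows l (x N.+ 2) k) * euler (ladder (+ 4) (+ (x N.+ 2 N.+ (x N.+ 2 N.+ 2) N.+ l N.* 2)) k))
        ≈⟨ solve 4 (λ a b c d → a :* (b :* con (+ 1)) :* (c :* d) := (a :* c) :* (b :* d)) refl _ _ _ _ ⟩
      _ ≈⟨ *-cong (sym (euler-++ (ladder (+ 2) y l) _)) (*-cong (cong≈ (λ z → b (y Z.+ z)) (P.sym (pos-* l 2))) (shifted (+ 4) k (P.cong +_ (eq x l)))) ⟩
      euler (windows l x (suc k)) * (b (+ (x N.+ (x N.+ 2) N.+ l N.* 2)) * euler (ladder (+ 4) (+ (x N.+ (x N.+ 2) N.+ l N.* 2 N.+ 4)) k)) ∎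
      where
      y = + (x N.+ (x N.+ 2))
      eq : ∀ x l → x N.+ 2 N.+ (x N.+ 2 N.+ 2) N.+ l N.* 2 ≡ x N.+ (x N.+ 2) N.+ l N.* 2 N.+ 4
      eq = ℕ-solve-∀

    no-windows : ∀ x k → euler (windows 0 x k) ≈ 1#
    no-windows x zero = refl
    no-windows x (suc k) = no-windows (x N.+ 2) k

    euler-windows : ∀ n k → B ≤ k → euler (windows (suc (n N.+ n)) 1 k) ≈ ∏ (λ l → R (4 N.* l N.+ 4)) (upTo n) * euler (ladder (+ 4) (+ (4 N.* n N.+ 4)) k)
    euler-windows zero k q = trans (windows-snoc 0 1 k) (*-congʳ (no-windows 1 k))
    euler-windows (suc n) k q = begin
      euler (windows (suc (suc n N.+ suc n)) 1 k) ≡⟨ P.cong (λ l → euler (windows (suc (suc l)) 1 k)) (+-suc n n) ⟩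
      euler (windows (suc (suc (suc (n N.+ n)))) 1 k) ≈⟨ trans (windows-snoc _ 1 k) (*-congʳ (trans (windows-snoc _ 1 k) (*-congʳ (euler-windows n k q)))) ⟩
      Π * l₄ (4 N.* n N.+ 4) * l₄ (4 N.+ suc (n N.+ n) N.* 2) * l₄ (4 N.+ suc (suc (n N.+ n)) N.* 2)
        ≈⟨ *-cong (trans (*-assoc _ _ _) (*-congˡ (trans (*-congˡ (shifted (+ 4) k (P.cong +_ (e₁ n)))) (trans (interleave 2 _ k) (stable _ 1 (k N.+ k) (≤-trans q (m≤m+n k k))))))) (shifted (+ 4) k (P.cong +_ (e₂ n))) ⟩
      Π * R (4 N.* n N.+ 4) * l₄ (4 N.* suc n N.+ 4) ≈⟨ *-congʳ (sym (∏-upTo-snoc _ n)) ⟩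
      _ ∎
      where
      l₄ : ℕ → C
      l₄ x = euler (ladder (+ 4) (+ x) k)
      Π = ∏ (λ l → R (4 N.* l N.+ 4)) (upTo n)
      e₁ : ∀ n → 4 N.+ suc (n N.+ n) N.* 2 ≡ 4 N.* n N.+ 4 N.+ 2
      e₁ = ℕ-solve-∀
      e₂ : ∀ n → 4 N.+ suc (suc (n N.+ n)) N.* 2 ≡ 4 N.* suc n N.+ 4
      e₂ = ℕ-solve-∀

  module Dual (p₀ : ℕ) where
    P T : ℤ
    P = + suc p₀
    T = P Z.+ P
    κ : ℕ → ℤ
    κ a = + a Z.+ + a

    -- Up to truncation H e = (x^(T+e);x^T) and O e = (x^(P+e);x^T), both with index ∞.
    H O : ℤ → C
    H e = euler (ladder T (T Z.+ e) Λ)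
    O e = euler (ladder T (P Z.+ e) Λ)

    theta' : ℕ → C
    theta' x = euler (ladder T (+ x) Λ) * euler (ladder T (T Z.- + x) Λ)

    theta₂ : ℕ → ℕ → C
    theta₂ A j = theta' (2 N.* (A N.∸ j)) * theta' (2 N.* (A N.+ j))

    H≡ : ∀ {x y} → x ≡ y → H x ≈ H y
    H≡ P.refl = refl

    theta-split : ∀ x → theta' x ≈ b (+ x) * (H (+ x) * H (Z.- + x))
    theta-split x = trans (*-congʳ (trans (first-factor x (p₀ N.+ suc p₀)) (*-congˡ (shifted T Λ (ZP.+-comm (+ x) T))))) (*-assoc _ _ _)

    h : ℕ → ℤ → C
    h A d = H (κ A Z.+ d) * H (Z.- κ A Z.+ d)

    signs : ∀ (h : ℤ → C) k → ∏ h (centre-pairs k) * h 0ℤ ≈ ∏ (λ j → h (κ j) * h (Z.- κ j)) (upTo (suc k))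
    signs h zero = solve 1 (λ a → a :* con (+ 1) :* a := a :* a :* con (+ 1)) refl (h 0ℤ)
    signs h (suc k) = trans (solve 4 (λ a b c d → a :* (b :* c) :* d := (c :* d) :* (a :* b)) refl _ _ _ _) (trans (*-congʳ (signs h k)) (sym (∏-upTo-snoc _ (suc k))))

    -- The four sign combinations of A and j make up two theta functions without their first
    -- factors; `b₂` supplies these.
    theta-row : ∀ A {j} → j < A → h A (κ j) * h A (Z.- κ j) * b₂ A j ≈ theta₂ A j
    theta-row A {j} q = begin
      H (κ A Z.+ κ j) * H (Z.- κ A Z.+ κ j) * (H (κ A Z.- κ j) * H (Z.- κ A Z.- κ j)) * b₂ A j
        ≈⟨ *-congʳ (*-cong (*-cong (H≡ plus) (H≡ (P.trans (e₁ (+ A) (+ j)) (P.cong Z.-_ minus)))) (*-cong (H≡ minus) (H≡ (P.trans (e₂ (+ A) (+ j)) (P.cong Z.-_ plus))))) ⟩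
      H (+ u) * H (Z.- + l) * (H (+ l) * H (Z.- + u)) * (b (+ l) * b (+ u)) ≈⟨ solve 6 (λ u l' l u' x y → u :* l' :* (l :* u') :* (x :* y) := x :* (l :* l') :* (y :* (u :* u'))) refl _ _ _ _ _ _ ⟩
      b (+ l) * (H (+ l) * H (Z.- + l)) * (b (+ u) * (H (+ u) * H (Z.- + u))) ≈⟨ *-cong (sym (theta-split l)) (sym (theta-split u)) ⟩
      theta₂ A j ∎
      where
      u l : ℕ
      u = 2 N.* (A N.+ j)
      l = 2 N.* (A N.∸ j)
      e₁ : ∀ A j → Z.- (A Z.+ A) Z.+ (j Z.+ j) ≡ Z.- (A Z.+ A Z.- (j Z.+ j))
      e₁ = solve-∀
      e₂ : ∀ A j → Z.- (A Z.+ A) Z.- (j Z.+ j) ≡ Z.- (A Z.+ A Z.+ (j Z.+ j))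
      e₂ = solve-∀
      e₃ : ∀ A j → A Z.+ A Z.+ (j Z.+ j) ≡ + 2 Z.* (A Z.+ j)
      e₃ = solve-∀
      e₄ : ∀ A j → A Z.+ A Z.- (j Z.+ j) ≡ + 2 Z.* (A Z.- j)
      e₄ = solve-∀
      plus : κ A Z.+ κ j ≡ + u
      plus = P.trans (e₃ (+ A) (+ j)) (P.trans (P.cong (λ z → + 2 Z.* z) (P.sym (pos-+ A j))) (P.sym (pos-* 2 (A N.+ j))))
      minus : κ A Z.- κ j ≡ + l
      minus = P.trans (e₄ (+ A) (+ j)) (P.trans (P.cong (λ z → + 2 Z.* z) (P.trans (m-n≡m⊖n A j) (⊖-≥ (<⇒≤ q)))) (P.sym (pos-* 2 (A N.∸ j))))

    row : ∀ a → let A = suc a in H (κ A) * H (Z.- κ A) * ∏ (h A) (centre-pairs a) * ∏ (b₂ A) (upTo A) ≈ ∏ (theta₂ A) (upTo A)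
    row a = trans (*-congʳ (trans (trans (*-comm (H (κ (suc a)) * H (Z.- κ (suc a))) _) (*-congˡ (*-cong (H≡ {κ (suc a)} (P.sym (ZP.+-identityʳ _))) (H≡ {Z.- κ (suc a)} (P.sym (ZP.+-identityʳ _)))))) (signs (h (suc a)) a)))
      (trans (sym (∏-* _ _ (upTo (suc a)))) (∏-cong∈ (upTo-< (suc a)) (λ j q → theta-row (suc a) q)))

    centres : ℕ → C
    centres n = ∏ (λ c → O c * H c) (centre-pairs n) * ∏₂ (λ c d → H (c Z.+ d)) (centre-pairs n)

    -- The additional O 0 is the limit of W_0; it completes the centre 0 to a pair of mirror images.
    -- Each new pair of centres adds H 0 through its mutual interaction and one `row` with the
    -- earlier centres.
    centres-Δ : ∀ n → O 0ℤ * centres n * Δ n ≈ H 0ℤ ^ suc n * (∏ (λ a → O (κ a) * O (Z.- κ a)) (upTo (suc n)) * ∏ (λ A → ∏ (theta₂ A) (upTo A)) (upTo (suc n)))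
    centres-Δ zero = solve 2 (λ o h → o :* (o :* h :* con (+ 1) :* (con (+ 1) :* con (+ 1))) :* (con (+ 1) :* con (+ 1)) := h :* con (+ 1) :* (o :* o :* con (+ 1) :* (con (+ 1) :* con (+ 1)))) refl (O 0ℤ) (H 0ℤ)
    centres-Δ (suc a) = begin
      O 0ℤ * (O k * H k * (O k' * H k' * u) * (H (k Z.+ k') * ∏ (λ d → H (k Z.+ d)) cs * (∏ (λ d → H (k' Z.+ d)) cs * v))) * Δ (suc a)
        ≈⟨ *-cong (*-congˡ (*-congˡ (*-congʳ (*-congʳ (H≡ (+-inverseʳ k)))))) (∏-upTo-snoc _ (suc a)) ⟩
      _ ≈⟨ solve 12 (λ o a b c d u z x y v e r → o :* (a :* b :* (c :* d :* u) :* (z :* x :* (y :* v))) :* (e :* r) := (o :* (u :* v) :* e) :* (z :* (a :* c)) :* (b :* d :* (x :* y) :* r)) refl _ _ _ _ _ _ _ _ _ _ _ _ ⟩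
      O 0ℤ * centres a * Δ a * (H 0ℤ * (O k * O k')) * (H k * H k' * (∏ (λ d → H (k Z.+ d)) cs * ∏ (λ d → H (k' Z.+ d)) cs) * ∏ (b₂ A) (upTo A))
        ≈⟨ *-cong (*-congʳ (centres-Δ a)) (trans (*-congʳ (*-congˡ (sym (∏-* _ _ cs)))) (row a)) ⟩
      H 0ℤ ^ suc a * (X * Y) * (H 0ℤ * (O k * O k')) * ∏ (theta₂ A) (upTo A) ≈⟨ solve 6 (λ p x y z o t → p :* (x :* y) :* (z :* o) :* t := z :* p :* (x :* o :* (y :* t))) refl _ _ _ _ _ _ ⟩
      H 0ℤ ^ suc A * (X * (O k * O k') * (Y * ∏ (theta₂ A) (upTo A))) ≈⟨ *-congˡ (*-cong (sym (∏-upTo-snoc _ A)) (sym (∏-upTo-snoc _ A))) ⟩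
      _ ∎
      where
      A = suc a
      k = κ A
      k' = Z.- κ A
      cs = centre-pairs a
      u = ∏ (λ c → O c * H c) cs
      v = ∏₂ (λ c d → H (c Z.+ d)) cs
      X = ∏ (λ a → O (κ a) * O (Z.- κ a)) (upTo A)
      Y = ∏ (λ A → ∏ (theta₂ A) (upTo A)) (upTo A)

    low : ℤ → List ℤ
    low c = ladder T (P Z.+ c) Λ ++ ladder T (P Z.+ (P Z.+ c)) Λ

    dualLows : ℕ → List ℤ
    dualLows n = concatMap low (centre-pairs n) ++ pairLists (λ c d → ladder T (P Z.+ c Z.+ (P Z.+ d)) Λ) (centre-pairs n)

    dual-product : ∀ n → O 0ℤ * euler (dualLows n) * Δ n ≈
      H 0ℤ ^ suc n * (∏ (λ a → O (κ a) * O (Z.- κ a)) (upTo (suc n)) * ∏ (λ A → ∏ (theta₂ A) (upTo A)) (upTo (suc n)))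
    dual-product n = trans (*-congʳ (*-congˡ (trans (euler-++ (concatMap low (centre-pairs n)) _) (*-cong
        (trans (∏-concatMap b low (centre-pairs n)) (∏-cong (centre-pairs n) (λ c → trans (euler-++ (ladder T (P Z.+ c) Λ) _) (*-congˡ (shifted T Λ (P.sym (ZP.+-assoc P P c)))))))
        (trans (∏-pairLists b _ (centre-pairs n)) (∏₂-cong' (centre-pairs n) (λ c d → shifted T Λ (eq P c d)))))))) (centres-Δ n)
      where
      open PairListProducts CR
      eq : ∀ P c d → P Z.+ c Z.+ (P Z.+ d) ≡ P Z.+ P Z.+ (c Z.+ d)
      eq = solve-∀
      ∏₂-cong' : ∀ {f g : ℤ → ℤ → C} xs → (∀ c d → f c d ≈ g c d) → ∏₂ f xs ≈ ∏₂ g xs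
      ∏₂-cong' [] e = refl
      ∏₂-cong' (x ∷ xs) e = *-cong (∏-cong xs (e x)) (∏₂-cong' xs e)

-- Assembly of the right-hand side

module Elimination (CR : CommutativeRing 0ℓ 0ℓ) where
  open RingKit CR

  -- w = c f/f' = c φ'/φ, with the last fraction expanded by Δ.
  quotient : ∀ {w f f' c φ φ' Δ num den i} → w * f' ≈ c * f → f' * φ' ≈ 1# → f * φ ≈ 1# → c * φ' * Δ ≈ num → φ * Δ ≈ den → den * i ≈ 1# → w ≈ num * i
  quotient {w} {f} {f'} {c} {φ} {φ'} {Δ} {num} {den} {i} e₁ e₂ e₃ e₄ e₅ e₆ = begin
    w ≈⟨ solve 1 (λ w → w := w :* con (+ 1) :* con (+ 1)) refl w ⟩
    w * 1# * 1# ≈⟨ *-cong (*-congˡ (sym e₂)) (sym e₆) ⟩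
    w * (f' * φ') * (den * i) ≈⟨ *-congˡ (*-congʳ (sym e₅)) ⟩
    w * (f' * φ') * (φ * Δ * i) ≈⟨ solve 6 (λ w f g x d i → w :* (f :* g) :* (x :* d :* i) := w :* f :* (g :* (x :* d :* i))) refl w f' φ' φ Δ i ⟩
    w * f' * (φ' * (φ * Δ * i)) ≈⟨ *-congʳ e₁ ⟩
    c * f * (φ' * (φ * Δ * i)) ≈⟨ solve 6 (λ c f g x d i → c :* f :* (g :* (x :* d :* i)) := (f :* x) :* (c :* g :* d :* i)) refl c f φ' φ Δ i ⟩
    f * φ * (c * φ' * Δ * i) ≈⟨ *-cong e₃ (*-congʳ e₄) ⟩
    1# * (num * i) ≈⟨ *-identityˡ _ ⟩
    num * i ∎

  divide : ∀ {f φ u i} → u * i ≈ 1# → f * (φ * u) ≈ u → f * φ ≈ 1#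
  divide {f} {φ} {u} {i} e e' = trans (sym (*-identityʳ _)) (trans (*-congˡ (sym e)) (trans (solve 4 (λ f p u i → f :* p :* (u :* i) := f :* (p :* u) :* i) refl f φ u i) (trans (*-congʳ e') e)))

module TargetForm (CR : CommutativeRing 0ℓ 0ℓ) (b : ℤ → CommutativeRing.Carrier CR) (B : ℕ)
  (big : ∀ e → NonNeg (e Z.- + B) → CommutativeRing._≈_ CR (b e) (CommutativeRing.1# CR)) (Λ : ℕ) (B≤Λ : B ≤ Λ) (m n : ℕ) where
  open RingKit CR
  open EulerProducts CR b B big Λ B≤Λ public

  period : ℕ
  period = suc (m N.+ (n N.+ n))

  open Dual (m N.+ (n N.+ n)) public

  ∏-reverse : ∀ (h : ℕ → C) k → ∏ h (upTo k) ≈ ∏ (λ i → h (k N.∸ suc i)) (upTo k)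
  ∏-reverse h zero = refl
  ∏-reverse h (suc k) = trans (∏-upTo-snoc h k) (trans (*-comm _ _) (trans (*-congˡ (∏-reverse h k)) (sym (∏-upTo-suc (λ i → h (k N.∸ i)) k))))

  triangle : ∀ (g : ℕ → ℕ → C) N → ∏ (λ i → ∏ (λ d → g i (suc i N.+ d)) (upTo (N N.∸ suc i))) (upTo N) ≈ ∏ (λ A → ∏ (λ j → g j A) (upTo A)) (upTo N)
  triangle g zero = refl
  triangle g (suc N) = begin
    ∏ (λ i → ∏ (λ d → g i (suc i N.+ d)) (upTo (N N.∸ i))) (upTo (suc N)) ≈⟨ trans (∏-upTo-snoc _ N) (trans (*-congˡ (cong≈ (λ k → ∏ (λ d → g N (suc N N.+ d)) (upTo k)) (n∸n≡0 N))) (*-identityʳ _)) ⟩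
    ∏ (λ i → ∏ (λ d → g i (suc i N.+ d)) (upTo (N N.∸ i))) (upTo N) ≈⟨ ∏-cong∈ (upTo-< N) (λ i q → trans (cong≈ (λ k → ∏ (λ d → g i (suc i N.+ d)) (upTo k)) (+-∸-assoc 1 q))
         (trans (∏-upTo-snoc _ (N N.∸ suc i)) (*-congˡ (cong≈ (g i) (m+[n∸m]≡n q))))) ⟩
    ∏ (λ i → ∏ (λ d → g i (suc i N.+ d)) (upTo (N N.∸ suc i)) * g i N) (upTo N) ≈⟨ trans (∏-* _ _ (upTo N)) (*-congʳ (triangle g N)) ⟩
    ∏ (λ A → ∏ (λ j → g j A) (upTo A)) (upTo N) * ∏ (λ j → g j N) (upTo N) ≈⟨ sym (∏-upTo-snoc _ N) ⟩
    _ ∎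

  module _ (Θ : ℕ → C) (Θ≈ : ∀ x → x ≤ period N.+ period → Θ x ≈ theta' x) where
    -- In reversed order the arguments are `period` - 2a, half a period of the theta function minus
    -- 2a, so each one consists of the ladders of two mirror images.
    single : ∏ (λ i → Θ (2 N.* i N.+ m N.∸ 1)) (range 1 (suc n)) ≈ ∏ (λ a → O (+ a Z.+ + a) * O (Z.- (+ a Z.+ + a))) (upTo (suc n))
    single = trans (∏-map _ (1 N.+_) (upTo (suc n))) (trans (∏-cong∈ (upTo-< (suc n)) (λ i q → one i (n N.∸ i) (m∸n+n≡m (≤-pred q)))) (sym (∏-reverse (λ a → O (+ a Z.+ + a) * O (Z.- (+ a Z.+ + a))) (suc n))))
      where
      one : ∀ i a → a N.+ i ≡ n → Θ (2 N.* suc i N.+ m N.∸ 1) ≈ O (+ a Z.+ + a) * O (Z.- (+ a Z.+ + a))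
      one i a e = trans (Θ≈ x (≤-trans (m≤m+n x (a N.+ a)) (≤-trans (≤-reflexive x+) (m≤m+n period period))))
          (trans (*-cong (shifted (+ (period N.+ period)) Λ x≡) (shifted (+ (period N.+ period)) Λ (P.trans (P.cong (λ z → + period Z.+ + period Z.- z) x≡) (eq₂ (+ period) (+ a Z.+ + a))))) (*-comm _ _))
        where
        x : ℕ
        x = i N.+ suc (i N.+ 0) N.+ m
        x+ : x N.+ (a N.+ a) ≡ period
        x+ = P.trans (eq i a m) (P.cong (λ n → suc (m N.+ (n N.+ n))) e)
          where
          eq : ∀ i a m → i N.+ suc (i N.+ 0) N.+ m N.+ (a N.+ a) ≡ suc (m N.+ ((a N.+ i) N.+ (a N.+ i)))
          eq = ℕ-solve-∀
        eq₁ : ∀ x c → x ≡ x Z.+ c Z.+ (Z.- c)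
        eq₁ = solve-∀
        eq₂ : ∀ P c → P Z.+ P Z.- (P Z.+ (Z.- c)) ≡ P Z.+ c
        eq₂ = solve-∀
        x≡ : + x ≡ + period Z.+ (Z.- (+ a Z.+ + a))
        x≡ = P.trans (eq₁ (+ x) (+ a Z.+ + a)) (P.cong (λ z → z Z.+ (Z.- (+ a Z.+ + a))) (P.cong +_ x+))

    -- With both indices lowered by one, j - i and i + j - 2 become the difference and the sum of A
    -- and j.
    double : ∏ id (concatMap (λ i → map (λ j → Θ (2 N.* (j N.∸ i)) * Θ (2 N.* (i N.+ j N.∸ 2))) (range (suc i) (suc n))) (range 1 (suc n))) ≈
      ∏ (λ A → ∏ (theta₂ A) (upTo A)) (upTo (suc n))
    double = trans (∏-concatMap id (λ i → map (g i) (range (suc i) (suc n))) (range 1 (suc n))) (trans (∏-map (λ i → ∏ id (map (g i) (range (suc i) (suc n)))) (1 N.+_) (upTo (suc n)))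
      (trans (∏-cong (upTo (suc n)) (λ i → trans (∏-map id (g (suc i)) (range (suc (suc i)) (suc n))) (∏-map (g (suc i)) (suc (suc i) N.+_) (upTo (n N.∸ i)))))
      (trans (triangle (λ j A → Θ (2 N.* (A N.∸ j)) * Θ (2 N.* (j N.+ suc A N.∸ 1))) (suc n))
        (∏-cong∈ (upTo-< (suc n)) (λ A q → ∏-cong∈ (upTo-< A) (λ j r → *-cong
          (Θ≈ _ (small (≤-trans (m∸n≤m A j) (≤-trans (≤-pred q) (m≤m+n n n)))))
          (trans (cong≈ (λ z → Θ (2 N.* (z N.∸ 1))) (P.trans (+-suc j A) (P.cong suc (NP.+-comm j A))))
            (Θ≈ _ (small (+-mono-≤ (≤-pred q) (≤-trans (<⇒≤ r) (≤-pred q))))))))))))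
      where
      g : ℕ → ℕ → C
      g i j = Θ (2 N.* (j N.∸ i)) * Θ (2 N.* (i N.+ j N.∸ 2))
      small : ∀ {k} → k ≤ n N.+ n → 2 N.* k ≤ period N.+ period
      small {k} q = +-mono-≤ le (≤-trans (≤-reflexive (NP.+-identityʳ k)) le)
        where le = ≤-trans q (≤-trans (m≤n+m (n N.+ n) m) (n≤1+n _))

    p₀ : ℕ
    p₀ = suc (n N.+ n)
    open Natural

    windowTops-big : ∀ l x k → B ≤ x N.+ k → All AtLeast (windowTops l x k)
    windowTops-big l x zero q = []
    windowTops-big l x (suc k) q = Allₚ.++⁺ (AtLeast-ladder l (NonNeg-ℕ 2) (NonNeg-∸ (≤-trans q (+-monoʳ-≤ x (≤-trans (≤-trans (s≤s (m≤m+n k k)) (n≤1+n _)) (m≤n+m _ x)) ▹ eq x k))))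
        (windowTops-big l (x N.+ 2) k (≤-trans q (≤-trans (n≤1+n _) (≤-reflexive (eq₂ x k)))))
      where
      _▹_ : ∀ {a b c} → a ≤ b → b ≡ c → a ≤ c
      q ▹ P.refl = q
      eq : ∀ x k → x N.+ (x N.+ suc (suc (k N.+ k))) ≡ x N.+ (x N.+ 2 N.+ (k N.+ k))
      eq = ℕ-solve-∀
      eq₂ : ∀ x k → suc (x N.+ suc k) ≡ x N.+ 2 N.+ k
      eq₂ = ℕ-solve-∀

    -- The number of columns is odd, so one column of step 4 finds no partner; it cancels against
    -- `natural-tops`.
    natural-lows : ∀ K → B ≤ K → euler (ladder (+ 2) (+ 1) K ++ ladder (+ 2) (+ (p₀ N.+ 1)) K ++ windows p₀ 1 K) ≈ R 1 * product n * euler (ladder (+ 4) (+ (4 N.* n N.+ 4)) K)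
    natural-lows K q = trans (euler-++ (ladder (+ 2) (+ 1) K) _) (trans (*-cong (stable 1 1 K q) (trans (euler-++ (ladder (+ 2) (+ (p₀ N.+ 1)) K) _)
        (*-cong (trans (stable _ 1 K q) (cong≈ R (eq n))) (euler-windows n K q))))
      (solve 4 (λ a b c d → a :* (b :* (c :* d)) := a :* (b :* c) :* d) refl _ _ _ _))
      where
      eq : ∀ n → suc (n N.+ n) N.+ 1 ≡ 2 N.* n N.+ 2
      eq = ℕ-solve-∀

    natural-tops : ∀ K → B ≤ K → euler (ladder (+ 4) (+ (p₀ N.+ 1 N.+ (p₀ N.+ 1))) K ++ windowTops p₀ 1 K) ≈ euler (ladder (+ 4) (+ (4 N.* n N.+ 4)) K)
    natural-tops K q = trans (euler-++ (ladder (+ 4) (+ (p₀ N.+ 1 N.+ (p₀ N.+ 1))) K) _) (trans (*-cong (shifted (+ 4) K (P.cong +_ (eq n))) (euler-big (windowTops-big p₀ 1 K (m≤n⇒m≤1+n q)))) (*-identityʳ _))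
      where
      eq : ∀ n → suc (n N.+ n) N.+ 1 N.+ (suc (n N.+ n) N.+ 1) ≡ 4 N.* n N.+ 4
      eq = ℕ-solve-∀

    evaluate : ∀ {w f f' c h p₁ p₂ i u} K → B ≤ K → w * f' ≈ c * f →
      f' * euler (dualLows n) ≈ 1# →
      f * euler (ladder (+ 2) (+ 1) K ++ ladder (+ 2) (+ (p₀ N.+ 1)) K ++ windows p₀ 1 K) ≈ euler (ladder (+ 4) (+ (p₀ N.+ 1 N.+ (p₀ N.+ 1))) K ++ windowTops p₀ 1 K) →
      euler (ladder (+ 4) (+ (4 N.* n N.+ 4)) K) * u ≈ 1# →
      c ≈ O 0ℤ → h ≈ H 0ℤ → p₁ ≈ euler (ladder (+ 1) (+ 1) Λ) → p₂ ≈ R 2 → p₂ ^ n * p₁ * i ≈ 1# →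
      w ≈ h ^ suc n * ∏ (λ i → Θ (2 N.* i N.+ m N.∸ 1)) (range 1 (suc n)) *
        ∏ id (concatMap (λ i → map (λ j → Θ (2 N.* (j N.∸ i)) * Θ (2 N.* (i N.+ j N.∸ 2))) (range (suc i) (suc n))) (range 1 (suc n))) * i
    evaluate {w} {f} {f'} {c} {h} {p₁} {p₂} {i} {u} K q wf f'φ' fφ ui c≈ h≈ p₁≈ p₂≈ di = quotient wf f'φ'
      (divide ui (trans (*-congˡ (sym (natural-lows K q))) (trans fφ (natural-tops K q))))
      (trans (*-congʳ (*-congʳ c≈)) (trans (dual-product n) (trans (sym (*-assoc _ _ _)) (*-cong (*-cong (^-cong (suc n) (sym h≈)) (sym single)) (sym double)))))
      -- One of the n + 1 factors R 2 interleaves with R 1 to the ladder of step 1, which is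
      -- (q^(1/2);q^(1/2)).
      (trans (*-assoc _ _ _) (trans (*-congˡ (product-Δ n)) (trans (x∙yz≈z∙xy _ _ _)
        (*-cong (^-cong n (sym p₂≈)) (trans (interleave 1 1 Λ) (trans (stable 1 0 (Λ N.+ Λ) (≤-trans B≤Λ (m≤m+n Λ Λ))) (sym p₁≈)))))))
      di
      where open Elimination CR

-- Euler products as power series

brkS : ℤ → Series
brkS (+ k) = oneS ⊖ mono k
-- A default value: `ι-euler` translates nonnegative exponents only.
brkS -[1+ k ] = oneS

brkS-big : ∀ B e → NonNeg (e Z.- + B) → ∀ i → i < B → brkS e i ≡ oneS i
brkS-big B e (k , q) i i<B = P.trans (P.cong (λ e → brkS e i) e≡) (P.trans (P.cong (λ z → oneS i Z.+ Z.- z) (P.trans (P.sym (P.trans (⊗-comm i (mono (B N.+ k)) oneS) (⊗-identityˡ i (mono (B N.+ k)))))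
    (mono-below (B N.+ k) oneS i (≤-trans i<B (m≤m+n B k))))) (ZP.+-identityʳ (oneS i)))
  where
  eq : ∀ e B → e ≡ B Z.+ (e Z.- B)
  eq = solve-∀
  e≡ : e ≡ + (B N.+ k)
  e≡ = P.trans (eq e (+ B)) (P.trans (P.cong (λ z → + B Z.+ z) q) (P.sym (pos-+ B k)))

eulerS : List ℤ → Series
eulerS E = prodS (map brkS E)

One-euler : ∀ d x k → One (eulerS (ladder (+ d) (+ suc x) k))
One-euler d x zero = P.refl
One-euler d x (suc k) = One-⊗ {brkS (+ suc x)} {eulerS (ladder (+ d) (+ suc x Z.+ + d) k)} P.refl (One-euler d (x N.+ d) k)

prodS-map : ∀ {A : Set} B (f : A → Series) xs → prodS (map f xs) ≡ RingKit.∏ (truncated B) f xs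
prodS-map B f [] = P.refl
prodS-map B f (x ∷ xs) = P.cong (f x ⊗_) (prodS-map B f xs)

prodS-id : ∀ B xs → prodS xs ≡ RingKit.∏ (truncated B) id xs
prodS-id B [] = P.refl
prodS-id B (x ∷ xs) = P.cong (x ⊗_) (prodS-id B xs)

powS-^ : ∀ B f k → powS f k ≡ RingKit._^_ (truncated B) f k
powS-^ B f zero = P.refl
powS-^ B f (suc k) = P.cong (f ⊗_) (powS-^ B f k)

prodS-cong : ∀ {A : Set} {f g : A → Series} xs → (∀ x → f x ≋ g x) → prodS (map f xs) ≋ prodS (map g xs)
prodS-cong [] e N = P.refl
prodS-cong {f = f} {g} (x ∷ xs) e N = ⊗-cong-at N (f x) (g x) (prodS (map f xs)) (prodS (map g xs)) (λ k _ → e x k) (λ k _ → prodS-cong xs e k)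

ladder-upTo : ∀ d e k → ladder (+ d) (+ e) k ≡ map (λ j → + (e N.+ d N.* j)) (upTo k)
ladder-upTo d e zero = P.refl
ladder-upTo d e (suc k) = P.cong₂ _∷_ (P.cong +_ (P.sym (P.trans (P.cong (e N.+_) (NP.*-zeroʳ d)) (NP.+-identityʳ e))))
  (P.trans (ladder-upTo d (e N.+ d) k) (P.trans (Lₚ.map-cong (λ j → P.cong +_ (P.trans (NP.+-assoc e d (d N.* j)) (P.cong (e N.+_) (P.sym (*-suc d j))))) (upTo k))
    (P.trans (Lₚ.map-∘ (upTo k)) (P.cong (map _) (Lₚ.map-upTo suc k)))))

poch-ladder : ∀ e d k → poch 1ℤ e d k ≋ eulerS (ladder (+ d) (+ e) k)
poch-ladder e d k N = P.trans (prodS-cong {g = λ j → brkS (+ (e N.+ d N.* j))} (upTo k) (λ j N → P.cong (λ z → oneS N Z.+ Z.- z) (ZP.*-identityˡ _)) N)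
  (P.cong (λ E → prodS E N) (P.trans (Lₚ.map-∘ (upTo k)) (P.cong (map brkS) (P.sym (ladder-upTo d e k)))))

-- `pochInf` uses i + 1 factors for coefficient i; modulo x^(i+1) all longer ladders have the same
-- product.
pochInf-ladder : ∀ {B Λ} → B ≤ Λ → ∀ e d i → i < B → pochInf 1ℤ e (suc d) i ≡ eulerS (ladder (+ suc d) (+ e) Λ) i
pochInf-ladder {B} {Λ} q e d i r = P.trans (poch-ladder e (suc d) (suc i) i) (P.trans (P.cong (λ f → f i) (prodS-map (suc i) brkS (ladder (+ suc d) (+ e) (suc i))))
    (P.trans (stable e d (suc i) ≤-refl i ≤-refl) (P.cong (λ f → f i) (P.sym (prodS-map (suc i) brkS (ladder (+ suc d) (+ e) Λ))))))
  where open EulerProducts (truncated (suc i)) brkS (suc i) (brkS-big (suc i)) Λ (≤-trans r q)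

NonNeg-ladder : ∀ {d e} k → NonNeg d → NonNeg e → All NonNeg (ladder d e k)
NonNeg-ladder zero n q = []
NonNeg-ladder (suc k) n q = q ∷ NonNeg-ladder k n (NonNeg-+ q n)

NonNeg-windows : ∀ l x k → All NonNeg (windows l x k)
NonNeg-windows l x zero = []
NonNeg-windows l x (suc k) = Allₚ.++⁺ (NonNeg-ladder l (NonNeg-ℕ 2) (NonNeg-ℕ _)) (NonNeg-windows l (x N.+ 2) k)

NonNeg-windowTops : ∀ l x k → All NonNeg (windowTops l x k)
NonNeg-windowTops l x zero = []
NonNeg-windowTops l x (suc k) = Allₚ.++⁺ (NonNeg-ladder l (NonNeg-ℕ 2) (NonNeg-ℕ _)) (NonNeg-windowTops l (x N.+ 2) k)

All-concatMap : ∀ {A B : Set} {P : A → Set} {Q : B → Set} (f : A → List B) {xs} → All P xs → (∀ x → P x → All Q (f x)) → All Q (concatMap f xs)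
All-concatMap f [] h = []
All-concatMap f (p ∷ ps) h = Allₚ.++⁺ (h _ p) (All-concatMap f ps h)

All-pairLists : ∀ {A B : Set} {P : A → Set} {Q : B → Set} (f : A → A → List B) {xs} → All P xs → (∀ x y → P x → P y → All Q (f x y)) → All Q (pairLists f xs)
All-pairLists f [] h = []
All-pairLists f (p ∷ ps) h = Allₚ.++⁺ (All-concatMap (f _) ps (λ y → h _ y p)) (All-pairLists f ps h)

length-blocks : ∀ p w x k → k ≤ length (blocks p (suc w) x k)
length-blocks p w x zero = z≤n
length-blocks p w x (suc k) = s≤s (≤-trans (length-blocks p w _ k) (≤-trans (m≤n+m _ (length (oddsFrom (x N.+ 2) w))) (≤-reflexive (P.sym (Lₚ.length-++ (oddsFrom (x N.+ 2) w))))))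

-- Evaluation of the N-th coefficient

module Evaluation (SE : SeriesExtension) (m' n' N : ℕ) where
  open SeriesExtension SE using (L; ι; ι-cong; ι-injective; ι-*; ι-1)
  open LaurentKit L
  open Divisibility SE

  m : ℕ
  m = suc m'
  open Comparison SE m n' using (offset; agreement)
  -- The coefficients below B are compared. Λ exceeds `offset` + N, as `agreement` demands, and also
  -- 2N, so that K ≥ Λ variables suffice for `lhs-finite`; K counts the letters in Λ blocks of width
  -- p.
  B Λ p K : ℕ
  B = suc N
  Λ = suc (offset N.+ N N.+ N)
  p = suc (n' N.+ n')
  K = Λ N.* p

  B≤Λ : B ≤ Λ
  B≤Λ = s≤s (m≤n+m N (offset N.+ N))

  Λ≤K : Λ ≤ K
  Λ≤K = m≤m*n Λ p

  module 𝓝 = Comparison.Natural SE m n' Λ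
  module 𝓓 = Comparison.Dual SE m n' Λ
  module T = TargetForm (truncated B) brkS B (brkS-big B) Λ B≤Λ m n'
  module D = ProductFormula L T.period 0 n' Λ (s≤s (m≤n+m (n' N.+ n') m))
  module O = NaturalOrder L (n' N.+ n')

  brk : ℤ → C
  brk e = 1# - ξ e

  ι-euler : ∀ {E} → All NonNeg E → ι (eulerS E) ≈ ∏ brk E
  ι-euler [] = ι-1
  ι-euler ((k , P.refl) ∷ qs) = trans (ι-* _ _) (*-cong (SeriesHallLittlewood.ι-1-mono SE 0 k) (ι-euler qs))

  with-euler : ∀ {u f E E'} → ι f ≈ u → All NonNeg E → All NonNeg E' → u * ∏ brk E ≈ ∏ brk E' → (f ⊗ eulerS E) ≋ eulerS E'
  with-euler e q q' r = ι-injective (trans (ι-* _ _) (trans (*-cong e (ι-euler q)) (trans r (sym (ι-euler q')))))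

  without-pole : ∀ {u} (d : Div 0 u) → ι (proj₁ d) ≈ u
  without-pole (f , e) = sym (trans e (trans (*-congʳ ξ-0) (*-identityˡ _)))

  S≡ : 𝓝.positions ≡ oddsFrom 1 K
  S≡ = P.trans (P.cong (λ x → blocks p p x Λ) (P.trans (+-∸-assoc 1 (≤-refl {n' N.+ n'})) (P.cong suc (n∸n≡0 (n' N.+ n'))))) (blocks-contiguous p 1 Λ)

  finite-W : ∀ p (0<p : 0 < p) → p ≡ suc (n' N.+ n') → ι (SeriesTerm.finiteSum SE p 0<p m K) ≈ 𝓝.W m (pos⁺ 𝓝.positions)
  finite-W p 0<p P.refl = trans (SeriesTerm.ι-finiteSum SE p 0<p m' K) (cong≈ (𝓝.W m) (P.trans (SeriesTerm.alphabet-odds SE p 0<p K) (P.cong pos⁺ (P.sym S≡))))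

  p≡ : 2 N.* suc n' N.∸ 1 ≡ p
  p≡ = P.trans (+-suc n' (n' N.+ 0)) (P.cong (λ z → suc (n' N.+ z)) (NP.+-identityʳ n'))

  0<p : 0 < 2 N.* suc n' N.∸ 1
  0<p = P.subst (0 <_) (P.sym p≡) (s≤s z≤n)

  open FinitePartitionSum SE (suc n') 0<p using (lhs-finite)

  w f f' c h p₁ p₂ den : Series
  w = SeriesTerm.finiteSum SE (2 N.* suc n' N.∸ 1) 0<p m K
  f = proj₁ (𝓝.Div-F 𝓝.positions-positive)
  f' = proj₁ (𝓓.Div-F 𝓓.positions-positive)
  len : ℕ
  len = length (pos⁺ 𝓓.positions)
  c = eulerS (ladder D.T (+ T.period) len)
  h = pochInf 1ℤ (T.period N.+ T.period) (T.period N.+ T.period)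
  p₁ = pochInf 1ℤ 1 1
  p₂ = pochInf 1ℤ 2 2
  den = powS p₂ n' ⊗ p₁

  P : ℤ
  P = + T.period

  rising-ladder : ∀ k → ∏ brk (ladder D.T P k) ≈ 𝓓.rising (- D.s) k
  rising-ladder zero = refl
  rising-ladder (suc k) = trans (cong≈ (∏ brk) (ladder-snoc D.T P k)) (trans (∏-++ brk (ladder D.T P k) _) (trans (*-comm _ _) (*-cong (trans (*-identityʳ _) (+-congˡ
      (trans (-‿cong (trans (ξ-+ P _) (*-congˡ (power k)))) (-‿distribˡ-* _ _)))) (rising-ladder k))))
    where
    power : ∀ k → ξ (+ k Z.* D.T) ≈ D.t ^ k
    power zero = trans (cong≈ ξ (ZP.*-zeroˡ D.T)) ξ-0
    power (suc k) = trans (cong≈ ξ (P.trans (P.cong (Z._* D.T) (pos-+ 1 k)) (eq D.T (+ k)))) (trans (ξ-+ D.T (+ k Z.* D.T)) (*-cong (ξ-+ P P) (power k)))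
      where
      eq : ∀ T k → (1ℤ Z.+ k) Z.* T ≡ T Z.+ k Z.* T
      eq = solve-∀

  constant-W : ι c ≈ 𝓓.W 0 (pos⁺ 𝓓.positions)
  constant-W = trans (ι-euler (NonNeg-ladder len (NonNeg-ℕ _) (NonNeg-ℕ _))) (trans (rising-ladder len) (sym (𝓓.W-0 (pos⁺ 𝓓.positions) 𝓓.positions-Good)))

  positive⇒NonNeg : ∀ {e} → D.Positive e → NonNeg e
  positive⇒NonNeg (k , q) = suc k , q

  top-≥ : ∀ c d → NonNeg (P Z.+ c) → NonNeg (P Z.+ d) → NonNeg (P Z.+ c Z.+ (P Z.+ D.adv d Λ) Z.- + B)
  top-≥ c d q r = NonNeg-≡ (P.trans (eq P c d (+ Λ) (+ t) (+ B)) (P.cong (λ z → P Z.+ c Z.+ (P Z.+ z) Z.- + B) (P.trans (P.cong (λ T → d Z.+ + Λ Z.* T) (P.sym (pos-+ 1 t))) (P.sym (D.adv≡ d Λ)))))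
      (NonNeg-+ (NonNeg-+ (NonNeg-+ q r) (NonNeg-∸ B≤Λ)) (NonNeg-* (NonNeg-ℕ Λ) (NonNeg-ℕ t)))
    where
    t : ℕ
    t = m N.+ (n' N.+ n') N.+ T.period
    eq : ∀ P c d l t B → (P Z.+ c) Z.+ (P Z.+ d) Z.+ (l Z.- B) Z.+ l Z.* t ≡ P Z.+ c Z.+ (P Z.+ (d Z.+ l Z.* (1ℤ Z.+ t))) Z.- B
    eq = solve-∀

  T⁺ : NonNeg D.T
  T⁺ = NonNeg-ℕ _

  dual-lows : All NonNeg D.lows
  dual-lows = Allₚ.++⁺ (All-concatMap D.low D.centres-positive (λ c q → Allₚ.++⁺ (NonNeg-ladder Λ T⁺ (positive⇒NonNeg q)) (NonNeg-ladder Λ T⁺ (NonNeg-+ (NonNeg-ℕ T.period) (positive⇒NonNeg q)))))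
    (All-pairLists D.low₂ D.centres-positive (λ c d q r → NonNeg-ladder Λ T⁺ (NonNeg-+ (positive⇒NonNeg q) (positive⇒NonNeg r))))

  dual-tops : All T.AtLeast D.tops
  dual-tops = Allₚ.++⁺ (All-concatMap (λ c → D.top c c) D.centres-positive (λ c q → T.AtLeast-ladder Λ T⁺ (top-≥ c c (positive⇒NonNeg q) (positive⇒NonNeg q))))
    (All-pairLists D.top D.centres-positive (λ c d q r → T.AtLeast-ladder Λ T⁺ (top-≥ c d (positive⇒NonNeg q) (positive⇒NonNeg r))))

  AtLeast⇒NonNeg : ∀ {e} → T.AtLeast e → NonNeg e
  AtLeast⇒NonNeg {e} q = NonNeg-≡ (eq e (+ B)) (NonNeg-+ q (NonNeg-ℕ B))
    where
    eq : ∀ e B → e Z.- B Z.+ B ≡ e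
    eq = solve-∀

  to-∏ : ∀ E → eulerS E ≡ T.euler E
  to-∏ = prodS-map B brkS

  f'-product : ∀ i → i < B → (f' ⊗ T.euler (T.dualLows n')) i ≡ oneS i
  f'-product i r = P.trans (P.cong (λ e → (f' ⊗ e) i) (P.sym (to-∏ D.lows))) (P.trans (with-euler {E = D.lows} {D.tops} (without-pole (𝓓.Div-F 𝓓.positions-positive)) dual-lows (All.map (λ {e} → AtLeast⇒NonNeg {e}) dual-tops) D.F-euler i)
    (P.trans (P.cong (λ e → e i) (to-∏ D.tops)) (T.euler-big dual-tops i r)))

  f-product : ∀ i → i < B → (f ⊗ T.euler (O.naturalLows 1 K)) i ≡ T.euler (O.naturalTops 1 K) i
  f-product i r = P.trans (P.cong (λ e → (f ⊗ e) i) (P.sym (to-∏ (O.naturalLows 1 K)))) (P.trans (with-euler {E = O.naturalLows 1 K} {O.naturalTops 1 K}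
      (trans (without-pole (𝓝.Div-F 𝓝.positions-positive)) (cong≈ (λ S → 𝓝.F (pos⁺ S)) S≡))
      (Allₚ.++⁺ (NonNeg-ladder K (NonNeg-ℕ 2) (NonNeg-ℕ _)) (Allₚ.++⁺ (NonNeg-ladder K (NonNeg-ℕ 2) (NonNeg-ℕ _)) (NonNeg-windows p 1 K)))
      (Allₚ.++⁺ (NonNeg-ladder K (NonNeg-ℕ 4) (NonNeg-ℕ _)) (NonNeg-windowTops p 1 K))
      (O.F-natural 1 K (s≤s z≤n)) i)
    (P.cong (λ e → e i) (to-∏ (O.naturalTops 1 K))))

  ladder-inverse : ∀ i → i < B → (T.euler (ladder (+ 4) (+ (4 N.* n' N.+ 4)) K) ⊗ invU (T.euler (ladder (+ 4) (+ (4 N.* n' N.+ 4)) K))) i ≡ oneS i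
  ladder-inverse i _ = invU-inverse (T.euler E) (P.trans (P.cong (λ e → e 0) (P.sym (to-∏ E))) (P.subst (λ x → One (eulerS (ladder (+ 4) (+ x) K))) (P.sym (+-suc (4 N.* n') 3)) (One-euler 4 (4 N.* n' N.+ 3) K))) i
    where E = ladder (+ 4) (+ (4 N.* n' N.+ 4)) K

  pochInf-∏ : ∀ e d {y} → + e ≡ y → ∀ i → i < B → pochInf 1ℤ e (suc d) i ≡ T.euler (ladder (+ suc d) y Λ) i
  pochInf-∏ e d P.refl i r = P.trans (pochInf-ladder B≤Λ e d i r) (P.cong (λ f → f i) (to-∏ (ladder (+ suc d) (+ e) Λ)))

  len-≥ : B ≤ len
  len-≥ = ≤-trans B≤Λ (≤-trans (length-blocks T.period (n' N.+ n') 𝓓.first Λ) (≤-reflexive (P.sym (Lₚ.length-map +_ 𝓓.positions))))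

  c-product : ∀ i → i < B → c i ≡ T.O 0ℤ i
  c-product i r = P.trans (P.cong (λ e → e i) (to-∏ (ladder D.T P len))) (P.trans (T.stable T.period _ len len-≥ i r) (P.cong (λ y → T.euler (ladder D.T y Λ) i) (P.sym (ZP.+-identityʳ P))))

  period₂ : ℕ
  period₂ = T.period N.+ T.period

  Θ : ℕ → Series
  Θ x = theta x period₂

  Θ-product : ∀ x → x ≤ period₂ → ∀ i → i < B → Θ x i ≡ T.theta' x i
  Θ-product x q i r = ⊗-cong-at i (pochInf 1ℤ x period₂) (T.euler (ladder (+ period₂) (+ x) Λ)) (pochInf 1ℤ (period₂ N.∸ x) period₂) (T.euler (ladder (+ period₂) (+ period₂ Z.- + x) Λ))
    (λ k k≤i → pochInf-∏ x _ P.refl k (≤-<-trans k≤i r))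
    (λ k k≤i → pochInf-∏ (period₂ N.∸ x) _ (P.sym (P.trans (m-n≡m⊖n period₂ x) (⊖-≥ q))) k (≤-<-trans k≤i r))

  module R = RingKit (truncated B)

  den-inverse : ∀ i → i < B → (((p₂ R.^ n') ⊗ p₁) ⊗ invU den) i ≡ oneS i
  den-inverse i _ = P.trans (P.cong (λ e → ((e ⊗ p₁) ⊗ invU den) i) (P.sym (powS-^ B p₂ n')))
    (invU-inverse den (One-⊗ {powS p₂ n'} {p₁} (One-powS p₂ n' (One-poch 1ℤ 2 2 1 (s≤s z≤n))) (One-poch 1ℤ 1 1 1 (s≤s z≤n))) i)

  pairTerm : ℕ → ℕ → Series
  pairTerm i j = Θ (2 N.* (j N.∸ i)) ⊗ Θ (2 N.* (i N.+ j N.∸ 2))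

  w-product : w N ≡ (((h R.^ suc n') ⊗ R.∏ (λ i → Θ (2 N.* i N.+ m N.∸ 1)) (range 1 (suc n')) ⊗
    R.∏ id (concatMap (λ i → map (pairTerm i) (range (suc i) (suc n'))) (range 1 (suc n')))) ⊗ invU den) N
  w-product = T.evaluate Θ Θ-product {w} {f} {f'} {c} {h} {p₁} {p₂} {invU den} {invU (T.euler (ladder (+ 4) (+ (4 N.* n' N.+ 4)) K))} K (≤-trans B≤Λ Λ≤K)
    (λ i r → agreement Λ w c f f' (finite-W _ 0<p p≡) constant-W (without-pole (𝓝.Div-F 𝓝.positions-positive)) (without-pole (𝓓.Div-F 𝓓.positions-positive)) i
      (s≤s (≤-trans (+-monoʳ-≤ offset (≤-pred r)) (m≤m+n (offset N.+ N) N))))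
    f'-product f-product ladder-inverse c-product (pochInf-∏ period₂ _ (P.sym (ZP.+-identityʳ (+ period₂)))) (pochInf-∏ 1 0 P.refl) (pochInf-∏ 2 1 P.refl) den-inverse N ≤-refl

  rhsAt : ℕ → Series
  rhsAt b = powS (pochInf 1ℤ b b) (suc n')
    ⊗ prodS (map (λ i → theta (2 N.* i N.+ m N.∸ 1) b) (range 1 (suc n')))
    ⊗ prodS (concatMap (λ i → map (λ j → theta (2 N.* (j N.∸ i)) b ⊗ theta (2 N.* (i N.+ j N.∸ 2)) b) (range (suc i) (suc n'))) (range 1 (suc n')))
    ⊗ invU den

  period≡ : 2 N.* kappa m (suc n') ≡ period₂
  period≡ = eq m' n'
    where
    eq : ∀ m n → 2 N.* (m N.+ 2 N.* suc n) ≡ suc (suc m N.+ (n N.+ n)) N.+ suc (suc m N.+ (n N.+ n))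
    eq = ℕ-solve-∀

  evaluation : lhs m (suc n') N ≡ rhs m (suc n') N
  evaluation = P.trans (lhs-finite m K N (≤-trans (s≤s (+-monoˡ-≤ N (m≤n+m N offset))) Λ≤K)) (P.trans w-product
    (P.trans (P.cong₂ (λ a b → (a ⊗ b ⊗ R.∏ id (concatMap (λ i → map (pairTerm i) (range (suc i) (suc n'))) (range 1 (suc n'))) ⊗ invU den) N)
        (P.sym (powS-^ B h (suc n'))) (P.sym (prodS-map B (λ i → Θ (2 N.* i N.+ m N.∸ 1)) (range 1 (suc n')))))
    (P.trans (P.cong (λ a → (powS h (suc n') ⊗ prodS (map (λ i → Θ (2 N.* i N.+ m N.∸ 1)) (range 1 (suc n'))) ⊗ a ⊗ invU den) N)
        (P.sym (prodS-id B (concatMap (λ i → map (pairTerm i) (range (suc i) (suc n'))) (range 1 (suc n'))))))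
    (P.cong (λ b → rhsAt b N) (P.sym period≡)))))

theorem5p12 : (m n : ℕ) → 1 ≤ m → 1 ≤ n → lhs m n ≋ rhs m n
theorem5p12 (suc m) (suc n) _ _ N = Evaluation.evaluation laurentSeries m n N
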